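{- Let $a,b$ be coprime positive integers with $b\ge2$, let $1\le k\le a$, and let $X$ be the set of $(P,Q)\in NC(a,b)$ having $k$ blocks in total (blocks of $P$ together with the blocks of $Q$ of positive rank). Let $C=\mathbb{Z}_{b-1}$ act on $X$ by rotation and let $X(q)=\mathrm{Nar}_q(a,b,k)=\frac{1}{[a]_q}{a\brack k}_q{b-1\brack k-1}_q$. Then $(X,C,X(q))$ exhibits the cyclic sieving phenomenon.
   Context: An $a,b$-Dyck path is a lattice path from $(0,0)$ to $(b,a)$ with unit north steps $N$ and east steps $E$ staying above the line $y=\frac{a}{b}x$; write it as $D=N^{v_0}EN^{v_1}E\cdots N^{v_{b-1}}E$, $v_i\ge 0$. A vertical run of length $v$ is a $P$-rise if $v>a/b$ and a $Q$-rise if $v<a/b$. For $1\le i\le b-1$ the label $i$ is the point $(i,v_0+\dots+v_{i-1})$. If $v_i>0$, the laser $\ell(i)$ is the segment of slope $a/b$ from label $i$ going northeast until it next meets $D$ (in the interior of an east step). $\ell(D)$ is the set of pairs $(i,j)$ with $\ell(i)$ ending on the east step whose west endpoint has $x$-coordinate $j$. The labeled pair $\pi(D)=(P,Q)$ of set partitions of $[b-1]$: $i,j$ in the same block of $P$ iff labels $i,j$ are not separated by any laser (label $k$ lies strictly below $\ell(k)$), and a block $B\in P$ gets rank $v_{\min(B)-1}$; $Q$ is the equivalence relation generated by $i\sim j$ whenever $\ell(i),\ell(j)$ end on the same east step immediately following a $Q$-rise, or $(i,j)\in\ell(D)$, or $(j,i)\in\ell(D)$, and a block $B\in Q$ gets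 rank $v_{\max(B)}$ (blocks of rank $0$ are called trivial and are not counted as blocks). $NC(a,b)=\{\pi(D)\}$ over all $a,b$-Dyck paths. The rotation (generator of $\mathbb{Z}_{b-1}$) acts by $i\mapsto i+1$ ($b-1\mapsto 1$) on every block of both partitions, ranks kept; it preserves $NC(a,b)$ and the number of blocks. Notation: $[n]_q=1+\dots+q^{n-1}$, $[n]!_q=\prod_{j\le n}[j]_q$, ${n\brack k}_q=\frac{[n]!_q}{[k]!_q[n-k]!_q}$. Cyclic sieving: for finite $X$, cyclic $C=\langle c\rangle$ acting on $X$, and $X(q)\in\mathbb{N}[q]$, the triple exhibits the cyclic sieving phenomenon if $X(\zeta^d)=|\{x: c^dx=x\}|$ for all $d\ge0$, where $\zeta$ has multiplicative order $|C|$. -}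

module Defs where

open import Data.Nat as ℕ using (ℕ; zero; suc; _+_; _*_; _∸_; _≤ᵇ_; _<ᵇ_; _≡ᵇ_)
open import Data.Nat.DivMod using (_mod_)
open import Data.Nat.Divisibility using (_∣?_)
open import Data.Integer as ℤ using (ℤ; +_)
open import Data.Bool using (Bool; true; false; _∧_; _∨_; not; if_then_else_)
open import Data.Fin using (Fin; toℕ)
open import Data.Vec as Vec using (Vec; []; _∷_; lookup; tabulate)
import Data.Vec.Properties as VecP
open import Data.List as List using (List; []; _∷_; map; upTo; allFin; filterᵇ; length; reverse; deduplicateᵇ; replicate; foldr; _++_)
open import Data.Product using (Σ; _×_; _,_; proj₁; proj₂)
open import Relation.Binary.PropositionalEquality using (_≡_)
open import Relation.Nullary.Decidable using (⌊_⌋)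
import Data.Bool.Properties as BoolP
import Data.Bool.ListAction as BL

-- Polynomials over ℤ, as coefficient lists (lowest degree first)

Poly : Set
Poly = List ℤ

coeff : Poly → ℕ → ℤ
coeff []       _       = + 0
coeff (c ∷ p)  zero    = c
coeff (c ∷ p)  (suc i) = coeff p i

-- equality of polynomials: all coefficients agree (trailing zeros irrelevant)
infix 4 _≈ₚ_
_≈ₚ_ : Poly → Poly → Set
p ≈ₚ r = ∀ i → coeff p i ≡ coeff r i

infixl 6 _+ₚ_ _-ₚ_
infixl 7 _*ₚ_

_+ₚ_ : Poly → Poly → Poly
[]      +ₚ r       = r
(c ∷ p) +ₚ []      = c ∷ p
(c ∷ p) +ₚ (d ∷ r) = (c ℤ.+ d) ∷ (p +ₚ r)

negₚ : Poly → Poly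
negₚ = map (λ x → ℤ.- x)

_-ₚ_ : Poly → Poly → Poly
p -ₚ r = p +ₚ negₚ r

_·ₚ_ : ℤ → Poly → Poly
c ·ₚ p = map (c ℤ.*_) p

_*ₚ_ : Poly → Poly → Poly
[]      *ₚ r = []
(c ∷ p) *ₚ r = (c ·ₚ r) +ₚ (+ 0 ∷ (p *ₚ r))

constₚ : ℤ → Poly
constₚ c = c ∷ []

shiftₚ : ℕ → Poly → Poly
shiftₚ s p = replicate s (+ 0) ++ p

prodₚ : List Poly → Poly
prodₚ = foldr _*ₚ_ (constₚ (+ 1))

toℤₚ : List ℕ → Poly
toℤₚ = map (λ n → + n)

substPow : ℕ → Poly → Poly
substPow d []      = []
substPow d (c ∷ p) = constₚ c +ₚ shiftₚ d (substPow d p)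

qint : ℕ → Poly
qint n = replicate n (+ 1)

-- Gaussian binomial coefficient via the q-Pascal recurrence
-- [n+1, k+1]_q = [n, k]_q + q^(k+1) [n, k+1]_q ;  equals [n]!/([k]![n-k]!) for k ≤ n, 0 for k > n
qbinom : ℕ → ℕ → Poly
qbinom n       zero    = constₚ (+ 1)
qbinom zero    (suc k) = []
qbinom (suc n) (suc k) = qbinom n k +ₚ shiftₚ (suc k) (qbinom n (suc k))

-- long division by a monic polynomial, high-degree-first representation.
-- gt = the coefficients of the divisor after its leading coefficient 1.
private
  subPrefix : ℤ → List ℤ → List ℤ → List ℤ
  subPrefix c []       h       = h
  subPrefix c (g ∷ gs) []      = []
  subPrefix c (g ∷ gs) (x ∷ h) = (x ℤ.- c ℤ.* g) ∷ subPrefix c gs h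

  longDiv : ℕ → List ℤ → List ℤ → List ℤ
  longDiv zero    gt h       = []
  longDiv (suc f) gt []      = []
  longDiv (suc f) gt (c ∷ h) =
    if length h <ᵇ length gt then [] else c ∷ longDiv f gt (subPrefix c gt h)

-- quotient of p by a monic polynomial g (g given without trailing zeros)
quotₚ : Poly → Poly → Poly
quotₚ p g with reverse g
... | []      = []
... | _ ∷ gt  = reverse (longDiv (length p) gt (reverse p))

qPowMinusOne : ℕ → Poly
qPowMinusOne m = shiftₚ m (constₚ (+ 1)) -ₚ constₚ (+ 1)

properDivisors : ℕ → List ℕ
properDivisors m = filterᵇ (λ d → ⌊ d ∣? m ⌋) (map suc (upTo (m ∸ 1)))

-- Φ_m = (q^m - 1) / ∏_{d ∣ m, d < m} Φ_d   (fuel argument for structural recursion)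
private
  cycloF : ℕ → ℕ → Poly
  cycloF zero    m = constₚ (+ 1)
  cycloF (suc f) m = quotₚ (qPowMinusOne m) (prodₚ (map (cycloF f) (properDivisors m)))

cyclotomic : ℕ → Poly
cyclotomic m = cycloF m m

-- "f(ζ^d) = c" where ζ is a primitive n-th root of unity: in the cyclotomic
-- field ℚ(ζ) ≅ ℚ[q]/(Φ_n) the element ζ^d is the class of q^d, so
-- f(ζ^d) = c  iff  Φ_n divides f(q^d) - c in ℤ[q].
EvalAtRootPow : (n d : ℕ) → Poly → ℤ → Set
EvalAtRootPow n d f c = Σ Poly λ g → cyclotomic n *ₚ g ≈ₚ substPow d f -ₚ constₚ c

-- Cyclic sieving for a cyclic group of order n with generator c:
-- fix d = |{x : c^d x = x}|, and X(q) ∈ ℕ[q]; X(ζ^d) = fix d for all d ≥ 0.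
CyclicSieving : (n : ℕ) → (fix : ℕ → ℕ) → (Xq : List ℕ) → Set
CyclicSieving n fix Xq = ∀ d → EvalAtRootPow n d (toℤₚ Xq) (+ fix d)

-- a,b-Dyck paths  D = N^{v_0} E N^{v_1} E ... N^{v_{b-1}} E,  v : Vec ℕ b

-- v_i (0 outside the range)
run : ∀ {b} → Vec ℕ b → ℕ → ℕ
run []       _       = 0
run (x ∷ xs) zero    = x
run (x ∷ xs) (suc i) = run xs i

ht : ∀ {b} → Vec ℕ b → ℕ → ℕ
ht v zero    = 0
ht v (suc i) = ht v i + run v i

compositions : (b a : ℕ) → List (Vec ℕ b)
compositions zero    zero    = [] ∷ []
compositions zero    (suc a) = []
compositions (suc b) a = List.concatMap (λ x → map (x ∷_) (compositions b (a ∸ x))) (List.filterᵇ (λ x → x ≤ᵇ a) (upTo (suc a)))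

-- staying weakly above y = (a/b) x : after the i-th east step (x = i+1) the
-- height v_0+...+v_i is ≥ a(i+1)/b
isDyck : (a b : ℕ) → Vec ℕ b → Bool
isDyck a b v = BL.all (λ i → (a * suc i) ≤ᵇ (b * ht v (suc i))) (upTo b)
             ∧ (ht v b ≡ᵇ a)

dyckPaths : (a b : ℕ) → List (Vec ℕ b)
dyckPaths a b = filterᵇ (isDyck a b) (compositions b a)

-- Lasers.  Label i (1 ≤ i ≤ b-1) is the point (i, ht v i).

-- first j in [s, s+c) with p j (fallback value s+c never occurs for lasers)
private
  firstFrom : (ℕ → Bool) → ℕ → ℕ → ℕ
  firstFrom p s zero    = s
  firstFrom p s (suc c) = if p s then s else firstFrom p (suc s) c

module _ (a b : ℕ) {b′ : ℕ} (v : Vec ℕ b′) where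

  hasLaser : ℕ → Bool
  hasLaser i = 0 <ᵇ run v i

  -- ℓ(i): y = ht v i + a (x - i)/b.  It stays below D over east step j'
  -- while b·(v_0+..+v_j') > b·ht v i + a(j'+1-i); it ends on the first east step j
  -- (west endpoint x = j, height ht v (j+1)) where this fails.
  laserEnd : ℕ → ℕ
  laserEnd i = firstFrom (λ j → (b * ht v (suc j)) <ᵇ (b * ht v i + a * (suc j ∸ i))) i (b ∸ i)

  -- label m lies in the region cut off above laser ℓ(k)
  cutOff : ℕ → ℕ → Bool
  cutOff m k = hasLaser k ∧ (k <ᵇ m) ∧ (m ≤ᵇ laserEnd k)

  labels : List ℕ
  labels = map suc (upTo (b ∸ 1))

  -- P: labels not separated by any laser
  relP : ℕ → ℕ → Bool
  relP i j = BL.all (λ k → ⌊ BoolP._≟_ (cutOff i k) (cutOff j k) ⌋) labels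

  qRise : ℕ → Bool
  qRise j = (b * run v j) <ᵇ a

  baseQ : ℕ → ℕ → Bool
  baseQ i j = (i ≡ᵇ j)
            ∨ (hasLaser i ∧ hasLaser j ∧ (laserEnd i ≡ᵇ laserEnd j) ∧ qRise (laserEnd i))
            ∨ (hasLaser i ∧ (laserEnd i ≡ᵇ j))
            ∨ (hasLaser j ∧ (laserEnd j ≡ᵇ i))

  -- paths of length ≤ t+1 in the graph baseQ
  reachQ : ℕ → ℕ → ℕ → Bool
  reachQ zero    i j = baseQ i j
  reachQ (suc t) i j = BL.any (λ k → reachQ t i k ∧ baseQ k j) labels

  -- Q: equivalence relation generated by baseQ (on b-1 labels paths of length ≤ b-1 suffice)
  relQ : ℕ → ℕ → Bool
  relQ = reachQ (b ∸ 1)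

  minBlock : (ℕ → ℕ → Bool) → ℕ → ℕ
  minBlock R i = List.foldr (λ l acc → if R i l then l else acc) i labels

  maxBlock : (ℕ → ℕ → Bool) → ℕ → ℕ
  maxBlock R i = List.foldl (λ acc l → if R i l then l else acc) i labels

  rankP : ℕ → ℕ
  rankP i = run v (minBlock relP i ∸ 1)

  rankQ : ℕ → ℕ
  rankQ i = run v (maxBlock relQ i)

-- Labeled set partitions of [n] (element t : Fin n stands for t+1):
-- the block relation as a Boolean matrix, and for each element the rank of its block.

LPart : ℕ → Set
LPart n = Vec (Vec Bool n) n × Vec ℕ n

mkLPart : (n : ℕ) → (ℕ → ℕ → Bool) → (ℕ → ℕ) → LPart n
mkLPart n R r = tabulate (λ i → tabulate (λ j → R (suc (toℕ i)) (suc (toℕ j))))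
              , tabulate (λ i → r (suc (toℕ i)))

LPair : ℕ → Set
LPair n = LPart n × LPart n

eqLPart : ∀ {n} → LPart n → LPart n → Bool
eqLPart (M , r) (M′ , r′) =
  ⌊ VecP.≡-dec (VecP.≡-dec BoolP._≟_) M M′ ⌋ ∧ ⌊ VecP.≡-dec ℕ._≟_ r r′ ⌋

eqLPair : ∀ {n} → LPair n → LPair n → Bool
eqLPair (P , Q) (P′ , Q′) = eqLPart P P′ ∧ eqLPart Q Q′

piD : (a b : ℕ) → Vec ℕ b → LPair (b ∸ 1)
piD a b v = mkLPart (b ∸ 1) (relP a b v) (rankP a b v)
          , mkLPart (b ∸ 1) (relQ a b v) (rankQ a b v)

isBlockMin : ∀ {n} → LPart n → Fin n → Bool
isBlockMin (M , r) t = BL.all (λ s → not (toℕ s <ᵇ toℕ t) ∨ not (lookup (lookup M t) s)) (allFin _)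

numBlocks : ∀ {n} → LPart n → ℕ
numBlocks P = length (filterᵇ (isBlockMin P) (allFin _))

numPosBlocks : ∀ {n} → LPart n → ℕ
numPosBlocks (M , r) = length (filterᵇ (λ t → isBlockMin (M , r) t ∧ (0 <ᵇ lookup r t)) (allFin _))

totalBlocks : ∀ {n} → LPair n → ℕ
totalBlocks (P , Q) = numBlocks P + numPosBlocks Q

rotFin : ∀ {n} → Fin n → Fin n
rotFin {suc n} t = (suc (toℕ t)) mod (suc n)

rotFin⁻¹ : ∀ {n} → Fin n → Fin n
rotFin⁻¹ {suc n} t = (toℕ t + n) mod (suc n)

rotLPart : ∀ {n} → LPart n → LPart n
rotLPart (M , r) = tabulate (λ i → tabulate (λ j → lookup (lookup M (rotFin⁻¹ i)) (rotFin⁻¹ j)))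
                 , tabulate (λ i → lookup r (rotFin⁻¹ i))

rotLPair : ∀ {n} → LPair n → LPair n
rotLPair (P , Q) = rotLPart P , rotLPart Q

rotPow : ∀ {n} → ℕ → LPair n → LPair n
rotPow zero    x = x
rotPow (suc d) x = rotLPair (rotPow d x)

NC : (a b : ℕ) → List (LPair (b ∸ 1))
NC a b = deduplicateᵇ eqLPair (map (piD a b) (dyckPaths a b))

Xset : (a b k : ℕ) → List (LPair (b ∸ 1))
Xset a b k = filterᵇ (λ x → totalBlocks x ≡ᵇ k) (NC a b)

fixCount : (a b k d : ℕ) → ℕ
fixCount a b k d = length (filterᵇ (λ x → eqLPair (rotPow d x) x) (Xset a b k))

{-# OPTIONS --safe #-}
module Submission where

-- A labeled pair with a marked block is a periodic word: reading the runs of a Dyck path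
-- around the circle of labels, with the rank of the marked (root) block kept apart, gives
-- a word w of period n = b - 1, and the blocks of the pair are recovered from w by nearest
-- smaller values of the partial sums of b w_i - a. Moving the root is shifting w.
-- Among the blocks of a pair one is central (a centroid of the tree of blocks), so a pair
-- fixed by a rotation has a fixed block, and its word rooted there has the smaller period m.
-- Fixed pairs thus correspond to words (h; u) with h + e |u| = a, where e = n/m > 1, and
-- these are counted by products of two binomial coefficients; for the identity the count
-- is the cycle lemma.
-- On the other side [b] X = [b k][a-1 k-1], and [b] = 1 at an e-th root of unity, e | n,
-- e > 1, so the q-Lucas theorem evaluates X. X is integral because [a] and [b] generate the
-- unit ideal, and nonnegative because [a k][b-1 k-1] is unimodal, which is proved with the
-- action of sl₂ on pairs of 01-strings.

open import Defs
open import Algebra.Bundles using (CommutativeRing)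
open import Data.Bool using (Bool; T; _∧_; _∨_; false; if_then_else_; not; true)
import Data.Bool.ListAction as BL
open import Data.Bool.Properties as BoolP using (T?)
open import Data.Empty using (⊥; ⊥-elim)
open import Data.Fin as Fin using (Fin; fromℕ<; punchIn; punchOut; toℕ)
import Data.Fin.Properties as FinP
open import Data.Integer as ℤ using (+<+; +_; -[1+_]; ℤ)
import Data.Integer.Properties as ℤP
import Data.Integer.Tactic.RingSolver as ℤS
open import Data.List as List using (List; []; _++_; _∷_; _∷ʳ_; allFin; applyUpTo; cartesianProduct; deduplicateᵇ; filter; filterᵇ; foldl; foldr; length; map; replicate; reverse; upTo)
open import Data.List.Membership.Propositional using (_∈_; lose)
open import Data.List.Membership.Propositional.Properties using (∈-++⁺ʳ; ∈-++⁺ˡ; ∈-++⁻; ∈-allFin; ∈-cartesianProduct⁺; ∈-cartesianProduct⁻; ∈-concatMap⁺; ∈-deduplicate⁻; ∈-filter⁺; ∈-filter⁻; ∈-lookup; ∈-map⁺; ∈-map⁻; ∈-upTo⁺; ∈-upTo⁻; ∈-∃++)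
import Data.List.Membership.Setoid.Properties as Membership
import Data.List.Properties as LP
open import Data.List.Relation.Unary.All as All using (All; []; _∷_)
import Data.List.Relation.Unary.All.Properties as AllP
open import Data.List.Relation.Unary.AllPairs using (AllPairs; []; _∷_)
open import Data.List.Relation.Unary.Any using (here; index; there)
open import Data.List.Relation.Unary.Any.Properties using (lookup-index)
open import Data.List.Relation.Unary.Unique.Propositional using (Unique)
import Data.List.Relation.Unary.Unique.Propositional.Properties as UniqueP
open import Data.Maybe using (Maybe; just; nothing)
open import Data.Nat as ℕ using (_<ᵇ_; _≡ᵇ_; _≤ᵇ_; _⊔_; suc; s≤s; zero; z≤n; ℕ)
open import Data.Nat.Coprimality as ℕC using (Coprime; coprime-Bézout; coprime-divisor)
open import Data.Nat.DivMod using (%-distribˡ-+; [m+kn]%n≡m%n; [m+n]%n≡m%n; _%_; _/_; _mod_; m%n%n≡m%n; m%n<n; m<n⇒m%n≡m; m≡m%n+[m/n]*n)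
open import Data.Nat.Divisibility as ∣ using (*-cancelʳ-∣; _∣_; divides; m∣m*n; n∣m*n; ∣m+n∣m⇒∣n; ∣⇒≤)
open import Data.Nat.GCD using (GCD; gcd; gcd-GCD; module Bézout; module GCD)
open import Data.Nat.Induction using (<-rec)
import Data.Nat.Properties as ℕP
import Data.Nat.Tactic.RingSolver as ℕS
open import Data.Product using (_,_; _×_; proj₁; proj₂; Σ; ∃; ∃₂)
import Data.Product.Properties as ×P
open import Data.Sum using (_⊎_; inj₁; inj₂)
open import Data.Unit using (tt)
open import Data.Vec using (Vec; []; _∷_; lookup; tabulate)
import Data.Vec.Properties as VecP
open import Function using (_∘_; _∘₂_; id)
open import Induction.WellFounded using (acc)
open import Level using (0ℓ)
open import Relation.Binary.Bundles using (Setoid)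
open import Relation.Binary.Definitions using (DecidableEquality; Tri; tri<; tri>; tri≈)
open import Relation.Binary.PropositionalEquality as ≡ using (_≡_; _≢_; cong; cong₂; module ≡-Reasoning; refl; subst; subst₂; sym; trans)
open import Relation.Binary.Structures using (IsEquivalence)
open import Relation.Nullary using (Dec; no; yes; ¬_)
open import Relation.Nullary.Decidable using (decidable-stable; fromWitness; toWitness; ¬?; ⌊_⌋)
open import Tactic.RingSolver using (solve-∀)
open import Tactic.RingSolver.Core.AlmostCommutativeRing using (AlmostCommutativeRing; fromCommutativeRing)

-- A path has b runs but the rotation has order n = b - 1, so cyclic shifts of the path do not act
-- on the pairs. Setting one run h aside leaves n letters, on which rotation is a shift; the price
-- is that the word depends on a root, which is a block of P or of Q according to the sign of the
-- drift over a period, that is, of a - b h. A nontrivial rotation fixes at most one block, so the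
-- word of a fixed pair rooted there is unique, and the centroid shows that it exists. The identity
-- fixes every block and is counted separately. The polynomial side splits in the same way: [b] = 1
-- + q [n] is 1 at an n-th root of unity other than 1, and b at 1. A value at ζ is a divisibility by
-- a polynomial computed by long division, so the computed list must first be recognised as Φ_n.
-- Irreducibility is avoided: distinct Φ_d, Φ_d′ generate an ideal containing a nonzero integer, and
-- ℤ[q]/Φ_n has no torsion. Unimodality gives nonnegativity because (1 - q^a) X = (1 - q) F with F =
-- [a k][b-1 k-1].

module Polynomials where

  open import Data.Nat using (_+_; _*_; _∸_; _<_; _≤_)

  -- Integer polynomials up to trailing zeros, and congruence modulo a polynomial.

  infix 4 _≋_

  -- A record around `_≈ₚ_`: the bare function type mentions `p` and `r` only under `coeff`, from
  -- where they cannot be inferred.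
  record _≋_ (p r : Poly) : Set where
    constructor mk≋
    field at : p ≈ₚ r
  open _≋_ public

  coeff-+ : ∀ p r i → coeff (p +ₚ r) i ≡ coeff p i ℤ.+ coeff r i
  coeff-+ []      r       i       = sym (ℤP.+-identityˡ _)
  coeff-+ (c ∷ p) []      zero    = sym (ℤP.+-identityʳ _)
  coeff-+ (c ∷ p) []      (suc i) = sym (ℤP.+-identityʳ _)
  coeff-+ (c ∷ p) (d ∷ r) zero    = refl
  coeff-+ (c ∷ p) (d ∷ r) (suc i) = coeff-+ p r i

  coeff-neg : ∀ p i → coeff (negₚ p) i ≡ ℤ.- coeff p i
  coeff-neg []      i       = refl
  coeff-neg (c ∷ p) zero    = refl
  coeff-neg (c ∷ p) (suc i) = coeff-neg p i

  coeff-· : ∀ c p i → coeff (c ·ₚ p) i ≡ c ℤ.* coeff p i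
  coeff-· c []      i       = sym (ℤP.*-zeroʳ c)
  coeff-· c (d ∷ p) zero    = refl
  coeff-· c (d ∷ p) (suc i) = coeff-· c p i

  coeff-- : ∀ p r i → coeff (p -ₚ r) i ≡ coeff p i ℤ.- coeff r i
  coeff-- p r i = trans (coeff-+ p (negₚ r) i) (cong (λ x → coeff p i ℤ.+ x) (coeff-neg r i))

  ≋-refl : ∀ {p} → p ≋ p
  ≋-refl = mk≋ λ i → refl

  ≋-sym : ∀ {p r} → p ≋ r → r ≋ p
  ≋-sym e = mk≋ λ i → sym (at e i)

  ≋-trans : ∀ {p r s} → p ≋ r → r ≋ s → p ≋ s
  ≋-trans e f = mk≋ λ i → trans (at e i) (at f i)

  ≡⇒≋ : ∀ {p r} → p ≡ r → p ≋ r
  ≡⇒≋ refl = ≋-refl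

  ∷-cong : ∀ {c d p r} → c ≡ d → p ≋ r → c ∷ p ≋ d ∷ r
  ∷-cong e f = mk≋ λ { zero → e ; (suc i) → at f i }

  0∷[] : + 0 ∷ [] ≋ []
  0∷[] = mk≋ λ { zero → refl ; (suc i) → refl }

  +ₚ-cong : ∀ {p p′ r r′} → p ≋ p′ → r ≋ r′ → p +ₚ r ≋ p′ +ₚ r′
  +ₚ-cong {p} {p′} {r} {r′} e f = mk≋ λ i → begin
    coeff (p +ₚ r) i            ≡⟨ coeff-+ p r i ⟩
    coeff p i ℤ.+ coeff r i     ≡⟨ cong₂ ℤ._+_ (at e i) (at f i) ⟩
    coeff p′ i ℤ.+ coeff r′ i   ≡⟨ coeff-+ p′ r′ i ⟨
    coeff (p′ +ₚ r′) i          ∎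
    where open ≡-Reasoning

  neg-cong : ∀ {p r} → p ≋ r → negₚ p ≋ negₚ r
  neg-cong {p} {r} e = mk≋ λ i → trans (coeff-neg p i) (trans (cong ℤ.-_ (at e i)) (sym (coeff-neg r i)))

  ·ₚ-cong : ∀ {c d p r} → c ≡ d → p ≋ r → c ·ₚ p ≋ d ·ₚ r
  ·ₚ-cong {c} {d} {p} {r} refl e =
    mk≋ λ i → trans (coeff-· c p i) (trans (cong (c ℤ.*_) (at e i)) (sym (coeff-· d r i)))

  +ₚ-comm : ∀ p r → p +ₚ r ≋ r +ₚ p
  +ₚ-comm p r = mk≋ λ i → trans (coeff-+ p r i) (trans (ℤP.+-comm (coeff p i) _) (sym (coeff-+ r p i)))

  +ₚ-assoc : ∀ p r s → (p +ₚ r) +ₚ s ≋ p +ₚ (r +ₚ s)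
  +ₚ-assoc p r s = mk≋ λ i → begin
    coeff ((p +ₚ r) +ₚ s) i                      ≡⟨ coeff-+ (p +ₚ r) s i ⟩
    coeff (p +ₚ r) i ℤ.+ coeff s i               ≡⟨ cong (ℤ._+ coeff s i) (coeff-+ p r i) ⟩
    coeff p i ℤ.+ coeff r i ℤ.+ coeff s i        ≡⟨ ℤP.+-assoc (coeff p i) _ _ ⟩
    coeff p i ℤ.+ (coeff r i ℤ.+ coeff s i)      ≡⟨ cong (λ x → coeff p i ℤ.+ x) (coeff-+ r s i) ⟨
    coeff p i ℤ.+ coeff (r +ₚ s) i               ≡⟨ coeff-+ p (r +ₚ s) i ⟨
    coeff (p +ₚ (r +ₚ s)) i                      ∎
    where open ≡-Reasoning

  +ₚ-identityʳ : ∀ p → p +ₚ [] ≋ p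
  +ₚ-identityʳ []      = ≋-refl
  +ₚ-identityʳ (c ∷ p) = ≋-refl

  +ₚ-inverseʳ : ∀ p → p +ₚ negₚ p ≋ []
  +ₚ-inverseʳ p = mk≋ λ i → trans (coeff-- p p i) (ℤP.+-inverseʳ (coeff p i))

  +ₚ-interchange : ∀ p r s t → (p +ₚ r) +ₚ (s +ₚ t) ≋ (p +ₚ s) +ₚ (r +ₚ t)
  +ₚ-interchange p r s t = mk≋ λ i → begin
    coeff ((p +ₚ r) +ₚ (s +ₚ t)) i ≡⟨ four p r s t i ⟩
    (coeff p i ℤ.+ coeff r i) ℤ.+ (coeff s i ℤ.+ coeff t i) ≡⟨ swap (coeff p i) (coeff r i) (coeff s i) (coeff t i) ⟩
    (coeff p i ℤ.+ coeff s i) ℤ.+ (coeff r i ℤ.+ coeff t i) ≡⟨ four p s r t i ⟨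
    coeff ((p +ₚ s) +ₚ (r +ₚ t)) i ∎
    where
    open ≡-Reasoning
    four : ∀ p r s t i → coeff ((p +ₚ r) +ₚ (s +ₚ t)) i ≡ (coeff p i ℤ.+ coeff r i) ℤ.+ (coeff s i ℤ.+ coeff t i)
    four p r s t i = trans (coeff-+ (p +ₚ r) (s +ₚ t) i) (cong₂ ℤ._+_ (coeff-+ p r i) (coeff-+ s t i))
    swap : ∀ a b c d → (a ℤ.+ b) ℤ.+ (c ℤ.+ d) ≡ (a ℤ.+ c) ℤ.+ (b ℤ.+ d)
    swap = ℤS.solve-∀

  0·ₚ : ∀ p → (+ 0) ·ₚ p ≋ []
  0·ₚ p = mk≋ λ i → coeff-· (+ 0) p i

  1·ₚ : ∀ p → (+ 1) ·ₚ p ≋ p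
  1·ₚ p = mk≋ λ i → trans (coeff-· (+ 1) p i) (ℤP.*-identityˡ _)

  ·ₚ-distrib-+ₚ : ∀ c p r → c ·ₚ (p +ₚ r) ≋ c ·ₚ p +ₚ c ·ₚ r
  ·ₚ-distrib-+ₚ c p r = mk≋ λ i → begin
    coeff (c ·ₚ (p +ₚ r)) i                      ≡⟨ coeff-· c (p +ₚ r) i ⟩
    c ℤ.* coeff (p +ₚ r) i                       ≡⟨ cong (c ℤ.*_) (coeff-+ p r i) ⟩
    c ℤ.* (coeff p i ℤ.+ coeff r i)              ≡⟨ ℤP.*-distribˡ-+ c _ _ ⟩
    c ℤ.* coeff p i ℤ.+ c ℤ.* coeff r i          ≡⟨ cong₂ ℤ._+_ (coeff-· c p i) (coeff-· c r i) ⟨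
    coeff (c ·ₚ p) i ℤ.+ coeff (c ·ₚ r) i        ≡⟨ coeff-+ (c ·ₚ p) (c ·ₚ r) i ⟨
    coeff (c ·ₚ p +ₚ c ·ₚ r) i                   ∎
    where open ≡-Reasoning

  ·ₚ-·ₚ : ∀ c d p → c ·ₚ (d ·ₚ p) ≋ (c ℤ.* d) ·ₚ p
  ·ₚ-·ₚ c d p = mk≋ λ i → begin
    coeff (c ·ₚ (d ·ₚ p)) i          ≡⟨ coeff-· c (d ·ₚ p) i ⟩
    c ℤ.* coeff (d ·ₚ p) i           ≡⟨ cong (c ℤ.*_) (coeff-· d p i) ⟩
    c ℤ.* (d ℤ.* coeff p i)          ≡⟨ ℤP.*-assoc c d _ ⟨
    c ℤ.* d ℤ.* coeff p i            ≡⟨ coeff-· (c ℤ.* d) p i ⟨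
    coeff ((c ℤ.* d) ·ₚ p) i         ∎
    where open ≡-Reasoning

  ·ₚ-∷0 : ∀ c p → c ·ₚ (+ 0 ∷ p) ≋ + 0 ∷ (c ·ₚ p)
  ·ₚ-∷0 c p = ∷-cong (ℤP.*-zeroʳ c) ≋-refl

  *ₚ-congˡ : ∀ p {r r′} → r ≋ r′ → p *ₚ r ≋ p *ₚ r′
  *ₚ-congˡ []      e = ≋-refl
  *ₚ-congˡ (c ∷ p) e = +ₚ-cong (·ₚ-cong {c} refl e) (∷-cong refl (*ₚ-congˡ p e))

  *ₚ-zeroʳ : ∀ p → p *ₚ [] ≋ []
  *ₚ-zeroʳ []      = ≋-refl
  *ₚ-zeroʳ (c ∷ p) = ≋-trans (∷-cong refl (*ₚ-zeroʳ p)) 0∷[]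

  ≋-isEquivalence : IsEquivalence _≋_
  ≋-isEquivalence = record { refl = ≋-refl ; sym = ≋-sym ; trans = ≋-trans }

  polySetoid : Setoid 0ℓ 0ℓ
  polySetoid = record { Carrier = Poly ; _≈_ = _≋_ ; isEquivalence = ≋-isEquivalence }

  open import Relation.Binary.Reasoning.Setoid polySetoid

  *ₚ-∷ : ∀ p d r → p *ₚ (d ∷ r) ≋ d ·ₚ p +ₚ (+ 0 ∷ p *ₚ r)
  *ₚ-∷ []      d r = ≋-sym 0∷[]
  *ₚ-∷ (c ∷ p) d r = ∷-cong (cong (ℤ._+ + 0) (ℤP.*-comm c d)) (begin
    c ·ₚ r +ₚ p *ₚ (d ∷ r)                    ≈⟨ +ₚ-cong (≋-refl {c ·ₚ r}) (*ₚ-∷ p d r) ⟩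
    c ·ₚ r +ₚ (d ·ₚ p +ₚ (+ 0 ∷ p *ₚ r))      ≈⟨ +ₚ-assoc (c ·ₚ r) (d ·ₚ p) _ ⟨
    c ·ₚ r +ₚ d ·ₚ p +ₚ (+ 0 ∷ p *ₚ r)        ≈⟨ +ₚ-cong (+ₚ-comm (c ·ₚ r) (d ·ₚ p)) ≋-refl ⟩
    d ·ₚ p +ₚ c ·ₚ r +ₚ (+ 0 ∷ p *ₚ r)        ≈⟨ +ₚ-assoc (d ·ₚ p) (c ·ₚ r) _ ⟩
    d ·ₚ p +ₚ (c ·ₚ r +ₚ (+ 0 ∷ p *ₚ r))      ∎)

  *ₚ-comm : ∀ p r → p *ₚ r ≋ r *ₚ p
  *ₚ-comm []      r = ≋-sym (*ₚ-zeroʳ r)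
  *ₚ-comm (c ∷ p) r = begin
    c ·ₚ r +ₚ (+ 0 ∷ p *ₚ r)   ≈⟨ +ₚ-cong (≋-refl {c ·ₚ r}) (∷-cong refl (*ₚ-comm p r)) ⟩
    c ·ₚ r +ₚ (+ 0 ∷ r *ₚ p)   ≈⟨ *ₚ-∷ r c p ⟨
    r *ₚ (c ∷ p)               ∎

  *ₚ-cong : ∀ {p p′ r r′} → p ≋ p′ → r ≋ r′ → p *ₚ r ≋ p′ *ₚ r′
  *ₚ-cong {p} {p′} {r} {r′} e f = begin
    p *ₚ r    ≈⟨ *ₚ-congˡ p f ⟩
    p *ₚ r′   ≈⟨ *ₚ-comm p r′ ⟩
    r′ *ₚ p   ≈⟨ *ₚ-congˡ r′ e ⟩
    r′ *ₚ p′  ≈⟨ *ₚ-comm r′ p′ ⟩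
    p′ *ₚ r′  ∎

  *ₚ-distribˡ : ∀ p r s → p *ₚ (r +ₚ s) ≋ p *ₚ r +ₚ p *ₚ s
  *ₚ-distribˡ []      r s = ≋-refl
  *ₚ-distribˡ (c ∷ p) r s = begin
    c ·ₚ (r +ₚ s) +ₚ (+ 0 ∷ p *ₚ (r +ₚ s))
      ≈⟨ +ₚ-cong (·ₚ-distrib-+ₚ c r s) (∷-cong refl (*ₚ-distribˡ p r s)) ⟩
    (c ·ₚ r +ₚ c ·ₚ s) +ₚ ((+ 0 ∷ p *ₚ r) +ₚ (+ 0 ∷ p *ₚ s))
      ≈⟨ +ₚ-interchange (c ·ₚ r) (c ·ₚ s) (+ 0 ∷ p *ₚ r) (+ 0 ∷ p *ₚ s) ⟩
    (c ·ₚ r +ₚ (+ 0 ∷ p *ₚ r)) +ₚ (c ·ₚ s +ₚ (+ 0 ∷ p *ₚ s)) ∎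

  *ₚ-distribʳ : ∀ p r s → (r +ₚ s) *ₚ p ≋ r *ₚ p +ₚ s *ₚ p
  *ₚ-distribʳ p r s = begin
    (r +ₚ s) *ₚ p       ≈⟨ *ₚ-comm (r +ₚ s) p ⟩
    p *ₚ (r +ₚ s)       ≈⟨ *ₚ-distribˡ p r s ⟩
    p *ₚ r +ₚ p *ₚ s    ≈⟨ +ₚ-cong (*ₚ-comm p r) (*ₚ-comm p s) ⟩
    r *ₚ p +ₚ s *ₚ p    ∎

  ·ₚ-*ₚ : ∀ c p r → (c ·ₚ p) *ₚ r ≋ c ·ₚ (p *ₚ r)
  ·ₚ-*ₚ c []      r = ≋-refl
  ·ₚ-*ₚ c (d ∷ p) r = begin
    (c ℤ.* d) ·ₚ r +ₚ (+ 0 ∷ (c ·ₚ p) *ₚ r)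
      ≈⟨ +ₚ-cong (≋-sym (·ₚ-·ₚ c d r)) (≋-trans (∷-cong refl (·ₚ-*ₚ c p r)) (≋-sym (·ₚ-∷0 c (p *ₚ r)))) ⟩
    c ·ₚ (d ·ₚ r) +ₚ c ·ₚ (+ 0 ∷ p *ₚ r)
      ≈⟨ ·ₚ-distrib-+ₚ c (d ·ₚ r) (+ 0 ∷ p *ₚ r) ⟨
    c ·ₚ (d ·ₚ r +ₚ (+ 0 ∷ p *ₚ r)) ∎

  0∷-*ₚ : ∀ p r → (+ 0 ∷ p) *ₚ r ≋ + 0 ∷ (p *ₚ r)
  0∷-*ₚ p r = +ₚ-cong (0·ₚ r) ≋-refl

  *ₚ-assoc : ∀ p r s → (p *ₚ r) *ₚ s ≋ p *ₚ (r *ₚ s)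
  *ₚ-assoc []      r s = ≋-refl
  *ₚ-assoc (c ∷ p) r s = begin
    (c ·ₚ r +ₚ (+ 0 ∷ p *ₚ r)) *ₚ s
      ≈⟨ *ₚ-distribʳ s (c ·ₚ r) (+ 0 ∷ p *ₚ r) ⟩
    (c ·ₚ r) *ₚ s +ₚ (+ 0 ∷ p *ₚ r) *ₚ s
      ≈⟨ +ₚ-cong (·ₚ-*ₚ c r s) (≋-trans (0∷-*ₚ (p *ₚ r) s) (∷-cong refl (*ₚ-assoc p r s))) ⟩
    c ·ₚ (r *ₚ s) +ₚ (+ 0 ∷ p *ₚ (r *ₚ s)) ∎

  1ₚ : Poly
  1ₚ = constₚ (+ 1)

  *ₚ-identityˡ : ∀ p → 1ₚ *ₚ p ≋ p
  *ₚ-identityˡ p = begin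
    (+ 1) ·ₚ p +ₚ (+ 0 ∷ [])  ≈⟨ +ₚ-cong (1·ₚ p) 0∷[] ⟩
    p +ₚ []                 ≈⟨ +ₚ-identityʳ p ⟩
    p                       ∎

  polyRing : CommutativeRing _ _
  polyRing = record
    { Carrier = Poly ; _≈_ = _≋_ ; _+_ = _+ₚ_ ; _*_ = _*ₚ_ ; -_ = negₚ ; 0# = [] ; 1# = 1ₚ
    ; isCommutativeRing = record
      { isRing = record
        { +-isAbelianGroup = record
          { isGroup = record
            { isMonoid = record
              { isSemigroup = record
                { isMagma = record { isEquivalence = ≋-isEquivalence ; ∙-cong = +ₚ-cong }
                ; assoc = +ₚ-assoc }
              ; identity = (λ p → ≋-refl) , +ₚ-identityʳ }
            ; inverse = (λ p → ≋-trans (+ₚ-comm (negₚ p) p) (+ₚ-inverseʳ p)) , +ₚ-inverseʳ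
            ; ⁻¹-cong = neg-cong }
          ; comm = +ₚ-comm }
        ; *-cong = *ₚ-cong
        ; *-assoc = *ₚ-assoc
        ; *-identity = *ₚ-identityˡ , (λ p → ≋-trans (*ₚ-comm p 1ₚ) (*ₚ-identityˡ p))
        ; distrib = *ₚ-distribˡ , *ₚ-distribʳ }
      ; *-comm = *ₚ-comm } }

  -- The zero test for the ring solver has to see through trailing zeros, since `[]` and a list of
  -- zeros denote the same polynomial.
  0≟ : ∀ p → Maybe ([] ≋ p)
  0≟ []      = just ≋-refl
  0≟ (c ∷ p) with c ℤ.≟ + 0 | 0≟ p
  ... | yes refl | just e = just (≋-trans (≋-sym 0∷[]) (∷-cong refl e))
  ... | _        | _      = nothing

  polySolver : AlmostCommutativeRing _ _
  polySolver = fromCommutativeRing polyRing 0≟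

  -- With `g` cyclotomic, `p` a `substPow` and `r` constant this is `EvalAtRootPow`.
  record Mod (g p r : Poly) : Set where
    constructor mkMod
    field
      quo : Poly
      eq  : g *ₚ quo ≋ p -ₚ r

  private
    r-refl : ∀ p → [] ≋ p +ₚ negₚ p
    r-refl = solve-∀ polySolver
    r-sym₁ : ∀ g h → g *ₚ negₚ h ≋ negₚ (g *ₚ h)
    r-sym₁ = solve-∀ polySolver
    r-sym₂ : ∀ p r → negₚ (p +ₚ negₚ r) ≋ r +ₚ negₚ p
    r-sym₂ = solve-∀ polySolver
    r-trans : ∀ p r s → (p +ₚ negₚ r) +ₚ (r +ₚ negₚ s) ≋ p +ₚ negₚ s
    r-trans = solve-∀ polySolver
    r-+ : ∀ p p′ r r′ → (p +ₚ negₚ p′) +ₚ (r +ₚ negₚ r′) ≋ (p +ₚ r) +ₚ negₚ (p′ +ₚ r′)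
    r-+ = solve-∀ polySolver
    r-neg : ∀ p r → negₚ (p +ₚ negₚ r) ≋ negₚ p +ₚ negₚ (negₚ r)
    r-neg = solve-∀ polySolver
    r-*₁ : ∀ g h k r p′ → g *ₚ (h *ₚ r +ₚ p′ *ₚ k) ≋ (g *ₚ h) *ₚ r +ₚ p′ *ₚ (g *ₚ k)
    r-*₁ = solve-∀ polySolver
    r-*₂ : ∀ p p′ r r′ → (p +ₚ negₚ p′) *ₚ r +ₚ p′ *ₚ (r +ₚ negₚ r′) ≋ p *ₚ r +ₚ negₚ (p′ *ₚ r′)
    r-*₂ = solve-∀ polySolver

  ≋⇒Mod : ∀ {g p r} → p ≋ r → Mod g p r
  ≋⇒Mod {g} {p} {r} e = mkMod [] (≋-trans (*ₚ-zeroʳ g) (≋-trans (r-refl r) (+ₚ-cong (≋-sym e) ≋-refl)))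

  Mod-refl : ∀ {g p} → Mod g p p
  Mod-refl = ≋⇒Mod ≋-refl

  Mod-sym : ∀ {g p r} → Mod g p r → Mod g r p
  Mod-sym {g} {p} {r} (mkMod h e) =
    mkMod (negₚ h) (≋-trans (r-sym₁ g h) (≋-trans (neg-cong e) (r-sym₂ p r)))

  Mod-trans : ∀ {g p r s} → Mod g p r → Mod g r s → Mod g p s
  Mod-trans {g} {p} {r} {s} (mkMod h e) (mkMod k f) =
    mkMod (h +ₚ k) (≋-trans (*ₚ-distribˡ g h k) (≋-trans (+ₚ-cong e f) (r-trans p r s)))

  Mod-+ : ∀ {g p p′ r r′} → Mod g p p′ → Mod g r r′ → Mod g (p +ₚ r) (p′ +ₚ r′)
  Mod-+ {g} {p} {p′} {r} {r′} (mkMod h e) (mkMod k f) =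
    mkMod (h +ₚ k) (≋-trans (*ₚ-distribˡ g h k) (≋-trans (+ₚ-cong e f) (r-+ p p′ r r′)))

  Mod-neg : ∀ {g p r} → Mod g p r → Mod g (negₚ p) (negₚ r)
  Mod-neg {g} {p} {r} (mkMod h e) =
    mkMod (negₚ h) (≋-trans (r-sym₁ g h) (≋-trans (neg-cong e) (r-neg p r)))

  Mod-* : ∀ {g p p′ r r′} → Mod g p p′ → Mod g r r′ → Mod g (p *ₚ r) (p′ *ₚ r′)
  Mod-* {g} {p} {p′} {r} {r′} (mkMod h e) (mkMod k f) =
    mkMod (h *ₚ r +ₚ p′ *ₚ k)
      (≋-trans (r-*₁ g h k r p′)
        (≋-trans (+ₚ-cong (*ₚ-cong e ≋-refl) (*ₚ-cong (≋-refl {p′}) f)) (r-*₂ p p′ r r′)))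

  modRing : Poly → CommutativeRing _ _
  modRing g = record
    { Carrier = Poly ; _≈_ = Mod g ; _+_ = _+ₚ_ ; _*_ = _*ₚ_ ; -_ = negₚ ; 0# = [] ; 1# = 1ₚ
    ; isCommutativeRing = record
      { isRing = record
        { +-isAbelianGroup = record
          { isGroup = record
            { isMonoid = record
              { isSemigroup = record
                { isMagma = record
                  { isEquivalence = record { refl = Mod-refl ; sym = Mod-sym ; trans = Mod-trans }
                  ; ∙-cong = Mod-+ }
                ; assoc = λ p r s → ≋⇒Mod (R.+-assoc p r s) }
              ; identity = (λ p → ≋⇒Mod (R.+-identityˡ p)) , (λ p → ≋⇒Mod (R.+-identityʳ p)) }
            ; inverse = (λ p → ≋⇒Mod (R.-‿inverseˡ p)) , (λ p → ≋⇒Mod (R.-‿inverseʳ p))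
            ; ⁻¹-cong = Mod-neg }
          ; comm = λ p r → ≋⇒Mod (R.+-comm p r) }
        ; *-cong = Mod-*
        ; *-assoc = λ p r s → ≋⇒Mod (R.*-assoc p r s)
        ; *-identity = (λ p → ≋⇒Mod (R.*-identityˡ p)) , (λ p → ≋⇒Mod (R.*-identityʳ p))
        ; distrib = (λ p r s → ≋⇒Mod (R.distribˡ p r s)) , (λ p r s → ≋⇒Mod (R.distribʳ p r s)) }
      ; *-comm = λ p r → ≋⇒Mod (R.*-comm p r) } }
    where module R = CommutativeRing polyRing

  multiple : ∀ {g} h → Mod g (g *ₚ h) []
  multiple {g} h = mkMod h (≋-sym (+ₚ-identityʳ (g *ₚ h)))

  -- q-integers and Gaussian binomials in an arbitrary base.

  infixr 8 _^ₚ_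
  _^ₚ_ : Poly → ℕ → Poly
  Q ^ₚ zero  = 1ₚ
  Q ^ₚ suc n = Q *ₚ Q ^ₚ n

  -- The q-integer [n] in base `Q`. With the base free, the substitutions of q^d or of 1 for q are
  -- mere changes of `Q`.
  int : Poly → ℕ → Poly
  int Q zero    = []
  int Q (suc n) = 1ₚ +ₚ Q *ₚ int Q n

  bin : Poly → ℕ → ℕ → Poly
  bin Q n       zero    = 1ₚ
  bin Q zero    (suc k) = []
  bin Q (suc n) (suc k) = bin Q n k +ₚ Q ^ₚ suc k *ₚ bin Q n (suc k)

  ^-+ : ∀ Q m n → Q ^ₚ (m + n) ≋ Q ^ₚ m *ₚ Q ^ₚ n
  ^-+ Q zero    n = ≋-sym (*ₚ-identityˡ _)
  ^-+ Q (suc m) n = ≋-trans (*ₚ-cong (≋-refl {Q}) (^-+ Q m n)) (≋-sym (*ₚ-assoc Q (Q ^ₚ m) (Q ^ₚ n)))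

  ^-cong : ∀ {P Q} n → P ≋ Q → P ^ₚ n ≋ Q ^ₚ n
  ^-cong zero    e = ≋-refl
  ^-cong (suc n) e = *ₚ-cong e (^-cong n e)

  1^ : ∀ n → 1ₚ ^ₚ n ≋ 1ₚ
  1^ zero    = ≋-refl
  1^ (suc n) = ≋-trans (*ₚ-identityˡ _) (1^ n)

  ^-^ : ∀ Q m n → (Q ^ₚ m) ^ₚ n ≋ Q ^ₚ (n * m)
  ^-^ Q m zero    = ≋-refl
  ^-^ Q m (suc n) = ≋-trans (*ₚ-cong (≋-refl {Q ^ₚ m}) (^-^ Q m n)) (≋-sym (^-+ Q m (n * m)))

  int-+ : ∀ Q m n → int Q (m + n) ≋ int Q m +ₚ Q ^ₚ m *ₚ int Q n
  int-+ Q zero    n = ≋-sym (*ₚ-identityˡ _)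
  int-+ Q (suc m) n = begin
    1ₚ +ₚ Q *ₚ int Q (m + n)                            ≈⟨ +ₚ-cong (≋-refl {1ₚ}) (*ₚ-cong (≋-refl {Q}) (int-+ Q m n)) ⟩
    1ₚ +ₚ Q *ₚ (int Q m +ₚ Q ^ₚ m *ₚ int Q n)           ≈⟨ lem Q (int Q m) (Q ^ₚ m) (int Q n) ⟩
    1ₚ +ₚ Q *ₚ int Q m +ₚ Q *ₚ Q ^ₚ m *ₚ int Q n        ∎
    where
    lem : ∀ Q a b c → 1ₚ +ₚ Q *ₚ (a +ₚ b *ₚ c) ≋ 1ₚ +ₚ Q *ₚ a +ₚ Q *ₚ b *ₚ c
    lem = solve-∀ polySolver

  int-* : ∀ Q x a → int Q (x * a) ≋ int Q a *ₚ int (Q ^ₚ a) x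
  int-* Q zero    a = ≋-sym (*ₚ-zeroʳ (int Q a))
  int-* Q (suc x) a = begin
    int Q (a + x * a)                                    ≈⟨ int-+ Q a (x * a) ⟩
    int Q a +ₚ Q ^ₚ a *ₚ int Q (x * a)                   ≈⟨ +ₚ-cong (≋-refl {int Q a}) (*ₚ-cong (≋-refl {Q ^ₚ a}) (int-* Q x a)) ⟩
    int Q a +ₚ Q ^ₚ a *ₚ (int Q a *ₚ int (Q ^ₚ a) x)     ≈⟨ lem (int Q a) (Q ^ₚ a) (int (Q ^ₚ a) x) ⟩
    int Q a *ₚ (1ₚ +ₚ Q ^ₚ a *ₚ int (Q ^ₚ a) x)          ∎
    where
    lem : ∀ a b c → a +ₚ b *ₚ (a *ₚ c) ≋ a *ₚ (1ₚ +ₚ b *ₚ c)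
    lem = solve-∀ polySolver

  int-geom : ∀ Q n → (1ₚ -ₚ Q) *ₚ int Q n ≋ 1ₚ -ₚ Q ^ₚ n
  int-geom Q zero    = ≋-trans (*ₚ-zeroʳ (1ₚ -ₚ Q)) (≋-sym (+ₚ-inverseʳ 1ₚ))
  int-geom Q (suc n) = begin
    (1ₚ -ₚ Q) *ₚ (1ₚ +ₚ Q *ₚ int Q n)            ≈⟨ l₁ Q (int Q n) ⟩
    (1ₚ -ₚ Q) +ₚ Q *ₚ ((1ₚ -ₚ Q) *ₚ int Q n)     ≈⟨ +ₚ-cong (≋-refl {1ₚ -ₚ Q}) (*ₚ-cong (≋-refl {Q}) (int-geom Q n)) ⟩
    (1ₚ -ₚ Q) +ₚ Q *ₚ (1ₚ -ₚ Q ^ₚ n)             ≈⟨ l₂ Q (Q ^ₚ n) ⟩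
    1ₚ -ₚ Q *ₚ Q ^ₚ n                            ∎
    where
    l₁ : ∀ Q a → (1ₚ +ₚ negₚ Q) *ₚ (1ₚ +ₚ Q *ₚ a) ≋ (1ₚ +ₚ negₚ Q) +ₚ Q *ₚ ((1ₚ +ₚ negₚ Q) *ₚ a)
    l₁ = solve-∀ polySolver
    l₂ : ∀ Q b → (1ₚ +ₚ negₚ Q) +ₚ Q *ₚ (1ₚ +ₚ negₚ b) ≋ 1ₚ +ₚ negₚ (Q *ₚ b)
    l₂ = solve-∀ polySolver

  -- An identity x a = 1 + y b lifts to [x a] = 1 + Q [y b], and `int-*` exhibits the two q-integers
  -- as multiples of [a] and [b].
  int-bezout : ∀ Q {a b} → Coprime a b → ∃₂ λ u v → u *ₚ int Q a +ₚ v *ₚ int Q b ≋ 1ₚ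
  int-bezout Q {a} {b} c with coprime-Bézout c
  ... | Bézout.+- x y e = int (Q ^ₚ a) x , negₚ (Q *ₚ int (Q ^ₚ b) y) , one (≡.sym e)
    where
    l : ∀ Q s t w → s *ₚ t +ₚ (negₚ (Q *ₚ w)) *ₚ 1ₚ ≋ t *ₚ s +ₚ negₚ (Q *ₚ w)
    l = solve-∀ polySolver
    l₂ : ∀ u t Q w v → u *ₚ t +ₚ (negₚ (Q *ₚ w)) *ₚ v ≋ t *ₚ u +ₚ negₚ (Q *ₚ (v *ₚ w))
    l₂ = solve-∀ polySolver
    l₃ : ∀ Q w → (1ₚ +ₚ Q *ₚ w) +ₚ negₚ (Q *ₚ w) ≋ 1ₚ
    l₃ = solve-∀ polySolver
    one : x * a ≡ suc (y * b) → _
    one e = begin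
      int (Q ^ₚ a) x *ₚ int Q a +ₚ (negₚ (Q *ₚ int (Q ^ₚ b) y)) *ₚ int Q b
        ≈⟨ l₂ (int (Q ^ₚ a) x) (int Q a) Q (int (Q ^ₚ b) y) (int Q b) ⟩
      int Q a *ₚ int (Q ^ₚ a) x +ₚ negₚ (Q *ₚ (int Q b *ₚ int (Q ^ₚ b) y))
        ≈⟨ +ₚ-cong (≋-trans (≋-sym (int-* Q x a)) (≡⇒≋ (cong (int Q) e)))
                   (neg-cong (*ₚ-cong (≋-refl {Q}) (≋-sym (int-* Q y b)))) ⟩
      (1ₚ +ₚ Q *ₚ int Q (y * b)) +ₚ negₚ (Q *ₚ int Q (y * b))
        ≈⟨ l₃ Q (int Q (y * b)) ⟩
      1ₚ ∎
  ... | Bézout.-+ x y e = negₚ (Q *ₚ int (Q ^ₚ a) x) , int (Q ^ₚ b) y , one (≡.sym e)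
    where
    l₂ : ∀ u t Q w v → (negₚ (Q *ₚ w)) *ₚ v +ₚ u *ₚ t ≋ t *ₚ u +ₚ negₚ (Q *ₚ (v *ₚ w))
    l₂ = solve-∀ polySolver
    l₃ : ∀ Q w → (1ₚ +ₚ Q *ₚ w) +ₚ negₚ (Q *ₚ w) ≋ 1ₚ
    l₃ = solve-∀ polySolver
    one : y * b ≡ suc (x * a) → _
    one e = begin
      (negₚ (Q *ₚ int (Q ^ₚ a) x)) *ₚ int Q a +ₚ int (Q ^ₚ b) y *ₚ int Q b
        ≈⟨ l₂ (int (Q ^ₚ b) y) (int Q b) Q (int (Q ^ₚ a) x) (int Q a) ⟩
      int Q b *ₚ int (Q ^ₚ b) y +ₚ negₚ (Q *ₚ (int Q a *ₚ int (Q ^ₚ a) x))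
        ≈⟨ +ₚ-cong (≋-trans (≋-sym (int-* Q y b)) (≡⇒≋ (cong (int Q) e)))
                   (neg-cong (*ₚ-cong (≋-refl {Q}) (≋-sym (int-* Q x a)))) ⟩
      (1ₚ +ₚ Q *ₚ int Q (x * a)) +ₚ negₚ (Q *ₚ int Q (x * a))
        ≈⟨ l₃ Q (int Q (x * a)) ⟩
      1ₚ ∎

  bin-> : ∀ Q {n k} → n < k → bin Q n k ≋ []
  bin-> Q {zero}  {suc k} _ = ≋-refl
  bin-> Q {suc n} {suc k} (s≤s h) = begin
    bin Q n k +ₚ Q ^ₚ suc k *ₚ bin Q n (suc k)
      ≈⟨ +ₚ-cong (bin-> Q h) (*ₚ-cong (≋-refl {Q ^ₚ suc k}) (bin-> Q (ℕP.m<n⇒m<1+n h))) ⟩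
    Q ^ₚ suc k *ₚ []  ≈⟨ *ₚ-zeroʳ (Q ^ₚ suc k) ⟩
    [] ∎

  bin-diag : ∀ Q n → bin Q n n ≋ 1ₚ
  bin-diag Q zero    = ≋-refl
  bin-diag Q (suc n) = begin
    bin Q n n +ₚ Q ^ₚ suc n *ₚ bin Q n (suc n)
      ≈⟨ +ₚ-cong (bin-diag Q n) (*ₚ-cong (≋-refl {Q ^ₚ suc n}) (bin-> Q (ℕP.n<1+n n))) ⟩
    1ₚ +ₚ Q ^ₚ suc n *ₚ []  ≈⟨ +ₚ-cong (≋-refl {1ₚ}) (*ₚ-zeroʳ (Q ^ₚ suc n)) ⟩
    1ₚ +ₚ []                ≈⟨ +ₚ-identityʳ 1ₚ ⟩
    1ₚ ∎

  -- The Gaussian form of k C(n,k) = n C(n-1,k-1). It stands in for the factorial formula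
  -- throughout, so that no quotient has to be formed.
  absorb : ∀ Q n k → int Q (suc k) *ₚ bin Q (suc n) (suc k) ≋ int Q (suc n) *ₚ bin Q n k
  absorb Q zero    zero    = l Q
    where
    l : ∀ Q → (1ₚ +ₚ Q *ₚ []) *ₚ (1ₚ +ₚ (Q *ₚ 1ₚ) *ₚ []) ≋ (1ₚ +ₚ Q *ₚ []) *ₚ 1ₚ
    l = solve-∀ polySolver
  absorb Q zero    (suc k) = begin
    int Q (suc (suc k)) *ₚ ([] +ₚ Q ^ₚ suc (suc k) *ₚ [])  ≈⟨ l (int Q (suc (suc k))) (Q ^ₚ suc (suc k)) (int Q 1) ⟩
    int Q 1 *ₚ []  ∎
    where
    l : ∀ a b c → a *ₚ ([] +ₚ b *ₚ []) ≋ c *ₚ []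
    l = solve-∀ polySolver
  absorb Q (suc n) zero    = begin
    (1ₚ +ₚ Q *ₚ []) *ₚ (1ₚ +ₚ (Q *ₚ 1ₚ) *ₚ bin Q (suc n) 1)
      ≈⟨ l₁ Q (bin Q (suc n) 1) ⟩
    1ₚ +ₚ Q *ₚ ((1ₚ +ₚ Q *ₚ []) *ₚ bin Q (suc n) 1)
      ≈⟨ +ₚ-cong (≋-refl {1ₚ}) (*ₚ-cong (≋-refl {Q}) (absorb Q n zero)) ⟩
    1ₚ +ₚ Q *ₚ (int Q (suc n) *ₚ 1ₚ)
      ≈⟨ l₂ Q (int Q (suc n)) ⟩
    (1ₚ +ₚ Q *ₚ int Q (suc n)) *ₚ 1ₚ ∎
    where
    l₁ : ∀ Q w → (1ₚ +ₚ Q *ₚ []) *ₚ (1ₚ +ₚ (Q *ₚ 1ₚ) *ₚ w) ≋ 1ₚ +ₚ Q *ₚ ((1ₚ +ₚ Q *ₚ []) *ₚ w)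
    l₁ = solve-∀ polySolver
    l₂ : ∀ Q w → 1ₚ +ₚ Q *ₚ (w *ₚ 1ₚ) ≋ (1ₚ +ₚ Q *ₚ w) *ₚ 1ₚ
    l₂ = solve-∀ polySolver
  absorb Q (suc n) (suc k) = begin
    (1ₚ +ₚ Q *ₚ I) *ₚ (bin Q (suc n) (suc k) +ₚ (Q *ₚ P) *ₚ B)
      ≈⟨ l₁ Q I (bin Q (suc n) (suc k)) P B ⟩
    bin Q (suc n) (suc k) +ₚ Q *ₚ (I *ₚ bin Q (suc n) (suc k)) +ₚ Q *ₚ P *ₚ ((1ₚ +ₚ Q *ₚ I) *ₚ B)
      ≈⟨ +ₚ-cong (+ₚ-cong (≋-refl {bin Q (suc n) (suc k)}) (*ₚ-cong (≋-refl {Q}) (absorb Q n k)))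
                 (*ₚ-cong (≋-refl {Q *ₚ P}) (absorb Q n (suc k))) ⟩
    bin Q (suc n) (suc k) +ₚ Q *ₚ (J *ₚ bin Q n k) +ₚ Q *ₚ P *ₚ (J *ₚ bin Q n (suc k))
      ≈⟨ l₂ Q J (bin Q n k) P (bin Q n (suc k)) ⟩
    (1ₚ +ₚ Q *ₚ J) *ₚ (bin Q n k +ₚ P *ₚ bin Q n (suc k)) ∎
    where
    I = int Q (suc k)
    J = int Q (suc n)
    P = Q ^ₚ suc k
    B = bin Q (suc n) (suc (suc k))
    l₁ : ∀ Q I X P B → (1ₚ +ₚ Q *ₚ I) *ₚ (X +ₚ (Q *ₚ P) *ₚ B)
         ≋ X +ₚ Q *ₚ (I *ₚ X) +ₚ Q *ₚ P *ₚ ((1ₚ +ₚ Q *ₚ I) *ₚ B)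
    l₁ = solve-∀ polySolver
    l₂ : ∀ Q J X P Y → (X +ₚ P *ₚ Y) +ₚ Q *ₚ (J *ₚ X) +ₚ Q *ₚ P *ₚ (J *ₚ Y)
         ≋ (1ₚ +ₚ Q *ₚ J) *ₚ (X +ₚ P *ₚ Y)
    l₂ = solve-∀ polySolver

  xₚ : Poly
  xₚ = + 0 ∷ + 1 ∷ []

  x* : ∀ p → xₚ *ₚ p ≋ + 0 ∷ p
  x* p = ≋-trans (0∷-*ₚ (+ 1 ∷ []) p) (∷-cong refl (*ₚ-identityˡ p))

  shift≋ : ∀ s p → shiftₚ s p ≋ xₚ ^ₚ s *ₚ p
  shift≋ zero    p = ≋-sym (*ₚ-identityˡ p)
  shift≋ (suc s) p = begin
    + 0 ∷ shiftₚ s p               ≈⟨ ∷-cong refl (shift≋ s p) ⟩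
    + 0 ∷ (xₚ ^ₚ s *ₚ p)           ≈⟨ x* _ ⟨
    xₚ *ₚ (xₚ ^ₚ s *ₚ p)           ≈⟨ *ₚ-assoc xₚ (xₚ ^ₚ s) p ⟨
    xₚ *ₚ xₚ ^ₚ s *ₚ p             ∎

  const*≋ : ∀ c p → constₚ c *ₚ p ≋ c ·ₚ p
  const*≋ c p = ≋-trans (+ₚ-cong (≋-refl {c ·ₚ p}) 0∷[]) (+ₚ-identityʳ _)

  ∷≋ : ∀ c p → c ∷ p ≋ constₚ c +ₚ xₚ *ₚ p
  ∷≋ c p = ≋-sym (≋-trans (+ₚ-cong (≋-refl {constₚ c}) (x* p)) (∷-cong (ℤP.+-identityʳ c) ≋-refl))

  ++≋ : ∀ p r → p ++ r ≋ p +ₚ xₚ ^ₚ length p *ₚ r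
  ++≋ []      r = ≋-sym (*ₚ-identityˡ r)
  ++≋ (c ∷ p) r = begin
    c ∷ (p ++ r)                                              ≈⟨ ∷≋ c (p ++ r) ⟩
    constₚ c +ₚ xₚ *ₚ (p ++ r)                                ≈⟨ +ₚ-cong (≋-refl {constₚ c}) (*ₚ-cong (≋-refl {xₚ}) (++≋ p r)) ⟩
    constₚ c +ₚ xₚ *ₚ (p +ₚ xₚ ^ₚ length p *ₚ r)              ≈⟨ l (constₚ c) xₚ p (xₚ ^ₚ length p) r ⟩
    (constₚ c +ₚ xₚ *ₚ p) +ₚ xₚ *ₚ xₚ ^ₚ length p *ₚ r        ≈⟨ +ₚ-cong (≋-sym (∷≋ c p)) ≋-refl ⟩
    (c ∷ p) +ₚ xₚ *ₚ xₚ ^ₚ length p *ₚ r                      ∎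
    where
    l : ∀ c x p y r → c +ₚ x *ₚ (p +ₚ y *ₚ r) ≋ (c +ₚ x *ₚ p) +ₚ x *ₚ y *ₚ r
    l = solve-∀ polySolver

  -- Exact long division on coefficient lists.

  length-+ : ∀ p r → length (p +ₚ r) ≡ length p ⊔ length r
  length-+ []      r       = refl
  length-+ (c ∷ p) []      = refl
  length-+ (c ∷ p) (d ∷ r) = cong suc (length-+ p r)

  -- Long division is a function of lists and not of polynomials; it is analysed with literal
  -- equality, for which exact lengths are needed.
  length-* : ∀ c p d r → length ((c ∷ p) *ₚ (d ∷ r)) ≡ suc (length p + length r)
  length-* c []       d r = cong suc (≡.trans (length-+ (map (c ℤ.*_) r) []) (≡.trans (ℕP.⊔-identityʳ _) (LP.length-map _ r)))
  length-* c (c′ ∷ p) d r = ≡.trans (length-+ (c ·ₚ (d ∷ r)) (+ 0 ∷ (c′ ∷ p) *ₚ (d ∷ r)))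
    (≡.trans (cong₂ _⊔_ (LP.length-map (c ℤ.*_) (d ∷ r)) (cong suc (length-* c′ p d r)))
      (cong suc (ℕP.m≤n⇒m⊔n≡n (ℕP.m≤n⇒m≤1+n (ℕP.m≤n+m (length r) (length p))))))

  ≋-length⇒≡ : ∀ p r → p ≋ r → length p ≡ length r → p ≡ r
  ≋-length⇒≡ []      []      e l = refl
  ≋-length⇒≡ (c ∷ p) (d ∷ r) e l =
    cong₂ _∷_ (at e 0) (≋-length⇒≡ p r (mk≋ λ i → at e (suc i)) (ℕP.suc-injective l))

  rev-∷ : ∀ c p → reverse (c ∷ p) ≋ reverse p +ₚ xₚ ^ₚ length p *ₚ constₚ c
  rev-∷ c p = begin
    reverse (c ∷ p)                                         ≡⟨ LP.unfold-reverse c p ⟩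
    reverse p ∷ʳ c                                          ≈⟨ ++≋ (reverse p) (constₚ c) ⟩
    reverse p +ₚ xₚ ^ₚ length (reverse p) *ₚ constₚ c       ≡⟨ cong (λ l → reverse p +ₚ xₚ ^ₚ l *ₚ constₚ c) (LP.length-reverse p) ⟩
    reverse p +ₚ xₚ ^ₚ length p *ₚ constₚ c                 ∎

  rev-+ : ∀ p r → length p ≤ length r →
          reverse (p +ₚ r) ≋ xₚ ^ₚ (length r ∸ length p) *ₚ reverse p +ₚ reverse r
  rev-+ []      r       h = ≋-sym (+ₚ-cong (*ₚ-zeroʳ (xₚ ^ₚ length r)) ≋-refl)
  rev-+ (c ∷ p) (d ∷ r) (s≤s h) = begin
    reverse ((c ℤ.+ d) ∷ (p +ₚ r))
      ≈⟨ rev-∷ (c ℤ.+ d) (p +ₚ r) ⟩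
    reverse (p +ₚ r) +ₚ xₚ ^ₚ length (p +ₚ r) *ₚ (constₚ c +ₚ constₚ d)
      ≡⟨ cong (λ l → reverse (p +ₚ r) +ₚ xₚ ^ₚ l *ₚ (constₚ c +ₚ constₚ d)) (≡.trans (length-+ p r) (ℕP.m≤n⇒m⊔n≡n h)) ⟩
    reverse (p +ₚ r) +ₚ xₚ ^ₚ length r *ₚ (constₚ c +ₚ constₚ d)
      ≈⟨ +ₚ-cong (rev-+ p r h) (*ₚ-distribˡ (xₚ ^ₚ length r) (constₚ c) (constₚ d)) ⟩
    xₚ ^ₚ δ *ₚ reverse p +ₚ reverse r +ₚ (xₚ ^ₚ length r *ₚ constₚ c +ₚ xₚ ^ₚ length r *ₚ constₚ d)
      ≈⟨ +ₚ-cong (≋-refl {xₚ ^ₚ δ *ₚ reverse p +ₚ reverse r})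
           (+ₚ-cong (*ₚ-cong (≋-trans (≡⇒≋ (cong (xₚ ^ₚ_) (≡.sym (ℕP.m∸n+n≡m h)))) (^-+ xₚ δ (length p))) (≋-refl {constₚ c})) ≋-refl) ⟩
    xₚ ^ₚ δ *ₚ reverse p +ₚ reverse r +ₚ (xₚ ^ₚ δ *ₚ xₚ ^ₚ length p *ₚ constₚ c +ₚ xₚ ^ₚ length r *ₚ constₚ d)
      ≈⟨ l (xₚ ^ₚ δ) (reverse p) (reverse r) (xₚ ^ₚ length p) (constₚ c) (xₚ ^ₚ length r *ₚ constₚ d) ⟩
    xₚ ^ₚ δ *ₚ (reverse p +ₚ xₚ ^ₚ length p *ₚ constₚ c) +ₚ (reverse r +ₚ xₚ ^ₚ length r *ₚ constₚ d)
      ≈⟨ +ₚ-cong (*ₚ-cong (≋-refl {xₚ ^ₚ δ}) (≋-sym (rev-∷ c p))) (≋-sym (rev-∷ d r)) ⟩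
    xₚ ^ₚ δ *ₚ reverse (c ∷ p) +ₚ reverse (d ∷ r) ∎
    where
    δ = length r ∸ length p
    l : ∀ D P R A c E → D *ₚ P +ₚ R +ₚ (D *ₚ A *ₚ c +ₚ E) ≋ D *ₚ (P +ₚ A *ₚ c) +ₚ (R +ₚ E)
    l = solve-∀ polySolver

  reverse-· : ∀ c p → reverse (c ·ₚ p) ≡ c ·ₚ reverse p
  reverse-· c p = ≡.sym (LP.reverse-map (c ℤ.*_) p)

  -- `quotₚ` works with the highest coefficient first, so products are carried through `reverse`.
  -- For nonempty lists the degrees add up, hence the top coefficients stay aligned.
  rev-* : ∀ c p d r → reverse ((c ∷ p) *ₚ (d ∷ r)) ≋ reverse (c ∷ p) *ₚ reverse (d ∷ r)
  rev-* c []       d r = begin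
    reverse (c ·ₚ (d ∷ r) +ₚ (+ 0 ∷ []))
      ≡⟨ cong reverse (≋-length⇒≡ _ _ (≋-trans (+ₚ-cong (≋-refl {c ·ₚ (d ∷ r)}) 0∷[]) (+ₚ-identityʳ _))
           (≡.trans (length-+ (c ·ₚ (d ∷ r)) (+ 0 ∷ [])) (cong suc (ℕP.⊔-identityʳ _)))) ⟩
    reverse (c ·ₚ (d ∷ r))       ≡⟨ reverse-· c (d ∷ r) ⟩
    c ·ₚ reverse (d ∷ r)         ≈⟨ const*≋ c _ ⟨
    constₚ c *ₚ reverse (d ∷ r)  ∎
  rev-* c (c′ ∷ p) d r = begin
    reverse (c ·ₚ R +ₚ (+ 0 ∷ P *ₚ R))
      ≈⟨ rev-+ (c ·ₚ R) (+ 0 ∷ P *ₚ R) lens ⟩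
    xₚ ^ₚ (length (+ 0 ∷ P *ₚ R) ∸ length (c ·ₚ R)) *ₚ reverse (c ·ₚ R) +ₚ reverse (+ 0 ∷ P *ₚ R)
      ≡⟨ cong (λ k → xₚ ^ₚ k *ₚ reverse (c ·ₚ R) +ₚ reverse (+ 0 ∷ P *ₚ R)) dif ⟩
    xₚ ^ₚ length P *ₚ reverse (c ·ₚ R) +ₚ reverse (+ 0 ∷ P *ₚ R)
      ≈⟨ +ₚ-cong (*ₚ-cong (≋-refl {xₚ ^ₚ length P}) (≋-trans (≡⇒≋ (reverse-· c R)) (≋-sym (const*≋ c (reverse R)))))
           (≋-trans (rev-∷ (+ 0) (P *ₚ R)) (≋-trans (+ₚ-cong (rev-* c′ p d r) (≋-trans (*ₚ-cong (≋-refl {xₚ ^ₚ length (P *ₚ R)}) 0∷[]) (*ₚ-zeroʳ (xₚ ^ₚ length (P *ₚ R))))) (+ₚ-identityʳ _))) ⟩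
    xₚ ^ₚ length P *ₚ (constₚ c *ₚ reverse R) +ₚ reverse P *ₚ reverse R
      ≈⟨ l (xₚ ^ₚ length P) (constₚ c) (reverse R) (reverse P) ⟩
    (reverse P +ₚ xₚ ^ₚ length P *ₚ constₚ c) *ₚ reverse R
      ≈⟨ *ₚ-cong (rev-∷ c P) (≋-refl {reverse R}) ⟨
    reverse (c ∷ P) *ₚ reverse R ∎
    where
    P = c′ ∷ p
    R = d ∷ r
    lR : length (c ·ₚ R) ≡ suc (length r)
    lR = LP.length-map (c ℤ.*_) R
    lPR : length (+ 0 ∷ P *ₚ R) ≡ suc (suc (length p + length r))
    lPR = cong suc (length-* c′ p d r)
    lens : length (c ·ₚ R) ≤ length (+ 0 ∷ P *ₚ R)
    lens = subst (λ z → z ≤ length (+ 0 ∷ P *ₚ R)) (≡.sym lR) (subst (suc (length r) ≤_) (≡.sym lPR)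
             (s≤s (ℕP.m≤n⇒m≤1+n (ℕP.m≤n+m (length r) (length p)))))
    dif : length (+ 0 ∷ P *ₚ R) ∸ length (c ·ₚ R) ≡ length P
    dif = ≡.trans (cong₂ _∸_ lPR lR) (ℕP.m+n∸n≡m (suc (length p)) (length r))
    l : ∀ A c R P → A *ₚ (c *ₚ R) +ₚ P *ₚ R ≋ (P +ₚ A *ₚ c) *ₚ R
    l = solve-∀ polySolver

  -- The helper functions of quotₚ are private in Defs; here they are recovered
  -- as solutions of the equations in which quotₚ exposes them.

  reverse-if : ∀ b (c : ℤ) p → reverse (if b then [] else c ∷ p) ≡ (if b then [] else reverse p ∷ʳ c)
  reverse-if true  c p = refl
  reverse-if false c p = LP.unfold-reverse c p

  mutual
    revLongDiv : ℕ → List ℤ → List ℤ → List ℤ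
    revLongDiv = _

    subPrefix : ℤ → List ℤ → List ℤ → List ℤ
    subPrefix = _

    quotₚ-revLongDiv : ∀ p g gt → reverse g ≡ + 1 ∷ gt →
                       quotₚ p g ≡ revLongDiv (length p) gt (reverse p)
    quotₚ-revLongDiv p g gt eg with reverse g | eg
    -- Abstracting the arguments leaves the unknown function applied to distinct variables, which
    -- determines it; it is the private division followed by `reverse`.
    ... | _ | refl with reverse p | length p
    ... | r | f = refl

    revLongDiv-∷ : ∀ f gt c h → revLongDiv (suc f) gt (c ∷ h) ≡
      (if length h <ᵇ length gt then [] else (revLongDiv f gt (subPrefix c gt h) ∷ʳ c))
    revLongDiv-∷ f gt c h = reverse-if (length h <ᵇ length gt) c _

  subPrefix-+ : ∀ c gt h → length gt ≤ length h → subPrefix c gt (c ·ₚ gt +ₚ h) ≡ h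
  subPrefix-+ c []       h       _       = refl
  subPrefix-+ c (g ∷ gs) (x ∷ h) (s≤s l) =
    (cong₂ _∷_ (lem (c ℤ.* g) x) (subPrefix-+ c gs h l))
    where
    lem : ∀ a x → (a ℤ.+ x) ℤ.+ (ℤ.- a) ≡ x
    lem = ℤS.solve-∀

  -- Each step emits the leading coefficient of `h` and leaves the divisor times the rest of `h`, so
  -- one unit of fuel per coefficient is enough. After the last one only zeros remain, too few for a
  -- further step.
  revLongDiv-* : ∀ f gt h → length h ≤ f → revLongDiv f gt (h *ₚ (+ 1 ∷ gt)) ≡ reverse h
  revLongDiv-* zero    gt []      lt = refl
  revLongDiv-* (suc f) gt []      lt = refl
  revLongDiv-* (suc f) gt (c ∷ []) (s≤s lt) =
    ≡.trans (cong (revLongDiv (suc f) gt) eq) (≡.trans (revLongDiv-∷ f gt _ _) step)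
    where
    zs = map (λ _ → + 0) gt
    eq : (c ∷ []) *ₚ (+ 1 ∷ gt) ≡ c ∷ (c ·ₚ gt +ₚ zs)
    eq = cong₂ _∷_ (≡.trans (ℤP.+-identityʳ _) (ℤP.*-identityʳ c)) (zeros gt)
      where
      zeros : ∀ gt → c ·ₚ gt +ₚ [] ≡ c ·ₚ gt +ₚ map (λ _ → + 0) gt
      zeros []       = refl
      zeros (g ∷ gt) = cong₂ _∷_ (≡.sym (ℤP.+-identityʳ _)) (≡.trans (≡.sym (id+ (c ·ₚ gt))) (zeros gt))
        where
        id+ : ∀ p → p +ₚ [] ≡ p
        id+ []      = refl
        id+ (x ∷ p) = refl
    lz : length gt ≤ length zs
    lz = ℕP.≤-reflexive (≡.sym (LP.length-map _ gt))
    len : length (c ·ₚ gt +ₚ zs) ≡ length gt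
    len = ≡.trans (length-+ (c ·ₚ gt) zs) (≡.trans (cong₂ _⊔_ (LP.length-map _ gt) (LP.length-map _ gt)) (ℕP.⊔-idem _))
    <ᵇ-irrefl : ∀ n → (n <ᵇ n) ≡ false
    <ᵇ-irrefl zero    = refl
    <ᵇ-irrefl (suc n) = <ᵇ-irrefl n
    short : ∀ k (gt : List ℤ) → k ≡ length gt → ∀ zs → length zs ≡ k → ∀ f → revLongDiv f gt zs ≡ []
    short k gt e zs       l zero    = refl
    short k gt e []       l (suc f) = refl
    short (suc k) gt e (z ∷ zs) l (suc f) =
      ≡.trans (revLongDiv-∷ f gt z zs) (cong (λ b → if b then [] else (revLongDiv f gt (subPrefix z gt zs) ∷ʳ z))
        (≡.trans (cong₂ _<ᵇ_ (ℕP.suc-injective l) (≡.sym e)) (n<ᵇ1+n k)))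
      where
      n<ᵇ1+n : ∀ n → (n <ᵇ suc n) ≡ true
      n<ᵇ1+n zero    = refl
      n<ᵇ1+n (suc n) = n<ᵇ1+n n
    step : (if length (c ·ₚ gt +ₚ zs) <ᵇ length gt then [] else (revLongDiv f gt (subPrefix c gt (c ·ₚ gt +ₚ zs)) ∷ʳ c)) ≡ reverse (c ∷ [])
    step rewrite len | <ᵇ-irrefl (length gt) | subPrefix-+ c gt zs lz =
      cong (_∷ʳ c) (short (length gt) gt refl zs (LP.length-map _ gt) f)
  revLongDiv-* (suc f) gt (c ∷ c′ ∷ h) (s≤s lt) =
    ≡.trans (cong (λ z → revLongDiv (suc f) gt (z ∷ (c ·ₚ gt +ₚ H))) (≡.trans (ℤP.+-identityʳ _) (ℤP.*-identityʳ c)))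
      (≡.trans (revLongDiv-∷ f gt c _) (step))
    where
    H = (c′ ∷ h) *ₚ (+ 1 ∷ gt)
    lH : length H ≡ suc (length h + length gt)
    lH = length-* c′ h (+ 1) gt
    l≤ : length gt ≤ length H
    l≤ = subst (length gt ≤_) (≡.sym lH) (ℕP.m≤n⇒m≤1+n (ℕP.m≤n+m _ _))
    len : length (c ·ₚ gt +ₚ H) ≡ length H
    len = ≡.trans (length-+ (c ·ₚ gt) H) (≡.trans (cong (_⊔ length H) (LP.length-map _ gt)) (ℕP.m≤n⇒m⊔n≡n l≤))
    ≥⇒<ᵇ : ∀ {m n} → n ≤ m → (m <ᵇ n) ≡ false
    ≥⇒<ᵇ {m}     {zero}  _       = refl
    ≥⇒<ᵇ {suc m} {suc n} (s≤s h) = ≥⇒<ᵇ h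
    step : (if length (c ·ₚ gt +ₚ H) <ᵇ length gt then [] else (revLongDiv f gt (subPrefix c gt (c ·ₚ gt +ₚ H)) ∷ʳ c)) ≡ reverse (c ∷ c′ ∷ h)
    step rewrite len | ≥⇒<ᵇ l≤ | subPrefix-+ c gt H l≤ =
      ≡.trans (cong (_∷ʳ c) (revLongDiv-* f gt (c′ ∷ h) lt)) (≡.sym (LP.unfold-reverse c (c′ ∷ h)))

  quotₚ-rev : ∀ p g gt h → reverse g ≡ + 1 ∷ gt → reverse p ≡ h *ₚ (+ 1 ∷ gt) →
              length h ≤ length p → quotₚ p g ≡ reverse h
  quotₚ-rev p g gt h eg ep lt =
    ≡.trans (quotₚ-revLongDiv p g gt eg)
      (≡.trans (cong (revLongDiv (length p) gt) ep) (revLongDiv-* (length p) gt h lt))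

  coeff-*-0 : ∀ p r → coeff (p *ₚ r) 0 ≡ coeff p 0 ℤ.* coeff r 0
  coeff-*-0 []      r = refl
  coeff-*-0 (c ∷ p) r = ≡.trans (coeff-+ (c ·ₚ r) _ 0) (≡.trans (ℤP.+-identityʳ _) (coeff-· c r 0))

  -- Constant coefficient ±1. Division can then start at the head of the list, where trailing zeros
  -- do no harm; Φ_n, q^n - 1 and [n] with n > 0 are all of this kind.
  record UnitConst (g : Poly) : Set where
    constructor mkUnit
    field
      u   : ℤ
      u*₀ : u ℤ.* coeff g 0 ≡ + 1

  coeff-snoc : ∀ p c → coeff (p ∷ʳ c) (length p) ≡ c
  coeff-snoc []      c = refl
  coeff-snoc (_ ∷ p) c = coeff-snoc p c

  coeff-beyond : ∀ p {i} → length p ≤ i → coeff p i ≡ + 0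
  coeff-beyond []      h       = refl
  coeff-beyond (c ∷ p) (s≤s h) = coeff-beyond p h

  rev⇒snoc : ∀ (p : Poly) {c t} → reverse p ≡ c ∷ t → p ≡ reverse t ∷ʳ c
  rev⇒snoc p {c} {t} e = ≡.trans (≡.sym (LP.reverse-involutive p)) (≡.trans (cong reverse e) (LP.unfold-reverse c t))

  coeff-top : ∀ (p : Poly) {c t} → reverse p ≡ c ∷ t → coeff p (length t) ≡ c
  coeff-top p {c} {t} e = ≡.trans (cong₂ coeff (rev⇒snoc p e) (≡.sym (LP.length-reverse t))) (coeff-snoc (reverse t) c)

  length-rev : ∀ (p : Poly) {c t} → reverse p ≡ c ∷ t → length p ≡ suc (length t)
  length-rev p e = ≡.trans (≡.sym (LP.length-reverse p)) (cong length e)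

  ≋⇒length≡ : ∀ {p r c d t u} → p ≋ r → c ≢ + 0 → d ≢ + 0 → reverse p ≡ c ∷ t → reverse r ≡ d ∷ u →
              length p ≡ length r
  ≋⇒length≡ {p} {r} {c} {d} {t} {u} e c≢0 d≢0 ep er = ℕP.≤-antisym
    (half e c≢0 ep) (half (≋-sym e) d≢0 er)
    where
    half : ∀ {p r c t} → p ≋ r → c ≢ + 0 → reverse p ≡ c ∷ t → length p ≤ length r
    half {p} {r} {c} {t} e c≢0 ep with length p ℕ.≤? length r
    ... | yes h = h
    ... | no h  = ⊥-elim (c≢0 (≡.trans (≡.sym (coeff-top p ep)) (≡.trans (at e (length t))
                    (coeff-beyond r (ℕ.s≤s⁻¹ (subst (suc (length r) ≤_) (length-rev p ep) (ℕP.≰⇒> h)))))))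

  rev-*≡ : ∀ (p r : Poly) {c t d u} → reverse p ≡ c ∷ t → reverse r ≡ d ∷ u → reverse (p *ₚ r) ≡ (c ∷ t) *ₚ (d ∷ u)
  rev-*≡ (c ∷ p) (d ∷ r) {c′} {t} {d′} {u} e f =
    ≋-length⇒≡ _ _ (≋-trans (rev-* c p d r) (≡⇒≋ (cong₂ _*ₚ_ e f)))
      (≡.trans (LP.length-reverse ((c ∷ p) *ₚ (d ∷ r)))
        (≡.trans (length-* c p d r)
          (≡.trans (cong suc (cong₂ _+_ (ℕP.suc-injective (length-rev (c ∷ p) e)) (ℕP.suc-injective (length-rev (d ∷ r) f))))
            (≡.sym (length-* c′ t d′ u)))))

  -- A representative without trailing zeros; only for such lists does equality of polynomials force
  -- equality of lengths.
  trim : ∀ h → h ≋ [] ⊎ ∃₂ λ c t → c ≢ + 0 × h ≋ reverse (c ∷ t)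
  trim []      = inj₁ ≋-refl
  trim (x ∷ h) with trim h
  ... | inj₂ (c , t , nz , e) = inj₂ (c , t ++ (x ∷ []) , nz ,
          ≋-trans (∷-cong refl e) (≡⇒≋ (≡.sym (LP.reverse-++ (c ∷ t) (x ∷ [])))))
  ... | inj₁ e with x ℤ.≟ + 0
  ...   | yes refl = inj₁ (≋-trans (∷-cong refl e) 0∷[])
  ...   | no nz    = inj₂ (x , [] , nz , ∷-cong refl e)

  Monic : Poly → Set
  Monic p = ∃ λ t → reverse p ≡ + 1 ∷ t

  1≢0 : (+ 1) ≢ + 0
  1≢0 ()

  Monic-* : ∀ {p r} → Monic p → Monic r → Monic (p *ₚ r)
  Monic-* {p} {r} (t , e) (u , f) = _ , rev-*≡ p r e f

  -- Once `h` is trimmed, the equation up to trailing zeros becomes a literal one, and `quotₚ-rev`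
  -- applies.
  quotₚ-exact : ∀ p g h → Monic p → Monic g → p ≋ g *ₚ h → (quotₚ p g ≋ h) × Monic (quotₚ p g)
  quotₚ-exact p g h (t , ep) (gt , eg) e with trim h
  ... | inj₁ h≋0 = ⊥-elim (1≢0 (≡.trans (≡.sym (coeff-top p ep))
          (at (≋-trans e (≋-trans (*ₚ-cong (≋-refl {g}) h≋0) (*ₚ-zeroʳ g))) (length t))))
  ... | inj₂ (c , hr , nz , f) = ≋-trans (≡⇒≋ eq) (≋-sym f) ,
          hr , ≡.trans (cong reverse eq) (≡.trans (LP.reverse-involutive _) (cong (_∷ hr) c≡1))
    where
    H = reverse (c ∷ hr)
    eH : reverse H ≡ c ∷ hr
    eH = LP.reverse-involutive _
    revHg : reverse (H *ₚ g) ≡ (c ∷ hr) *ₚ (+ 1 ∷ gt)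
    revHg = rev-*≡ H g eH eg
    p≋Hg : p ≋ H *ₚ g
    p≋Hg = ≋-trans e (≋-trans (*ₚ-comm g h) (*ₚ-cong f (≋-refl {g})))
    c*1 : c ℤ.* + 1 ℤ.+ + 0 ≡ c
    c*1 = ≡.trans (ℤP.+-identityʳ _) (ℤP.*-identityʳ c)
    p≡Hg : p ≡ H *ₚ g
    p≡Hg = ≋-length⇒≡ _ _ p≋Hg (≋⇒length≡ p≋Hg 1≢0 (λ z → nz (≡.trans (≡.sym c*1) z)) ep revHg)
    revp : reverse p ≡ (c ∷ hr) *ₚ (+ 1 ∷ gt)
    revp = ≡.trans (cong reverse p≡Hg) revHg
    len : length (c ∷ hr) ≤ length p
    len = subst (length (c ∷ hr) ≤_) (≡.trans (≡.sym (length-* c hr (+ 1) gt)) (≡.trans (≡.sym (cong length revp)) (LP.length-reverse p)))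
            (s≤s (ℕP.m≤m+n _ _))
    c≡1 : c ≡ + 1
    c≡1 = ≡.trans (≡.sym c*1) (cong (λ z → coeff z 0) (≡.trans (≡.sym revp) ep))
    eq : quotₚ p g ≡ H
    eq = quotₚ-rev p g gt (c ∷ hr) eg revp len

  -- Cancellation, torsion and coprimality in ℤ[q].

  tailₚ : Poly → Poly
  tailₚ []      = []
  tailₚ (c ∷ p) = p

  coeff-tail : ∀ p i → coeff (tailₚ p) i ≡ coeff p (suc i)
  coeff-tail []      i = refl
  coeff-tail (c ∷ p) i = refl

  ∷-tail : ∀ {z p} → + 0 ∷ z ≋ p → z ≋ tailₚ p
  ∷-tail {z} {p} e = mk≋ λ i → ≡.trans (at e (suc i)) (≡.sym (coeff-tail p i))

  -- Modulo N the constant term of `g` is still invertible, so `g` is no zero divisor there.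
  -- Concretely, the coefficients of W / N are found from the lowest upwards.
  divConst : ∀ {g} {N} → UnitConst g → ∀ W {A} → g *ₚ W ≋ N ·ₚ A → ∃ λ C → W ≋ N ·ₚ C
  divConst         _          []      e = [] , ≋-refl
  divConst {g} {N} (mkUnit u ug≡1) (w ∷ W) {A} e = (c₀ ∷ C) , ∷-cong w≡ W≋
    where
    c₀ = u ℤ.* coeff A 0
    l₁ : ∀ u g w → w ≡ w ℤ.* + 1 → u ℤ.* g ≡ + 1 → w ≡ u ℤ.* (g ℤ.* w)
    l₁ u g w e f = ≡.trans e (≡.trans (cong (w ℤ.*_) (≡.sym f)) (l u g w))
      where
      l : ∀ u g w → w ℤ.* (u ℤ.* g) ≡ u ℤ.* (g ℤ.* w)
      l = ℤS.solve-∀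
    l₂ : ∀ u N a → u ℤ.* (N ℤ.* a) ≡ N ℤ.* (u ℤ.* a)
    l₂ = ℤS.solve-∀
    w≡ : w ≡ N ℤ.* c₀
    w≡ = ≡.trans (l₁ u (coeff g 0) w (≡.sym (ℤP.*-identityʳ w)) ug≡1)
          (≡.trans (cong (u ℤ.*_) (≡.trans (≡.sym (coeff-*-0 g (w ∷ W))) (≡.trans (at e 0) (coeff-· N A 0))))
            (l₂ u N (coeff A 0)))
    l₃ : ∀ a b → b ≋ (a +ₚ b) +ₚ negₚ a
    l₃ = solve-∀ polySolver
    rest : + 0 ∷ (g *ₚ W) ≋ N ·ₚ (A -ₚ c₀ ·ₚ g)
    rest = begin
      + 0 ∷ (g *ₚ W)                                ≈⟨ l₃ (w ·ₚ g) (+ 0 ∷ (g *ₚ W)) ⟩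
      (w ·ₚ g +ₚ (+ 0 ∷ (g *ₚ W))) -ₚ w ·ₚ g        ≈⟨ +ₚ-cong (≋-trans (≋-sym (*ₚ-∷ g w W)) e) (neg-cong (≋-trans (·ₚ-cong {w} {N ℤ.* c₀} {g} w≡ ≋-refl) (≋-sym (·ₚ-·ₚ N c₀ g)))) ⟩
      N ·ₚ A -ₚ N ·ₚ (c₀ ·ₚ g)                      ≈⟨ +ₚ-cong (≋-refl {N ·ₚ A}) (neg· N (c₀ ·ₚ g)) ⟩
      N ·ₚ A +ₚ N ·ₚ negₚ (c₀ ·ₚ g)                 ≈⟨ ·ₚ-distrib-+ₚ N A (negₚ (c₀ ·ₚ g)) ⟨
      N ·ₚ (A -ₚ c₀ ·ₚ g)                           ∎
      where
      neg· : ∀ N p → negₚ (N ·ₚ p) ≋ N ·ₚ negₚ p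
      neg· N p = mk≋ λ i → ≡.trans (coeff-neg (N ·ₚ p) i) (≡.trans (cong ℤ.-_ (coeff-· N p i))
        (≡.trans (ℤP.neg-distribʳ-* N (coeff p i)) (≡.trans (cong (N ℤ.*_) (≡.sym (coeff-neg p i))) (≡.sym (coeff-· N (negₚ p) i)))))
    tail· : ∀ N p → tailₚ (N ·ₚ p) ≋ N ·ₚ tailₚ p
    tail· N []      = ≋-refl
    tail· N (c ∷ p) = ≋-refl
    IH = divConst {g} {N} (mkUnit u ug≡1) W (≋-trans (∷-tail rest) (tail· N (A -ₚ c₀ ·ₚ g)))
    C = proj₁ IH
    W≋ = proj₂ IH

  cancelConst : ∀ {N p r} → N ≢ + 0 → N ·ₚ p ≋ N ·ₚ r → p ≋ r
  cancelConst {N} {p} {r} nz e = mk≋ λ i →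
    ℤP.*-cancelˡ-≡ N _ _ {{ℤ.≢-nonZero nz}} (≡.trans (≡.sym (coeff-· N p i)) (≡.trans (at e i) (coeff-· N r i)))

  -- The case N = 0 of `divConst`.
  cancelUnit₀ : ∀ {g} → UnitConst g → ∀ W → g *ₚ W ≋ [] → W ≋ []
  cancelUnit₀ U W e with divConst {N = + 0} U W {[]} e
  ... | C , f = ≋-trans f (0·ₚ C)

  cancelUnit : ∀ {g A B} → UnitConst g → g *ₚ A ≋ g *ₚ B → A ≋ B
  cancelUnit {g} {A} {B} U e = begin
    A                ≈⟨ l₁ A B ⟩
    B +ₚ (A -ₚ B)    ≈⟨ +ₚ-cong (≋-refl {B}) (cancelUnit₀ U (A -ₚ B) (≋-trans (l₂ g A B) (≋-trans (+ₚ-cong e ≋-refl) (+ₚ-inverseʳ (g *ₚ B))))) ⟩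
    B +ₚ []          ≈⟨ +ₚ-identityʳ B ⟩
    B                ∎
    where
    l₁ : ∀ A B → A ≋ B +ₚ (A +ₚ negₚ B)
    l₁ = solve-∀ polySolver
    l₂ : ∀ g A B → g *ₚ (A +ₚ negₚ B) ≋ g *ₚ A +ₚ negₚ (g *ₚ B)
    l₂ = solve-∀ polySolver

  -- From g h = N p, `divConst` makes `h` divisible by N, and N cancels. This removes the integers
  -- that Bézout arguments in ℤ[q] leave behind.
  torsionfree : ∀ {g N p} → UnitConst g → N ≢ + 0 → Mod g (N ·ₚ p) [] → Mod g p []
  torsionfree {g} {N} {p} U nz (mkMod h e) with divConst {N = N} U h (≋-trans e (+ₚ-identityʳ _))
  ... | C , f = mkMod C (≋-trans (cancelConst {N} nz eq) (≋-sym (+ₚ-identityʳ p)))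
    where
    l : ∀ n g C → n *ₚ (g *ₚ C) ≋ g *ₚ (n *ₚ C)
    l = solve-∀ polySolver
    eq : N ·ₚ (g *ₚ C) ≋ N ·ₚ p
    eq = begin
      N ·ₚ (g *ₚ C)            ≈⟨ const*≋ N _ ⟨
      constₚ N *ₚ (g *ₚ C)     ≈⟨ l (constₚ N) g C ⟩
      g *ₚ (constₚ N *ₚ C)     ≈⟨ *ₚ-cong (≋-refl {g}) (≋-trans (const*≋ N C) (≋-sym f)) ⟩
      g *ₚ h                   ≈⟨ ≋-trans e (+ₚ-identityʳ _) ⟩
      N ·ₚ p                   ∎

  -- A nonzero integer in the ideal (f , g).
  record Cop (f g : Poly) : Set where
    constructor mkCop
    field
      {N}   : ℤ
      {u v} : Poly
      N≢0   : N ≢ + 0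
      eq    : u *ₚ f +ₚ v *ₚ g ≋ constₚ N

  *≢0 : ∀ {M N} → M ≢ + 0 → N ≢ + 0 → M ℤ.* N ≢ + 0
  *≢0 {M} m n e with ℤP.i*j≡0⇒i≡0∨j≡0 M e
  ... | inj₁ z = m z
  ... | inj₂ z = n z

  -- In the product of the two identities every term contains f, except one that contains g times
  -- the remaining product.
  Cop-prod : ∀ {f gs} → All (Cop f) gs → Cop f (prodₚ gs)
  Cop-prod {f} [] = mkCop {N = + 1} {u = []} {v = 1ₚ} 1≢0 (*ₚ-identityˡ 1ₚ)
  Cop-prod {f} {g ∷ gs} (mkCop {N} {u} {v} nz e ∷ cs) with Cop-prod cs
  ... | mkCop {M} {u′} {v′} nz′ e′ =
    mkCop {N = N ℤ.* M} {u = u *ₚ (u′ *ₚ f +ₚ v′ *ₚ G) +ₚ v *ₚ g *ₚ u′} {v = v *ₚ v′} (*≢0 nz nz′) (begin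
      (u *ₚ (u′ *ₚ f +ₚ v′ *ₚ G) +ₚ v *ₚ g *ₚ u′) *ₚ f +ₚ (v *ₚ v′) *ₚ (g *ₚ G) ≈⟨ l u u′ v v′ f g G ⟩
      (u *ₚ f +ₚ v *ₚ g) *ₚ (u′ *ₚ f +ₚ v′ *ₚ G)                               ≈⟨ *ₚ-cong e e′ ⟩
      constₚ N *ₚ constₚ M                                                     ≈⟨ const*≋ N (constₚ M) ⟩
      constₚ (N ℤ.* M)                                                         ∎)
    where
    G = prodₚ gs
    l : ∀ u u′ v v′ f g G → (u *ₚ (u′ *ₚ f +ₚ v′ *ₚ G) +ₚ v *ₚ g *ₚ u′) *ₚ f +ₚ (v *ₚ v′) *ₚ (g *ₚ G)
                           ≋ (u *ₚ f +ₚ v *ₚ g) *ₚ (u′ *ₚ f +ₚ v′ *ₚ G)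
    l = solve-∀ polySolver

  UnitConst-* : ∀ {f g} → UnitConst f → UnitConst g → UnitConst (f *ₚ g)
  UnitConst-* {f} {g} (mkUnit u e) (mkUnit v e′) = mkUnit (u ℤ.* v) (
    ≡.trans (cong (u ℤ.* v ℤ.*_) (coeff-*-0 f g)) (≡.trans (l u v (coeff f 0) (coeff g 0)) (cong₂ ℤ._*_ e e′)))
    where
    l : ∀ u v a b → u ℤ.* v ℤ.* (a ℤ.* b) ≡ u ℤ.* a ℤ.* (v ℤ.* b)
    l = ℤS.solve-∀

  UnitConst-prod : ∀ {gs} → All UnitConst gs → UnitConst (prodₚ gs)
  UnitConst-prod []       = mkUnit (+ 1) refl
  UnitConst-prod {g ∷ gs} (U ∷ Us) = UnitConst-* {g} {prodₚ gs} U (UnitConst-prod Us)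

  -- With P = f A = g B the identity u f + v g = N gives g (u B + v A) = N A; by `divConst` the
  -- factor N can be removed, so g divides A.
  coprime-* : ∀ {f g P} → UnitConst g → Cop f g → Mod f P [] → Mod g P [] → Mod (f *ₚ g) P []
  coprime-* {f} {g} {P} U (mkCop {N} {u} {v} nz e) (mkMod A a) (mkMod B b) =
    finish (divConst {N = N} U (u *ₚ B +ₚ v *ₚ A) {A} eq)
    where
    l₁ : ∀ g u v A B → g *ₚ (u *ₚ B +ₚ v *ₚ A) ≋ u *ₚ (g *ₚ B) +ₚ v *ₚ g *ₚ A
    l₁ = solve-∀ polySolver
    l₂ : ∀ f g u v A → u *ₚ (f *ₚ A) +ₚ v *ₚ g *ₚ A ≋ (u *ₚ f +ₚ v *ₚ g) *ₚ A
    l₂ = solve-∀ polySolver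
    l₃ : ∀ n g C → n *ₚ (g *ₚ C) ≋ g *ₚ (n *ₚ C)
    l₃ = solve-∀ polySolver
    eq : g *ₚ (u *ₚ B +ₚ v *ₚ A) ≋ N ·ₚ A
    eq = begin
      g *ₚ (u *ₚ B +ₚ v *ₚ A)            ≈⟨ l₁ g u v A B ⟩
      u *ₚ (g *ₚ B) +ₚ v *ₚ g *ₚ A       ≈⟨ +ₚ-cong (*ₚ-cong (≋-refl {u}) (≋-trans b (≋-sym a))) ≋-refl ⟩
      u *ₚ (f *ₚ A) +ₚ v *ₚ g *ₚ A       ≈⟨ l₂ f g u v A ⟩
      (u *ₚ f +ₚ v *ₚ g) *ₚ A            ≈⟨ *ₚ-cong e (≋-refl {A}) ⟩
      constₚ N *ₚ A                      ≈⟨ const*≋ N A ⟩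
      N ·ₚ A                             ∎
    finish : (∃ λ C → u *ₚ B +ₚ v *ₚ A ≋ N ·ₚ C) → Mod (f *ₚ g) P []
    finish (C , W≋) = mkMod C (≋-trans (*ₚ-assoc f g C) (≋-trans (*ₚ-cong (≋-refl {f}) (cancelConst {N} nz (begin
      N ·ₚ (g *ₚ C)                      ≈⟨ const*≋ N _ ⟨
      constₚ N *ₚ (g *ₚ C)               ≈⟨ l₃ (constₚ N) g C ⟩
      g *ₚ (constₚ N *ₚ C)               ≈⟨ *ₚ-cong (≋-refl {g}) (≋-trans (const*≋ N C) (≋-sym W≋)) ⟩
      g *ₚ (u *ₚ B +ₚ v *ₚ A)            ≈⟨ eq ⟩
      N ·ₚ A                             ∎))) a))

  coprime-prod : ∀ {fs P} → AllPairs Cop fs → All UnitConst fs → All (λ f → Mod f P []) fs → Mod (prodₚ fs) P []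
  coprime-prod {P = P} [] [] [] = mkMod P (≋-trans (*ₚ-identityˡ P) (≋-sym (+ₚ-identityʳ P)))
  coprime-prod (c ∷ cs) (U ∷ Us) (d ∷ ds) = coprime-* (UnitConst-prod Us) (Cop-prod c) d (coprime-prod cs Us ds)

  -- Cyclotomic polynomials.

  ∈-properDivisors⁻ : ∀ {d n} → d ∈ properDivisors n → 0 < d × d < n × d ∣ n
  ∈-properDivisors⁻ {d} {n} h with ∈-filter⁻ _ {xs = map suc (upTo (n ∸ 1))} h
  ... | m , t with ∈-map⁻ suc m
  ...   | i , i∈ , refl = s≤s z≤n , below n (∈-upTo⁻ i∈) , toWitness t
    where
    below : ∀ n → i < n ∸ 1 → suc i < n
    below (suc n) h = s≤s h

  ∈-properDivisors⁺ : ∀ {d n} → 0 < d → d < n → d ∣ n → d ∈ properDivisors n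
  ∈-properDivisors⁺ {suc d} {suc n} (s≤s z≤n) (s≤s h) dv =
    ∈-filter⁺ _ (∈-map⁺ suc (∈-upTo⁺ h)) (fromWitness dv)

  properDivisors-unique : ∀ n → Unique (properDivisors n)
  properDivisors-unique n = UniqueP.filter⁺ _ (UniqueP.map⁺ ℕP.suc-injective (UniqueP.upTo⁺ (n ∸ 1)))

  mutual
    -- The private recursion with fuel, recovered from the equation in which `cyclotomic` unfolds to
    -- it.
    cycloFuel : ℕ → ℕ → Poly
    cycloFuel = _

    cyclotomic-fuel : ∀ f → cyclotomic (suc f) ≡
      quotₚ (qPowMinusOne (suc f)) (prodₚ (map (cycloFuel f) (properDivisors (suc f))))
    cyclotomic-fuel f = refl

  cycloFuel-irrelevant : ∀ N d {f f′} → d ≤ N → 0 < d → d ≤ f → d ≤ f′ → cycloFuel f d ≡ cycloFuel f′ d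
  cycloFuel-irrelevant zero    (suc d) ()
  cycloFuel-irrelevant (suc N) (suc d) {suc f} {suc f′} (s≤s h) _ (s≤s k) (s≤s k′) =
    cong (λ z → quotₚ (qPowMinusOne (suc d)) (prodₚ z)) (maps (properDivisors (suc d)) (All.tabulate ∈-properDivisors⁻))
    where
    maps : ∀ ds → All (λ e → 0 < e × e < suc d × e ∣ suc d) ds → map (cycloFuel f) ds ≡ map (cycloFuel f′) ds
    maps []       []                        = refl
    maps (e ∷ ds) ((e>0 , s≤s e≤d , _) ∷ a) =
      cong₂ _∷_ (cycloFuel-irrelevant N e (ℕP.≤-trans e≤d h) e>0 (ℕP.≤-trans e≤d k) (ℕP.≤-trans e≤d k′)) (maps ds a)

  cyclotomic-rec : ∀ n → 0 < n → cyclotomic n ≡ quotₚ (qPowMinusOne n) (prodₚ (map cyclotomic (properDivisors n)))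
  cyclotomic-rec (suc f) _ = cong (λ z → quotₚ (qPowMinusOne (suc f)) (prodₚ z))
    (maps (properDivisors (suc f)) (All.tabulate ∈-properDivisors⁻))
    where
    maps : ∀ ds → All (λ e → 0 < e × e < suc f × e ∣ suc f) ds → map (cycloFuel f) ds ≡ map cyclotomic ds
    maps []       []                        = refl
    maps (e ∷ ds) ((e>0 , s≤s e≤f , _) ∷ a) =
      cong₂ _∷_ (cycloFuel-irrelevant e e ℕP.≤-refl e>0 e≤f ℕP.≤-refl) (maps ds a)

  qPowMinusOne≋ : ∀ n → qPowMinusOne n ≋ xₚ ^ₚ n -ₚ 1ₚ
  qPowMinusOne≋ n = +ₚ-cong (≋-trans (shift≋ n 1ₚ) (≋-trans (*ₚ-comm (xₚ ^ₚ n) 1ₚ) (*ₚ-identityˡ _))) ≋-refl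

  qPowMinusOne-monic : ∀ n → 0 < n → Monic (qPowMinusOne n)
  qPowMinusOne-monic (suc m) _ = reverse (-[1+ 0 ] ∷ replicate m (+ 0)) ,
    ≡.trans (cong reverse (cong (-[1+ 0 ] ∷_) (id+ (shiftₚ m (+ 1 ∷ []))))) (LP.reverse-++ (-[1+ 0 ] ∷ replicate m (+ 0)) (+ 1 ∷ []))
    where
    id+ : ∀ p → p +ₚ [] ≡ p
    id+ []      = refl
    id+ (_ ∷ p) = refl

  coeff₀-xⁿ-1 : ∀ n → 0 < n → coeff (xₚ ^ₚ n -ₚ 1ₚ) 0 ≡ -[1+ 0 ]
  coeff₀-xⁿ-1 (suc n) _ = ≡.trans (coeff-- (xₚ ^ₚ suc n) 1ₚ 0) (cong (ℤ._- + 1) (coeff-*-0 xₚ (xₚ ^ₚ n)))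

  UnitConst-xⁿ-1 : ∀ n → 0 < n → UnitConst (xₚ ^ₚ n -ₚ 1ₚ)
  UnitConst-xⁿ-1 n h = mkUnit -[1+ 0 ] (cong (-[1+ 0 ] ℤ.*_) (coeff₀-xⁿ-1 n h))

  geom-x : ∀ Q k → (Q -ₚ 1ₚ) *ₚ int Q k ≋ Q ^ₚ k -ₚ 1ₚ
  geom-x Q k = ≋-trans (l₁ Q (int Q k)) (≋-trans (neg-cong (int-geom Q k)) (l₂ (Q ^ₚ k)))
    where
    l₁ : ∀ Q I → (Q +ₚ negₚ 1ₚ) *ₚ I ≋ negₚ ((1ₚ +ₚ negₚ Q) *ₚ I)
    l₁ = solve-∀ polySolver
    l₂ : ∀ A → negₚ (1ₚ +ₚ negₚ A) ≋ A +ₚ negₚ 1ₚ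
    l₂ = solve-∀ polySolver

  xⁿ-1-dvd : ∀ d k → (xₚ ^ₚ d -ₚ 1ₚ) *ₚ int (xₚ ^ₚ d) k ≋ xₚ ^ₚ (k * d) -ₚ 1ₚ
  xⁿ-1-dvd d k = ≋-trans (geom-x (xₚ ^ₚ d) k) (+ₚ-cong (^-^ xₚ d k) ≋-refl)

  Mod-^ : ∀ {g p r} n → Mod g p r → Mod g (p ^ₚ n) (r ^ₚ n)
  Mod-^ zero    e = Mod-refl
  Mod-^ (suc n) e = Mod-* e (Mod-^ n e)

  Mod-int : ∀ {g p r} n → Mod g p r → Mod g (int p n) (int r n)
  Mod-int zero    e = Mod-refl
  Mod-int (suc n) e = Mod-+ (Mod-refl {p = 1ₚ}) (Mod-* e (Mod-int n e))

  int-1 : ∀ k → int 1ₚ k ≋ constₚ (+ k)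
  int-1 zero    = ≋-sym 0∷[]
  int-1 (suc k) = +ₚ-cong (≋-refl {1ₚ}) (≋-trans (*ₚ-identityˡ _) (int-1 k))

  Mod-1^ : ∀ {g p} n → Mod g p 1ₚ → Mod g (p ^ₚ n) 1ₚ
  Mod-1^ n e = Mod-trans (Mod-^ n e) (≋⇒Mod (1^ n))

  -- The properties of Φ_n on which everything rests. `quotient` says that Φ_n divides (q^n -
  -- 1)/(q^g - 1) for proper divisors g; it expresses that the root is primitive and takes the place
  -- of irreducibility.
  record IsCyclotomic (n : ℕ) : Set where
    field
      monic    : Monic (cyclotomic n)
      factor   : prodₚ (map cyclotomic (properDivisors n)) *ₚ cyclotomic n ≋ xₚ ^ₚ n -ₚ 1ₚ
      quotient : ∀ g k → n ≡ k * g → g < n → Mod (cyclotomic n) (int (xₚ ^ₚ g) k) []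

  open IsCyclotomic

  module _ {n} (pos : 0 < n) (C : IsCyclotomic n) where

    cyclotomic-unitConst : UnitConst (cyclotomic n)
    cyclotomic-unitConst = mkUnit (ℤ.- coeff P 0) (≡.trans (≡.sym (ℤP.neg-distribˡ-* (coeff P 0) (coeff (cyclotomic n) 0)))
      (cong ℤ.-_ (≡.trans (≡.sym (coeff-*-0 P (cyclotomic n))) (≡.trans (at (factor C) 0) (coeff₀-xⁿ-1 n pos)))))
      where P = prodₚ (map cyclotomic (properDivisors n))

    xⁿ≡1 : Mod (cyclotomic n) (xₚ ^ₚ n) 1ₚ
    xⁿ≡1 = mkMod (prodₚ (map cyclotomic (properDivisors n))) (≋-trans (*ₚ-comm (cyclotomic n) _) (factor C))

    cyclotomic-dvd : ∀ {N} → n ∣ N → Mod (cyclotomic n) (xₚ ^ₚ N -ₚ 1ₚ) []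
    cyclotomic-dvd (divides k refl) = Mod-trans (≋⇒Mod (+ₚ-cong (≋-sym (^-^ xₚ n k)) ≋-refl))
      (Mod-trans (Mod-+ (Mod-1^ k xⁿ≡1) (Mod-refl {p = negₚ 1ₚ})) (≋⇒Mod (+ₚ-inverseʳ 1ₚ)))

  -- Modulo (f, f′) both p r and r are 1, hence p is.
  ideal-difference : ∀ {f f′ p r} → Mod f (p *ₚ r) 1ₚ → Mod f′ r 1ₚ → ∃₂ λ u v → u *ₚ f +ₚ v *ₚ f′ ≋ p -ₚ 1ₚ
  ideal-difference {f} {f′} {p} {r} (mkMod A a) (mkMod B b) = A , negₚ (p *ₚ B) , (begin
    A *ₚ f +ₚ negₚ (p *ₚ B) *ₚ f′                          ≈⟨ l₁ A f p B f′ ⟩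
    f *ₚ A +ₚ negₚ (p *ₚ (f′ *ₚ B))                        ≈⟨ +ₚ-cong a (neg-cong (*ₚ-cong (≋-refl {p}) b)) ⟩
    (p *ₚ r -ₚ 1ₚ) +ₚ negₚ (p *ₚ (r -ₚ 1ₚ))                ≈⟨ l₂ p r ⟩
    p -ₚ 1ₚ                                                ∎)
    where
    l₁ : ∀ A f p B g → A *ₚ f +ₚ negₚ (p *ₚ B) *ₚ g ≋ f *ₚ A +ₚ negₚ (p *ₚ (g *ₚ B))
    l₁ = solve-∀ polySolver
    l₂ : ∀ p r → (p *ₚ r +ₚ negₚ 1ₚ) +ₚ negₚ (p *ₚ (r +ₚ negₚ 1ₚ)) ≋ p +ₚ negₚ 1ₚ
    l₂ = solve-∀ polySolver

  -- Modulo (f, f′) both D and I vanish, while I is the integer K modulo D.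
  ideal-constant : ∀ {f f′ D I K} → K ≢ + 0 → (∃₂ λ u v → u *ₚ f +ₚ v *ₚ f′ ≋ D) →
                   Mod f I [] → Mod D I (constₚ K) → Cop f f′
  ideal-constant {f} {f′} {D} {I} {K} K≢0 (u , v , e) (mkMod S s) (mkMod E ee) =
    mkCop {N = K} {u = S -ₚ u *ₚ E} {v = negₚ (v *ₚ E)} K≢0 (begin
      (S -ₚ u *ₚ E) *ₚ f +ₚ negₚ (v *ₚ E) *ₚ f′            ≈⟨ l₁ S u E f v f′ ⟩
      f *ₚ S -ₚ (u *ₚ f +ₚ v *ₚ f′) *ₚ E                   ≈⟨ +ₚ-cong s (neg-cong (≋-trans (*ₚ-cong e (≋-refl {E})) ee)) ⟩
      (I +ₚ []) -ₚ (I -ₚ constₚ K)                         ≈⟨ l₂ I (constₚ K) ⟩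
      constₚ K                                             ∎)
    where
    l₁ : ∀ S u E f v g → (S +ₚ negₚ (u *ₚ E)) *ₚ f +ₚ negₚ (v *ₚ E) *ₚ g ≋ f *ₚ S +ₚ negₚ ((u *ₚ f +ₚ v *ₚ g) *ₚ E)
    l₁ = solve-∀ polySolver
    l₂ : ∀ I K → (I +ₚ []) +ₚ negₚ (I +ₚ negₚ K) ≋ K
    l₂ = solve-∀ polySolver

  int-at-1 : ∀ X k → Mod (X -ₚ 1ₚ) (int X k) (constₚ (+ k))
  int-at-1 X k = Mod-trans {r = int 1ₚ k} (Mod-int k X≡1) (≋⇒Mod (int-1 k))
    where
    X≡1 : Mod (X -ₚ 1ₚ) X 1ₚ
    X≡1 = mkMod 1ₚ (≋-trans (*ₚ-comm (X -ₚ 1ₚ) 1ₚ) (*ₚ-identityˡ _))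

  xⁿ-power : ∀ {n} → 0 < n → IsCyclotomic n → ∀ x → Mod (cyclotomic n) (xₚ ^ₚ (x * n)) 1ₚ
  xⁿ-power {n} p C x = Mod-trans (≋⇒Mod (≋-sym (^-^ xₚ n x))) (Mod-1^ x (xⁿ≡1 p C))

  gcd-ideal : ∀ {f f′ g s t} → g + s ≡ t → Mod f (xₚ ^ₚ t) 1ₚ → Mod f′ (xₚ ^ₚ s) 1ₚ →
              ∃₂ λ u v → u *ₚ f +ₚ v *ₚ f′ ≋ xₚ ^ₚ g -ₚ 1ₚ
  gcd-ideal {g = g} {s} refl e e′ = ideal-difference (Mod-trans (≋⇒Mod (≋-sym (^-+ xₚ g s))) e) e′

  Cop-sym : ∀ {f g} → Cop f g → Cop g f
  Cop-sym {f} {g} (mkCop {N} {u} {v} nz e) = mkCop {N = N} {u = v} {v = u} nz (≋-trans (+ₚ-comm (v *ₚ g) (u *ₚ f)) e)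

  -- Modulo both Φ_d and Φ_d′ one has q^g = 1 for g = gcd d d′, so that the
  -- multiple [d/g]_{q^g} of Φ_d becomes the integer d/g.
  cyclotomic-cop : ∀ {d d′} → 0 < d → 0 < d′ → IsCyclotomic d → IsCyclotomic d′ →
                   ∀ {g} k → d ≡ k * g → g < d → Bézout.Identity g d d′ → Cop (cyclotomic d) (cyclotomic d′)
  cyclotomic-cop {d} {d′} p p′ C C′ {g} k dk g<d bz =
    ideal-constant (k≢0 {k} dk) (ideal bz) (quotient C g k dk g<d) (int-at-1 (xₚ ^ₚ g) k)
    where
    ideal : Bézout.Identity g d d′ → ∃₂ λ u v → u *ₚ cyclotomic d +ₚ v *ₚ cyclotomic d′ ≋ xₚ ^ₚ g -ₚ 1ₚ
    ideal (Bézout.+- x y e) = gcd-ideal {g = g} {s = y * d′} e (xⁿ-power p C x) (xⁿ-power p′ C′ y)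
    ideal (Bézout.-+ x y e) = swap (gcd-ideal {g = g} {s = x * d} e (xⁿ-power p′ C′ y) (xⁿ-power p C x))
      where
      swap : (∃₂ λ u v → u *ₚ cyclotomic d′ +ₚ v *ₚ cyclotomic d ≋ xₚ ^ₚ g -ₚ 1ₚ) → ∃₂ λ u v → u *ₚ cyclotomic d +ₚ v *ₚ cyclotomic d′ ≋ xₚ ^ₚ g -ₚ 1ₚ
      swap (u , v , eq) = v , u , ≋-trans (+ₚ-comm (v *ₚ cyclotomic d) (u *ₚ cyclotomic d′)) eq
    k≢0 : ∀ {k} → d ≡ k * g → + k ≢ + 0
    k≢0 {zero} refl _ = ℕP.<-irrefl refl p

  -- As d and d′ differ, their gcd is a proper divisor of at least one of them, and that one
  -- supplies the q-integer of `cyclotomic-cop`.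
  cyclotomic-cop-≢ : ∀ {d d′} → 0 < d → 0 < d′ → d ≢ d′ → IsCyclotomic d → IsCyclotomic d′ → Cop (cyclotomic d) (cyclotomic d′)
  cyclotomic-cop-≢ {d} {d′} p p′ ne C C′ with Bézout.lemma d d′
  ... | Bézout.result g G b with GCD.gcd∣m G | GCD.gcd∣n G
  ...   | dv@(divides k e) | dv′@(divides k′ e′) with g ℕ.<? d | g ℕ.<? d′
  ...     | yes l | _     = cyclotomic-cop p p′ C C′ k e l b
  ...     | no _  | yes l = Cop-sym (cyclotomic-cop p′ p C′ C k′ e′ l (Bézout.Identity.sym b))
  ...     | no l  | no l′ = ⊥-elim (ne (≡.trans (≡.sym (eq p l dv)) (eq p′ l′ dv′)))
    where
    eq : ∀ {d} → 0 < d → ¬ g < d → g ∣ d → g ≡ d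
    eq p nl dv = ℕP.≤-antisym (∣.∣⇒≤ {{ℕ.>-nonZero p}} dv) (ℕP.≮⇒≥ nl)

  AllPairs-map : ∀ {ds} → Unique ds → All (0 <_) ds → All IsCyclotomic ds → AllPairs Cop (map cyclotomic ds)
  AllPairs-map {[]}     _        _        _        = []
  AllPairs-map {d ∷ ds} (u ∷ us) (p ∷ ps) (c ∷ cs) = AllP.map⁺ (go u ps cs) ∷ AllPairs-map us ps cs
    where
    go : ∀ {es} → All (d ≢_) es → All (0 <_) es → All IsCyclotomic es → All (λ e → Cop (cyclotomic d) (cyclotomic e)) es
    go []       []       []       = []
    go (n ∷ ns) (p′ ∷ ps) (c′ ∷ cs) = cyclotomic-cop-≢ p p′ n c c′ ∷ go ns ps cs

  -- By induction the Φ_d of the proper divisors are pairwise coprime in the sense of `Cop`, and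
  -- each divides q^n - 1; hence so does their product G, and the division in `cyclotomic n` is
  -- exact with quotient H.
  isCyclotomic-below : ∀ N n → n ≤ N → 0 < n → IsCyclotomic n
  isCyclotomic-below zero    zero _ ()
  isCyclotomic-below (suc N) n n≤N pos = record
    { monic    = subst Monic (≡.sym Φ≡) (proj₂ exact)
    ; factor   = ≋-trans (*ₚ-cong (≋-refl {G}) Φ≋) (≋-trans G*H (≋-refl))
    ; quotient = quot }
    where
    G = prodₚ (map cyclotomic (properDivisors n))
    info = All.tabulate {xs = properDivisors n} ∈-properDivisors⁻
    IH : ∀ {d} → 0 < d → d < n → IsCyclotomic d
    IH p l = isCyclotomic-below N _ (ℕ.s≤s⁻¹ (ℕP.≤-trans l n≤N)) p
    ps : All (0 <_) (properDivisors n)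
    ps = All.map proj₁ info
    cs : All IsCyclotomic (properDivisors n)
    cs = All.map (λ { (p , l , _) → IH p l }) info
    units : ∀ {ds} → All (λ d → 0 < d × d < n) ds → All UnitConst (map cyclotomic ds)
    units a = AllP.map⁺ (All.map (λ { (p , l) → cyclotomic-unitConst p (IH p l) }) a)
    dvd : Mod G (xₚ ^ₚ n -ₚ 1ₚ) []
    dvd = coprime-prod (AllPairs-map (properDivisors-unique n) ps cs)
            (units (All.map (λ { (p , l , _) → p , l }) info))
            (AllP.map⁺ (All.map (λ { (p , l , d) → cyclotomic-dvd p (IH p l) d }) info))
    H = Mod.quo dvd
    G*H : G *ₚ H ≋ xₚ ^ₚ n -ₚ 1ₚ
    G*H = ≋-trans (Mod.eq dvd) (+ₚ-identityʳ _)
    monics : ∀ {ds} → All IsCyclotomic ds → Monic (prodₚ (map cyclotomic ds))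
    monics []       = [] , refl
    monics {d ∷ ds} (c ∷ cs) = Monic-* {cyclotomic d} {prodₚ (map cyclotomic ds)} (monic c) (monics cs)
    exact = quotₚ-exact (qPowMinusOne n) G H (qPowMinusOne-monic n pos) (monics cs)
              (≋-trans (qPowMinusOne≋ n) (≋-sym G*H))
    Φ≡ : cyclotomic n ≡ quotₚ (qPowMinusOne n) G
    Φ≡ = cyclotomic-rec n pos
    Φ≋ : cyclotomic n ≋ H
    Φ≋ = ≋-trans (≡⇒≋ Φ≡) (proj₁ exact)
    quot : ∀ g k → n ≡ k * g → g < n → Mod (cyclotomic n) (int (xₚ ^ₚ g) k) []
    quot g k n≡kg g<n = mkMod R (≋-trans (≋-trans (*ₚ-comm _ R) (≋-sym I≋)) (≋-sym (+ₚ-identityʳ _)))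
      where
      factor>0 : ∀ g → n ≡ k * g → 0 < g
      factor>0 zero    e = ⊥-elim (ℕP.<-irrefl (≡.sym (≡.trans e (ℕP.*-zeroʳ k))) pos)
      factor>0 (suc _) e = s≤s z≤n
      0<g : 0 < g
      0<g = factor>0 g n≡kg
      Cg = IH 0<g g<n
      -- The divisors of g are proper divisors of n, so the product q^g - 1 of their Φ divides G,
      -- once more by coprimality. Cancelling q^g - 1 from q^n - 1 = G Φ_n shows that Φ_n divides
      -- [k] in base q^g.
      ds = g ∷ properDivisors g
      ginfo = All.tabulate {xs = properDivisors g} ∈-properDivisors⁻
      dinfo : All (λ d → 0 < d × d < n) ds
      dinfo = (0<g , g<n) ∷ All.map (λ { (p , l , _) → p , ℕP.<-trans l g<n }) ginfo
      ddvd : All (_∣ n) ds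
      ddvd = divides k n≡kg ∷ All.map (λ { (_ , _ , d) → ∣.∣-trans d (divides k n≡kg) }) ginfo
      member : ∀ {p xs} → p ∈ xs → Mod p (prodₚ xs) []
      member {p} {x ∷ xs} (here refl) = multiple (prodₚ xs)
      member {p} {x ∷ xs} (there m)   = Mod-trans (Mod-* (Mod-refl {p = x}) (member m)) (≋⇒Mod (*ₚ-zeroʳ x))
      inG : ∀ {es} → All (λ d → 0 < d × d < n) es → All (_∣ n) es → All (λ f → Mod f G []) (map cyclotomic es)
      inG []             []       = []
      inG ((p , l) ∷ as) (d ∷ dv) = member (∈-map⁺ cyclotomic (∈-properDivisors⁺ p l d)) ∷ inG as dv
      dG : Mod (prodₚ (map cyclotomic ds)) G []
      dG = coprime-prod
        (AllPairs-map (All.map (λ { (_ , l , _) e → ℕP.<-irrefl (≡.sym e) l }) ginfo ∷ properDivisors-unique g)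
          (All.map proj₁ dinfo) (All.map (λ { (p , l) → IH p l }) dinfo))
        (units dinfo) (inG dinfo ddvd)
      R = Mod.quo dG
      xg : prodₚ (map cyclotomic ds) ≋ xₚ ^ₚ g -ₚ 1ₚ
      xg = ≋-trans (*ₚ-comm (cyclotomic g) _) (factor Cg)
      GR : G ≋ (xₚ ^ₚ g -ₚ 1ₚ) *ₚ R
      GR = ≋-sym (≋-trans (*ₚ-cong (≋-sym xg) (≋-refl {R})) (≋-trans (Mod.eq dG) (+ₚ-identityʳ G)))
      I≋ : int (xₚ ^ₚ g) k ≋ R *ₚ cyclotomic n
      I≋ = cancelUnit (UnitConst-xⁿ-1 g 0<g) (begin
        (xₚ ^ₚ g -ₚ 1ₚ) *ₚ int (xₚ ^ₚ g) k         ≈⟨ xⁿ-1-dvd g k ⟩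
        xₚ ^ₚ (k * g) -ₚ 1ₚ                        ≡⟨ cong (λ z → xₚ ^ₚ z -ₚ 1ₚ) n≡kg ⟨
        xₚ ^ₚ n -ₚ 1ₚ                              ≈⟨ G*H ⟨
        G *ₚ H                                     ≈⟨ *ₚ-cong GR (≋-sym Φ≋) ⟩
        (xₚ ^ₚ g -ₚ 1ₚ) *ₚ R *ₚ cyclotomic n       ≈⟨ *ₚ-assoc (xₚ ^ₚ g -ₚ 1ₚ) R (cyclotomic n) ⟩
        (xₚ ^ₚ g -ₚ 1ₚ) *ₚ (R *ₚ cyclotomic n)     ∎)

  isCyclotomic : ∀ n → 0 < n → IsCyclotomic n
  isCyclotomic n = isCyclotomic-below n n ℕP.≤-refl

  -- ζ^j ≠ 1 may be cancelled from ζ^j z = z, because 1 - ζ^j divides an integer.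
  root-cancel : ∀ n j Z → 0 < n → ¬ n ∣ j → Mod (cyclotomic n) (xₚ ^ₚ j *ₚ Z) Z → Mod (cyclotomic n) Z []
  root-cancel n j Z pos n∤j e with Bézout.lemma n j
  ... | Bézout.result g G b with GCD.gcd∣m G | GCD.gcd∣n G
  ...   | divides k n≡kg | g∣j = torsionfree (cyclotomic-unitConst pos C) (k≢0 {k} n≡kg)
            (Mod-trans (Mod-sym kZ) (Mod-trans (Mod-* (quotient C g k n≡kg g<n) (Mod-refl {p = Z})) Mod-refl))
    where
    C = isCyclotomic n pos
    Φ = cyclotomic n
    k≢0 : ∀ {k} → n ≡ k * g → + k ≢ + 0
    k≢0 {zero} refl _ = ℕP.<-irrefl refl pos
    g<n : g < n
    g<n with g ℕ.<? n
    ... | yes l = l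
    ... | no nl = ⊥-elim (n∤j (subst (_∣ j) (ℕP.≤-antisym (∣.∣⇒≤ {{ℕ.>-nonZero pos}} (divides k n≡kg)) (ℕP.≮⇒≥ nl)) g∣j))
    fixpow : ∀ {P} x → Mod Φ (P *ₚ Z) Z → Mod Φ (P ^ₚ x *ₚ Z) Z
    fixpow     zero    h = ≋⇒Mod (*ₚ-identityˡ Z)
    fixpow {P} (suc x) h = Mod-trans (≋⇒Mod (*ₚ-assoc P (P ^ₚ x) Z)) (Mod-trans (Mod-* (Mod-refl {p = P}) (fixpow x h)) h)
    xn : Mod Φ (xₚ ^ₚ n *ₚ Z) Z
    xn = Mod-trans (Mod-* (xⁿ≡1 pos C) (Mod-refl {p = Z})) (≋⇒Mod (*ₚ-identityˡ Z))
    pw : ∀ m x → Mod Φ (xₚ ^ₚ m *ₚ Z) Z → Mod Φ (xₚ ^ₚ (x * m) *ₚ Z) Z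
    pw m x h = Mod-trans (≋⇒Mod (*ₚ-cong (≋-sym (^-^ xₚ m x)) (≋-refl {Z}))) (fixpow x h)
    sumup : ∀ s t → g + s ≡ t → Mod Φ (xₚ ^ₚ s *ₚ Z) Z → Mod Φ (xₚ ^ₚ t *ₚ Z) Z → Mod Φ (xₚ ^ₚ g *ₚ Z) Z
    sumup s t refl hs ht = Mod-trans (Mod-* (Mod-refl {p = xₚ ^ₚ g}) (Mod-sym hs))
      (Mod-trans (≋⇒Mod (≋-trans (≋-sym (*ₚ-assoc (xₚ ^ₚ g) (xₚ ^ₚ s) Z)) (*ₚ-cong (≋-sym (^-+ xₚ g s)) (≋-refl {Z})))) ht)
    bez : Bézout.Identity g n j → Mod Φ (xₚ ^ₚ g *ₚ Z) Z
    bez (Bézout.+- x y e′) = sumup (y * j) (x * n) e′ (pw j y e) (pw n x xn)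
    bez (Bézout.-+ x y e′) = sumup (x * n) (y * j) e′ (pw n x xn) (pw j y e)
    xg : Mod Φ (xₚ ^ₚ g *ₚ Z) Z
    xg = bez b
    intZ : ∀ k → Mod Φ (int (xₚ ^ₚ g) k *ₚ Z) (constₚ (+ k) *ₚ Z)
    intZ zero    = ≋⇒Mod (≋-sym (*ₚ-cong 0∷[] (≋-refl {Z})))
    intZ (suc k) = Mod-trans (≋⇒Mod (l₁ (xₚ ^ₚ g) (int (xₚ ^ₚ g) k) Z))
      (Mod-trans (Mod-+ (Mod-refl {p = Z}) (Mod-trans (Mod-* (Mod-refl {p = int (xₚ ^ₚ g) k}) xg) (intZ k)))
        (≋⇒Mod (≋-trans (l₂ (constₚ (+ k)) Z) (*ₚ-cong (≋-refl {constₚ (+ suc k)}) (≋-refl {Z})))))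
      where
      l₁ : ∀ X I Z → (1ₚ +ₚ X *ₚ I) *ₚ Z ≋ Z +ₚ I *ₚ (X *ₚ Z)
      l₁ = solve-∀ polySolver
      l₂ : ∀ K Z → Z +ₚ K *ₚ Z ≋ (1ₚ +ₚ K) *ₚ Z
      l₂ = solve-∀ polySolver
    kZ : Mod Φ (int (xₚ ^ₚ g) k *ₚ Z) ((+ k) ·ₚ Z)
    kZ = Mod-trans (intZ k) (≋⇒Mod (const*≋ (+ k) Z))

-- Gaussian binomials at roots of unity, and the q-Narayana polynomial.

module RootsOfUnity where

  open Polynomials
  open import Data.Nat using (_+_; _*_; _∸_; _<_; _≤_)

  choose : ℕ → ℕ → ℕ
  choose n       zero    = 1
  choose zero    (suc k) = 0
  choose (suc n) (suc k) = choose n k + choose n (suc k)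

  constℕ : ℕ → Poly
  constℕ n = constₚ (+ n)

  constℕ-* : ∀ m n → constℕ m *ₚ constℕ n ≋ constℕ (m * n)
  constℕ-* m n = ≋-trans (const*≋ (+ m) (constℕ n)) (≡⇒≋ (cong constₚ (≡.sym (ℤP.pos-* m n))))

  module Lucas (g Q : Poly) (e′ : ℕ) (Qᵉ≡1 : Mod g (Q ^ₚ suc e′) 1ₚ)
               (vanish : ∀ k → 0 < k → k < suc e′ → Mod g (bin Q (suc e′) k) []) where

    private
      e = suc e′
      module M = CommutativeRing (modRing g)
    open import Relation.Binary.Reasoning.Setoid M.setoid

    -- `low` and `high` together: raising the top index by e acts on the lower index like one
    -- ordinary Pascal step of width e. Both propagate along the q-Pascal rule because Q^e = 1.
    low : ∀ N K → K < e → Mod g (bin Q (N + e) K) (bin Q N K)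
    low N       zero    _ = Mod-refl
    low zero    (suc K) h = vanish (suc K) (s≤s z≤n) h
    low (suc N) (suc K) h = Mod-+ (low N K (ℕP.<-trans (ℕP.n<1+n K) h)) (Mod-* (Mod-refl {p = Q ^ₚ suc K}) (low N (suc K) h))

    Q^+e : ∀ K → Mod g (Q ^ₚ (K + e)) (Q ^ₚ K)
    Q^+e K = Mod-trans (≋⇒Mod (^-+ Q K e)) (Mod-trans (Mod-* (Mod-refl {p = Q ^ₚ K}) Qᵉ≡1)
      (≋⇒Mod (≋-trans (*ₚ-comm (Q ^ₚ K) 1ₚ) (*ₚ-identityˡ _))))

    high : ∀ N K → Mod g (bin Q (N + e) (K + e)) (bin Q N (K + e) +ₚ bin Q N K)
    high zero    zero    = ≋⇒Mod (bin-diag Q e)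
    high zero    (suc K) = ≋⇒Mod (bin-> Q (s≤s (ℕP.m≤n+m e K)))
    high (suc N) zero    = begin
      bin Q (N + e) e′ +ₚ Q ^ₚ e *ₚ bin Q (N + e) e
        ≈⟨ Mod-+ (low N e′ (ℕP.n<1+n e′)) (Mod-* Qᵉ≡1 (high N zero)) ⟩
      bin Q N e′ +ₚ 1ₚ *ₚ (bin Q N e +ₚ 1ₚ)
        ≈⟨ ≋⇒Mod (l (bin Q N e′) 1ₚ (bin Q N e)) ⟩
      (bin Q N e′ +ₚ 1ₚ *ₚ bin Q N e) +ₚ 1ₚ
        ≈⟨ Mod-+ (Mod-+ (Mod-refl {p = bin Q N e′}) (Mod-* (Mod-sym Qᵉ≡1) (Mod-refl {p = bin Q N e}))) (Mod-refl {p = 1ₚ}) ⟩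
      (bin Q N e′ +ₚ Q ^ₚ e *ₚ bin Q N e) +ₚ 1ₚ ∎
      where
      l : ∀ a q b → a +ₚ q *ₚ (b +ₚ 1ₚ) ≋ (a +ₚ q *ₚ b) +ₚ q
      l = solve-∀ polySolver
    high (suc N) (suc K) = begin
      bin Q (N + e) (K + e) +ₚ Q ^ₚ (suc K + e) *ₚ bin Q (N + e) (suc K + e)
        ≈⟨ Mod-+ (high N K) (Mod-* (Mod-refl {p = Q ^ₚ (suc K + e)}) (high N (suc K))) ⟩
      (bin Q N (K + e) +ₚ bin Q N K) +ₚ Q ^ₚ (suc K + e) *ₚ (bin Q N (suc K + e) +ₚ bin Q N (suc K))
        ≈⟨ ≋⇒Mod (l (bin Q N (K + e)) (bin Q N K) (Q ^ₚ (suc K + e)) (bin Q N (suc K + e)) (bin Q N (suc K))) ⟩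
      (bin Q N (K + e) +ₚ Q ^ₚ (suc K + e) *ₚ bin Q N (suc K + e)) +ₚ (bin Q N K +ₚ Q ^ₚ (suc K + e) *ₚ bin Q N (suc K))
        ≈⟨ Mod-+ (Mod-refl {p = bin Q N (K + e) +ₚ Q ^ₚ (suc K + e) *ₚ bin Q N (suc K + e)})
                 (Mod-+ (Mod-refl {p = bin Q N K}) (Mod-* (Q^+e (suc K)) (Mod-refl {p = bin Q N (suc K)}))) ⟩
      (bin Q N (K + e) +ₚ Q ^ₚ (suc K + e) *ₚ bin Q N (suc K + e)) +ₚ (bin Q N K +ₚ Q ^ₚ suc K *ₚ bin Q N (suc K)) ∎
      where
      l : ∀ a b q c d → (a +ₚ b) +ₚ q *ₚ (c +ₚ d) ≋ (a +ₚ q *ₚ c) +ₚ (b +ₚ q *ₚ d)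
      l = solve-∀ polySolver

    -- Every full block of e in the top index contributes an ordinary Pascal step; what remains are
    -- the last digits r and k.
    lucas : ∀ A κ r k → r < e → k < e →
            Mod g (bin Q (A * e + r) (κ * e + k)) (constℕ (choose A κ) *ₚ bin Q r k)
    lucas zero    zero    r k r<e k<e = ≋⇒Mod (≋-sym (*ₚ-identityˡ _))
    lucas zero    (suc κ) r k r<e k<e = ≋⇒Mod (≋-trans (bin-> Q (ℕP.≤-trans r<e (ℕP.≤-trans (ℕP.m≤m+n e (κ * e)) (ℕP.m≤m+n (e + κ * e) k))))
                                          (≋-sym (*ₚ-cong 0∷[] (≋-refl {bin Q r k}))))
    lucas (suc A) zero    r k r<e k<e = begin
      bin Q (e + A * e + r) k        ≡⟨ cong (λ z → bin Q z k) (s e (A * e) r) ⟩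
      bin Q (A * e + r + e) k        ≈⟨ low (A * e + r) k k<e ⟩
      bin Q (A * e + r) k            ≈⟨ lucas A zero r k r<e k<e ⟩
      constℕ (choose A 0) *ₚ bin Q r k ∎
      where
      s : ∀ e x r → e + x + r ≡ x + r + e
      s = ℕS.solve-∀
    lucas (suc A) (suc κ) r k r<e k<e = begin
      bin Q (e + A * e + r) (e + κ * e + k)
        ≡⟨ cong₂ (bin Q) (s e (A * e) r) (s e (κ * e) k) ⟩
      bin Q (A * e + r + e) (κ * e + k + e)
        ≈⟨ high (A * e + r) (κ * e + k) ⟩
      bin Q (A * e + r) (κ * e + k + e) +ₚ bin Q (A * e + r) (κ * e + k)
        ≡⟨ cong (λ z → bin Q (A * e + r) z +ₚ bin Q (A * e + r) (κ * e + k)) (≡.sym (s e (κ * e) k)) ⟩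
      bin Q (A * e + r) (suc κ * e + k) +ₚ bin Q (A * e + r) (κ * e + k)
        ≈⟨ Mod-+ (lucas A (suc κ) r k r<e k<e) (lucas A κ r k r<e k<e) ⟩
      constℕ (choose A (suc κ)) *ₚ bin Q r k +ₚ constℕ (choose A κ) *ₚ bin Q r k
        ≈⟨ ≋⇒Mod (≋-sym (*ₚ-distribʳ (bin Q r k) (constℕ (choose A (suc κ))) (constℕ (choose A κ)))) ⟩
      constℕ (choose A (suc κ) + choose A κ) *ₚ bin Q r k
        ≡⟨ cong (λ z → constℕ z *ₚ bin Q r k) (ℕP.+-comm (choose A (suc κ)) (choose A κ)) ⟩
      constℕ (choose (suc A) (suc κ)) *ₚ bin Q r k ∎
      where
      s : ∀ e x r → e + x + r ≡ x + r + e
      s = ℕS.solve-∀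

  bin-1 : ∀ n k → bin 1ₚ n k ≋ constℕ (choose n k)
  bin-1 n       zero    = ≋-refl
  bin-1 zero    (suc k) = ≋-sym 0∷[]
  bin-1 (suc n) (suc k) = +ₚ-cong {r′ = constℕ (choose n (suc k))} (bin-1 n k)
    (≋-trans (*ₚ-cong (1^ (suc k)) (bin-1 n (suc k))) (*ₚ-identityˡ (constℕ (choose n (suc k)))))

  -- The hypotheses say that ζ^d has multiplicative order e.
  module Root {n d e′ : ℕ} (0<n : 0 < n) (n∣de : n ∣ d * suc e′)
              (primRoot : ∀ j → 0 < j → j < suc e′ → ¬ n ∣ d * j) where

    private
      e = suc e′
      Q = xₚ ^ₚ d
      Φ = cyclotomic n
      C = isCyclotomic n 0<n

    Q^≡ : ∀ j → Q ^ₚ j ≋ xₚ ^ₚ (d * j)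
    Q^≡ j = ≋-trans (^-^ xₚ d j) (≡⇒≋ (cong (xₚ ^ₚ_) (ℕP.*-comm j d)))

    Q^≡1 : ∀ {j} → n ∣ d * j → Mod Φ (Q ^ₚ j) 1ₚ
    Q^≡1 {j} (divides q eq) = Mod-trans (≋⇒Mod (≋-trans (Q^≡ j) (≡⇒≋ (cong (xₚ ^ₚ_) eq)))) (xⁿ-power 0<n C q)

    -- (1 - Q)[j] = 1 - Q^j = 0, and Q differs from 1, so `root-cancel` applies.
    int-vanish : ∀ {j} → 1 < e → n ∣ d * j → Mod Φ (int Q j) []
    int-vanish {j} 1<e h = root-cancel n (d * 1) (int Q j) 0<n (primRoot 1 (s≤s z≤n) 1<e)
      (Mod-trans (≋⇒Mod (*ₚ-cong (≋-trans (≋-sym (Q^≡ 1)) (≋-trans (*ₚ-comm Q 1ₚ) (*ₚ-identityˡ Q))) (≋-refl {int Q j})))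
        (Mod-trans (≋⇒Mod (l Q (int Q j))) (Mod-trans
          (Mod-+ (Mod-refl {p = int Q j}) (Mod-neg (Mod-trans (≋⇒Mod (int-geom Q j)) (Mod-+ (Mod-refl {p = 1ₚ}) (Mod-neg (Q^≡1 {j} h))))))
          (≋⇒Mod (l′ (int Q j))))))
      where
      l : ∀ Q I → Q *ₚ I ≋ I +ₚ negₚ ((1ₚ +ₚ negₚ Q) *ₚ I)
      l = solve-∀ polySolver
      l′ : ∀ I → I +ₚ negₚ (1ₚ +ₚ negₚ 1ₚ) ≋ I
      l′ = solve-∀ polySolver

    -- By `absorb`, (1 - Q^k)[e k] = (1 - Q^e)[e-1 k-1] = 0, and Q^k differs from 1 for 0 < k < e.
    bin-vanish : ∀ k → 0 < k → k < e → Mod Φ (bin Q e k) []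
    bin-vanish (suc k) _ k<e = root-cancel n (d * suc k) B 0<n (primRoot (suc k) (s≤s z≤n) k<e)
      (Mod-trans (≋⇒Mod (≋-trans (*ₚ-cong (≋-sym (Q^≡ (suc k))) (≋-refl {B})) (l (Q ^ₚ suc k) B)))
        (Mod-trans (Mod-+ (Mod-refl {p = B}) (Mod-neg zeroish)) (≋⇒Mod (l′ B))))
      where
      B = bin Q e (suc k)
      B′ = bin Q e′ k
      l : ∀ Q I → Q *ₚ I ≋ I +ₚ negₚ ((1ₚ +ₚ negₚ Q) *ₚ I)
      l = solve-∀ polySolver
      l′ : ∀ I → I +ₚ negₚ [] ≋ I
      l′ = solve-∀ polySolver
      l₀ : ∀ P → (1ₚ +ₚ negₚ 1ₚ) *ₚ P ≋ []
      l₀ = solve-∀ polySolver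
      eq : (1ₚ -ₚ Q ^ₚ suc k) *ₚ B ≋ (1ₚ -ₚ Q ^ₚ e) *ₚ B′
      eq = ≋-trans (*ₚ-cong (≋-sym (int-geom Q (suc k))) (≋-refl {B}))
        (≋-trans (*ₚ-assoc (1ₚ -ₚ Q) (int Q (suc k)) B)
        (≋-trans (*ₚ-cong (≋-refl {1ₚ -ₚ Q}) (absorb Q e′ k))
        (≋-trans (≋-sym (*ₚ-assoc (1ₚ -ₚ Q) (int Q e) B′)) (*ₚ-cong (int-geom Q e) (≋-refl {B′})))))
      zeroish : Mod Φ ((1ₚ -ₚ Q ^ₚ suc k) *ₚ B) []
      zeroish = Mod-trans (≋⇒Mod eq) (Mod-trans
        (Mod-* (Mod-+ (Mod-refl {p = 1ₚ}) (Mod-neg (Q^≡1 {e} n∣de))) (Mod-refl {p = B′})) (≋⇒Mod (l₀ B′)))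

    open Lucas Φ Q e′ (Q^≡1 {e} n∣de) bin-vanish public using (lucas)

  -- Evaluation at the polynomial `Q`: `substPow d` is the case q^d, and `Q` = 1 gives the sum of
  -- the coefficients.
  sub : Poly → Poly → Poly
  sub Q []      = []
  sub Q (c ∷ p) = constₚ c +ₚ Q *ₚ sub Q p

  sub-0 : ∀ Q {p} → p ≋ [] → sub Q p ≋ []
  sub-0 Q {[]}    e = ≋-refl
  sub-0 Q {c ∷ p} e = ≋-trans (+ₚ-cong (≋-trans (≡⇒≋ (cong constₚ (at e 0))) 0∷[]) (*ₚ-cong (≋-refl {Q}) (sub-0 Q {p} (mk≋ λ i → at e (suc i)))))
    (*ₚ-zeroʳ Q)

  sub-cong : ∀ Q {p r} → p ≋ r → sub Q p ≋ sub Q r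
  sub-cong Q {[]}    {r}     e = ≋-sym (sub-0 Q (≋-sym e))
  sub-cong Q {c ∷ p} {[]}    e = sub-0 Q e
  sub-cong Q {c ∷ p} {d ∷ r} e = +ₚ-cong (≡⇒≋ (cong constₚ (at e 0))) (*ₚ-cong (≋-refl {Q}) (sub-cong Q {p} {r} (mk≋ λ i → at e (suc i))))

  sub-+ : ∀ Q p r → sub Q (p +ₚ r) ≋ sub Q p +ₚ sub Q r
  sub-+ Q []      r       = ≋-refl
  sub-+ Q (c ∷ p) []      = ≋-sym (+ₚ-identityʳ _)
  sub-+ Q (c ∷ p) (d ∷ r) = ≋-trans (+ₚ-cong (≋-refl {constₚ (c ℤ.+ d)}) (*ₚ-cong (≋-refl {Q}) (sub-+ Q p r)))
    (l (constₚ c) (constₚ d) Q (sub Q p) (sub Q r))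
    where
    l : ∀ c d Q p r → (c +ₚ d) +ₚ Q *ₚ (p +ₚ r) ≋ (c +ₚ Q *ₚ p) +ₚ (d +ₚ Q *ₚ r)
    l = solve-∀ polySolver

  sub-· : ∀ Q c p → sub Q (c ·ₚ p) ≋ constₚ c *ₚ sub Q p
  sub-· Q c []      = ≋-sym (*ₚ-zeroʳ (constₚ c))
  sub-· Q c (d ∷ p) = ≋-trans (+ₚ-cong (≋-sym (const*≋ c (constₚ d))) (*ₚ-cong (≋-refl {Q}) (sub-· Q c p)))
    (l (constₚ c) (constₚ d) Q (sub Q p))
    where
    l : ∀ c d Q p → c *ₚ d +ₚ Q *ₚ (c *ₚ p) ≋ c *ₚ (d +ₚ Q *ₚ p)
    l = solve-∀ polySolver

  sub-* : ∀ Q p r → sub Q (p *ₚ r) ≋ sub Q p *ₚ sub Q r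
  sub-* Q []      r = ≋-refl
  sub-* Q (c ∷ p) r = ≋-trans (sub-+ Q (c ·ₚ r) (+ 0 ∷ p *ₚ r))
    (≋-trans (+ₚ-cong (sub-· Q c r) (+ₚ-cong 0∷[] (*ₚ-cong (≋-refl {Q}) (sub-* Q p r))))
      (l (constₚ c) Q (sub Q p) (sub Q r)))
    where
    l : ∀ c Q p r → c *ₚ r +ₚ ([] +ₚ Q *ₚ (p *ₚ r)) ≋ (c +ₚ Q *ₚ p) *ₚ r
    l = solve-∀ polySolver

  sub-const : ∀ Q c → sub Q (constₚ c) ≋ constₚ c
  sub-const Q c = ≋-trans (+ₚ-cong (≋-refl {constₚ c}) (*ₚ-zeroʳ Q)) (+ₚ-identityʳ _)

  sub-x : ∀ Q → sub Q xₚ ≋ Q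
  sub-x Q = ≋-trans (+ₚ-cong 0∷[] (*ₚ-cong (≋-refl {Q}) (sub-const Q (+ 1)))) (≋-trans (*ₚ-comm Q 1ₚ) (*ₚ-identityˡ Q))

  sub-^ : ∀ Q p n → sub Q (p ^ₚ n) ≋ sub Q p ^ₚ n
  sub-^ Q p zero    = sub-const Q (+ 1)
  sub-^ Q p (suc n) = ≋-trans (sub-* Q p (p ^ₚ n)) (*ₚ-cong (≋-refl {sub Q p}) (sub-^ Q p n))

  sub-int : ∀ Q n → sub Q (int xₚ n) ≋ int Q n
  sub-int Q zero    = ≋-refl
  sub-int Q (suc n) = ≋-trans (sub-+ Q 1ₚ (xₚ *ₚ int xₚ n)) (+ₚ-cong (sub-const Q (+ 1))
    (≋-trans (sub-* Q xₚ (int xₚ n)) (*ₚ-cong (sub-x Q) (sub-int Q n))))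

  sub-bin : ∀ Q n k → sub Q (bin xₚ n k) ≋ bin Q n k
  sub-bin Q n       zero    = sub-const Q (+ 1)
  sub-bin Q zero    (suc k) = ≋-refl
  sub-bin Q (suc n) (suc k) = ≋-trans (sub-+ Q (bin xₚ n k) _) (+ₚ-cong (sub-bin Q n k)
    (≋-trans (sub-* Q (xₚ ^ₚ suc k) (bin xₚ n (suc k))) (*ₚ-cong (≋-trans (sub-^ Q xₚ (suc k)) (^-cong (suc k) (sub-x Q))) (sub-bin Q n (suc k)))))

  substPow≋ : ∀ d p → substPow d p ≋ sub (xₚ ^ₚ d) p
  substPow≋ d []      = ≋-refl
  substPow≋ d (c ∷ p) = +ₚ-cong (≋-refl {constₚ c}) (≋-trans (shift≋ d (substPow d p)) (*ₚ-cong (≋-refl {xₚ ^ₚ d}) (substPow≋ d p)))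

  Mod-sub : ∀ {g P Q} p → Mod g P Q → Mod g (sub P p) (sub Q p)
  Mod-sub []      e = Mod-refl
  Mod-sub (c ∷ p) e = Mod-+ (Mod-refl {p = constₚ c}) (Mod-* e (Mod-sub p e))

  qint≋ : ∀ n → qint n ≋ int xₚ n
  qint≋ zero    = ≋-refl
  qint≋ (suc n) = ≋-trans (∷-cong refl (qint≋ n)) (∷≋ (+ 1) (int xₚ n))

  qbinom≋ : ∀ n k → qbinom n k ≋ bin xₚ n k
  qbinom≋ n       zero    = lem n
    where
    lem : ∀ n → qbinom n zero ≋ 1ₚ
    lem zero    = ≋-refl
    lem (suc n) = ≋-refl
  qbinom≋ zero    (suc k) = ≋-refl
  qbinom≋ (suc n) (suc k) = +ₚ-cong (qbinom≋ n k) (≋-trans (shift≋ (suc k) (qbinom n (suc k))) (*ₚ-cong (≋-refl {xₚ ^ₚ suc k}) (qbinom≋ n (suc k))))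

  UnitConst-int : ∀ n → UnitConst (int xₚ (suc n))
  UnitConst-int n = mkUnit (+ 1) (≡.trans (ℤP.*-identityˡ _) (≡.trans (coeff-+ 1ₚ (xₚ *ₚ int xₚ n) 0) (cong (λ z → + 1 ℤ.+ z) (coeff-*-0 xₚ (int xₚ n)))))

  -- The rational q-Narayana polynomial as u [a k][b-1 k-1] + v [b k][a-1 k-1] with u [a] + v [b] = 1.
  narayana : ∀ a b k → Coprime (suc a) (suc b) → ∃ λ X →
    (int xₚ (suc a) *ₚ X ≋ bin xₚ (suc a) (suc k) *ₚ bin xₚ b k) ×
    (int xₚ (suc b) *ₚ X ≋ bin xₚ (suc b) (suc k) *ₚ bin xₚ a k)
  narayana a b k cop with int-bezout xₚ cop
  ... | u , v , e = X , cancelUnit (UnitConst-int k) eqa , cancelUnit (UnitConst-int k) eqb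
    where
    open import Relation.Binary.Reasoning.Setoid (CommutativeRing.setoid polyRing)
    A = int xₚ (suc a)
    B = int xₚ (suc b)
    K = int xₚ (suc k)
    Ak = bin xₚ (suc a) (suc k)
    Bk = bin xₚ (suc b) (suc k)
    A′ = bin xₚ a k
    B′ = bin xₚ b k
    X = u *ₚ (Ak *ₚ B′) +ₚ v *ₚ (Bk *ₚ A′)
    l₁ : ∀ K u v Ak B′ Bk A′ → K *ₚ (u *ₚ (Ak *ₚ B′) +ₚ v *ₚ (Bk *ₚ A′)) ≋ u *ₚ ((K *ₚ Ak) *ₚ B′) +ₚ v *ₚ ((K *ₚ Bk) *ₚ A′)
    l₁ = solve-∀ polySolver
    l₂ : ∀ u v A B A′ B′ → u *ₚ ((A *ₚ A′) *ₚ B′) +ₚ v *ₚ ((B *ₚ B′) *ₚ A′) ≋ (u *ₚ A +ₚ v *ₚ B) *ₚ (A′ *ₚ B′)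
    l₂ = solve-∀ polySolver
    -- This form is symmetric in the two parameters. Multiplied by either q-integer and absorbed, it
    -- gives the two identities up to the factor [k], which cancels.
    KX : K *ₚ X ≋ A′ *ₚ B′
    KX = begin
      K *ₚ X                                                  ≈⟨ l₁ K u v Ak B′ Bk A′ ⟩
      u *ₚ ((K *ₚ Ak) *ₚ B′) +ₚ v *ₚ ((K *ₚ Bk) *ₚ A′)        ≈⟨ +ₚ-cong (*ₚ-cong (≋-refl {u}) (*ₚ-cong (absorb xₚ a k) (≋-refl {B′})))
                                                                         (*ₚ-cong (≋-refl {v}) (*ₚ-cong (absorb xₚ b k) (≋-refl {A′}))) ⟩
      u *ₚ ((A *ₚ A′) *ₚ B′) +ₚ v *ₚ ((B *ₚ B′) *ₚ A′)        ≈⟨ l₂ u v A B A′ B′ ⟩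
      (u *ₚ A +ₚ v *ₚ B) *ₚ (A′ *ₚ B′)                        ≈⟨ *ₚ-cong e (≋-refl {A′ *ₚ B′}) ⟩
      1ₚ *ₚ (A′ *ₚ B′)                                        ≈⟨ *ₚ-identityˡ _ ⟩
      A′ *ₚ B′                                                ∎
    l₃ : ∀ K A X → K *ₚ (A *ₚ X) ≋ A *ₚ (K *ₚ X)
    l₃ = solve-∀ polySolver
    l₄ : ∀ A A′ B′ → A *ₚ (A′ *ₚ B′) ≋ (A *ₚ A′) *ₚ B′
    l₄ = solve-∀ polySolver
    l₅ : ∀ B A′ B′ → B *ₚ (A′ *ₚ B′) ≋ (B *ₚ B′) *ₚ A′
    l₅ = solve-∀ polySolver
    eqa : K *ₚ (A *ₚ X) ≋ K *ₚ (Ak *ₚ B′)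
    eqa = begin
      K *ₚ (A *ₚ X)     ≈⟨ l₃ K A X ⟩
      A *ₚ (K *ₚ X)     ≈⟨ *ₚ-cong (≋-refl {A}) KX ⟩
      A *ₚ (A′ *ₚ B′)   ≈⟨ l₄ A A′ B′ ⟩
      (A *ₚ A′) *ₚ B′   ≈⟨ *ₚ-cong (≋-sym (absorb xₚ a k)) (≋-refl {B′}) ⟩
      (K *ₚ Ak) *ₚ B′   ≈⟨ *ₚ-assoc K Ak B′ ⟩
      K *ₚ (Ak *ₚ B′)   ∎
    eqb : K *ₚ (B *ₚ X) ≋ K *ₚ (Bk *ₚ A′)
    eqb = begin
      K *ₚ (B *ₚ X)     ≈⟨ l₃ K B X ⟩
      B *ₚ (K *ₚ X)     ≈⟨ *ₚ-cong (≋-refl {B}) KX ⟩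
      B *ₚ (A′ *ₚ B′)   ≈⟨ l₅ B A′ B′ ⟩
      (B *ₚ B′) *ₚ A′   ≈⟨ *ₚ-cong (≋-sym (absorb xₚ b k)) (≋-refl {A′}) ⟩
      (K *ₚ Bk) *ₚ A′   ≈⟨ *ₚ-assoc K Bk A′ ⟩
      K *ₚ (Bk *ₚ A′)   ∎

-- Dimension counting over the integers.

module LinearAlgebra where

  open import Data.Fin using (zero; suc)
  open import Data.Integer using (_+_; _*_; -_; _-_)

  open import Algebra.Properties.CommutativeMonoid.Sum ℤP.+-0-commutativeMonoid using (sum; sum-remove; sum-cong-≗; ∑-distrib-+)

  sum-scale : ∀ {n} c (f : Fin n → ℤ) → c * sum f ≡ sum (λ i → c * f i)
  sum-scale {zero}  c f = ℤP.*-zeroʳ c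
  sum-scale {suc n} c f = trans (ℤP.*-distribˡ-+ c (f zero) _) (cong (λ z → c * f zero + z) (sum-scale c (f ∘ suc)))

  sum-0 : ∀ {n} (f : Fin n → ℤ) → (∀ i → f i ≡ + 0) → sum f ≡ + 0
  sum-0 {zero}  f h = refl
  sum-0 {suc n} f h = cong₂ _+_ (h zero) (sum-0 (f ∘ suc) (h ∘ suc))

  -- Fraction-free elimination.
  kernel : ∀ q p → q ℕ.< p → (M : Fin q → Fin p → ℤ) →
           ∃ λ (x : Fin p → ℤ) → (∃ λ j → x j ≢ + 0) × (∀ i → sum (λ j → M i j * x j) ≡ + 0)
  kernel zero    (suc p) _         M = (λ _ → + 1) , (zero , λ ()) , λ ()
  kernel (suc q) (suc p) (s≤s q<p) M with FinP.any? (λ j → ¬? (M zero j ℤ.≟ + 0))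
  ... | no none with kernel q (suc p) (ℕP.m<n⇒m<1+n q<p) (M ∘ suc)
  ...   | x , nz , sol = x , nz , λ { zero    → sum-0 _ (λ j → trans (cong (_* x j) (decidable-stable (M zero j ℤ.≟ + 0) (λ n → none (j , n)))) (ℤP.*-zeroˡ (x j)))
                                    ; (suc i) → sol i }
  kernel (suc q) (suc p) (s≤s q<p) M | yes (j₀ , m≢0) with kernel q p q<p (λ i l → M zero j₀ * M (suc i) (punchIn j₀ l) - M zero (punchIn j₀ l) * M (suc i) j₀)
  ... | x′ , (l₀ , nz) , sol = x , (punchIn j₀ l₀ , nz′) , sol′
    where
    m = M zero j₀
    x₀ = - sum (λ l → M zero (punchIn j₀ l) * x′ l)
    x : Fin (suc p) → ℤ
    x j with j₀ Fin.≟ j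
    ... | yes _ = x₀
    ... | no ne = m * x′ (punchOut ne)
    x-pivot : x j₀ ≡ x₀
    x-pivot with j₀ Fin.≟ j₀
    ... | yes _ = refl
    ... | no ne = ⊥-elim (ne refl)
    x-other : ∀ l → x (punchIn j₀ l) ≡ m * x′ l
    x-other l with j₀ Fin.≟ punchIn j₀ l
    ... | yes e = ⊥-elim (FinP.punchInᵢ≢i j₀ l (sym e))
    ... | no ne = cong (λ z → m * x′ z) (trans (FinP.punchOut-cong j₀ refl) (FinP.punchOut-punchIn j₀))
    nz′ : x (punchIn j₀ l₀) ≢ + 0
    nz′ e with ℤP.i*j≡0⇒i≡0∨j≡0 m (trans (sym (x-other l₀)) e)
    ... | inj₁ z = m≢0 z
    ... | inj₂ z = nz z
    split : ∀ i → sum (λ j → M i j * x j) ≡ M i j₀ * x₀ + sum (λ l → m * (M i (punchIn j₀ l) * x′ l))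
    split i = trans (sum-remove {i = j₀} (λ j → M i j * x j))
      (cong₂ _+_ (cong (M i j₀ *_) x-pivot) (sum-cong-≗ (λ l → trans (cong (M i (punchIn j₀ l) *_) (x-other l)) (swap (M i (punchIn j₀ l)) m (x′ l)))))
      where
      swap : ∀ a b c → a * (b * c) ≡ b * (a * c)
      swap = ℤS.solve-∀
    S₀ = sum (λ l → M zero (punchIn j₀ l) * x′ l)
    sol′ : ∀ i → sum (λ j → M i j * x j) ≡ + 0
    sol′ zero    = trans (split zero) (trans (cong (λ z → m * (- S₀) + z) (sym (sum-scale m (λ l → M zero (punchIn j₀ l) * x′ l)))) (canc m S₀))
      where
      canc : ∀ m s → m * (- s) + m * s ≡ + 0
      canc = ℤS.solve-∀
    sol′ (suc i) = trans (split (suc i)) (begin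
      c * (- S₀) + sum (λ l → m * (M (suc i) (punchIn j₀ l) * x′ l))
        ≡⟨ cong (λ z → z + sum (λ l → m * (M (suc i) (punchIn j₀ l) * x′ l))) (trans (neg c S₀) (sum-scale (- c) (λ l → M zero (punchIn j₀ l) * x′ l))) ⟩
      sum (λ l → (- c) * (M zero (punchIn j₀ l) * x′ l)) + sum (λ l → m * (M (suc i) (punchIn j₀ l) * x′ l))
        ≡⟨ ∑-distrib-+ (λ l → (- c) * (M zero (punchIn j₀ l) * x′ l)) _ ⟨
      sum (λ l → (- c) * (M zero (punchIn j₀ l) * x′ l) + m * (M (suc i) (punchIn j₀ l) * x′ l))
        ≡⟨ sum-cong-≗ (λ l → fac c (M zero (punchIn j₀ l)) (x′ l) m (M (suc i) (punchIn j₀ l))) ⟩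
      sum (λ l → (m * M (suc i) (punchIn j₀ l) - M zero (punchIn j₀ l) * c) * x′ l)
        ≡⟨ sol i ⟩
      + 0 ∎)
      where
      open ≡-Reasoning
      c = M (suc i) j₀
      neg : ∀ c s → c * (- s) ≡ (- c) * s
      neg = ℤS.solve-∀
      fac : ∀ c a x m d → (- c) * (a * x) + m * (d * x) ≡ (m * d - a * c) * x
      fac = ℤS.solve-∀

  -- `A-cong` is required because functions that agree pointwise need not be equal.
  record Linear {S T : Set} (A : (S → ℤ) → T → ℤ) : Set where
    field
      A-cong : ∀ {f g} → (∀ s → f s ≡ g s) → ∀ t → A f t ≡ A g t
      A-+    : ∀ f g t → A (λ s → f s + g s) t ≡ A f t + A g t
      A-*    : ∀ c f t → A (λ s → c * f s) t ≡ c * A f t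

    A-0 : ∀ t → A (λ _ → + 0) t ≡ + 0
    A-0 t = trans (A-cong {g = λ _ → + 0 * + 0} (λ _ → refl) t) (trans (A-* (+ 0) (λ _ → + 0) t) (ℤP.*-zeroˡ (A (λ _ → + 0) t)))

    A-sum : ∀ {n} (f : Fin n → S → ℤ) t → A (λ s → sum (λ j → f j s)) t ≡ sum (λ j → A (f j) t)
    A-sum {zero}  f t = A-0 t
    A-sum {suc n} f t = trans (A-+ (f zero) (λ s → sum (λ j → f (suc j) s)) t) (cong (λ z → A (f zero) t + z) (A-sum (f ∘ suc) t))

  lookup-injective : ∀ {S : Set} {xs : List S} → Unique xs → ∀ i j → List.lookup xs i ≡ List.lookup xs j → i ≡ j
  lookup-injective (u ∷ us) zero    zero    e = refl
  lookup-injective (u ∷ us) zero    (suc j) e = ⊥-elim (All.lookup u (∈-lookup j) e)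
  lookup-injective (u ∷ us) (suc i) zero    e = ⊥-elim (All.lookup u (∈-lookup i) (sym e))
  lookup-injective (u ∷ us) (suc i) (suc j) e = cong suc (lookup-injective us i j e)

  module _ {S T : Set} (_≟_ : DecidableEquality S) {A : (S → ℤ) → T → ℤ} (lin : Linear A) where

    open Linear lin

    private
      δ : S → S → ℤ
      δ s t with s ≟ t
      ... | yes _ = + 1
      ... | no _  = + 0
      δ-refl : ∀ s → δ s s ≡ + 1
      δ-refl s with s ≟ s
      ... | yes _ = refl
      ... | no n  = ⊥-elim (n refl)
      δ-≢ : ∀ {s t} → s ≢ t → δ s t ≡ + 0
      δ-≢ {s} {t} n with s ≟ t
      ... | yes e = ⊥-elim (n e)
      ... | no _  = refl

    -- Functions supported on `xs` have `length xs` free values, and vanishing of A f on `ys`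
    -- imposes `length ys` linear conditions; with fewer conditions than values, `kernel` yields a
    -- nonzero solution.
    injective⇒length≤ : (xs : List S) (ys : List T) → Unique xs →
      (∀ f → (∀ s → ¬ s ∈ xs → f s ≡ + 0) → (∀ t → t ∈ ys → A f t ≡ + 0) → ∀ s → f s ≡ + 0) →
      length xs ℕ.≤ length ys
    injective⇒length≤ xs ys u inj with length xs ℕ.≤? length ys
    ... | yes h = h
    ... | no h with kernel (length ys) (length xs) (ℕP.≰⇒> h) (λ i j → A (δ (List.lookup xs j)) (List.lookup ys i))
    ...   | x , (j₀ , nz) , sol = ⊥-elim (nz (trans (sym (f-at j₀)) (inj f supp vanish (List.lookup xs j₀))))
      where
      f : S → ℤ
      f s = sum (λ j → x j * δ (List.lookup xs j) s)
      supp : ∀ s → ¬ s ∈ xs → f s ≡ + 0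
      supp s s∉ = sum-0 _ (λ j → trans (cong (x j *_) (δ-≢ (λ e → s∉ (subst (_∈ xs) e (∈-lookup j))))) (ℤP.*-zeroʳ (x j)))
      Af : ∀ t → A f t ≡ sum (λ j → A (δ (List.lookup xs j)) t * x j)
      Af t = trans (A-sum (λ j s → x j * δ (List.lookup xs j) s) t)
        (sum-cong-≗ (λ j → trans (A-* (x j) (δ (List.lookup xs j)) t) (ℤP.*-comm (x j) _)))
      vanish : ∀ t → t ∈ ys → A f t ≡ + 0
      vanish t t∈ = trans (Af t) (trans (cong (λ z → sum (λ j → A (δ (List.lookup xs j)) z * x j)) (lookup-index t∈)) (sol (index t∈)))
      f-at : ∀ j → f (List.lookup xs j) ≡ x j
      f-at = go (length xs) (List.lookup xs) (lookup-injective u) x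
        where
        go : ∀ n (lk : Fin n → S) → (∀ i j → lk i ≡ lk j → i ≡ j) → (x : Fin n → ℤ) →
             ∀ j → sum (λ l → x l * δ (lk l) (lk j)) ≡ x j
        go (suc n) lk lkinj x j = trans (sum-remove {i = j} (λ l → x l * δ (lk l) (lk j)))
          (trans (cong₂ _+_ (trans (cong (x j *_) (δ-refl (lk j))) (ℤP.*-identityʳ (x j)))
            (sum-0 _ (λ l → trans (cong (x (punchIn j l) *_) (δ-≢ (λ e → FinP.punchInᵢ≢i j l (lkinj _ _ e)))) (ℤP.*-zeroʳ (x (punchIn j l))))))
            (ℤP.+-identityʳ (x j)))

-- Unimodality from an sl₂ action, and nonnegativity of the q-Narayana coefficients.

module Unimodality where

  open Polynomials
  open LinearAlgebra
  open import Data.Integer using (_+_; _*_; -_; _-_)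

  -- If B A - A B acts on functions as multiplication by the weight wt, and B
  -- raises weights by 2, then A is injective on functions of positive weight:
  -- A B^(j+1) f is a negative multiple of B^j f, while B^j f eventually vanishes.
  module Commutator {S : Set} {A B : (S → ℤ) → S → ℤ} (linA : Linear A) (linB : Linear B)
    (wt : S → ℤ)
    (comm : ∀ f s → B (A f) s - A (B f) s ≡ wt s * f s)
    (raise : ∀ μ f → (∀ s → wt s ≢ μ → f s ≡ + 0) → ∀ s → wt s ≢ μ + + 2 → B f s ≡ + 0)
    (bound : ℕ) (bounded : ∀ s → wt s ℤ.< + bound) where

    module A = Linear linA
    module B = Linear linB

    iter : ℕ → (S → ℤ) → S → ℤ
    iter zero    f = f
    iter (suc j) f = B (iter j f)

    -- The sum of the weights λ₀ + 2i for i < j, which is the scalar c in A B^j f = - c B^(j-1) f.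
    coef : ℕ → ℕ → ℕ
    coef λ₀ zero    = 0
    coef λ₀ (suc j) = coef λ₀ j ℕ.+ (λ₀ ℕ.+ 2 ℕ.* j)

    module _ (λ₀ : ℕ) (f : S → ℤ) (supp : ∀ s → wt s ≢ + λ₀ → f s ≡ + 0) (Af≡0 : ∀ s → A f s ≡ + 0) where

      iter-supp : ∀ j s → wt s ≢ + (λ₀ ℕ.+ 2 ℕ.* j) → iter j f s ≡ + 0
      iter-supp zero    s n = supp s (λ e → n (trans e (cong +_ (sym (ℕP.+-identityʳ λ₀)))))
      iter-supp (suc j) s n = raise (+ (λ₀ ℕ.+ 2 ℕ.* j)) (iter j f) (iter-supp j) s
        (λ e → n (trans e (cong +_ (l λ₀ j))))
        where
        l : ∀ a j → a ℕ.+ 2 ℕ.* j ℕ.+ 2 ≡ a ℕ.+ 2 ℕ.* suc j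
        l = ℕS.solve-∀

      wt*iter : ∀ j s → wt s * iter j f s ≡ + (λ₀ ℕ.+ 2 ℕ.* j) * iter j f s
      wt*iter j s with wt s ℤ.≟ + (λ₀ ℕ.+ 2 ℕ.* j)
      ... | yes e = cong (_* iter j f s) e
      ... | no n  = trans (cong (wt s *_) (iter-supp j s n)) (trans (ℤP.*-zeroʳ (wt s))
                      (sym (trans (cong (+ (λ₀ ℕ.+ 2 ℕ.* j) *_) (iter-supp j s n)) (ℤP.*-zeroʳ (+ (λ₀ ℕ.+ 2 ℕ.* j))))))

      A-iter : ∀ j s → A (iter (suc j) f) s ≡ - (+ coef λ₀ (suc j)) * iter j f s
      A-iter j s = begin
        A (B (iter j f)) s
          ≡⟨ l₁ (B (A (iter j f)) s) (A (B (iter j f)) s) ⟩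
        B (A (iter j f)) s - (B (A (iter j f)) s - A (B (iter j f)) s)
          ≡⟨ cong₂ _-_ (lower j s) (trans (comm (iter j f) s) (wt*iter j s)) ⟩
        - (+ coef λ₀ j) * iter j f s - + (λ₀ ℕ.+ 2 ℕ.* j) * iter j f s
          ≡⟨ l₂ (+ coef λ₀ j) (+ (λ₀ ℕ.+ 2 ℕ.* j)) (iter j f s) ⟩
        - (+ coef λ₀ (suc j)) * iter j f s ∎
        where
        open ≡-Reasoning
        l₁ : ∀ b a → a ≡ b - (b - a)
        l₁ = ℤS.solve-∀
        l₂ : ∀ c d x → (- c) * x - d * x ≡ (- (c + d)) * x
        l₂ = ℤS.solve-∀
        lower : ∀ j s → B (A (iter j f)) s ≡ - (+ coef λ₀ j) * iter j f s
        lower zero    s = trans (B.A-cong Af≡0 s) (trans (B.A-0 s) (sym (ℤP.*-zeroˡ (f s))))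
        lower (suc j) s = trans (B.A-cong (A-iter j) s) (B.A-* (- (+ coef λ₀ (suc j))) (iter j f) s)

      -- Applying A to B^(j+1) f = 0 gives B^j f up to a scalar that is nonzero because λ₀ > 0; so
      -- the vanishing descends to f.
      vanish : ∀ j → 0 ℕ.< λ₀ → (∀ s → iter j f s ≡ + 0) → ∀ s → f s ≡ + 0
      vanish zero    p h s = h s
      vanish (suc j) p h s = vanish j p prev s
        where
        prev : ∀ s → iter j f s ≡ + 0
        prev s = go (ℤP.i*j≡0⇒i≡0∨j≡0 (- (+ coef λ₀ (suc j))) (trans (sym (A-iter j s)) (trans (A.A-cong h s) (A.A-0 s))))
          where
          go : - (+ coef λ₀ (suc j)) ≡ + 0 ⊎ iter j f s ≡ + 0 → iter j f s ≡ + 0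
          go (inj₂ z) = z
          go (inj₁ z) = ⊥-elim (ℕP.<-irrefl (sym (ℤP.+-injective (ℤP.neg-injective {+ coef λ₀ (suc j)} {+ 0} z)))
                          (ℕP.≤-trans p (ℕP.≤-trans (ℕP.m≤m+n λ₀ (2 ℕ.* j)) (ℕP.m≤n+m _ (coef λ₀ j)))))

      injective : 0 ℕ.< λ₀ → ∀ s → f s ≡ + 0
      injective p = vanish bound p (λ s → iter-supp bound s (λ e → ℤP.<-irrefl e (ℤP.<-≤-trans (bounded s)
        (ℤ.+≤+ (ℕP.≤-trans (ℕP.m≤m+n bound (bound ℕ.+ 0)) (ℕP.m≤n+m (2 ℕ.* bound) λ₀))))))

  -- The sl₂ action on 01-strings (k-th exterior power of the irreducible
  -- n-dimensional representation): raise and lower move a one across a zero.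

  Str : ℕ → Set
  Str = Vec Bool

  bit : Bool → ℕ
  bit true  = 1
  bit false = 0

  ones : ∀ {n} → Str n → ℕ
  ones []      = 0
  ones (x ∷ s) = bit x ℕ.+ ones s

  rank : ∀ {n} → Str n → ℕ
  rank []          = 0
  rank (true ∷ s)  = rank s
  rank (false ∷ s) = rank s ℕ.+ ones s

  at01 : ∀ {n} → (Str (suc (suc n)) → ℤ) → Bool → Bool → Str n → ℤ
  at01 f false true  s = f (true ∷ false ∷ s)
  at01 f _     _     s = + 0

  at10 : ∀ {n} → (Str (suc (suc n)) → ℤ) → Bool → Bool → Str n → ℤ
  at10 f true false s = f (false ∷ true ∷ s)
  at10 f _    _     s = + 0

  -- the weight of a move is the product of the numbers of sites on either side; p counts those on the left
  U : ∀ {n} → ℕ → (Str n → ℤ) → Str n → ℤ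
  U p f []          = + 0
  U p f (x ∷ [])    = + 0
  U {suc (suc n)} p f (x ∷ y ∷ s) = + (p ℕ.* suc n) * at01 f x y s + U (suc p) (λ t → f (x ∷ t)) (y ∷ s)

  D : ∀ {n} → (Str n → ℤ) → Str n → ℤ
  D f []          = + 0
  D f (x ∷ [])    = + 0
  D f (x ∷ y ∷ s) = at10 f x y s + D (λ t → f (x ∷ t)) (y ∷ s)

  weight : ∀ {n} → ℕ → Str n → ℤ
  weight p []          = + 0
  weight p (x ∷ [])    = + 0
  weight {suc (suc n)} p (x ∷ y ∷ s) = + (p ℕ.* suc n) * (+ bit x - + bit y) + weight (suc p) (y ∷ s)

  -- U and D only look at strings with one move undone.
  U-local : ∀ {n} p (f g : Str n → ℤ) s → (∀ t → ones t ≡ ones s → suc (rank t) ≡ rank s → f t ≡ g t) → U p f s ≡ U p g s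
  U-local p f g []          h = refl
  U-local p f g (x ∷ [])    h = refl
  U-local {suc (suc n)} p f g (x ∷ y ∷ s) h = cong₂ _+_ (cong (+ (p ℕ.* suc n) *_) (hd x y h))
    (U-local (suc p) _ _ (y ∷ s) (λ t e r → h (x ∷ t) (cong (bit x ℕ.+_) e) (rk x t e r)))
    where
    hd : ∀ x y → (∀ t → ones t ≡ ones (x ∷ y ∷ s) → suc (rank t) ≡ rank (x ∷ y ∷ s) → f t ≡ g t) → at01 f x y s ≡ at01 g x y s
    hd false false h = refl
    hd false true  h = h (true ∷ false ∷ s) refl (sym (ℕP.+-suc (rank s) (ones s)))
    hd true  false h = refl
    hd true  true  h = refl
    rk : ∀ x t → ones t ≡ ones (y ∷ s) → suc (rank t) ≡ rank (y ∷ s) → suc (rank (x ∷ t)) ≡ rank (x ∷ y ∷ s)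
    rk true  t e r = r
    rk false t e r = cong₂ ℕ._+_ r e

  D-local : ∀ {n} (f g : Str n → ℤ) s → (∀ t → ones t ≡ ones s → rank t ≡ suc (rank s) → f t ≡ g t) → D f s ≡ D g s
  D-local f g []          h = refl
  D-local f g (x ∷ [])    h = refl
  D-local f g (x ∷ y ∷ s) h = cong₂ _+_ (hd x y h)
    (D-local _ _ (y ∷ s) (λ t e r → h (x ∷ t) (cong (bit x ℕ.+_) e) (rk x t e r)))
    where
    hd : ∀ x y → (∀ t → ones t ≡ ones (x ∷ y ∷ s) → rank t ≡ suc (rank (x ∷ y ∷ s)) → f t ≡ g t) → at10 f x y s ≡ at10 g x y s
    hd false false h = refl
    hd false true  h = refl
    hd true  false h = h (false ∷ true ∷ s) refl (ℕP.+-suc (rank s) (ones s))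
    hd true  true  h = refl
    rk : ∀ x t → ones t ≡ ones (y ∷ s) → rank t ≡ suc (rank (y ∷ s)) → rank (x ∷ t) ≡ suc (rank (x ∷ y ∷ s))
    rk true  t e r = r
    rk false t e r = cong₂ ℕ._+_ r e

  U-+ : ∀ {n} p (f g : Str n → ℤ) s → U p (λ t → f t + g t) s ≡ U p f s + U p g s
  U-+ p f g []          = refl
  U-+ p f g (x ∷ [])    = refl
  U-+ {suc (suc n)} p f g (x ∷ y ∷ s) = trans (cong₂ _+_ (cong (+ (p ℕ.* suc n) *_) (hd x y)) (U-+ (suc p) _ _ (y ∷ s)))
    (l (+ (p ℕ.* suc n)) (at01 f x y s) (at01 g x y s) _ _)
    where
    hd : ∀ x y → at01 (λ t → f t + g t) x y s ≡ at01 f x y s + at01 g x y s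
    hd false false = refl
    hd false true  = refl
    hd true  false = refl
    hd true  true  = refl
    l : ∀ c a b u v → c * (a + b) + (u + v) ≡ (c * a + u) + (c * b + v)
    l = ℤS.solve-∀

  D-+ : ∀ {n} (f g : Str n → ℤ) s → D (λ t → f t + g t) s ≡ D f s + D g s
  D-+ f g []          = refl
  D-+ f g (x ∷ [])    = refl
  D-+ f g (x ∷ y ∷ s) = trans (cong₂ _+_ (hd x y) (D-+ _ _ (y ∷ s))) (l (at10 f x y s) (at10 g x y s) _ _)
    where
    hd : ∀ x y → at10 (λ t → f t + g t) x y s ≡ at10 f x y s + at10 g x y s
    hd false false = refl
    hd false true  = refl
    hd true  false = refl
    hd true  true  = refl
    l : ∀ a b u v → (a + b) + (u + v) ≡ (a + u) + (b + v)
    l = ℤS.solve-∀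

  U-* : ∀ {n} p c (f : Str n → ℤ) s → U p (λ t → c * f t) s ≡ c * U p f s
  U-* p c f []          = sym (ℤP.*-zeroʳ c)
  U-* p c f (x ∷ [])    = sym (ℤP.*-zeroʳ c)
  U-* {suc (suc n)} p c f (x ∷ y ∷ s) = trans (cong₂ _+_ (cong (+ (p ℕ.* suc n) *_) (hd x y)) (U-* (suc p) c _ (y ∷ s)))
    (l (+ (p ℕ.* suc n)) c (at01 f x y s) _)
    where
    hd : ∀ x y → at01 (λ t → c * f t) x y s ≡ c * at01 f x y s
    hd false false = sym (ℤP.*-zeroʳ c)
    hd false true  = refl
    hd true  false = sym (ℤP.*-zeroʳ c)
    hd true  true  = sym (ℤP.*-zeroʳ c)
    l : ∀ d c a u → d * (c * a) + c * u ≡ c * (d * a + u)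
    l = ℤS.solve-∀

  D-* : ∀ {n} c (f : Str n → ℤ) s → D (λ t → c * f t) s ≡ c * D f s
  D-* c f []          = sym (ℤP.*-zeroʳ c)
  D-* c f (x ∷ [])    = sym (ℤP.*-zeroʳ c)
  D-* c f (x ∷ y ∷ s) = trans (cong₂ _+_ (hd x y) (D-* c _ (y ∷ s))) (sym (ℤP.*-distribˡ-+ c (at10 f x y s) _))
    where
    hd : ∀ x y → at10 (λ t → c * f t) x y s ≡ c * at10 f x y s
    hd false false = sym (ℤP.*-zeroʳ c)
    hd false true  = sym (ℤP.*-zeroʳ c)
    hd true  false = refl
    hd true  true  = sym (ℤP.*-zeroʳ c)

  linU : ∀ {n} p → Linear (U {n} p)
  linU p = record { A-cong = λ h s → U-local p _ _ s (λ t _ _ → h t) ; A-+ = U-+ p ; A-* = U-* p }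

  linD : ∀ {n} → Linear (D {n})
  linD = record { A-cong = λ h s → D-local _ _ s (λ t _ _ → h t) ; A-+ = D-+ ; A-* = D-* }

  U-0 : ∀ {n} p (s : Str n) → U p (λ _ → + 0) s ≡ + 0
  U-0 p = Linear.A-0 (linU p)
  D-0 : ∀ {n} (s : Str n) → D (λ _ → + 0) s ≡ + 0
  D-0 = Linear.A-0 linD

  headU headD : ∀ {n} → (Str (suc (suc n)) → ℤ) → Str (suc (suc n)) → ℤ
  headU f (x ∷ y ∷ s) = at01 f x y s
  headD f (x ∷ y ∷ s) = at10 f x y s

  tailU : ∀ {n} → ℕ → (Str (suc (suc n)) → ℤ) → Str (suc (suc n)) → ℤ
  tailU p f (x ∷ t) = U p (λ t → f (x ∷ t)) t

  tailD : ∀ {n} → (Str (suc (suc n)) → ℤ) → Str (suc (suc n)) → ℤ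
  tailD f (x ∷ t) = D (λ t → f (x ∷ t)) t

  -- Two moves across adjacent bonds never compose, in either order.
  at10-U : ∀ {n} p (f : Str (suc (suc n)) → ℤ) x y (s : Str n) →
    at10 (tailU p f) x y s ≡ U p (λ t → headD f (x ∷ t)) (y ∷ s)
  at10-U p f true  false []         = refl
  at10-U {suc n} p f true  false (true ∷ s)  = cong₂ _+_ {y = + (p ℕ.* suc n) * + 0} refl refl
  at10-U {suc n} p f true  false (false ∷ s) = refl
  at10-U p f true  true  []         = refl
  at10-U {suc n} p f true  true  (z ∷ s)   = sym (trans (cong₂ _+_ (ℤP.*-zeroʳ (+ (p ℕ.* suc n))) (U-0 (suc p) (z ∷ s))) refl)
  at10-U p f false y     s          = sym (trans (U-local p _ (λ _ → + 0) (y ∷ s) (λ { (_ ∷ _) _ _ → refl })) (U-0 p (y ∷ s)))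

  at01-D : ∀ {n} (f : Str (suc (suc n)) → ℤ) x y (s : Str n) →
    at01 (tailD f) x y s ≡ D (λ t → headU f (x ∷ t)) (y ∷ s)
  at01-D f false true  []         = refl
  at01-D f false true  (true ∷ s)  = refl
  at01-D f false true  (false ∷ s) = refl
  at01-D f false false []         = refl
  at01-D f false false (z ∷ s)   = sym (trans (cong₂ _+_ {y = + 0} refl (D-0 (z ∷ s))) refl)
  at01-D f true y     s          = sym (trans (D-local _ (λ _ → + 0) (y ∷ s) (λ { (_ ∷ _) _ _ → refl })) (D-0 (y ∷ s)))

  -- Split both operators into the first bond and the rest. First bond of one combined with rest of
  -- the other gives the same term in either order and cancels; the first bond with itself gives the
  -- difference of its bits, and the rest is the induction hypothesis.
  commutator : ∀ {n} p (f : Str n → ℤ) s → D (U p f) s - U p (D f) s ≡ weight p s * f s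
  commutator p f []       = sym (ℤP.*-zeroˡ (f []))
  commutator p f (x ∷ []) = sym (ℤP.*-zeroˡ (f (x ∷ [])))
  commutator {suc (suc n)} p f (x ∷ y ∷ s) = begin
    D (U p f) (x ∷ y ∷ s) - U p (D f) (x ∷ y ∷ s)
      ≡⟨ cong₂ _-_ DU UD ⟩
    (c * a₁ + b + (c * d + e)) - (c * (a₂ + d) + (b + g))
      ≡⟨ l c a₁ a₂ b d e g ⟩
    c * (a₁ - a₂) + (e - g)
      ≡⟨ cong₂ (λ u v → c * u + v) (diag x y) (commutator (suc p) (λ t → f (x ∷ t)) (y ∷ s)) ⟩
    c * ((+ bit x - + bit y) * f (x ∷ y ∷ s)) + weight (suc p) (y ∷ s) * f (x ∷ y ∷ s)
      ≡⟨ l₂ c (+ bit x - + bit y) (f (x ∷ y ∷ s)) (weight (suc p) (y ∷ s)) ⟩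
    weight p (x ∷ y ∷ s) * f (x ∷ y ∷ s) ∎
    where
    open ≡-Reasoning
    c = + (p ℕ.* suc n)
    fx = λ t → f (x ∷ t)
    U₀ = headU f
    U₁ = tailU (suc p) f
    D₀ = headD f
    D₁ = tailD f
    a₁ = at10 U₀ x y s
    a₂ = at01 D₀ x y s
    b = at10 U₁ x y s
    d = at01 D₁ x y s
    e = D (U (suc p) fx) (y ∷ s)
    g = U (suc p) (D fx) (y ∷ s)
    at10-lin : ∀ (h k l : Str (suc (suc n)) → ℤ) → (∀ x y s → h (x ∷ y ∷ s) ≡ c * k (x ∷ y ∷ s) + l (x ∷ y ∷ s)) →
               ∀ x y s → at10 h x y s ≡ c * at10 k x y s + at10 l x y s
    at10-lin h k l e true  false s = e false true s
    at10-lin h k l e true  true  s = sym (trans (ℤP.+-identityʳ (c * + 0)) (ℤP.*-zeroʳ c))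
    at10-lin h k l e false y     s = sym (trans (ℤP.+-identityʳ (c * + 0)) (ℤP.*-zeroʳ c))
    at01-lin : ∀ (h k l : Str (suc (suc n)) → ℤ) → (∀ x y s → h (x ∷ y ∷ s) ≡ k (x ∷ y ∷ s) + l (x ∷ y ∷ s)) →
               ∀ x y s → at01 h x y s ≡ at01 k x y s + at01 l x y s
    at01-lin h k l e false true  s = e true false s
    at01-lin h k l e false false s = refl
    at01-lin h k l e true  y     s = refl
    DU : D (U p f) (x ∷ y ∷ s) ≡ c * a₁ + b + (c * d + e)
    DU = cong₂ _+_ (at10-lin (U p f) U₀ U₁ (λ _ _ _ → refl) x y s)
      (trans (D-local _ (λ t → c * U₀ (x ∷ t) + U₁ (x ∷ t)) (y ∷ s) (λ { (_ ∷ _) _ _ → refl }))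
        (trans (D-+ (λ t → c * U₀ (x ∷ t)) (λ t → U₁ (x ∷ t)) (y ∷ s))
          (cong₂ _+_ (trans (D-* c (λ t → U₀ (x ∷ t)) (y ∷ s)) (cong (c *_) (sym (at01-D f x y s)))) refl)))
    UD : U p (D f) (x ∷ y ∷ s) ≡ c * (a₂ + d) + (b + g)
    UD = cong₂ _+_ (cong (c *_) (at01-lin (D f) D₀ D₁ (λ _ _ _ → refl) x y s))
      (trans (U-local (suc p) _ (λ t → D₀ (x ∷ t) + D₁ (x ∷ t)) (y ∷ s) (λ { (_ ∷ _) _ _ → refl }))
        (trans (U-+ (suc p) (λ t → D₀ (x ∷ t)) (λ t → D₁ (x ∷ t)) (y ∷ s))
          (cong₂ _+_ (sym (at10-U (suc p) f x y s)) refl)))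
    l : ∀ c a₁ a₂ b d e g → (c * a₁ + b + (c * d + e)) - (c * (a₂ + d) + (b + g)) ≡ c * (a₁ - a₂) + (e - g)
    l = ℤS.solve-∀
    l₂ : ∀ c u v w → c * (u * v) + w * v ≡ (c * u + w) * v
    l₂ = ℤS.solve-∀
    diag : ∀ x y → at10 U₀ x y s - at01 D₀ x y s ≡ (+ bit x - + bit y) * f (x ∷ y ∷ s)
    diag true  true  = refl
    diag true  false = l₃ (f (true ∷ false ∷ s))
      where
      l₃ : ∀ a → a - + 0 ≡ + 1 * a
      l₃ = ℤS.solve-∀
    diag false true  = l₃ (f (false ∷ true ∷ s))
      where
      l₃ : ∀ a → + 0 - a ≡ (- (+ 1)) * a
      l₃ = ℤS.solve-∀
    diag false false = refl

  headbit : ∀ {n} → Str n → ℕ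
  headbit []      = 0
  headbit (x ∷ s) = bit x

  -- Summation by parts of Σ (p+i)(n-i)(x_i - x_(i+1)). The offset p is general because it grows
  -- along the recursion; the boundary term with `headbit` disappears at p = 0.
  weight-closed : ∀ {n} p (s : Str n) → weight (suc p) s ≡
    + headbit s * + p * + n + + ones s * (+ n - + p - + ones s) - + 2 * + rank s
  weight-closed p []           = refl-lem (+ p)
    where
    refl-lem : ∀ p → + 0 ≡ + 0 * p * + 0 + + 0 * (+ 0 - p - + 0) - + 2 * + 0
    refl-lem = ℤS.solve-∀
  weight-closed p (true ∷ [])  = l (+ p)
    where
    l : ∀ p → + 0 ≡ + 1 * p * + 1 + + 1 * (+ 1 - p - + 1) - + 2 * + 0
    l = ℤS.solve-∀
  weight-closed p (false ∷ []) = l (+ p)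
    where
    l : ∀ p → + 0 ≡ + 0 * p * + 1 + + 0 * (+ 1 - p - + 0) - + 2 * + 0
    l = ℤS.solve-∀
  weight-closed {suc (suc n)} p (x ∷ y ∷ s) = trans (cong₂ (λ u v → u * (+ bit x - + bit y) + v) (ℤP.pos-* (suc p) (suc n)) (weight-closed (suc p) (y ∷ s)))
    (step x)
    where
    k = ones (y ∷ s)
    r = rank (y ∷ s)
    step : ∀ x → + suc p * + suc n * (+ bit x - + bit y) + (+ bit y * + suc p * + suc n + + k * (+ suc n - + suc p - + k) - + 2 * + r)
         ≡ + bit x * + p * + suc (suc n) + + ones (x ∷ y ∷ s) * (+ suc (suc n) - + p - + ones (x ∷ y ∷ s)) - + 2 * + rank (x ∷ y ∷ s)
    step true  = l (+ p) (+ n) (+ bit y) (+ k) (+ r)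
      where
      l : ∀ p n y k r → (+ 1 + p) * (+ 1 + n) * (+ 1 - y) + (y * (+ 1 + p) * (+ 1 + n) + k * ((+ 1 + n) - (+ 1 + p) - k) - + 2 * r)
        ≡ + 1 * p * (+ 2 + n) + (+ 1 + k) * ((+ 2 + n) - p - (+ 1 + k)) - + 2 * r
      l = ℤS.solve-∀
    step false = l (+ p) (+ n) (+ bit y) (+ k) (+ r)
      where
      l : ∀ p n y k r → (+ 1 + p) * (+ 1 + n) * (+ 0 - y) + (y * (+ 1 + p) * (+ 1 + n) + k * ((+ 1 + n) - (+ 1 + p) - k) - + 2 * r)
        ≡ + 0 * p * (+ 2 + n) + k * ((+ 2 + n) - p - k) - + 2 * (r + k)
      l = ℤS.solve-∀

  weight₁ : ∀ {n} (s : Str n) → weight 1 s ≡ + ones s * (+ n - + ones s) - + 2 * + rank s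
  weight₁ {n} s = trans (weight-closed 0 s) (l (+ headbit s) (+ n) (+ ones s) (+ rank s))
    where
    l : ∀ h n k r → h * + 0 * n + k * (n - + 0 - k) - + 2 * r ≡ k * (n - k) - + 2 * r
    l = ℤS.solve-∀

  D-swap : ∀ {n} {T : Set} {A : (T → ℤ) → T → ℤ} → Linear A → ∀ (f : Str n → T → ℤ) s t →
           D (λ s′ → A (f s′) t) s ≡ A (λ t′ → D (λ s′ → f s′ t′) s) t
  D-swap lin f []          t = sym (Linear.A-0 lin t)
  D-swap lin f (x ∷ [])    t = sym (Linear.A-0 lin t)
  D-swap {A = A} lin f (x ∷ y ∷ s) t = trans (cong₂ _+_ (hd x y) (D-swap lin (λ s′ → f (x ∷ s′)) (y ∷ s) t)) (sym (Linear.A-+ lin _ _ t))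
    where
    hd : ∀ x y → at10 (λ s′ → A (f s′) t) x y s ≡ A (λ t′ → at10 (λ s′ → f s′ t′) x y s) t
    hd true  false = refl
    hd true  true  = sym (Linear.A-0 lin t)
    hd false y     = sym (Linear.A-0 lin t)

  U-swap : ∀ {n} {T : Set} {A : (T → ℤ) → T → ℤ} → Linear A → ∀ p (f : Str n → T → ℤ) s t →
           U p (λ s′ → A (f s′) t) s ≡ A (λ t′ → U p (λ s′ → f s′ t′) s) t
  U-swap lin p f []          t = sym (Linear.A-0 lin t)
  U-swap lin p f (x ∷ [])    t = sym (Linear.A-0 lin t)
  U-swap {suc (suc n)} {A = A} lin p f (x ∷ y ∷ s) t =
    trans (cong₂ _+_ (trans (cong (+ (p ℕ.* suc n) *_) (hd x y)) (sym (Linear.A-* lin (+ (p ℕ.* suc n)) _ t))) (U-swap lin (suc p) (λ s′ → f (x ∷ s′)) (y ∷ s) t))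
      (sym (Linear.A-+ lin _ _ t))
    where
    hd : ∀ x y → at01 (λ s′ → A (f s′) t) x y s ≡ A (λ t′ → at01 (λ s′ → f s′ t′) x y s) t
    hd false true  = refl
    hd false false = sym (Linear.A-0 lin t)
    hd true  y     = sym (Linear.A-0 lin t)

  -- Tensor product of two such representations.

  Pair : ℕ → ℕ → Set
  Pair m n = Str m × Str n

  _⊕_ : ∀ {m n} → ((Str m → ℤ) → Str m → ℤ) → ((Str n → ℤ) → Str n → ℤ) → (Pair m n → ℤ) → Pair m n → ℤ
  (A ⊕ B) f (s , t) = A (λ s′ → f (s′ , t)) s + B (λ t′ → f (s , t′)) t

  lin⊕ : ∀ {m n} {A : (Str m → ℤ) → Str m → ℤ} {B : (Str n → ℤ) → Str n → ℤ} → Linear A → Linear B → Linear (A ⊕ B)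
  lin⊕ {A = A} {B} a b = record
    { A-cong = λ h → λ { (s , t) → cong₂ _+_ (Linear.A-cong a (λ s′ → h (s′ , t)) s) (Linear.A-cong b (λ t′ → h (s , t′)) t) }
    ; A-+ = λ f g → λ { (s , t) → trans (cong₂ _+_ (Linear.A-+ a _ _ s) (Linear.A-+ b _ _ t)) (i (A (λ s′ → f (s′ , t)) s) (A (λ s′ → g (s′ , t)) s) (B (λ t′ → f (s , t′)) t) (B (λ t′ → g (s , t′)) t)) }
    ; A-* = λ c f → λ { (s , t) → trans (cong₂ _+_ (Linear.A-* a c _ s) (Linear.A-* b c _ t)) (sym (ℤP.*-distribˡ-+ c _ _)) } }
    where
    i : ∀ a b c d → (a + b) + (c + d) ≡ (a + c) + (b + d)
    i = ℤS.solve-∀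

  U₂ D₂ : ∀ {m n} → (Pair m n → ℤ) → Pair m n → ℤ
  U₂ = U 1 ⊕ U 1
  D₂ = D ⊕ D

  linU₂ : ∀ {m n} → Linear (U₂ {m} {n})
  linU₂ = lin⊕ (linU 1) (linU 1)
  linD₂ : ∀ {m n} → Linear (D₂ {m} {n})
  linD₂ = lin⊕ linD linD

  weight₂ : ∀ {m n} → Pair m n → ℤ
  weight₂ (s , t) = weight 1 s + weight 1 t

  -- Operators on different tensor factors commute (`D-swap`, `U-swap`), so the mixed terms cancel
  -- and the weights add.
  commutator₂ : ∀ {m n} (f : Pair m n → ℤ) p → D₂ (U₂ f) p - U₂ (D₂ f) p ≡ weight₂ p * f p
  commutator₂ f (s , t) = begin
    D₂ (U₂ f) (s , t) - U₂ (D₂ f) (s , t)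
      ≡⟨ cong₂ _-_
          (cong₂ _+_ (D-+ (λ s′ → U 1 (λ s″ → f (s″ , t)) s′) (λ s′ → U 1 (λ t′ → f (s′ , t′)) t) s)
                     (D-+ (λ t′ → U 1 (λ s′ → f (s′ , t′)) s) (λ t′ → U 1 (λ t″ → f (s , t″)) t′) t))
          (cong₂ _+_ (U-+ 1 (λ s′ → D (λ s″ → f (s″ , t)) s′) (λ s′ → D (λ t′ → f (s′ , t′)) t) s)
                     (U-+ 1 (λ t′ → D (λ s′ → f (s′ , t′)) s) (λ t′ → D (λ t″ → f (s , t″)) t′) t)) ⟩
    (DU₁ + D₁U₂) + (D₂U₁ + DU₂) - ((UD₁ + U₁D₂) + (U₂D₁ + UD₂))
      ≡⟨ cong₂ (λ u v → (DU₁ + u) + (D₂U₁ + DU₂) - ((UD₁ + v) + (U₂D₁ + UD₂)))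
           (D-swap (linU 1) (λ s t → f (s , t)) s t) (U-swap linD 1 (λ s t → f (s , t)) s t) ⟩
    (DU₁ + U₂D₁) + (D₂U₁ + DU₂) - ((UD₁ + D₂U₁) + (U₂D₁ + UD₂))
      ≡⟨ l DU₁ U₂D₁ D₂U₁ DU₂ UD₁ UD₂ ⟩
    (DU₁ - UD₁) + (DU₂ - UD₂)
      ≡⟨ cong₂ _+_ (commutator 1 (λ s′ → f (s′ , t)) s) (commutator 1 (λ t′ → f (s , t′)) t) ⟩
    weight 1 s * f (s , t) + weight 1 t * f (s , t)
      ≡⟨ ℤP.*-distribʳ-+ (f (s , t)) (weight 1 s) (weight 1 t) ⟨
    weight₂ (s , t) * f (s , t) ∎
    where
    open ≡-Reasoning
    DU₁ = D (λ s′ → U 1 (λ s″ → f (s″ , t)) s′) s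
    D₁U₂ = D (λ s′ → U 1 (λ t′ → f (s′ , t′)) t) s
    D₂U₁ = D (λ t′ → U 1 (λ s′ → f (s′ , t′)) s) t
    DU₂ = D (λ t′ → U 1 (λ t″ → f (s , t″)) t′) t
    UD₁ = U 1 (λ s′ → D (λ s″ → f (s″ , t)) s′) s
    U₁D₂ = U 1 (λ s′ → D (λ t′ → f (s′ , t′)) t) s
    U₂D₁ = U 1 (λ t′ → D (λ s′ → f (s′ , t′)) s) t
    UD₂ = U 1 (λ t′ → D (λ t″ → f (s , t″)) t′) t
    l : ∀ a b c d e g → (a + b) + (c + d) - ((e + c) + (b + g)) ≡ (a - e) + (d - g)
    l = ℤS.solve-∀

  rank₂ : ∀ {m n} → Pair m n → ℕ
  rank₂ (s , t) = rank s ℕ.+ rank t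

  SameOnes : ∀ {m n} → Pair m n → Pair m n → Set
  SameOnes (s , t) (s′ , t′) = ones s ≡ ones s′ × ones t ≡ ones t′

  U₂-vanish : ∀ {m n} (f : Pair m n → ℤ) p → (∀ q → SameOnes q p → suc (rank₂ q) ≡ rank₂ p → f q ≡ + 0) → U₂ f p ≡ + 0
  U₂-vanish f (s , t) h = cong₂ _+_
    (trans (U-local 1 _ (λ _ → + 0) s (λ s′ e r → h (s′ , t) (e , refl) (cong (ℕ._+ rank t) r))) (U-0 1 s))
    (trans (U-local 1 _ (λ _ → + 0) t (λ t′ e r → h (s , t′) (refl , e) (trans (sym (ℕP.+-suc (rank s) (rank t′))) (cong (rank s ℕ.+_) r)))) (U-0 1 t))

  D₂-vanish : ∀ {m n} (f : Pair m n → ℤ) p → (∀ q → SameOnes q p → rank₂ q ≡ suc (rank₂ p) → f q ≡ + 0) → D₂ f p ≡ + 0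
  D₂-vanish f (s , t) h = cong₂ _+_
    (trans (D-local _ (λ _ → + 0) s (λ s′ e r → h (s′ , t) (e , refl) (cong (ℕ._+ rank t) r))) (D-0 s))
    (trans (D-local _ (λ _ → + 0) t (λ t′ e r → h (s , t′) (refl , e) (trans (cong (rank s ℕ.+_) r) (ℕP.+-suc (rank s) (rank t))))) (D-0 t))

  -- The degree of [m k][n l]. A weight `top` - 2 rank is positive exactly below the middle degree.
  top : ℕ → ℕ → ℕ → ℕ → ℤ
  top m n k l = + k * (+ m - + k) + + l * (+ n - + l)

  weight₂-closed : ∀ {m n} (s : Str m) (t : Str n) → weight₂ (s , t) ≡ top m n (ones s) (ones t) - + 2 * + rank₂ (s , t)
  weight₂-closed {m} {n} s t = trans (cong₂ _+_ (weight₁ s) (weight₁ t))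
    (trans (l (+ ones s * (+ m - + ones s)) (+ rank s) (+ ones t * (+ n - + ones t)) (+ rank t)) refl)
    where
    l : ∀ a r b u → (a - + 2 * r) + (b - + 2 * u) ≡ a + b - + 2 * (r + u)
    l = ℤS.solve-∀

  weight₂-suc : ∀ {m n} {p q : Pair m n} → SameOnes q p → suc (rank₂ q) ≡ rank₂ p → weight₂ q ≡ weight₂ p + + 2
  weight₂-suc {m} {n} {s , t} {s′ , t′} (e , e′) r = trans (weight₂-closed s′ t′)
    (trans (cong₂ (λ u v → top m n u v - + 2 * + rank₂ (s′ , t′)) e e′)
    (trans (l (top m n (ones s) (ones t)) (+ rank₂ (s′ , t′)))
    (trans (cong (λ z → top m n (ones s) (ones t) - + 2 * z + + 2) (cong +_ r)) (cong (_+ + 2) (sym (weight₂-closed s t))))))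
    where
    l : ∀ a r → a - + 2 * r ≡ a - + 2 * (+ 1 + r) + + 2
    l = ℤS.solve-∀

  bounded : ∀ {n} (w : Str n → ℕ) → ∃ λ N → ∀ s → w s ℕ.≤ N
  bounded {zero}  w = w [] , λ { [] → ℕP.≤-refl }
  bounded {suc n} w with bounded (λ s → w (true ∷ s)) | bounded (λ s → w (false ∷ s))
  ... | N , h | M , k = N ℕ.⊔ M , λ { (true ∷ s) → ℕP.≤-trans (h s) (ℕP.m≤m⊔n N M) ; (false ∷ s) → ℕP.≤-trans (k s) (ℕP.m≤n⊔m N M) }

  bounded₂ : ∀ {m n} (w : Pair m n → ℤ) → ∃ λ N → ∀ p → w p ℤ.< + N
  bounded₂ w with bounded (λ s → proj₁ (bounded (λ t → ℤ.∣ w (s , t) ∣)))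
  ... | N , h = suc N , λ { (s , t) → ℤP.≤-<-trans (i≤∣i∣ (w (s , t))) (ℤ.+<+ (s≤s (ℕP.≤-trans (proj₂ (bounded (λ t → ℤ.∣ w (s , t) ∣)) t) (h s)))) }
    where
    i≤∣i∣ : ∀ i → i ℤ.≤ + ℤ.∣ i ∣
    i≤∣i∣ (+ n)        = ℤP.≤-refl
    i≤∣i∣ (ℤ.-[1+ n ]) = ℤ.-≤+

  module _ {m n : ℕ} where

    private
      W : Pair m n → ℤ
      W = weight₂

    U₂-injective : ∀ l (f : Pair m n → ℤ) → 0 ℕ.< l → (∀ p → W p ≢ + l → f p ≡ + 0) → (∀ p → U₂ f p ≡ + 0) → ∀ p → f p ≡ + 0
    U₂-injective l f pos supp vanish = C.injective l f supp vanish pos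
      where
      module C = Commutator linU₂ linD₂ W commutator₂
        (λ μ f supp p ne → D₂-vanish f p (λ q e r → supp q (λ w → ne (trans (weight₂-suc {p = q} {q = p} (sym (proj₁ e) , sym (proj₂ e)) (sym r)) (cong (_+ + 2) w)))))
        (proj₁ (bounded₂ W)) (proj₂ (bounded₂ W))

    -- The two operators exchange roles and the weight changes sign, which serves the upper half.
    D₂-injective : ∀ l (f : Pair m n → ℤ) → 0 ℕ.< l → (∀ p → - W p ≢ + l → f p ≡ + 0) → (∀ p → D₂ f p ≡ + 0) → ∀ p → f p ≡ + 0
    D₂-injective l f pos supp vanish = C.injective l f supp vanish pos
      where
      neg+2 : ∀ w → - w ≡ - (w + + 2) + + 2
      neg+2 = ℤS.solve-∀
      flip : ∀ a b w x → a - b ≡ w * x → b - a ≡ (- w) * x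
      flip a b w x e = trans (l₁ a b) (trans (cong -_ e) (l₂ w x))
        where
        l₁ : ∀ a b → b - a ≡ - (a - b)
        l₁ = ℤS.solve-∀
        l₂ : ∀ w x → - (w * x) ≡ (- w) * x
        l₂ = ℤS.solve-∀
      module C = Commutator linD₂ linU₂ (λ p → - W p) (λ f p → flip (D₂ (U₂ f) p) (U₂ (D₂ f) p) (W p) (f p) (commutator₂ f p))
        (λ μ f supp p ne → U₂-vanish f p (λ q e r → supp q (λ w → ne (trans (neg+2 (W p)) (cong (_+ + 2) (trans (cong -_ (sym (weight₂-suc {p = p} {q = q} e r))) w))))))
        (proj₁ (bounded₂ (λ p → - W p))) (proj₂ (bounded₂ (λ p → - W p)))

  strings : (n k : ℕ) → List (Str n)
  strings zero    zero    = [] ∷ []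
  strings zero    (suc k) = []
  strings (suc n) zero    = map (false ∷_) (strings n zero)
  strings (suc n) (suc k) = map (true ∷_) (strings n k) ++ map (false ∷_) (strings n (suc k))

  ∷-inj : ∀ {n b} {s t : Str n} → b ∷ s ≡ b ∷ t → s ≡ t
  ∷-inj refl = refl

  strings-unique : ∀ n k → Unique (strings n k)
  strings-unique zero    zero    = [] ∷ []
  strings-unique zero    (suc k) = []
  strings-unique (suc n) zero    = UniqueP.map⁺ ∷-inj (strings-unique n zero)
  strings-unique (suc n) (suc k) = UniqueP.++⁺ (UniqueP.map⁺ ∷-inj (strings-unique n k)) (UniqueP.map⁺ ∷-inj (strings-unique n (suc k)))
    (λ { (a , b) → dis (∈-map⁻ _ a) (∈-map⁻ _ b) })
    where
    dis : ∀ {v : Str (suc n)} → (∃ λ s → s ∈ strings n k × v ≡ true ∷ s) → (∃ λ s → s ∈ strings n (suc k) × v ≡ false ∷ s) → ⊥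
    dis (_ , _ , refl) (_ , _ , ())

  ∈-strings⁺ : ∀ {n} (s : Str n) {k} → ones s ≡ k → s ∈ strings n k
  ∈-strings⁺ []                  refl = here refl
  ∈-strings⁺ {suc n} (true ∷ s)  refl = ∈-++⁺ˡ (∈-map⁺ (true ∷_) (∈-strings⁺ s refl))
  ∈-strings⁺ {suc n} (false ∷ s) {zero} e = ∈-map⁺ (false ∷_) (∈-strings⁺ s e)
  ∈-strings⁺ {suc n} (false ∷ s) {suc k} e = ∈-++⁺ʳ (map (true ∷_) (strings n k)) (∈-map⁺ (false ∷_) (∈-strings⁺ s e))

  ∈-strings⁻ : ∀ n k {s : Str n} → s ∈ strings n k → ones s ≡ k
  ∈-strings⁻ zero    zero    (here refl) = refl
  ∈-strings⁻ (suc n) zero    h with ∈-map⁻ _ h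
  ... | s , s∈ , refl = ∈-strings⁻ n zero s∈
  ∈-strings⁻ (suc n) (suc k) h with ∈-++⁻ (map (true ∷_) (strings n k)) h
  ... | inj₁ h′ with ∈-map⁻ _ h′
  ...   | s , s∈ , refl = cong suc (∈-strings⁻ n k s∈)
  ∈-strings⁻ (suc n) (suc k) h | inj₂ h′ with ∈-map⁻ _ h′
  ...   | s , s∈ , refl = ∈-strings⁻ n (suc k) s∈

  module _ (m n k l : ℕ) where

    pairs : List (Pair m n)
    pairs = cartesianProduct (strings m k) (strings n l)

    level : ℕ → List (Pair m n)
    level i = filter (λ p → rank₂ p ℕ.≟ i) pairs

    level-unique : ∀ i → Unique (level i)
    level-unique i = UniqueP.filter⁺ _ (UniqueP.cartesianProduct⁺ (strings-unique m k) (strings-unique n l))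

    ∈-level⁺ : ∀ {i s t} → ones s ≡ k → ones t ≡ l → rank₂ (s , t) ≡ i → (s , t) ∈ level i
    ∈-level⁺ e e′ r = ∈-filter⁺ (λ p → rank₂ p ℕ.≟ _) (∈-cartesianProduct⁺ (∈-strings⁺ _ e) (∈-strings⁺ _ e′)) r

    ∈-level⁻ : ∀ {i s t} → (s , t) ∈ level i → ones s ≡ k × ones t ≡ l × rank₂ (s , t) ≡ i
    ∈-level⁻ {i} h with ∈-filter⁻ (λ p → rank₂ p ℕ.≟ i) {xs = pairs} h
    ... | h′ , r with ∈-cartesianProduct⁻ (strings m k) (strings n l) h′
    ...   | a , b = ∈-strings⁻ m k a , ∈-strings⁻ n l b , r

    _≟₂_ : DecidableEquality (Pair m n)
    _≟₂_ = ×P.≡-dec (VecP.≡-dec BoolP._≟_) (VecP.≡-dec BoolP._≟_)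

    level-weight : ∀ {i s t} → (s , t) ∈ level i → weight₂ (s , t) ≡ top m n k l - + 2 * + i
    level-weight {i} {s} {t} h with ∈-level⁻ {i} h
    ... | refl , refl , refl = weight₂-closed s t

    open import Data.List.Membership.DecPropositional _≟₂_ using (_∈?_)

    -- `U₂` sends functions on level i to functions on level i + 1, injectively while the weight of
    -- level i is positive.
    level-increasing : ∀ i d → top m n k l - + 2 * + i ≡ + suc d → length (level i) ℕ.≤ length (level (suc i))
    level-increasing i d e = injective⇒length≤ _≟₂_ linU₂ (level i) (level (suc i)) (level-unique i)
      (λ f supp vanish → U₂-injective (suc d) f (s≤s z≤n)
        (λ p ne → supp p (λ p∈ → ne (trans (level-weight {i} p∈) e)))
        (λ p → allzero f supp vanish p (p ∈? level (suc i))))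
      where
      open import Relation.Nullary using (Dec)
      allzero : ∀ f → (∀ s → ¬ s ∈ level i → f s ≡ + 0) → (∀ t → t ∈ level (suc i) → U₂ f t ≡ + 0) → ∀ p → Dec (p ∈ level (suc i)) → U₂ f p ≡ + 0
      allzero f supp vanish p (yes h) = vanish p h
      allzero f supp vanish (s , t) (no h) = U₂-vanish f (s , t) (λ { (s′ , t′) (e₁ , e₂) r → supp (s′ , t′) (λ q∈ →
        h (∈-level⁺ (trans (sym e₁) (proj₁ (∈-level⁻ {i} q∈))) (trans (sym e₂) (proj₁ (proj₂ (∈-level⁻ {i} q∈)))) (trans (sym r) (cong suc (proj₂ (proj₂ (∈-level⁻ {i} q∈))))))) })

    level-decreasing : ∀ i d → - (top m n k l - + 2 * + suc i) ≡ + suc d → length (level (suc i)) ℕ.≤ length (level i)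
    level-decreasing i d e = injective⇒length≤ _≟₂_ linD₂ (level (suc i)) (level i) (level-unique (suc i))
      (λ f supp vanish → D₂-injective (suc d) f (s≤s z≤n)
        (λ p ne → supp p (λ p∈ → ne (trans (cong -_ (level-weight {suc i} p∈)) e)))
        (λ p → allzero f supp vanish p (p ∈? level i)))
      where
      open import Relation.Nullary using (Dec)
      allzero : ∀ f → (∀ s → ¬ s ∈ level (suc i) → f s ≡ + 0) → (∀ t → t ∈ level i → D₂ f t ≡ + 0) → ∀ p → Dec (p ∈ level i) → D₂ f p ≡ + 0
      allzero f supp vanish p (yes h) = vanish p h
      allzero f supp vanish (s , t) (no h) = D₂-vanish f (s , t) (λ { (s′ , t′) (e₁ , e₂) r → supp (s′ , t′) (λ q∈ →
        h (∈-level⁺ (trans (sym e₁) (proj₁ (∈-level⁻ {suc i} q∈))) (trans (sym e₂) (proj₁ (proj₂ (∈-level⁻ {suc i} q∈)))) (ℕP.suc-injective (trans (sym r) (proj₂ (proj₂ (∈-level⁻ {suc i} q∈))))))) })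

  gf : ∀ {S : Set} → (S → ℕ) → List S → Poly
  gf r []       = []
  gf r (s ∷ xs) = xₚ ^ₚ r s +ₚ gf r xs

  gf-++ : ∀ {S : Set} (r : S → ℕ) xs ys → gf r (xs ++ ys) ≋ gf r xs +ₚ gf r ys
  gf-++ r []       ys = ≋-refl
  gf-++ r (x ∷ xs) ys = ≋-trans (+ₚ-cong (≋-refl {xₚ ^ₚ r x}) (gf-++ r xs ys)) (≋-sym (+ₚ-assoc (xₚ ^ₚ r x) (gf r xs) (gf r ys)))

  gf-map : ∀ {S T : Set} (r : T → ℕ) (f : S → T) xs → gf r (map f xs) ≡ gf (λ s → r (f s)) xs
  gf-map r f []       = refl
  gf-map r f (x ∷ xs) = cong (xₚ ^ₚ r (f x) +ₚ_) (gf-map r f xs)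

  gf-shift : ∀ {S : Set} (r e : S → ℕ) k xs → All (λ s → e s ≡ k) xs → gf (λ s → r s ℕ.+ e s) xs ≋ xₚ ^ₚ k *ₚ gf r xs
  gf-shift r e k []       []         = ≋-sym (*ₚ-zeroʳ (xₚ ^ₚ k))
  gf-shift r e k (x ∷ xs) (refl ∷ a) = ≋-trans
    (+ₚ-cong (≋-trans (^-+ xₚ (r x) (e x)) (*ₚ-comm (xₚ ^ₚ r x) (xₚ ^ₚ e x))) (gf-shift r e (e x) xs a))
    (≋-sym (*ₚ-distribˡ (xₚ ^ₚ e x) (xₚ ^ₚ r x) (gf r xs)))

  strings-ones : ∀ n k → All (λ s → ones s ≡ k) (strings n k)
  strings-ones n k = All.tabulate (∈-strings⁻ n k)

  gf-strings : ∀ n k → gf rank (strings n k) ≋ bin xₚ n k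
  gf-strings zero    zero    = +ₚ-identityʳ 1ₚ
  gf-strings zero    (suc k) = ≋-refl
  gf-strings (suc n) zero    = ≋-trans (≡⇒≋ (gf-map rank (false ∷_) (strings n zero)))
    (≋-trans (gf-shift rank ones 0 (strings n zero) (strings-ones n zero)) (≋-trans (*ₚ-identityˡ _) (gf-strings n zero)))
  gf-strings (suc n) (suc k) = ≋-trans (gf-++ rank (map (true ∷_) (strings n k)) _)
    (+ₚ-cong (≋-trans (≡⇒≋ (gf-map rank (true ∷_) (strings n k))) (gf-strings n k))
      (≋-trans (≡⇒≋ (gf-map rank (false ∷_) (strings n (suc k))))
        (≋-trans (gf-shift rank ones (suc k) (strings n (suc k)) (strings-ones n (suc k)))
          (*ₚ-cong (≋-refl {xₚ ^ₚ suc k}) (gf-strings n (suc k))))))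

  gf-product : ∀ {m n} (xs : List (Str m)) (ys : List (Str n)) → gf rank₂ (cartesianProduct xs ys) ≋ gf rank xs *ₚ gf rank ys
  gf-product []       ys = ≋-refl
  gf-product (x ∷ xs) ys = ≋-trans (gf-++ rank₂ (map (x ,_) ys) (cartesianProduct xs ys))
    (≋-trans (+ₚ-cong (≋-trans (≡⇒≋ (gf-map rank₂ (x ,_) ys)) (row ys)) (gf-product xs ys))
      (≋-sym (*ₚ-distribʳ (gf rank ys) (xₚ ^ₚ rank x) (gf rank xs))))
    where
    row : ∀ ys → gf (λ t → rank x ℕ.+ rank t) ys ≋ xₚ ^ₚ rank x *ₚ gf rank ys
    row []       = ≋-sym (*ₚ-zeroʳ (xₚ ^ₚ rank x))
    row (y ∷ ys) = ≋-trans (+ₚ-cong (^-+ xₚ (rank x) (rank y)) (row ys)) (≋-sym (*ₚ-distribˡ (xₚ ^ₚ rank x) (xₚ ^ₚ rank y) (gf rank ys)))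

  coeff-^-≡ : ∀ i → coeff (xₚ ^ₚ i) i ≡ + 1
  coeff-^-≡ zero    = refl
  coeff-^-≡ (suc i) = trans (at (x* (xₚ ^ₚ i)) (suc i)) (coeff-^-≡ i)

  coeff-^-≢ : ∀ m i → m ≢ i → coeff (xₚ ^ₚ m) i ≡ + 0
  coeff-^-≢ zero    zero    n = ⊥-elim (n refl)
  coeff-^-≢ zero    (suc i) n = refl
  coeff-^-≢ (suc m) zero    n = at (x* (xₚ ^ₚ m)) 0
  coeff-^-≢ (suc m) (suc i) n = trans (at (x* (xₚ ^ₚ m)) (suc i)) (coeff-^-≢ m i (λ e → n (cong suc e)))

  coeff-gf : ∀ {S : Set} (r : S → ℕ) xs i → coeff (gf r xs) i ≡ + length (filter (λ s → r s ℕ.≟ i) xs)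
  coeff-gf r []       i = refl
  coeff-gf r (x ∷ xs) i with r x ℕ.≟ i
  ... | yes e = trans (coeff-+ (xₚ ^ₚ r x) (gf r xs) i)
        (trans (cong₂ _+_ (trans (cong (λ z → coeff (xₚ ^ₚ z) i) e) (coeff-^-≡ i)) (coeff-gf r xs i))
          (sym (cong (λ l → + length l) (LP.filter-accept (λ s → r s ℕ.≟ i) {x} {xs} e))))
  ... | no n  = trans (coeff-+ (xₚ ^ₚ r x) (gf r xs) i)
        (trans (cong₂ _+_ (coeff-^-≢ (r x) i n) (coeff-gf r xs i))
          (trans (ℤP.+-identityˡ _) (sym (cong (λ l → + length l) (LP.filter-reject (λ s → r s ℕ.≟ i) {x} {xs} n)))))

  coeff-level : ∀ m n k l i → coeff (bin xₚ m k *ₚ bin xₚ n l) i ≡ + length (level m n k l i)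
  coeff-level m n k l i = trans (at (≋-sym (≋-trans (gf-product (strings m k) (strings n l)) (*ₚ-cong (gf-strings m k) (gf-strings n l)))) i)
    (coeff-gf rank₂ (pairs m n k l) i)

  coeff-xᵃ*-+ : ∀ a p i → coeff (xₚ ^ₚ a *ₚ p) (a ℕ.+ i) ≡ coeff p i
  coeff-xᵃ*-+ zero    p i = at (*ₚ-identityˡ p) i
  coeff-xᵃ*-+ (suc a) p i = trans (at (≋-trans (*ₚ-assoc xₚ (xₚ ^ₚ a) p) (x* (xₚ ^ₚ a *ₚ p))) (suc (a ℕ.+ i))) (coeff-xᵃ*-+ a p i)

  coeff-xᵃ*-< : ∀ a p i → i ℕ.< a → coeff (xₚ ^ₚ a *ₚ p) i ≡ + 0
  coeff-xᵃ*-< (suc a) p zero    h       = at (≋-trans (*ₚ-assoc xₚ (xₚ ^ₚ a) p) (x* (xₚ ^ₚ a *ₚ p))) 0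
  coeff-xᵃ*-< (suc a) p (suc i) (s≤s h) = trans (at (≋-trans (*ₚ-assoc xₚ (xₚ ^ₚ a) p) (x* (xₚ ^ₚ a *ₚ p))) (suc i)) (coeff-xᵃ*-< a p i h)

  -- X = F (1 - q) / (1 - q^a): in the lower half the coefficients of X are sums
  -- of increments of the unimodal polynomial F, in the upper half of decrements.
  module Quotient (a′ n k l : ℕ) (X : Poly) (eq : int xₚ (suc a′) *ₚ X ≋ bin xₚ (suc a′) k *ₚ bin xₚ n l) where

    private
      a = suc a′
      F = bin xₚ a k *ₚ bin xₚ n l
      N = top a n k l
      c = coeff X

      -- This is (1 - q^a) X = (1 - q) F without subtraction.
      master : X +ₚ xₚ *ₚ F ≋ xₚ ^ₚ a *ₚ X +ₚ F
      master = ≋-trans (+ₚ-cong (≋-refl {X}) (*ₚ-cong (≋-refl {xₚ}) (≋-sym eq)))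
        (≋-trans (l₁ X xₚ (int xₚ a))
        (≋-trans (+ₚ-cong (+ₚ-cong (≋-refl {X}) (neg-cong (*ₚ-cong (int-geom xₚ a) (≋-refl {X})))) eq)
          (l₂ X (xₚ ^ₚ a) F)))
        where
        l₁ : ∀ X x I → X +ₚ x *ₚ (I *ₚ X) ≋ (X +ₚ negₚ (((1ₚ +ₚ negₚ x) *ₚ I) *ₚ X)) +ₚ I *ₚ X
        l₁ = solve-∀ polySolver
        l₂ : ∀ X A F → (X +ₚ negₚ ((1ₚ +ₚ negₚ A) *ₚ X)) +ₚ F ≋ A *ₚ X +ₚ F
        l₂ = solve-∀ polySolver

      master-coeff : ∀ i → c i + coeff (xₚ *ₚ F) i ≡ coeff (xₚ ^ₚ a *ₚ X) i + coeff F i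
      master-coeff i = trans (sym (coeff-+ X (xₚ *ₚ F) i)) (trans (at master i) (coeff-+ (xₚ ^ₚ a *ₚ X) F i))

      first : c 0 ≡ coeff F 0
      first = trans (sym (ℤP.+-identityʳ (c 0))) (trans (cong (λ z → c 0 + z) (sym (at (x* F) 0)))
        (trans (master-coeff 0) (trans (cong (λ z → z + coeff F 0) (coeff-xᵃ*-< a X 0 (s≤s z≤n))) (ℤP.+-identityˡ _))))

      next : ∀ i → c (suc i) + coeff F i ≡ coeff (xₚ ^ₚ a *ₚ X) (suc i) + coeff F (suc i)
      next i = trans (cong (λ z → c (suc i) + z) (sym (at (x* F) (suc i)))) (master-coeff (suc i))

      -- Passing from level i to i + 1 needs N - 2i > 0, which in terms of i + 1 reads 2(i + 1) <= N
      -- + 1.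
      increasing : ∀ i → + (2 ℕ.* suc i) ℤ.≤ N + + 1 → coeff F i ℤ.≤ coeff F (suc i)
      increasing i h = subst₂ ℤ._≤_ (sym (coeff-level a n k l i)) (sym (coeff-level a n k l (suc i)))
        (ℤ.+≤+ (level-increasing a n k l i _ (proj₂ (positive (ℤP.i≤j⇒0≤j-i h)))))
        where
        open ≡ using (subst₂)
        l₁ : ∀ N i → N - + 2 * i ≡ + 1 + (N + + 1 - + 2 * (+ 1 + i))
        l₁ = ℤS.solve-∀
        positive : + 0 ℤ.≤ N + + 1 - + (2 ℕ.* suc i) → ∃ λ d → N - + 2 * + i ≡ + suc d
        positive h with N + + 1 - + (2 ℕ.* suc i) in e
        positive (ℤ.+≤+ _) | + d = d , trans (l₁ N (+ i)) (trans (cong (λ z → + 1 + (N + + 1 - z)) (sym (ℤP.pos-* 2 (suc i)))) (cong (λ z → + 1 + z) e))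

      decreasing : ∀ i → N + + 1 ℤ.< + (2 ℕ.* suc i) → coeff F (suc i) ℤ.≤ coeff F i
      decreasing i h = subst₂ ℤ._≤_ (sym (coeff-level a n k l (suc i))) (sym (coeff-level a n k l i))
        (ℤ.+≤+ (level-decreasing a n k l i _ (proj₂ (positive (ℤP.i≤j⇒0≤j-i (ℤP.i<j⇒suc[i]≤j h))))))
        where
        open ≡ using (subst₂)
        l₁ : ∀ N i → - (N - + 2 * i) ≡ + 1 + (+ 1 + (+ 2 * i - (+ 1 + (N + + 1))))
        l₁ = ℤS.solve-∀
        positive : + 0 ℤ.≤ + (2 ℕ.* suc i) - ℤ.suc (N + + 1) → ∃ λ d → - (N - + 2 * + suc i) ≡ + suc d
        positive h with + (2 ℕ.* suc i) - ℤ.suc (N + + 1) in e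
        positive (ℤ.+≤+ _) | + d = suc d , trans (l₁ N (+ suc i)) (trans (cong (λ z → + 1 + (+ 1 + (z - (+ 1 + (N + + 1))))) (sym (ℤP.pos-* 2 (suc i)))) (cong (λ z → + 1 + (+ 1 + z)) e))

      F≥0 : ∀ i → + 0 ℤ.≤ coeff F i
      F≥0 i = subst (+ 0 ℤ.≤_) (sym (coeff-level a n k l i)) (ℤ.+≤+ z≤n)

      step-up : ∀ {x f y g} → x + f ≡ y + g → + 0 ℤ.≤ y → f ℤ.≤ g → + 0 ℤ.≤ x
      step-up {x} {f} {y} {g} e h h′ = subst (+ 0 ℤ.≤_) (trans (l₁ y g f) (trans (cong (_- f) (sym e)) (l₂ x f)))
        (ℤP.+-mono-≤ h (ℤP.i≤j⇒0≤j-i h′))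
        where
        l₁ : ∀ y g f → y + (g - f) ≡ (y + g) - f
        l₁ = ℤS.solve-∀
        l₂ : ∀ x f → (x + f) - f ≡ x
        l₂ = ℤS.solve-∀

      -- Recursion c_i = c_(i-a) + F_i - F_(i-1), where the first term is 0 for i < a.
      lower : ∀ i → + (2 ℕ.* i) ℤ.≤ N + + 1 → + 0 ℤ.≤ c i
      lower = <-rec _ go
        where
        go : ∀ i → (∀ {j} → j ℕ.< i → + (2 ℕ.* j) ℤ.≤ N + + 1 → + 0 ℤ.≤ c j) → + (2 ℕ.* i) ℤ.≤ N + + 1 → + 0 ℤ.≤ c i
        go zero    rec h = subst (+ 0 ℤ.≤_) (sym first) (F≥0 0)
        go (suc i) rec h with suc i ℕ.<? a
        ... | yes i<a = step-up (next i) (ℤP.≤-reflexive (sym (coeff-xᵃ*-< a X (suc i) i<a))) (increasing i h)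
        ... | no i≮a  = step-up (next i) (subst (+ 0 ℤ.≤_) (sym xa) (rec j<i (ℤP.≤-trans (ℤ.+≤+ (ℕP.*-monoʳ-≤ 2 (ℕP.<⇒≤ j<i))) h))) (increasing i h)
          where
          a≤i : a ℕ.≤ suc i
          a≤i = ℕP.≮⇒≥ i≮a
          j = suc i ℕ.∸ a
          j<i : j ℕ.< suc i
          j<i = s≤s (ℕP.m∸n≤m i a′)
          xa : coeff (xₚ ^ₚ a *ₚ X) (suc i) ≡ c j
          xa = trans (cong (coeff (xₚ ^ₚ a *ₚ X)) (sym (ℕP.m+[n∸m]≡n a≤i))) (coeff-xᵃ*-+ a X j)

      -- The same recursion backwards, c_i = c_(i+a) + F_(i+a-1) - F_(i+a); the fuel `d` lasts until
      -- i exceeds the length of X, where coefficients are 0.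
      upper : ∀ d i → length X ℕ.≤ d ℕ.+ i → N + + 1 ℤ.< + (2 ℕ.* i) → + 0 ℤ.≤ c i
      upper zero    i len h = ℤP.≤-reflexive (sym (coeff-beyond X len))
      upper (suc d) i len h = step-up {f = coeff F (suc (a′ ℕ.+ i))} (trans (sym (cong (λ z → z + coeff F (suc (a′ ℕ.+ i))) (coeff-xᵃ*-+ a X i))) (sym (next (a′ ℕ.+ i))))
        (upper d (a ℕ.+ i) (ℕP.≤-trans len (ℕP.≤-trans (ℕP.≤-reflexive (sym (ℕP.+-suc d i))) (ℕP.+-monoʳ-≤ d (s≤s (ℕP.m≤n+m i a′))))) h′)
        (decreasing (a′ ℕ.+ i) h′)
        where
        h′ : N + + 1 ℤ.< + (2 ℕ.* (a ℕ.+ i))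
        h′ = ℤP.<-≤-trans h (ℤ.+≤+ (ℕP.*-monoʳ-≤ 2 (ℕP.m≤n+m i a)))

    nonneg : ∀ i → + 0 ℤ.≤ coeff X i
    nonneg i with + (2 ℕ.* i) ℤ.≤? N + + 1
    ... | yes h = lower i h
    ... | no h  = upper (length X) i (ℕP.m≤m+n _ _) (ℤP.≰⇒> h)

  toℕₚ : Poly → List ℕ
  toℕₚ = map ℤ.∣_∣

  toℤ-toℕ : ∀ p → (∀ i → + 0 ℤ.≤ coeff p i) → toℤₚ (toℕₚ p) ≡ p
  toℤ-toℕ []      h = refl
  toℤ-toℕ (x ∷ p) h = cong₂ _∷_ (ℤP.0≤i⇒+∣i∣≡i (h 0)) (toℤ-toℕ p (λ i → h (suc i)))

open import Data.Nat using (_+_; _*_; _∸_; _<_; _≤_)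

-- Boolean reflection, searches and nearest smaller values.

mutual
  firstFrom′ : (ℕ → Bool) → ℕ → ℕ → ℕ
  firstFrom′ = _

  laserEnd-firstFrom : ∀ a b {b′} (v : Vec ℕ b′) i → laserEnd a b v i ≡
    firstFrom′ (λ j → (b * ht v (suc j)) <ᵇ (b * ht v i + a * (suc j ∸ i))) i (b ∸ i)
  laserEnd-firstFrom a b v i with (λ j → (b * ht v (suc j)) <ᵇ (b * ht v i + a * (suc j ∸ i))) | b ∸ i
  ... | p | c = refl

T→≡ : ∀ {x} → T x → x ≡ true
T→≡ {true} _ = refl

≡→T : ∀ {x} → x ≡ true → T x
≡→T refl = tt

∧-elim : ∀ {x y} → x ∧ y ≡ true → x ≡ true × y ≡ true
∧-elim {true} {true} _ = refl , refl

∧-intro : ∀ {x y} → x ≡ true → y ≡ true → x ∧ y ≡ true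
∧-intro refl refl = refl

∨-elim : ∀ {x y} → x ∨ y ≡ true → x ≡ true ⊎ y ≡ true
∨-elim {true}  _ = inj₁ refl
∨-elim {false} e = inj₂ e

∨-introˡ : ∀ {x} y → x ≡ true → x ∨ y ≡ true
∨-introˡ y refl = refl

∨-introʳ : ∀ x {y} → y ≡ true → x ∨ y ≡ true
∨-introʳ true  refl = refl
∨-introʳ false refl = refl

<ᵇ-true : ∀ {m n} → m < n → (m <ᵇ n) ≡ true
<ᵇ-true h = T→≡ (ℕP.<⇒<ᵇ h)

<ᵇ-sound : ∀ {m n} → (m <ᵇ n) ≡ true → m < n
<ᵇ-sound e = ℕP.<ᵇ⇒< _ _ (≡→T e)

<ᵇ-false : ∀ {m n} → (m <ᵇ n) ≡ false → n ≤ m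
<ᵇ-false {m} {n} e = ℕP.≮⇒≥ (λ h → case (trans (sym (<ᵇ-true h)) e))
  where
  case : true ≡ false → ⊥
  case ()

≤ᵇ-true : ∀ {m n} → m ≤ n → (m ≤ᵇ n) ≡ true
≤ᵇ-true h = T→≡ (ℕP.≤⇒≤ᵇ h)

≤ᵇ-sound : ∀ {m n} → (m ≤ᵇ n) ≡ true → m ≤ n
≤ᵇ-sound e = ℕP.≤ᵇ⇒≤ _ _ (≡→T e)

≡ᵇ-true : ∀ {m n} → m ≡ n → (m ≡ᵇ n) ≡ true
≡ᵇ-true {m} {n} e = T→≡ (ℕP.≡⇒≡ᵇ m n e)

≡ᵇ-sound : ∀ {m n} → (m ≡ᵇ n) ≡ true → m ≡ n
≡ᵇ-sound e = ℕP.≡ᵇ⇒≡ _ _ (≡→T e)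

bool-iff : ∀ {x y} → (x ≡ true → y ≡ true) → (y ≡ true → x ≡ true) → x ≡ y
bool-iff {true}          f g = sym (f refl)
bool-iff {false} {false} f g = refl
bool-iff {false} {true}  f g = g refl

map-upTo : ∀ {A : Set} (f : ℕ → A) n → map f (upTo n) ≡ applyUpTo f n
map-upTo f n = go (λ i → i) n
  where
  go : ∀ g n → map f (applyUpTo g n) ≡ applyUpTo (λ i → f (g i)) n
  go g zero    = refl
  go g (suc n) = cong (f (g 0) ∷_) (go (λ i → g (suc i)) n)

all-elim : ∀ (p : ℕ → Bool) f n → BL.all p (applyUpTo f n) ≡ true → ∀ {k} → k < n → p (f k) ≡ true
all-elim p f (suc n) e {zero}  _       = proj₁ (∧-elim e)
all-elim p f (suc n) e {suc k} (s≤s h) = all-elim p (λ i → f (suc i)) n (proj₂ (∧-elim {p (f 0)} e)) h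

all-intro : ∀ (p : ℕ → Bool) f n → (∀ k → k < n → p (f k) ≡ true) → BL.all p (applyUpTo f n) ≡ true
all-intro p f zero    h = refl
all-intro p f (suc n) h = ∧-intro (h 0 (s≤s z≤n)) (all-intro p (λ i → f (suc i)) n (λ k k<n → h (suc k) (s≤s k<n)))

any-elim : ∀ (p : ℕ → Bool) f n → BL.any p (applyUpTo f n) ≡ true → ∃ λ k → k < n × p (f k) ≡ true
any-elim p f (suc n) e with ∨-elim {p (f 0)} e
... | inj₁ h = 0 , s≤s z≤n , h
... | inj₂ h with any-elim p (λ i → f (suc i)) n h
...   | k , k<n , pk = suc k , s≤s k<n , pk

any-intro : ∀ (p : ℕ → Bool) f n {k} → k < n → p (f k) ≡ true → BL.any p (applyUpTo f n) ≡ true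
any-intro p f (suc n) {zero}  _       h = ∨-introˡ _ h
any-intro p f (suc n) {suc k} (s≤s l) h = ∨-introʳ (p (f 0)) (any-intro p (λ i → f (suc i)) n l h)

-- The fold of `minBlock` selects the first hit in the list, and that of `maxBlock`, treated next,
-- the last one.
foldr-first : ∀ (p : ℕ → Bool) d f n m → m < n → p (f m) ≡ true → (∀ i → i < m → p (f i) ≡ false) →
  foldr (λ l acc → if p l then l else acc) d (applyUpTo f n) ≡ f m
foldr-first p d f (suc n) zero    _       h _ rewrite h = refl
foldr-first p d f (suc n) (suc m) (s≤s l) h k rewrite k 0 (s≤s z≤n) =
  foldr-first p d (λ i → f (suc i)) n m l h (λ i i<m → k (suc i) (s≤s i<m))

foldl-last : ∀ (p : ℕ → Bool) d f n m → m < n → p (f m) ≡ true → (∀ i → m < i → i < n → p (f i) ≡ false) →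
  foldl (λ acc l → if p l then l else acc) d (applyUpTo f n) ≡ f m
foldl-last p d f (suc n) zero    _       h k rewrite h = none (λ i → f (suc i)) n (f 0) (λ i i<n → k (suc i) (s≤s z≤n) (s≤s i<n))
  where
  none : ∀ g n d → (∀ i → i < n → p (g i) ≡ false) → foldl (λ acc l → if p l then l else acc) d (applyUpTo g n) ≡ d
  none g zero    d k = refl
  none g (suc n) d k rewrite k 0 (s≤s z≤n) = none (λ i → g (suc i)) n d (λ i i<n → k (suc i) (s≤s i<n))
foldl-last p d f (suc n) (suc m) (s≤s l) h k =
  foldl-last p _ (λ i → f (suc i)) n m l h (λ i m<i i<n → k (suc i) (s≤s m<i) (s≤s i<n))

-- A known hit `j₀` in the range rules out the fallback value.
firstFrom-spec : ∀ p s c j₀ → s ≤ j₀ → j₀ < s + c → p j₀ ≡ true →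
  let j = firstFrom′ p s c in s ≤ j × j ≤ j₀ × p j ≡ true × (∀ i → s ≤ i → i < j → p i ≡ false)
firstFrom-spec p s zero    j₀ s≤j j<s _ = ⊥-elim (ℕP.<-irrefl refl (ℕP.<-≤-trans j<s (subst (_≤ j₀) (sym (ℕP.+-identityʳ s)) s≤j)))
firstFrom-spec p s (suc c) j₀ s≤j j<s h with p s in e
... | true  = ℕP.≤-refl , s≤j , e , λ i s≤i i<s → ⊥-elim (ℕP.<-irrefl refl (ℕP.<-≤-trans i<s s≤i))
... | false with firstFrom-spec p (suc s) c j₀ (ℕP.≤∧≢⇒< s≤j (λ { refl → case (trans (sym h) e) })) (subst (j₀ <_) (ℕP.+-suc s c) j<s) h
  where
  case : true ≡ false → ⊥
  case ()
...   | a , b , c′ , d = ℕP.<⇒≤ a , b , c′ , λ i s≤i i<j → below i s≤i i<j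
  where
  below : ∀ i → s ≤ i → i < firstFrom′ p (suc s) c → p i ≡ false
  below i s≤i i<j with s ℕ.≟ i
  ... | yes refl = e
  ... | no ne    = d i (ℕP.≤∧≢⇒< s≤i ne) i<j

diff-< : ∀ x y z w → + x ℤ.- + y ℤ.< + z ℤ.- + w → x + w < z + y
diff-< x y z w h = ℤP.drop‿+<+ (subst₂ ℤ._<_ (l x y w) (l′ z w y) (ℤP.+-monoˡ-< (+ y ℤ.+ + w) h))
  where
  open ≡ using (subst₂)
  l : ∀ x y w → (+ x ℤ.- + y) ℤ.+ (+ y ℤ.+ + w) ≡ + (x + w)
  l x y w = l₀ (+ x) (+ y) (+ w)
    where
    l₀ : ∀ x y w → (x ℤ.- y) ℤ.+ (y ℤ.+ w) ≡ x ℤ.+ w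
    l₀ = ℤS.solve-∀
  l′ : ∀ z w y → (+ z ℤ.- + w) ℤ.+ (+ y ℤ.+ + w) ≡ + (z + y)
  l′ z w y = l₀ (+ z) (+ w) (+ y)
    where
    l₀ : ∀ z w y → (z ℤ.- w) ℤ.+ (y ℤ.+ w) ≡ z ℤ.+ y
    l₀ = ℤS.solve-∀

diff-<⁻ : ∀ x y z w → x + w < z + y → + x ℤ.- + y ℤ.< + z ℤ.- + w
diff-<⁻ x y z w h = subst₂ ℤ._<_ (l (+ x) (+ y) (+ w)) (l′ (+ z) (+ w) (+ y)) (ℤP.+-monoˡ-< (ℤ.- + y ℤ.- + w) (ℤ.+<+ h))
  where
  open ≡ using (subst₂)
  l : ∀ x y w → (x ℤ.+ w) ℤ.+ (ℤ.- y ℤ.- w) ≡ x ℤ.- y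
  l = ℤS.solve-∀
  l′ : ∀ z w y → (z ℤ.+ y) ℤ.+ (ℤ.- y ℤ.- w) ≡ z ℤ.- w
  l′ = ℤS.solve-∀

false≢true : false ≡ true → ⊥
false≢true ()

-- k is the last position before i at which s is below s i; e + 1 is the first one after i.
record IsPrev (s : ℕ → ℤ) (i k : ℕ) : Set where
  constructor isPrev
  field
    before : k < i
    below  : s k ℤ.< s i
    above  : ∀ l → k < l → l < i → s i ℤ.≤ s l

record IsNext (s : ℕ → ℤ) (i e : ℕ) : Set where
  constructor isNext
  field
    after : i ≤ e
    below : s (suc e) ℤ.< s i
    above : ∀ l → i < l → l ≤ e → s i ℤ.≤ s l

lastBelow : ∀ (s : ℕ → ℤ) t i → (∃ λ k → k < i × s k ℤ.< t × (∀ l → k < l → l < i → t ℤ.≤ s l)) ⊎ (∀ l → l < i → t ℤ.≤ s l)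
lastBelow s t zero    = inj₂ λ l ()
lastBelow s t (suc i) with s i ℤ.<? t
... | yes h = inj₁ (i , ℕP.≤-refl , h , λ l i<l l<si → ⊥-elim (ℕP.<-irrefl refl (ℕP.≤-trans i<l (ℕ.s≤s⁻¹ l<si))))
... | no ¬h with lastBelow s t i
...   | inj₁ (k , k<i , b , ab) = inj₁ (k , ℕP.m<n⇒m<1+n k<i , b , λ l k<l l<si → up l k<l l<si)
  where
  up : ∀ l → k < l → l < suc i → t ℤ.≤ s l
  up l k<l (s≤s l≤i) with ℕP.m≤n⇒m<n∨m≡n l≤i
  ... | inj₁ l<i  = ab l k<l l<i
  ... | inj₂ refl = ℤP.≮⇒≥ ¬h
...   | inj₂ ab = inj₂ λ { l (s≤s l≤i) → up l (ℕP.m≤n⇒m<n∨m≡n l≤i) }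
  where
  up : ∀ l → l < i ⊎ l ≡ i → t ℤ.≤ s l
  up l (inj₁ l<i)  = ab l l<i
  up l (inj₂ refl) = ℤP.≮⇒≥ ¬h

firstBelow : ∀ (s : ℕ → ℤ) t i d → (∃ λ e → i ≤ e × e < i + d × s (suc e) ℤ.< t × (∀ l → i < l → l ≤ e → t ℤ.≤ s l)) ⊎ (∀ l → i < l → l ≤ i + d → t ℤ.≤ s l)
firstBelow s t i zero    = inj₂ λ l i<l l≤i → ⊥-elim (ℕP.<-irrefl refl (ℕP.<-≤-trans i<l (subst (l ≤_) (ℕP.+-identityʳ i) l≤i)))
firstBelow s t i (suc d) with firstBelow s t i d
... | inj₁ (e , a , b , c , f) = inj₁ (e , a , ℕP.<-≤-trans b (ℕP.+-monoʳ-≤ i (ℕP.n≤1+n d)) , c , f)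
... | inj₂ ab with s (suc (i + d)) ℤ.<? t
...   | yes h = inj₁ (i + d , ℕP.m≤m+n i d , ℕP.≤-reflexive (sym (ℕP.+-suc i d)) , h , ab)
...   | no ¬h = inj₂ λ l i<l l≤ → up l i<l (ℕP.m≤n⇒m<n∨m≡n (subst (l ≤_) (ℕP.+-suc i d) l≤))
  where
  up : ∀ l → i < l → l < suc (i + d) ⊎ l ≡ suc (i + d) → t ℤ.≤ s l
  up l i<l (inj₁ (s≤s h)) = ab l i<l h
  up l i<l (inj₂ refl)    = ℤP.≮⇒≥ ¬h

isPrev-unique : ∀ {s i k k′} → IsPrev s i k → IsPrev s i k′ → k ≡ k′
isPrev-unique {s} {i} {k} {k′} (isPrev a b c) (isPrev a′ b′ c′) with ℕP.<-cmp k k′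
... | tri< l _ _ = ⊥-elim (ℤP.<⇒≱ b′ (c k′ l a′))
... | tri≈ _ e _ = e
... | tri> _ _ l = ⊥-elim (ℤP.<⇒≱ b (c′ k l a))

isNext-unique : ∀ {s i e e′} → IsNext s i e → IsNext s i e′ → e ≡ e′
isNext-unique {s} {i} {e} {e′} (isNext a b c) (isNext a′ b′ c′) with ℕP.<-cmp e e′
... | tri< l _ _ = ⊥-elim (ℤP.<⇒≱ b (c′ (suc e) (s≤s a) l))
... | tri≈ _ q _ = q
... | tri> _ _ l = ⊥-elim (ℤP.<⇒≱ b′ (c (suc e′) (s≤s a′) l))

-- The two partitions of a Dyck path through nearest smaller values.

record Dyck (a b : ℕ) (v : Vec ℕ b) : Set where
  field
    above : ∀ i → i ≤ b → a * i ≤ b * ht v i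
    total : ht v b ≡ a

isDyck-sound : ∀ {a b} {v : Vec ℕ b} → isDyck a b v ≡ true → Dyck a b v
isDyck-sound {a} {b} {v} e = record { above = ab ; total = ≡ᵇ-sound (proj₂ (∧-elim {BL.all _ (upTo b)} e)) }
  where
  ab : ∀ i → i ≤ b → a * i ≤ b * ht v i
  ab zero    _ = subst (_≤ b * 0) (sym (ℕP.*-zeroʳ a)) z≤n
  ab (suc i) h = ≤ᵇ-sound (all-elim (λ i → (a * suc i) ≤ᵇ (b * ht v (suc i))) (λ i → i) b (proj₁ (∧-elim e)) h)

isDyck-complete : ∀ {a b} {v : Vec ℕ b} → Dyck a b v → isDyck a b v ≡ true
isDyck-complete {a} {b} {v} d = ∧-intro (all-intro (λ i → (a * suc i) ≤ᵇ (b * ht v (suc i))) (λ i → i) b (λ i i<b → ≤ᵇ-true (Dyck.above d (suc i) i<b)))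
  (≡ᵇ-true (Dyck.total d))

module Path (a n : ℕ) (v : Vec ℕ (suc n)) (a>0 : 0 < a) (cop : Coprime a (suc n)) (dyck : Dyck a (suc n) v) where

  private
    b = suc n

  -- b times the vertical distance of label k from the line y = (a/b) x. Lasers are parallel to this
  -- line, so they become level.
  height : ℕ → ℤ
  height k = + (b * ht v k) ℤ.- + (a * k)

  height-< : ∀ {i j} → height i ℤ.< height j → b * ht v i + a * j < b * ht v j + a * i
  height-< {i} {j} = diff-< (b * ht v i) (a * i) (b * ht v j) (a * j)

  height-<⁻ : ∀ {i j} → b * ht v i + a * j < b * ht v j + a * i → height i ℤ.< height j
  height-<⁻ {i} {j} = diff-<⁻ (b * ht v i) (a * i) (b * ht v j) (a * j)

  -- Equal heights would make b divide a (j - i), and a is coprime to b. This general position is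
  -- what turns weak inequalities into strict ones.
  height-≢ : ∀ {i j} → i < j → j < i + b → height i ≢ height j
  height-≢ {i} {j} i<j j<i+b e = ℕP.<⇒≱ d<b (∣⇒≤ {{ℕ.>-nonZero 0<d}} (coprime-divisor (ℕC.sym cop) b∣ad))
    where
    d = j ∸ i
    0<d : 0 < d
    0<d = ℕP.m<n⇒0<n∸m i<j
    d<b : d < b
    d<b = ℕP.+-cancelˡ-< i _ _ (subst (_< i + b) (sym (ℕP.m+[n∸m]≡n (ℕP.<⇒≤ i<j))) j<i+b)
    eq : b * ht v i + a * j ≡ b * ht v j + a * i
    eq = ℕP.≤-antisym (ℕP.≮⇒≥ (λ h → ℤP.<-irrefl (sym e) (height-<⁻ {j} {i} h))) (ℕP.≮⇒≥ (λ h → ℤP.<-irrefl e (height-<⁻ {i} {j} h)))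
    eq′ : b * ht v i + a * d ≡ b * ht v j
    eq′ = ℕP.+-cancelʳ-≡ (a * i) _ _ (trans (trans (ℕP.+-assoc (b * ht v i) (a * d) (a * i))
      (cong (λ z → b * ht v i + z) (trans (sym (ℕP.*-distribˡ-+ a d i)) (cong (a *_) (ℕP.m∸n+n≡m (ℕP.<⇒≤ i<j)))))) eq)
    b∣ad : b ∣ a * d
    b∣ad = ∣m+n∣m⇒∣n (subst (b ∣_) (sym eq′) (m∣m*n (ht v j))) (m∣m*n (ht v i))

  height-0 : height 0 ≡ + 0
  height-0 = cong₂ (λ x y → + x ℤ.- + y) (ℕP.*-zeroʳ b) (ℕP.*-zeroʳ a)

  height-b : height b ≡ + 0
  height-b = trans (cong (λ z → + (b * z) ℤ.- + (a * b)) (Dyck.total dyck)) (trans (cong (λ z → + z ℤ.- + (a * b)) (ℕP.*-comm b a)) (ℤP.+-inverseʳ (+ (a * b))))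

  height-≥0 : ∀ {i} → i ≤ b → + 0 ℤ.≤ height i
  height-≥0 {i} h = ℤP.i≤j⇒0≤j-i (ℤ.+≤+ (Dyck.above dyck i h))

  height->0 : ∀ {i} → 0 < i → i ≤ n → + 0 ℤ.< height i
  height->0 {i} p h = ℤP.≤∧≢⇒< (height-≥0 (ℕP.m≤n⇒m≤1+n h)) (λ e → height-≢ p (s≤s h) (trans height-0 e))

  hasPrev : ∀ {i} → 0 < i → i ≤ n → ∃ (IsPrev height i)
  hasPrev {i} p h with lastBelow height (height i) i
  ... | inj₁ (k , x , y , z) = k , isPrev x y z
  ... | inj₂ ab = ⊥-elim (ℤP.<⇒≱ (height->0 p h) (subst (height i ℤ.≤_) height-0 (ab 0 p)))

  isPrev-≤ : ∀ {i k} → i ≤ n → IsPrev height i k → k < n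
  isPrev-≤ h p = ℕP.<-≤-trans (IsPrev.before p) h

  laser-test : ∀ {i j} → i ≤ suc j → ((b * ht v (suc j)) <ᵇ (b * ht v i + a * (suc j ∸ i))) ≡ true → height (suc j) ℤ.< height i
  laser-test {i} {j} h e = height-<⁻ {suc j} {i} (subst (b * ht v (suc j) + a * i <_) l (ℕP.+-monoˡ-< (a * i) (<ᵇ-sound e)))
    where
    l : b * ht v i + a * (suc j ∸ i) + a * i ≡ b * ht v i + a * suc j
    l = trans (ℕP.+-assoc (b * ht v i) (a * (suc j ∸ i)) (a * i)) (cong (λ z → b * ht v i + z) (trans (sym (ℕP.*-distribˡ-+ a (suc j ∸ i) i)) (cong (a *_) (ℕP.m∸n+n≡m h))))

  laser-test⁻ : ∀ {i j} → i ≤ suc j → height (suc j) ℤ.< height i → ((b * ht v (suc j)) <ᵇ (b * ht v i + a * (suc j ∸ i))) ≡ true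
  laser-test⁻ {i} {j} h lt = <ᵇ-true (ℕP.+-cancelʳ-< (a * i) _ _ (subst (b * ht v (suc j) + a * i <_) (sym l) (height-< {suc j} {i} lt)))
    where
    l : b * ht v i + a * (suc j ∸ i) + a * i ≡ b * ht v i + a * suc j
    l = trans (ℕP.+-assoc (b * ht v i) (a * (suc j ∸ i)) (a * i)) (cong (λ z → b * ht v i + z) (trans (sym (ℕP.*-distribˡ-+ a (suc j ∸ i) i)) (cong (a *_) (ℕP.m∸n+n≡m h))))

  laser : ℕ → ℕ
  laser = laserEnd a b v

  -- The search stops at the first east step whose right end has dropped below the level of i. It
  -- succeeds by n, as the path ends at height 0, below all labels.
  laser-spec : ∀ {i} → 0 < i → i ≤ n → IsNext height i (laser i) × laser i ≤ n
  laser-spec {i} p h = finish (subst Ends (sym (laserEnd-firstFrom a b v i)) (firstFrom-spec test i (b ∸ i) n h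
      (subst (n <_) (sym (ℕP.m+[n∸m]≡n (ℕP.m≤n⇒m≤1+n h))) ℕP.≤-refl)
      (laser-test⁻ {i} {n} (ℕP.m≤n⇒m≤1+n h) (subst (ℤ._< height i) (sym height-b) (height->0 p h)))))
    where
    test : ℕ → Bool
    test j = (b * ht v (suc j)) <ᵇ (b * ht v i + a * (suc j ∸ i))
    Ends : ℕ → Set
    Ends e = i ≤ e × e ≤ n × test e ≡ true × (∀ l → i ≤ l → l < e → test l ≡ false)
    finish : Ends (laser i) → IsNext height i (laser i) × laser i ≤ n
    finish (x , y , z , w) = isNext x (laser-test {i} {laser i} (ℕP.m≤n⇒m≤1+n x) z) up , y
      where
      up : ∀ l → i < l → l ≤ laser i → height i ℤ.≤ height l
      up (suc l) (s≤s i≤l) l< = ℤP.≮⇒≥ (λ lt → false≢true (trans (sym (w l i≤l l<)) (laser-test⁻ {i} {l} (ℕP.m≤n⇒m≤1+n i≤l) lt)))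

  isNext⇒laser : ∀ {i e} → 0 < i → i ≤ n → IsNext height i e → laser i ≡ e
  isNext⇒laser p h x = isNext-unique (proj₁ (laser-spec p h)) x

  -- Just after the end of a laser the height is below its level, hence below the height at the end
  -- itself. So ends of lasers are canonical representatives for Q.
  laser-idem : ∀ {i} → 0 < i → i ≤ n → laser (laser i) ≡ laser i
  laser-idem {i} p h = isNext⇒laser (ℕP.<-≤-trans p x) (proj₂ (laser-spec p h))
      (isNext ℕP.≤-refl (ℤP.<-≤-trans (IsNext.below (proj₁ (laser-spec p h))) (top (ℕP.m≤n⇒m<n∨m≡n x))) (λ l a b → ⊥-elim (ℕP.<-irrefl refl (ℕP.<-≤-trans a b))))
    where
    x = IsNext.after (proj₁ (laser-spec p h))
    top : i < laser i ⊎ i ≡ laser i → height i ℤ.≤ height (laser i)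
    top (inj₁ i<) = IsNext.above (proj₁ (laser-spec p h)) (laser i) i< ℕP.≤-refl
    top (inj₂ e)  = ℤP.≤-reflexive (cong height e)

  -- Without a north step the height drops at once and the search ends at i. Thus `laser` treats
  -- labels with and without a laser alike.
  no-laser : ∀ {i} → 0 < i → i ≤ n → hasLaser a b v i ≡ false → laser i ≡ i
  no-laser {i} p h e = isNext⇒laser p h (isNext ℕP.≤-refl down (λ l a b → ⊥-elim (ℕP.<-irrefl refl (ℕP.<-≤-trans a b))))
    where
    run0 : run v i ≡ 0
    run0 = ℕP.n≤0⇒n≡0 (<ᵇ-false e)
    down : height (suc i) ℤ.< height i
    down = height-<⁻ {suc i} {i} (subst₂ _<_ (cong (λ z → b * z + a * i) (sym (trans (cong (λ z → ht v i + z) run0) (ℕP.+-identityʳ _)))) refl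
      (ℕP.+-monoʳ-< (b * ht v i) (ℕP.*-monoʳ-< a {{ℕ.>-nonZero a>0}} (ℕP.n<1+n i))))

  cutOff⇒ : ∀ {m k} → 0 < k → k ≤ n → cutOff a b v m k ≡ true → k < m × (∀ l → k < l → l ≤ m → height k ℤ.≤ height l)
  cutOff⇒ {m} {k} p h e with ∧-elim {hasLaser a b v k} e
  ... | _ , e′ with ∧-elim {k <ᵇ m} e′
  ...   | x , y = <ᵇ-sound x , λ l k<l l≤m → IsNext.above (proj₁ (laser-spec p h)) l k<l (ℕP.≤-trans l≤m (≤ᵇ-sound y))

  -- `hasLaser` follows: by `no-laser` the search would otherwise end at k, before m.
  cutOff⇐ : ∀ {m k} → 0 < k → k ≤ n → k < m → (∀ l → k < l → l ≤ m → height k ℤ.≤ height l) → cutOff a b v m k ≡ true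
  cutOff⇐ {m} {k} p h k<m ab = ∧-intro has (∧-intro (<ᵇ-true k<m) (≤ᵇ-true m≤))
    where
    m≤ : m ≤ laser k
    m≤ with m ℕ.≤? laser k
    ... | yes q = q
    ... | no q  = ⊥-elim (ℤP.<⇒≱ (IsNext.below (proj₁ (laser-spec p h))) (ab (suc (laser k)) (s≤s (IsNext.after (proj₁ (laser-spec p h)))) (ℕP.≰⇒> q)))
    has : hasLaser a b v k ≡ true
    has with hasLaser a b v k in e
    ... | true  = refl
    ... | false = ⊥-elim (ℕP.<⇒≱ k<m (subst (m ≤_) (no-laser p h e) m≤))

  relP-iff : ∀ {i j} → relP a b v i j ≡ true → ∀ k → 0 < k → k ≤ n → cutOff a b v i k ≡ cutOff a b v j k
  relP-iff {i} {j} e (suc k) _ h = toWitness (≡→T (all-elim (λ k → ⌊ BoolP._≟_ (cutOff a b v i k) (cutOff a b v j k) ⌋) suc n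
    (trans (cong (BL.all _) (sym (map-upTo suc n))) e) h))

  relP-iff⁻ : ∀ {i j} → (∀ k → 0 < k → k ≤ n → cutOff a b v i k ≡ cutOff a b v j k) → relP a b v i j ≡ true
  relP-iff⁻ {i} {j} h = trans (cong (BL.all _) (map-upTo suc n))
    (all-intro (λ k → ⌊ BoolP._≟_ (cutOff a b v i k) (cutOff a b v j k) ⌋) suc n (λ k k<n → T→≡ (fromWitness (h (suc k) (s≤s z≤n) k<n))))

  cutOff-prev : ∀ {i k} → i ≤ n → 0 < k → IsPrev height i k → cutOff a b v i k ≡ true
  cutOff-prev {i} {k} h p (isPrev x y z) = cutOff⇐ p (ℕP.<⇒≤ (ℕP.<-≤-trans x h)) x
    (λ l k<l l≤i → up l k<l (ℕP.m≤n⇒m<n∨m≡n l≤i))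
    where
    up : ∀ l → k < l → l < i ⊎ l ≡ i → height k ℤ.≤ height l
    up l k<l (inj₁ l<i)  = ℤP.≤-trans (ℤP.<⇒≤ y) (z l k<l l<i)
    up l k<l (inj₂ refl) = ℤP.<⇒≤ y

  -- A laser starting between k and i could only cut i off at equal height, which `height-≢`
  -- excludes. So the nearest smaller value names the last laser above i, and the value 0 says that
  -- there is none.
  cutOff-≤prev : ∀ {i k c} → i ≤ n → IsPrev height i k → 0 < c → c ≤ n → cutOff a b v i c ≡ true → c ≤ k
  cutOff-≤prev {i} {k} {c} h (isPrev x y z) p c≤n e with c ℕ.≤? k
  ... | yes q = q
  ... | no q = ⊥-elim (height-≢ c<i (ℕP.≤-<-trans h (ℕP.m≤n+m b c))
            (ℤP.≤-antisym (proj₂ (cutOff⇒ p c≤n e) i c<i ℕP.≤-refl) (z c (ℕP.≰⇒> q) c<i)))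
    where c<i = proj₁ (cutOff⇒ p c≤n e)

  -- A laser above i starts at or before k and stays below k's level, and from k up to j the path
  -- does not go below that level.
  cutOff-transfer : ∀ {i j k c} → i ≤ n → IsPrev height i k → IsPrev height j k → 0 < c → c ≤ n → cutOff a b v i c ≡ true → cutOff a b v j c ≡ true
  cutOff-transfer {i} {j} {k} {c} h pi (isPrev x y z) p c≤n e = cutOff⇐ p c≤n (ℕP.≤-<-trans c≤k x) up
    where
    c≤k = cutOff-≤prev h pi p c≤n e
    ab = proj₂ (cutOff⇒ p c≤n e)
    c≤hk : height c ℤ.≤ height k
    c≤hk with ℕP.m≤n⇒m<n∨m≡n c≤k
    ... | inj₁ c<k  = ab k c<k (ℕP.<⇒≤ (IsPrev.before pi))
    ... | inj₂ refl = ℤP.≤-refl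
    up : ∀ l → c < l → l ≤ j → height c ℤ.≤ height l
    up l c<l l≤j with l ℕ.≤? k
    ... | yes l≤k = ab l c<l (ℕP.≤-trans l≤k (ℕP.<⇒≤ (IsPrev.before pi)))
    ... | no l≰k with ℕP.m≤n⇒m<n∨m≡n l≤j
    ...   | inj₁ l<j  = ℤP.≤-trans c≤hk (ℤP.≤-trans (ℤP.<⇒≤ y) (z l (ℕP.≰⇒> l≰k) l<j))
    ...   | inj₂ refl = ℤP.≤-trans c≤hk (ℤP.<⇒≤ y)

  relP⇒ : ∀ {i j k k′} → i ≤ n → j ≤ n → IsPrev height i k → IsPrev height j k′ → relP a b v i j ≡ true → k ≡ k′
  relP⇒ {i} {j} {k} {k′} hi hj pi pj e = ℕP.≤-antisym (half hi hj pi pj (relP-iff {i} {j} e)) (half hj hi pj pi (λ c p h → sym (relP-iff {i} {j} e c p h)))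
    where
    half : ∀ {i j k k′} → i ≤ n → j ≤ n → IsPrev height i k → IsPrev height j k′ → (∀ c → 0 < c → c ≤ n → cutOff a b v i c ≡ cutOff a b v j c) → k ≤ k′
    half {k = zero}  hi hj pi pj e = z≤n
    half {k = suc k} hi hj pi pj e = cutOff-≤prev hj pj (s≤s z≤n) k≤n (trans (sym (e (suc k) (s≤s z≤n) k≤n)) (cutOff-prev hi (s≤s z≤n) pi))
      where k≤n = ℕP.<⇒≤ (isPrev-≤ hi pi)

  relP⇐ : ∀ {i j k} → i ≤ n → j ≤ n → IsPrev height i k → IsPrev height j k → relP a b v i j ≡ true
  relP⇐ {i} {j} hi hj pi pj = relP-iff⁻ {i} {j} (λ c p h → bool-iff (cutOff-transfer hi pi pj p h) (cutOff-transfer hj pj pi p h))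

  -- So a block of P with nearest smaller value k has minimum k + 1, and its rank, the run before
  -- the minimum, is `run v k`.
  firstChild : ∀ {i k} → IsPrev height i k → IsPrev height (suc k) k
  firstChild {i} {k} (isPrev x y z) = isPrev ℕP.≤-refl (up (ℕP.m≤n⇒m<n∨m≡n x)) (λ l k<l l<sk → ⊥-elim (ℕP.<⇒≱ k<l (ℕ.s≤s⁻¹ l<sk)))
    where
    up : suc k < i ⊎ suc k ≡ i → height k ℤ.< height (suc k)
    up (inj₁ h)    = ℤP.<-≤-trans y (z (suc k) ℕP.≤-refl h)
    up (inj₂ refl) = y

  minBlockP : ∀ {i k} → i ≤ n → IsPrev height i k → minBlock a b v (relP a b v) i ≡ suc k
  minBlockP {i} {k} h p = trans (cong (foldr _ i) (map-upTo suc n))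
    (foldr-first (relP a b v i) i suc n k (isPrev-≤ h p) (relP⇐ h (isPrev-≤ h p) p (firstChild p)) none)
    where
    none : ∀ l → l < k → relP a b v i (suc l) ≡ false
    none l l<k with relP a b v i (suc l) in e
    ... | false = refl
    ... | true with hasPrev {suc l} (s≤s z≤n) (ℕP.≤-trans l<k (ℕP.<⇒≤ (isPrev-≤ h p)))
    ...   | k′ , p′ = ⊥-elim (ℕP.<-irrefl (sym (relP⇒ h (ℕP.≤-trans l<k (ℕP.<⇒≤ (isPrev-≤ h p))) p p′ e)) (ℕP.<-≤-trans (IsPrev.before p′) l<k))

  rankP-run : ∀ {i k} → i ≤ n → IsPrev height i k → rankP a b v i ≡ run v k
  rankP-run h p = cong (λ z → run v (z ∸ 1)) (minBlockP h p)

  -- Every generator of Q preserves the end of the laser, by `laser-idem` for those that relate a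
  -- label to such an end.
  baseQ⇒ : ∀ {i j} → 0 < i → i ≤ n → 0 < j → j ≤ n → baseQ a b v i j ≡ true → laser i ≡ laser j
  baseQ⇒ {i} {j} pi hi pj hj e with ∨-elim {i ≡ᵇ j} e
  ... | inj₁ q = cong laser (≡ᵇ-sound {i} q)
  ... | inj₂ e₁ with ∨-elim {hasLaser a b v i ∧ hasLaser a b v j ∧ (laser i ≡ᵇ laser j) ∧ qRise a b v (laser i)} e₁
  ...   | inj₁ q = ≡ᵇ-sound (proj₁ (∧-elim {laser i ≡ᵇ laser j} (proj₂ (∧-elim {hasLaser a b v j} (proj₂ (∧-elim {hasLaser a b v i} q))))))
  ...   | inj₂ e₂ with ∨-elim {hasLaser a b v i ∧ (laser i ≡ᵇ j)} e₂
  ...     | inj₁ q = trans (sym (laser-idem pi hi)) (cong laser (≡ᵇ-sound {laser i} (proj₂ (∧-elim {hasLaser a b v i} q))))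
  ...     | inj₂ q = sym (trans (sym (laser-idem pj hj)) (cong laser (≡ᵇ-sound {laser j} (proj₂ (∧-elim {hasLaser a b v j} q)))))

  baseQ-refl : ∀ i → baseQ a b v i i ≡ true
  baseQ-refl i = ∨-introˡ _ (≡ᵇ-true {i} refl)

  baseQ-to : ∀ {i} → 0 < i → i ≤ n → baseQ a b v i (laser i) ≡ true
  baseQ-to {i} p h with hasLaser a b v i in e
  ... | true  = ∨-introʳ (i ≡ᵇ laser i) (∨-introʳ (hasLaser a b v (laser i) ∧ (laser i ≡ᵇ laser (laser i)) ∧ qRise a b v (laser i)) (∨-introˡ _ (≡ᵇ-true {laser i} refl)))
  ... | false = ∨-introˡ _ (≡ᵇ-true {i} (sym (no-laser p h e)))

  baseQ-from : ∀ {j} → 0 < j → j ≤ n → baseQ a b v (laser j) j ≡ true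
  baseQ-from {j} p h with hasLaser a b v j in e
  ... | true  = ∨-introʳ (laser j ≡ᵇ j) (∨-introʳ (hasLaser a b v (laser j) ∧ (laser (laser j) ≡ᵇ laser j) ∧ qRise a b v (laser (laser j))) (∨-introʳ (hasLaser a b v (laser j) ∧ (laser (laser j) ≡ᵇ j)) (≡ᵇ-true {laser j} refl)))
  ... | false = ∨-introˡ _ (≡ᵇ-true {laser j} (no-laser p h e))

  any-labels : ∀ (p : ℕ → Bool) → BL.any p (labels a b v) ≡ BL.any p (applyUpTo suc n)
  any-labels p = cong (BL.any p) (map-upTo suc n)

  reachQ⇒ : ∀ t {i j} → 0 < i → i ≤ n → 0 < j → j ≤ n → reachQ a b v t i j ≡ true → laser i ≡ laser j
  reachQ⇒ zero    pi hi pj hj e = baseQ⇒ pi hi pj hj e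
  reachQ⇒ (suc t) {i} {j} pi hi pj hj e with any-elim (λ k → reachQ a b v t i k ∧ baseQ a b v k j) suc n (trans (sym (any-labels _)) e)
  ... | k , k<n , q with ∧-elim {reachQ a b v t i (suc k)} q
  ...   | x , y = trans (reachQ⇒ t pi hi (s≤s z≤n) k<n x) (baseQ⇒ (s≤s z≤n) k<n pj hj y)

  reachQ-step : ∀ t {i k j} → 0 < k → k ≤ n → reachQ a b v t i k ≡ true → baseQ a b v k j ≡ true → reachQ a b v (suc t) i j ≡ true
  reachQ-step t {i} {suc k} {j} _ h x y = trans (any-labels _) (any-intro (λ k → reachQ a b v t i k ∧ baseQ a b v k j) suc n h (∧-intro x y))

  relQ⇒ : ∀ {i j} → 0 < i → i ≤ n → 0 < j → j ≤ n → relQ a b v i j ≡ true → laser i ≡ laser j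
  relQ⇒ = reachQ⇒ n

  relQ⇐ : ∀ {i j} → 0 < i → i ≤ n → 0 < j → j ≤ n → laser i ≡ laser j → relQ a b v i j ≡ true
  relQ⇐ {i} {j} pi hi pj hj e = pad n 0<n
    where
    0<n : 0 < n
    0<n = ℕP.<-≤-trans pi hi
    -- Two edges through the common end suffice; `pad` adds loops at j, since `relQ` asks for a path
    -- of fixed length.
    two : reachQ a b v 1 i j ≡ true
    two = reachQ-step 0 {i} {laser i} {j} (ℕP.<-≤-trans pi (IsNext.after (proj₁ (laser-spec pi hi)))) (proj₂ (laser-spec pi hi)) (baseQ-to pi hi)
      (subst (λ z → baseQ a b v z j ≡ true) (sym e) (baseQ-from pj hj))
    pad : ∀ t → 0 < t → reachQ a b v t i j ≡ true
    pad (suc zero)    _ = two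
    pad (suc (suc t)) _ = reachQ-step (suc t) {i} {j} {j} pj hj (pad (suc t) (s≤s z≤n)) (baseQ-refl j)

  -- A label beyond the end of the laser has an end even further out, so it lies in another block.
  maxBlockQ : ∀ {i} → 0 < i → i ≤ n → maxBlock a b v (relQ a b v) i ≡ laser i
  maxBlockQ {i} p h = go (laser i) refl
    where
    x = IsNext.after (proj₁ (laser-spec p h))
    w = proj₂ (laser-spec p h)
    go : ∀ e → laser i ≡ e → maxBlock a b v (relQ a b v) i ≡ laser i
    go zero    eq = ⊥-elim (ℕP.<⇒≱ p (subst (i ≤_) eq x))
    go (suc e) eq = trans (cong (foldl _ i) (map-upTo suc n)) (trans
      (foldl-last (relQ a b v i) i suc n e e<n (relQ⇐ p h (s≤s z≤n) e<n (trans (sym (laser-idem p h)) (cong laser eq))) none) (sym eq))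
      where
      e<n : suc e ≤ n
      e<n = subst (_≤ n) eq w
      none : ∀ l → e < l → l < n → relQ a b v i (suc l) ≡ false
      none l e<l l<n with relQ a b v i (suc l) in q
      ... | false = refl
      ... | true  = ⊥-elim (ℕP.<⇒≱ (s≤s e<l) (subst (suc l ≤_) (trans (sym (relQ⇒ p h (s≤s z≤n) l<n q)) eq) (IsNext.after (proj₁ (laser-spec {suc l} (s≤s z≤n) l<n)))))

  rankQ-run : ∀ {i} → 0 < i → i ≤ n → rankQ a b v i ≡ run v (laser i)
  rankQ-run p h = cong (run v) (maxBlockQ p h)

-- Bijective counting, and labels modulo n.

relation-length≤ : ∀ {A B : Set} (R : A → B → Set) xs ys → Unique xs →
  (∀ {x} → x ∈ xs → ∃ λ y → y ∈ ys × R x y) →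
  (∀ {x x′ y} → x ∈ xs → x′ ∈ xs → R x y → R x′ y → x ≡ x′) →
  length xs ≤ length ys
relation-length≤ R []       ys u total inj = z≤n
relation-length≤ R (x ∷ xs) ys (x≢ ∷ u) total inj with total (here refl)
... | y , y∈ , r with ∈-∃++ y∈
...   | ys₁ , ys₂ , refl = subst (suc (length xs) ≤_) (sym len)
        (s≤s (relation-length≤ R xs (ys₁ ++ ys₂) u total′ (λ a b → inj (there a) (there b))))
  where
  len : length (ys₁ ++ y ∷ ys₂) ≡ suc (length (ys₁ ++ ys₂))
  len = trans (LP.length-++ ys₁) (trans (ℕP.+-suc (length ys₁) (length ys₂)) (cong suc (sym (LP.length-++ ys₁))))
  total′ : ∀ {x′} → x′ ∈ xs → ∃ λ y′ → y′ ∈ ys₁ ++ ys₂ × R x′ y′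
  total′ x′∈ with total (there x′∈)
  ... | y′ , y′∈ , r′ with ∈-++⁻ ys₁ y′∈
  ...   | inj₁ h            = y′ , ∈-++⁺ˡ h , r′
  ...   | inj₂ (here refl)  = ⊥-elim (All.lookup x≢ x′∈ (inj (here refl) (there x′∈) r r′))
  ...   | inj₂ (there h)    = y′ , ∈-++⁺ʳ ys₁ h , r′

-- Phrased with a relation: partners are often only known to exist, and a defining property is
-- easier to give than a map and its inverse.
bijection-length : ∀ {A B : Set} (R : A → B → Set) xs ys → Unique xs → Unique ys →
  (∀ {x} → x ∈ xs → ∃ λ y → y ∈ ys × R x y) →
  (∀ {y} → y ∈ ys → ∃ λ x → x ∈ xs × R x y) →
  (∀ {x x′ y} → x ∈ xs → x′ ∈ xs → R x y → R x′ y → x ≡ x′) →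
  (∀ {x y y′} → y ∈ ys → y′ ∈ ys → R x y → R x y′ → y ≡ y′) →
  length xs ≡ length ys
bijection-length R xs ys u u′ t t′ i i′ = ℕP.≤-antisym (relation-length≤ R xs ys u t i)
  (relation-length≤ (λ y x → R x y) ys xs u′ t′ i′)

module _ {A : Set} (p : A → Bool) where

  ∈-filterᵇ⁺ : ∀ {x xs} → x ∈ xs → p x ≡ true → x ∈ filterᵇ p xs
  ∈-filterᵇ⁺ {x} m e = ∈-filter⁺ _ m (subst T (sym e) tt)

  ∈-filterᵇ⁻ : ∀ {x} xs → x ∈ filterᵇ p xs → x ∈ xs × p x ≡ true
  ∈-filterᵇ⁻ xs m with ∈-filter⁻ _ {xs = xs} m
  ... | x∈ , t = x∈ , T→ t
    where
    T→ : ∀ {b} → T b → b ≡ true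
    T→ {true} _ = refl

  filterᵇ-unique : ∀ {xs} → Unique xs → Unique (filterᵇ p xs)
  filterᵇ-unique = UniqueP.filter⁺ _

filterᵇ-split : ∀ {A : Set} (p q : A → Bool) xs →
  length (filterᵇ p xs) ≡ length (filterᵇ (λ x → p x ∧ q x) xs) + length (filterᵇ (λ x → p x ∧ not (q x)) xs)
filterᵇ-split p q []       = refl
filterᵇ-split p q (x ∷ xs) with p x | q x
... | true  | true  = cong suc (filterᵇ-split p q xs)
... | true  | false = trans (cong suc (filterᵇ-split p q xs)) (sym (ℕP.+-suc _ _))
... | false | true  = filterᵇ-split p q xs
... | false | false = filterᵇ-split p q xs

eqLPart-sound : ∀ {n} (p q : LPart n) → eqLPart p q ≡ true → p ≡ q
eqLPart-sound (M , r) (M′ , r′) e with ∧-elim {⌊ VecP.≡-dec (VecP.≡-dec BoolP._≟_) M M′ ⌋} e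
... | x , y = cong₂ _,_ (toWitness (≡→T x)) (toWitness (≡→T y))

eqLPart-refl : ∀ {n} (p : LPart n) → eqLPart p p ≡ true
eqLPart-refl (M , r) = ∧-intro (T→≡ (fromWitness {a? = VecP.≡-dec (VecP.≡-dec BoolP._≟_) M M} refl))
                               (T→≡ (fromWitness {a? = VecP.≡-dec ℕ._≟_ r r} refl))

eqLPair-sound : ∀ {n} (x y : LPair n) → eqLPair x y ≡ true → x ≡ y
eqLPair-sound (P , Q) (P′ , Q′) e with ∧-elim {eqLPart P P′} e
... | a , b = cong₂ _,_ (eqLPart-sound P P′ a) (eqLPart-sound Q Q′ b)

eqLPair-refl : ∀ {n} (x : LPair n) → eqLPair x x ≡ true
eqLPair-refl (P , Q) = ∧-intro (eqLPart-refl P) (eqLPart-refl Q)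

module Access (n′ : ℕ) where

  private
    n = suc n′

  -- Elements are addressed by natural numbers modulo n, the number i standing for the label i % n + 1.
  idx : ℕ → Fin n
  idx i = i mod n

  toℕ-idx : ∀ i → toℕ (idx i) ≡ i % n
  toℕ-idx i = FinP.toℕ-fromℕ< (m%n<n i n)

  idx-toℕ : ∀ t → idx (toℕ t) ≡ t
  idx-toℕ t = FinP.toℕ-injective (trans (toℕ-idx (toℕ t)) (m<n⇒m%n≡m (FinP.toℕ<n t)))

  infix 4 _≅_

  record _≅_ (i j : ℕ) : Set where
    constructor cong%
    field %≡ : i % n ≡ j % n
  open _≅_ public

  ≅-refl : ∀ {i} → i ≅ i
  ≅-refl = cong% refl

  ≅-sym : ∀ {i j} → i ≅ j → j ≅ i
  ≅-sym (cong% e) = cong% (sym e)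

  ≅-trans : ∀ {i j k} → i ≅ j → j ≅ k → i ≅ k
  ≅-trans (cong% e) (cong% f) = cong% (trans e f)

  ≡⇒≅ : ∀ {i j} → i ≡ j → i ≅ j
  ≡⇒≅ refl = ≅-refl

  +n-≅ : ∀ i → i + n ≅ i
  +n-≅ i = cong% ([m+n]%n≡m%n i n)

  +kn-≅ : ∀ i k → i + k * n ≅ i
  +kn-≅ i k = cong% ([m+kn]%n≡m%n i k n)

  %-≅ : ∀ i → i % n ≅ i
  %-≅ i = cong% (m%n%n≡m%n i n)

  ≅-+ : ∀ {i j} k → i ≅ j → i + k ≅ j + k
  ≅-+ {i} {j} k (cong% e) = cong% (trans (%-distribˡ-+ i k n) (trans (cong (λ z → (z + k % n) % n) e) (sym (%-distribˡ-+ j k n))))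

  ≅-+⁻ : ∀ {i j} k → i + k ≅ j + k → i ≅ j
  ≅-+⁻ {i} {j} k e = ≅-trans (≅-sym (back i)) (≅-trans (≅-+ (k * n ∸ k) e) (back j))
    where
    back : ∀ i → i + k + (k * n ∸ k) ≅ i
    back i = ≅-trans (≡⇒≅ (trans (ℕP.+-assoc i k _) (cong (λ z → i + z) (ℕP.m+[n∸m]≡n (ℕP.m≤m*n k n))))) (+kn-≅ i k)

  idx-cong : ∀ {i j} → i ≅ j → idx i ≡ idx j
  idx-cong {i} {j} (cong% e) = FinP.toℕ-injective (trans (toℕ-idx i) (trans e (sym (toℕ-idx j))))

  rel : LPart n → ℕ → ℕ → Bool
  rel (M , r) i j = lookup (lookup M (idx i)) (idx j)

  rnk : LPart n → ℕ → ℕ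
  rnk (M , r) i = lookup r (idx i)

  vec-ext : ∀ {A : Set} (u v : Vec A n) → (∀ i → lookup u (idx i) ≡ lookup v (idx i)) → u ≡ v
  vec-ext u v h = trans (sym (VecP.tabulate∘lookup u)) (trans (VecP.tabulate-cong (λ t → trans (cong (lookup u) (sym (idx-toℕ t)))
    (trans (h (toℕ t)) (cong (lookup v) (idx-toℕ t))))) (VecP.tabulate∘lookup v))

  lpart-ext : ∀ (p q : LPart n) → (∀ i j → rel p i j ≡ rel q i j) → (∀ i → rnk p i ≡ rnk q i) → p ≡ q
  lpart-ext (M , r) (M′ , r′) h k = cong₂ _,_ (vec-ext M M′ (λ i → vec-ext _ _ (h i))) (vec-ext r r′ k)

  rel-cong : ∀ (p : LPart n) {i i′ j j′} → i ≅ i′ → j ≅ j′ → rel p i j ≡ rel p i′ j′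
  rel-cong (M , r) e e′ = cong₂ (λ x y → lookup (lookup M x) y) (idx-cong e) (idx-cong e′)

  rnk-cong : ∀ (p : LPart n) {i i′} → i ≅ i′ → rnk p i ≡ rnk p i′
  rnk-cong (M , r) e = cong (lookup r) (idx-cong e)

  rotFin⁻¹-idx : ∀ i → rotFin⁻¹ (idx (suc i)) ≡ idx i
  rotFin⁻¹-idx i = idx-cong (≅-trans (≅-+ n′ (≅-trans (≡⇒≅ (toℕ-idx (suc i))) (%-≅ (suc i)))) (≅-trans (≡⇒≅ (sym (ℕP.+-suc i n′))) (+n-≅ i)))

  rel-rot : ∀ p i j → rel (rotLPart p) (suc i) (suc j) ≡ rel p i j
  rel-rot (M , r) i j = trans (cong (λ z → lookup z (idx (suc j))) (VecP.lookup∘tabulate (λ s → tabulate (λ t → lookup (lookup M (rotFin⁻¹ s)) (rotFin⁻¹ t))) (idx (suc i))))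
    (trans (VecP.lookup∘tabulate (λ t → lookup (lookup M (rotFin⁻¹ (idx (suc i)))) (rotFin⁻¹ t)) (idx (suc j))) (cong₂ (λ x y → lookup (lookup M x) y) (rotFin⁻¹-idx i) (rotFin⁻¹-idx j)))

  rnk-rot : ∀ p i → rnk (rotLPart p) (suc i) ≡ rnk p i
  rnk-rot (M , r) i = trans (VecP.lookup∘tabulate (λ s → lookup r (rotFin⁻¹ s)) (idx (suc i))) (cong (lookup r) (rotFin⁻¹-idx i))

  rel-mk : ∀ (R : ℕ → ℕ → Bool) r i j → rel (mkLPart n R r) i j ≡ R (suc (i % n)) (suc (j % n))
  rel-mk R r i j = trans (cong (λ z → lookup z (idx j)) (VecP.lookup∘tabulate (λ s → tabulate (λ t → R (suc (toℕ s)) (suc (toℕ t)))) (idx i)))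
    (trans (VecP.lookup∘tabulate (λ t → R (suc (toℕ (idx i))) (suc (toℕ t))) (idx j)) (cong₂ (λ x y → R (suc x) (suc y)) (toℕ-idx i) (toℕ-idx j)))

  rnk-mk : ∀ (R : ℕ → ℕ → Bool) r i → rnk (mkLPart n R r) i ≡ r (suc (i % n))
  rnk-mk R r i = trans (VecP.lookup∘tabulate (λ s → r (suc (toℕ s))) (idx i)) (cong (λ x → r (suc x)) (toℕ-idx i))

  -- x is y turned by d, entry by entry. Addresses count modulo n, which avoids cases at the
  -- wrap-around.
  record SameData (x y : LPair n) (d : ℕ) : Set where
    field
      relP≡ : ∀ i j → rel (proj₁ x) (i + d) (j + d) ≡ rel (proj₁ y) i j
      rnkP≡ : ∀ i → rnk (proj₁ x) (i + d) ≡ rnk (proj₁ y) i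
      relQ≡ : ∀ i j → rel (proj₂ x) (i + d) (j + d) ≡ rel (proj₂ y) i j
      rnkQ≡ : ∀ i → rnk (proj₂ x) (i + d) ≡ rnk (proj₂ y) i
  open SameData public

  rotPow-data : ∀ d x → SameData (rotPow d x) x d
  rotPow-data zero    x = record
    { relP≡ = λ i j → cong₂ (rel (proj₁ x)) (ℕP.+-identityʳ i) (ℕP.+-identityʳ j)
    ; rnkP≡ = λ i → cong (rnk (proj₁ x)) (ℕP.+-identityʳ i)
    ; relQ≡ = λ i j → cong₂ (rel (proj₂ x)) (ℕP.+-identityʳ i) (ℕP.+-identityʳ j)
    ; rnkQ≡ = λ i → cong (rnk (proj₂ x)) (ℕP.+-identityʳ i) }
  rotPow-data (suc d) x = record
    { relP≡ = λ i j → trans (cong₂ (rel (proj₁ (rotPow (suc d) x))) (ℕP.+-suc i d) (ℕP.+-suc j d)) (trans (rel-rot (proj₁ y) _ _) (relP≡ IH i j))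
    ; rnkP≡ = λ i → trans (cong (rnk (proj₁ (rotPow (suc d) x))) (ℕP.+-suc i d)) (trans (rnk-rot (proj₁ y) _) (rnkP≡ IH i))
    ; relQ≡ = λ i j → trans (cong₂ (rel (proj₂ (rotPow (suc d) x))) (ℕP.+-suc i d) (ℕP.+-suc j d)) (trans (rel-rot (proj₂ y) _ _) (relQ≡ IH i j))
    ; rnkQ≡ = λ i → trans (cong (rnk (proj₂ (rotPow (suc d) x))) (ℕP.+-suc i d)) (trans (rnk-rot (proj₂ y) _) (rnkQ≡ IH i)) }
    where
    y = rotPow d x
    IH = rotPow-data d x

  -- Subtraction of d modulo n, with d n - d as the natural number representing - d.
  unshift : ℕ → ℕ → ℕ
  unshift d i = i + d * n ∸ d

  unshift-+ : ∀ d i → unshift d i + d ≅ i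
  unshift-+ d i = ≅-trans (≡⇒≅ (ℕP.m∸n+n≡m (ℕP.≤-trans (ℕP.m≤m*n d n) (ℕP.m≤n+m (d * n) i)))) (+kn-≅ i d)

  sameData-unique : ∀ {x y z d} → SameData x z d → SameData y z d → x ≡ y
  sameData-unique {x} {y} {z} {d} s t = cong₂ _,_
    (lpart-ext (proj₁ x) (proj₁ y)
      (λ i j → trans (rel-cong (proj₁ x) (≅-sym (unshift-+ d i)) (≅-sym (unshift-+ d j))) (trans (relP≡ s (unshift d i) (unshift d j)) (trans (sym (relP≡ t (unshift d i) (unshift d j))) (rel-cong (proj₁ y) (unshift-+ d i) (unshift-+ d j)))))
      (λ i → trans (rnk-cong (proj₁ x) (≅-sym (unshift-+ d i))) (trans (rnkP≡ s (unshift d i)) (trans (sym (rnkP≡ t (unshift d i))) (rnk-cong (proj₁ y) (unshift-+ d i))))))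
    (lpart-ext (proj₂ x) (proj₂ y)
      (λ i j → trans (rel-cong (proj₂ x) (≅-sym (unshift-+ d i)) (≅-sym (unshift-+ d j))) (trans (relQ≡ s (unshift d i) (unshift d j)) (trans (sym (relQ≡ t (unshift d i) (unshift d j))) (rel-cong (proj₂ y) (unshift-+ d i) (unshift-+ d j)))))
      (λ i → trans (rnk-cong (proj₂ x) (≅-sym (unshift-+ d i))) (trans (rnkQ≡ s (unshift d i)) (trans (sym (rnkQ≡ t (unshift d i))) (rnk-cong (proj₂ y) (unshift-+ d i))))))

all-tabulate⁻ : ∀ {A : Set} (p : A → Bool) {n} (f : Fin n → A) → BL.all p (List.tabulate f) ≡ true → ∀ i → p (f i) ≡ true
all-tabulate⁻ p {suc n} f e Fin.zero    = proj₁ (∧-elim e)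
all-tabulate⁻ p {suc n} f e (Fin.suc i) = all-tabulate⁻ p (λ i → f (Fin.suc i)) (proj₂ (∧-elim {p (f Fin.zero)} e)) i

all-tabulate⁺ : ∀ {A : Set} (p : A → Bool) {n} (f : Fin n → A) → (∀ i → p (f i) ≡ true) → BL.all p (List.tabulate f) ≡ true
all-tabulate⁺ p {zero}  f h = refl
all-tabulate⁺ p {suc n} f h = ∧-intro (h Fin.zero) (all-tabulate⁺ p (λ i → f (Fin.suc i)) (λ i → h (Fin.suc i)))

¬true : ∀ {x} → ¬ (x ≡ true) → x ≡ false
¬true {true}  h = ⊥-elim (h refl)
¬true {false} h = refl

not-true : ∀ {x} → not x ≡ true → x ≡ false
not-true {false} _ = refl

least : ∀ (P : ℕ → Set) → (∀ i → Dec (P i)) → ∀ {m} → P m → ∃ λ i → i ≤ m × P i × (∀ j → j < i → ¬ P j)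
least P P? {m} pm with P? 0
... | yes p0 = 0 , z≤n , p0 , λ j ()
least P P? {zero}  pm | no n0 = ⊥-elim (n0 pm)
least P P? {suc m} pm | no n0 with least (λ i → P (suc i)) (λ i → P? (suc i)) pm
... | i , i≤m , pi , mn = suc i , s≤s i≤m , pi , λ { zero _ → n0 ; (suc j) (s≤s h) → mn j h }

module Min (n′ : ℕ) where

  open Access n′

  private
    n = suc n′

  isBlockMin⇒ : ∀ (p : LPart n) t → isBlockMin p t ≡ true → ∀ s → s < toℕ t → rel p (toℕ t) s ≡ false
  isBlockMin⇒ p@(M , r) t e s s<t with ∨-elim {not (toℕ (idx s) <ᵇ toℕ t)} (all-tabulate⁻ (λ s → not (toℕ s <ᵇ toℕ t) ∨ not (lookup (lookup M t) s)) (λ i → i) e (idx s))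
  ... | inj₁ q = ⊥-elim (false≢true (trans (sym (not-true q)) (<ᵇ-true (subst (_< toℕ t) (sym (trans (toℕ-idx s) (m<n⇒m%n≡m (ℕP.<-trans s<t (FinP.toℕ<n t))))) s<t))))
  ... | inj₂ q = trans (cong (λ z → lookup (lookup M z) (idx s)) (idx-toℕ t)) (not-true q)

  isBlockMin⇐ : ∀ (p : LPart n) t → (∀ s → s < toℕ t → rel p (toℕ t) s ≡ false) → isBlockMin p t ≡ true
  isBlockMin⇐ p@(M , r) t h = all-tabulate⁺ (λ s → not (toℕ s <ᵇ toℕ t) ∨ not (lookup (lookup M t) s)) (λ i → i) go
    where
    go : ∀ s → not (toℕ s <ᵇ toℕ t) ∨ not (lookup (lookup M t) s) ≡ true
    go s with toℕ s <ᵇ toℕ t in e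
    ... | false = refl
    ... | true  = cong not (trans (sym (cong₂ (λ x y → lookup (lookup M x) y) (idx-toℕ t) (idx-toℕ s))) (h (toℕ s) (<ᵇ-sound e)))

-- The number of blocks is the number of nonzero runs.

module PathBlocks (a n′ : ℕ) (v : Vec ℕ (suc (suc n′))) (a>0 : 0 < a) (cop : Coprime a (suc (suc n′))) (dyck : Dyck a (suc (suc n′)) v) where

  private
    n = suc n′
    b = suc n

  open Access n′
  open Min n′
  open Path a n v a>0 cop dyck

  P Q : LPart n
  P = proj₁ (piD a b v)
  Q = proj₂ (piD a b v)

  rel-P : ∀ i j → i < n → j < n → rel P i j ≡ relP a b v (suc i) (suc j)
  rel-P i j hi hj = trans (rel-mk (relP a b v) (rankP a b v) i j) (cong₂ (λ x y → relP a b v (suc x) (suc y)) (m<n⇒m%n≡m hi) (m<n⇒m%n≡m hj))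

  rel-Q : ∀ i j → i < n → j < n → rel Q i j ≡ relQ a b v (suc i) (suc j)
  rel-Q i j hi hj = trans (rel-mk (relQ a b v) (rankQ a b v) i j) (cong₂ (λ x y → relQ a b v (suc x) (suc y)) (m<n⇒m%n≡m hi) (m<n⇒m%n≡m hj))

  rnk-P : ∀ i → i < n → rnk P i ≡ rankP a b v (suc i)
  rnk-P i hi = trans (rnk-mk (relP a b v) (rankP a b v) i) (cong (λ x → rankP a b v (suc x)) (m<n⇒m%n≡m hi))

  rnk-Q : ∀ i → i < n → rnk Q i ≡ run v (laser (suc i))
  rnk-Q i hi = trans (trans (rnk-mk (relQ a b v) (rankQ a b v) i) (cong (λ x → rankQ a b v (suc x)) (m<n⇒m%n≡m hi))) (rankQ-run (s≤s z≤n) hi)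

  pos pRise : ℕ → Bool
  pos k = 0 <ᵇ run v k
  pRise k = ⌊ height k ℤ.<? height (suc k) ⌋

  pRise⇒ : ∀ {k} → pRise k ≡ true → height k ℤ.< height (suc k)
  pRise⇒ e = toWitness (≡→T e)

  pRise⇐ : ∀ {k} → height k ℤ.< height (suc k) → pRise k ≡ true
  pRise⇐ {k} h = T→≡ (fromWitness {a? = height k ℤ.<? height (suc k)} h)

  pRise-prev : ∀ {k} → height k ℤ.< height (suc k) → IsPrev height (suc k) k
  pRise-prev h = isPrev ℕP.≤-refl h (λ l k<l l<sk → ⊥-elim (ℕP.<⇒≱ k<l (ℕ.s≤s⁻¹ l<sk)))

  zero-descends : ∀ {k} → run v k ≡ 0 → height (suc k) ℤ.< height k
  zero-descends {k} run0 = height-<⁻ {suc k} {k} (subst₂ _<_ (cong (λ z → b * z + a * k) (sym (trans (cong (λ z → ht v k + z) run0) (ℕP.+-identityʳ _)))) refl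
      (ℕP.+-monoʳ-< (b * ht v k) (ℕP.*-monoʳ-< a {{ℕ.>-nonZero a>0}} (ℕP.n<1+n k))))

  pRise-pos : ∀ {k} → height k ℤ.< height (suc k) → pos k ≡ true
  pRise-pos {k} h = go (run v k) refl
    where
    go : ∀ m → run v k ≡ m → (0 <ᵇ m) ≡ true
    go zero    e = ⊥-elim (ℤP.<-asym h (zero-descends e))
    go (suc m) e = refl

  pRise-<n : ∀ {k} → k ≤ n → height k ℤ.< height (suc k) → k < n
  pRise-<n {k} h lt = ℕP.≤∧≢⇒< h (λ { refl → ℤP.<⇒≱ (subst (height n ℤ.<_) height-b lt) (height-≥0 (ℕP.n≤1+n n)) })

  Descent : ℕ → Set
  Descent k = height (suc k) ℤ.< height k

  -- Consecutive heights differ by `height-≢`, so each run is a P-rise or a Q-rise.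
  pRise-or-descent : ∀ {k} → ¬ (height k ℤ.< height (suc k)) → Descent k
  pRise-or-descent {k} h = ℤP.≤∧≢⇒< (ℤP.≮⇒≥ h) (λ e → height-≢ ℕP.≤-refl (subst (suc k <_) (sym (ℕP.+-suc k n)) (s≤s (ℕP.m<m+n k (s≤s z≤n)))) (sym e))

  descent-laser : ∀ {k} → 0 < k → k ≤ n → Descent k → laser k ≡ k
  descent-laser p h d = isNext⇒laser p h (isNext ℕP.≤-refl d (λ l x y → ⊥-elim (ℕP.<⇒≱ x y)))

  laser-descent : ∀ {i} → 0 < i → i ≤ n → Descent (laser i)
  laser-descent {i} p h = subst (λ z → height (suc z) ℤ.< height (laser i)) (laser-idem p h)
    (IsNext.below (proj₁ (laser-spec (ℕP.<-≤-trans p (IsNext.after (proj₁ (laser-spec p h)))) (proj₂ (laser-spec p h)))))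

  private
    Ppred Qpred : Fin n → Bool
    Ppred t = isBlockMin P t
    Qpred t = isBlockMin Q t ∧ (0 <ᵇ lookup (proj₂ Q) t)

  posRise posFall : ℕ → Bool
  posRise k = pos k ∧ pRise k
  posFall k = pos k ∧ not (pRise k)

  -- A block corresponds to the P-rise before its minimum. Element t is label t + 1, so that run has
  -- index t.
  P-blocks : numBlocks P ≡ length (filterᵇ posRise (upTo b))
  P-blocks = bijection-length (λ t k → toℕ t ≡ k) (filterᵇ Ppred (allFin n)) (filterᵇ posRise (upTo b))
    (filterᵇ-unique Ppred (UniqueP.allFin⁺ n)) (filterᵇ-unique posRise (UniqueP.upTo⁺ b))
    to from (λ _ _ e e′ → FinP.toℕ-injective (trans e (sym e′))) (λ _ _ e e′ → trans (sym e) e′)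
    where
    rises : ∀ t → isBlockMin P t ≡ true → height (toℕ t) ℤ.< height (suc (toℕ t))
    rises t e with hasPrev {suc (toℕ t)} (s≤s z≤n) (FinP.toℕ<n t)
    ... | k , p with ℕP.m≤n⇒m<n∨m≡n (ℕ.s≤s⁻¹ (IsPrev.before p))
    ...   | inj₂ refl = IsPrev.below p
    ...   | inj₁ k<t  = ⊥-elim (false≢true (trans (sym (isBlockMin⇒ P t e k k<t)) (trans (rel-P (toℕ t) k (FinP.toℕ<n t) k<n) (relP⇐ (FinP.toℕ<n t) k<n p (firstChild p)))))
      where k<n = ℕP.<-trans k<t (FinP.toℕ<n t)
    to : ∀ {t} → t ∈ filterᵇ Ppred (allFin n) → ∃ λ k → k ∈ filterᵇ posRise (upTo b) × toℕ t ≡ k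
    to {t} m = toℕ t , ∈-filterᵇ⁺ posRise (∈-upTo⁺ (ℕP.m<n⇒m<1+n (FinP.toℕ<n t))) (∧-intro (pRise-pos r) (pRise⇐ r)) , refl
      where r = rises t (proj₂ (∈-filterᵇ⁻ Ppred (allFin n) m))
    from : ∀ {k} → k ∈ filterᵇ posRise (upTo b) → ∃ λ t → t ∈ filterᵇ Ppred (allFin n) × toℕ t ≡ k
    from {k} m = fromℕ< k<n , ∈-filterᵇ⁺ Ppred (∈-allFin _) (isBlockMin⇐ P (fromℕ< k<n) (subst (λ z → ∀ s → s < z → rel P z s ≡ false) (sym (FinP.toℕ-fromℕ< k<n)) mn)) , FinP.toℕ-fromℕ< k<n
      where
      info = ∈-filterᵇ⁻ posRise (upTo b) m
      r : height k ℤ.< height (suc k)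
      r = pRise⇒ (proj₂ (∧-elim {pos k} (proj₂ info)))
      k<n : k < n
      k<n = pRise-<n (ℕ.s≤s⁻¹ (∈-upTo⁻ (proj₁ info))) r
      mn : ∀ s → s < k → rel P k s ≡ false
      mn s h = ¬true (λ e → ℕP.<-irrefl (sym (relP⇒ k<n s<n (pRise-prev r) p′ (trans (sym (rel-P k s k<n s<n)) e))) (ℕP.≤-<-trans (ℕ.s≤s⁻¹ (IsPrev.before p′)) h))
        where
        s<n = ℕP.<-trans h k<n
        p′ = proj₂ (hasPrev {suc s} (s≤s z≤n) s<n)

  rnk-lookup : ∀ t → lookup (proj₂ Q) t ≡ run v (laser (suc (toℕ t)))
  rnk-lookup t = trans (cong (lookup (proj₂ Q)) (sym (idx-toℕ t))) (rnk-Q (toℕ t) (FinP.toℕ<n t))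

  -- A block corresponds to the common end of its lasers, where the path has a Q-rise whose length
  -- is the rank. The run 0 is a P-rise and so never occurs here.
  Q-blocks : numPosBlocks Q ≡ length (filterᵇ posFall (upTo b))
  Q-blocks = bijection-length R (filterᵇ Qpred (allFin n)) (filterᵇ posFall (upTo b))
    (filterᵇ-unique Qpred (UniqueP.allFin⁺ n)) (filterᵇ-unique posFall (UniqueP.upTo⁺ b))
    to from inj (λ _ _ e e′ → trans (sym e) e′)
    where
    R : Fin n → ℕ → Set
    R t k = laser (suc (toℕ t)) ≡ k
    mins : ∀ {t} → t ∈ filterᵇ Qpred (allFin n) → isBlockMin Q t ≡ true × (0 <ᵇ lookup (proj₂ Q) t) ≡ true
    mins {t} m = ∧-elim {isBlockMin Q t} (proj₂ (∈-filterᵇ⁻ Qpred (allFin n) m))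
    to : ∀ {t} → t ∈ filterᵇ Qpred (allFin n) → ∃ λ k → k ∈ filterᵇ posFall (upTo b) × R t k
    to {t} m = laser (suc (toℕ t)) , ∈-filterᵇ⁺ posFall (∈-upTo⁺ (s≤s (proj₂ (laser-spec (s≤s z≤n) (FinP.toℕ<n t)))))
      (∧-intro (trans (cong (0 <ᵇ_) (sym (rnk-lookup t))) (proj₂ (mins m))) nr) , refl
      where
      nr : not (pRise (laser (suc (toℕ t)))) ≡ true
      nr = cong not (¬true (λ e → ℤP.<-asym (pRise⇒ {laser (suc (toℕ t))} e) (laser-descent (s≤s z≤n) (FinP.toℕ<n t))))
    from : ∀ {k} → k ∈ filterᵇ posFall (upTo b) → ∃ λ t → t ∈ filterᵇ Qpred (allFin n) × R t k
    from {zero} m = ⊥-elim (false≢true (trans (sym (not-true {pRise 0} (proj₂ (∧-elim {pos 0} (proj₂ (∈-filterᵇ⁻ posFall (upTo b) m))))))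
      (pRise⇐ {0} (subst (ℤ._< height 1) (sym height-0) (height->0 (s≤s z≤n) (s≤s z≤n))))))
    from {suc k} m = t₀ , ∈-filterᵇ⁺ Qpred (∈-allFin _) (∧-intro (isBlockMin⇐ Q t₀ mn) (trans (cong (0 <ᵇ_) (trans (rnk-lookup t₀) (cong (run v) Rt))) (proj₁ (∧-elim (proj₂ info))))) , Rt
      where
      info = ∈-filterᵇ⁻ posFall (upTo b) m
      k≤n : suc k ≤ n
      k≤n = ℕ.s≤s⁻¹ (∈-upTo⁻ (proj₁ info))
      desc : Descent (suc k)
      desc = pRise-or-descent (λ r → false≢true (trans (sym (not-true {pRise (suc k)} (proj₂ (∧-elim {pos (suc k)} (proj₂ info))))) (pRise⇐ r)))
      search = least (λ i → laser (suc i) ≡ suc k) (λ i → laser (suc i) ℕ.≟ suc k) (descent-laser (s≤s z≤n) k≤n desc)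
      i₀ = proj₁ search
      i<n : i₀ < n
      i<n = ℕP.≤-trans (s≤s (proj₁ (proj₂ search))) k≤n
      t₀ = fromℕ< i<n
      Rt : laser (suc (toℕ t₀)) ≡ suc k
      Rt = trans (cong (λ z → laser (suc z)) (FinP.toℕ-fromℕ< i<n)) (proj₁ (proj₂ (proj₂ search)))
      mn : ∀ s → s < toℕ t₀ → rel Q (toℕ t₀) s ≡ false
      mn s h = ¬true (λ e → proj₂ (proj₂ (proj₂ search)) s (subst (s <_) (FinP.toℕ-fromℕ< i<n) h)
          (trans (sym (relQ⇒ (s≤s z≤n) (FinP.toℕ<n t₀) (s≤s z≤n) s<n (trans (sym (rel-Q (toℕ t₀) s (FinP.toℕ<n t₀) s<n)) e))) Rt))
        where s<n = ℕP.<-trans h (FinP.toℕ<n t₀)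
    earlier : ∀ {t t′ k} → isBlockMin Q t′ ≡ true → R t k → R t′ k → ¬ (toℕ t < toℕ t′)
    earlier {t} {t′} e r r′ h = false≢true (trans (sym (isBlockMin⇒ Q t′ e (toℕ t) h))
      (trans (rel-Q (toℕ t′) (toℕ t) (FinP.toℕ<n t′) (FinP.toℕ<n t)) (relQ⇐ (s≤s z≤n) (FinP.toℕ<n t′) (s≤s z≤n) (FinP.toℕ<n t) (trans r′ (sym r)))))
    inj : ∀ {t t′ k} → t ∈ filterᵇ Qpred (allFin n) → t′ ∈ filterᵇ Qpred (allFin n) → R t k → R t′ k → t ≡ t′
    inj {t} {t′} m m′ r r′ = go (ℕP.<-cmp (toℕ t) (toℕ t′))
      where
      go : Tri (toℕ t < toℕ t′) (toℕ t ≡ toℕ t′) (toℕ t′ < toℕ t) → t ≡ t′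
      go (tri< l _ _) = ⊥-elim (earlier {t} {t′} (proj₁ (mins m′)) r r′ l)
      go (tri≈ _ e _) = FinP.toℕ-injective e
      go (tri> _ _ l) = ⊥-elim (earlier {t′} {t} (proj₁ (mins m)) r′ r l)

  totalBlocks-π : totalBlocks (piD a b v) ≡ length (filterᵇ pos (upTo b))
  totalBlocks-π = trans (cong₂ _+_ P-blocks Q-blocks) (sym (filterᵇ-split pos pRise (upTo b)))

-- Periodic words and the labeled pairs they represent.

shift : ∀ {A : Set} → ℕ → (ℕ → A) → ℕ → A
shift t w i = w (i + t)

module Cover (n′ : ℕ) (inc : ℕ → ℤ) where

  private
    n = suc n′

  open Access n′

  s : (ℕ → ℕ) → ℕ → ℤ
  s w zero    = + 0
  s w (suc i) = s w i ℤ.+ inc (w i)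

  s-cong : ∀ {w w′} → (∀ i → w i ≡ w′ i) → ∀ i → s w i ≡ s w′ i
  s-cong e zero    = refl
  s-cong e (suc i) = cong₂ (λ x y → x ℤ.+ inc y) (s-cong e i) (e i)

  s-shift : ∀ w t i → s w (i + t) ≡ s (shift t w) i ℤ.+ s w t
  s-shift w t zero    = sym (ℤP.+-identityˡ _)
  s-shift w t (suc i) = trans (cong (ℤ._+ inc (w (i + t))) (s-shift w t i)) (l (s (shift t w) i) (s w t) (inc (w (i + t))))
    where
    l : ∀ x y z → x ℤ.+ y ℤ.+ z ≡ x ℤ.+ z ℤ.+ y
    l = ℤS.solve-∀

  s-shift-< : ∀ w t {i j} → s (shift t w) i ℤ.< s (shift t w) j → s w (i + t) ℤ.< s w (j + t)
  s-shift-< w t {i} {j} h = subst₂ ℤ._<_ (sym (s-shift w t i)) (sym (s-shift w t j)) (ℤP.+-monoˡ-< (s w t) h)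

  s-shift-≤ : ∀ w t {i j} → s (shift t w) i ℤ.≤ s (shift t w) j → s w (i + t) ℤ.≤ s w (j + t)
  s-shift-≤ w t {i} {j} h = subst₂ ℤ._≤_ (sym (s-shift w t i)) (sym (s-shift w t j)) (ℤP.+-monoˡ-≤ (s w t) h)

  -- The parent of label i on the left, and the end of its laser, in the periodic picture;
  -- nothing when it lies infinitely far away.
  data PC (w : ℕ → ℕ) (i : ℕ) : Maybe ℕ → Set where
    pcJ : ∀ {k} → i ≤ k + n → IsPrev (s w) i k → PC w i (just k)
    pcN : (∀ l → l < i → i ≤ l + n → s w i ℤ.≤ s w l) → PC w i nothing

  data QC (w : ℕ → ℕ) (i : ℕ) : Maybe ℕ → Set where
    qcJ : ∀ {e} → e < i + n → IsNext (s w) i e → QC w i (just e)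
    qcN : (∀ l → i < l → l ≤ i + n → s w i ℤ.≤ s w l) → QC w i nothing

  _⊞_ : Maybe ℕ → ℕ → Maybe ℕ
  just k  ⊞ t = just (k + t)
  nothing ⊞ t = nothing

  private
    split : ∀ {l t} → t ≤ l → l ∸ t + t ≡ l
    split = ℕP.m∸n+n≡m

    swap : ∀ k t m → k + m + t ≡ k + t + m
    swap k t m = trans (ℕP.+-assoc k m t) (trans (cong (λ z → k + z) (ℕP.+-comm m t)) (sym (ℕP.+-assoc k t m)))

  -- With n <= i a whole turn to the left of i lies inside the word, so nothing is cut off at its
  -- beginning. For this reason labels are always read at positions i >= n.
  PC-shift : ∀ w t {i c} → n ≤ i → PC (shift t w) i c → PC w (i + t) (c ⊞ t)
  PC-shift w t {i} n≤i (pcJ {k} h (isPrev x y z)) = pcJ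
    (subst (i + t ≤_) (swap k t n) (ℕP.+-monoˡ-≤ t h))
    (isPrev (ℕP.+-monoˡ-< t x) (s-shift-< w t {k} {i} y) up)
    where
    up : ∀ l → k + t < l → l < i + t → s w (i + t) ℤ.≤ s w l
    up l h₁ h₂ = subst (λ z → s w (i + t) ℤ.≤ s w z) (split t≤l) (s-shift-≤ w t {i} {l ∸ t}
      (z (l ∸ t) (ℕP.+-cancelʳ-< t k (l ∸ t) (subst (k + t <_) (sym (split t≤l)) h₁))
                 (ℕP.+-cancelʳ-< t (l ∸ t) i (subst (_< i + t) (sym (split t≤l)) h₂))))
      where t≤l = ℕP.≤-trans (ℕP.m≤n+m t k) (ℕP.<⇒≤ h₁)
  PC-shift w t {i} n≤i (pcN z) = pcN up
    where
    up : ∀ l → l < i + t → i + t ≤ l + n → s w (i + t) ℤ.≤ s w l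
    up l h₁ h₂ = subst (λ z → s w (i + t) ℤ.≤ s w z) (split t≤l) (s-shift-≤ w t {i} {l ∸ t}
      (z (l ∸ t) (ℕP.+-cancelʳ-< t (l ∸ t) i (subst (_< i + t) (sym (split t≤l)) h₁))
        (ℕP.+-cancelʳ-≤ t i (l ∸ t + n) (subst (i + t ≤_) (trans (cong (_+ n) (sym (split t≤l))) (sym (swap (l ∸ t) t n))) h₂))))
      where
      t≤l : t ≤ l
      t≤l = ℕP.+-cancelʳ-≤ n t l (ℕP.≤-trans (ℕP.≤-trans (ℕP.≤-reflexive (ℕP.+-comm t n)) (ℕP.+-monoˡ-≤ t n≤i)) h₂)

  QC-shift : ∀ w t {i c} → QC (shift t w) i c → QC w (i + t) (c ⊞ t)
  QC-shift w t {i} (qcJ {e} h (isNext x y z)) = qcJ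
    (subst (e + t <_) (swap i t n) (ℕP.+-monoˡ-< t h))
    (isNext (ℕP.+-monoˡ-≤ t x) (s-shift-< w t {suc e} {i} y) up)
    where
    up : ∀ l → i + t < l → l ≤ e + t → s w (i + t) ℤ.≤ s w l
    up l h₁ h₂ = subst (λ z → s w (i + t) ℤ.≤ s w z) (split t≤l) (s-shift-≤ w t {i} {l ∸ t}
      (z (l ∸ t) (ℕP.+-cancelʳ-< t i (l ∸ t) (subst (i + t <_) (sym (split t≤l)) h₁))
                 (ℕP.+-cancelʳ-≤ t (l ∸ t) e (subst (_≤ e + t) (sym (split t≤l)) h₂))))
      where t≤l = ℕP.≤-trans (ℕP.m≤n+m t i) (ℕP.<⇒≤ h₁)
  QC-shift w t {i} (qcN z) = qcN up
    where
    up : ∀ l → i + t < l → l ≤ i + t + n → s w (i + t) ℤ.≤ s w l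
    up l h₁ h₂ = subst (λ z → s w (i + t) ℤ.≤ s w z) (split t≤l) (s-shift-≤ w t {i} {l ∸ t}
      (z (l ∸ t) (ℕP.+-cancelʳ-< t i (l ∸ t) (subst (i + t <_) (sym (split t≤l)) h₁))
                 (ℕP.+-cancelʳ-≤ t (l ∸ t) (i + n) (subst₂ _≤_ (sym (split t≤l)) (sym (swap i t n)) h₂))))
      where t≤l = ℕP.≤-trans (ℕP.m≤n+m t i) (ℕP.<⇒≤ h₁)

  private
    IsPrev-cong : ∀ {u u′ : ℕ → ℤ} {i k} → (∀ l → u l ≡ u′ l) → IsPrev u i k → IsPrev u′ i k
    IsPrev-cong {i = i} {k} e (isPrev x y z) = isPrev x (subst₂ ℤ._<_ (e k) (e i) y) (λ l a b → subst₂ ℤ._≤_ (e i) (e l) (z l a b))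

    IsNext-cong : ∀ {u u′ : ℕ → ℤ} {i k} → (∀ l → u l ≡ u′ l) → IsNext u i k → IsNext u′ i k
    IsNext-cong {i = i} {k} e (isNext x y z) = isNext x (subst₂ ℤ._<_ (e (suc k)) (e i) y) (λ l a b → subst₂ ℤ._≤_ (e i) (e l) (z l a b))

  PC-cong : ∀ {w w′ i c} → (∀ l → w l ≡ w′ l) → PC w i c → PC w′ i c
  PC-cong e (pcJ h p) = pcJ h (IsPrev-cong (s-cong e) p)
  PC-cong {i = i} e (pcN z) = pcN (λ l a b → subst₂ ℤ._≤_ (s-cong e i) (s-cong e l) (z l a b))

  QC-cong : ∀ {w w′ i c} → (∀ l → w l ≡ w′ l) → QC w i c → QC w′ i c
  QC-cong e (qcJ h p) = qcJ h (IsNext-cong (s-cong e) p)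
  QC-cong {i = i} e (qcN z) = qcN (λ l a b → subst₂ ℤ._≤_ (s-cong e i) (s-cong e l) (z l a b))

  PC-total : ∀ w i → ∃ (PC w i)
  PC-total w i with lastBelow (s w) (s w i) i
  ... | inj₂ ab = nothing , pcN (λ l l<i _ → ab l l<i)
  ... | inj₁ (k , x , y , z) with i ℕ.≤? k + n
  ...   | yes h = just k , pcJ h (isPrev x y z)
  ...   | no h  = nothing , pcN (λ l l<i i≤ → z l (ℕP.+-cancelʳ-< n k l (ℕP.<-≤-trans (ℕP.≰⇒> h) i≤)) l<i)

  QC-total : ∀ w i → ∃ (QC w i)
  QC-total w i with firstBelow (s w) (s w i) i n
  ... | inj₂ ab = nothing , qcN ab
  ... | inj₁ (e , x , y , z , u) = just e , qcJ y (isNext x z u)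

  PC-unique : ∀ {w i c c′} → PC w i c → PC w i c′ → c ≡ c′
  PC-unique (pcJ h p) (pcJ h′ p′) = cong just (isPrev-unique p p′)
  PC-unique (pcJ h p) (pcN z)     = ⊥-elim (ℤP.<⇒≱ (IsPrev.below p) (z _ (IsPrev.before p) h))
  PC-unique (pcN z)   (pcJ h p)   = ⊥-elim (ℤP.<⇒≱ (IsPrev.below p) (z _ (IsPrev.before p) h))
  PC-unique (pcN z)   (pcN z′)    = refl

  QC-unique : ∀ {w i c c′} → QC w i c → QC w i c′ → c ≡ c′
  QC-unique (qcJ h p) (qcJ h′ p′) = cong just (isNext-unique p p′)
  QC-unique (qcJ h p) (qcN z)     = ⊥-elim (ℤP.<⇒≱ (IsNext.below p) (z _ (s≤s (IsNext.after p)) h))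
  QC-unique (qcN z)   (qcJ h p)   = ⊥-elim (ℤP.<⇒≱ (IsNext.below p) (z _ (s≤s (IsNext.after p)) h))
  QC-unique (qcN z)   (qcN z′)    = refl

  -- Targets are compared modulo a full turn: labels share a block when their targets agree, and
  -- `nothing` stands for the root block.
  infix 4 _≈ᶜ_
  data _≈ᶜ_ : Maybe ℕ → Maybe ℕ → Set where
    both : ∀ {k k′} → k ≅ k′ → just k ≈ᶜ just k′
    none : nothing ≈ᶜ nothing

  ≈ᶜ-refl : ∀ {c} → c ≈ᶜ c
  ≈ᶜ-refl {just _}  = both ≅-refl
  ≈ᶜ-refl {nothing} = none

  ≈ᶜ-sym : ∀ {c d} → c ≈ᶜ d → d ≈ᶜ c
  ≈ᶜ-sym (both e) = both (≅-sym e)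
  ≈ᶜ-sym none     = none

  ≈ᶜ-trans : ∀ {c d e} → c ≈ᶜ d → d ≈ᶜ e → c ≈ᶜ e
  ≈ᶜ-trans (both e) (both f) = both (≅-trans e f)
  ≈ᶜ-trans none     none     = none

  ≡⇒≈ᶜ : ∀ {c d} → c ≡ d → c ≈ᶜ d
  ≡⇒≈ᶜ refl = ≈ᶜ-refl

  ⊞-≈ : ∀ {c d} t → c ≈ᶜ d → c ⊞ t ≈ᶜ d ⊞ t
  ⊞-≈ t (both e) = both (≅-+ t e)
  ⊞-≈ t none     = none

  ⊞-≈⁻ : ∀ {c d} t → c ⊞ t ≈ᶜ d ⊞ t → c ≈ᶜ d
  ⊞-≈⁻ {just _}  {just _}  t (both e) = both (≅-+⁻ t e)
  ⊞-≈⁻ {nothing} {nothing} t none     = none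

  ⊞-period : ∀ c k → c ⊞ (k * n) ≈ᶜ c
  ⊞-period (just x) k = both (+kn-≅ x k)
  ⊞-period nothing  k = none

  -- The rank of a block is the letter at its target; the root has no target, and its rank is the
  -- number set aside.
  val : ℕ → (ℕ → ℕ) → Maybe ℕ → ℕ
  val h w (just k) = w k
  val h w nothing  = h

  Periodic : (ℕ → ℕ) → Set
  Periodic w = ∀ i → w (i + n) ≡ w i

  periodic-* : ∀ {w} → Periodic w → ∀ k i → w (i + k * n) ≡ w i
  periodic-* {w} per zero    i = cong w (ℕP.+-identityʳ i)
  periodic-* {w} per (suc k) i = trans (cong w (trans (cong (λ z → i + z) (ℕP.+-comm n (k * n))) (sym (ℕP.+-assoc i (k * n) n))))
    (trans (per (i + k * n)) (periodic-* per k i))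

  periodic-≅ : ∀ {w} → Periodic w → ∀ {i j} → i ≅ j → w i ≡ w j
  periodic-≅ {w} per {i} {j} (cong% e) = trans (at i) (trans (cong w e) (sym (at j)))
    where
    at : ∀ i → w i ≡ w (i % n)
    at i = trans (cong w (m≡m%n+[m/n]*n i n)) (periodic-* per (i / n) (i % n))

  val-≈ : ∀ {h w} → Periodic w → ∀ {c d} → c ≈ᶜ d → val h w c ≡ val h w d
  val-≈ per (both e) = periodic-≅ per e
  val-≈ per none     = refl

  PC-period : ∀ {w} → Periodic w → ∀ k {i c} → n ≤ i → PC w i c → PC w (i + k * n) (c ⊞ (k * n))
  PC-period {w} per k h p = PC-shift w (k * n) h (PC-cong (λ l → sym (periodic-* per k l)) p)

  QC-period : ∀ {w} → Periodic w → ∀ k {i c} → QC w i c → QC w (i + k * n) (c ⊞ (k * n))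
  QC-period {w} per k p = QC-shift w (k * n) (QC-cong (λ l → sym (periodic-* per k l)) p)

  -- Label i of the word (h ; w) is element i + z of x.
  record Rep (z : ℕ) (x : LPair n) (h : ℕ) (w : ℕ → ℕ) : Set where
    field
      rankP⇐ : ∀ {i c} → n ≤ i → PC w i c → rnk (proj₁ x) (i + z) ≡ val h w c
      relP⇔  : ∀ {i j c d} → n ≤ i → n ≤ j → PC w i c → PC w j d →
               (rel (proj₁ x) (i + z) (j + z) ≡ true → c ≈ᶜ d) × (c ≈ᶜ d → rel (proj₁ x) (i + z) (j + z) ≡ true)
      rankQ⇐ : ∀ {i c} → n ≤ i → QC w i c → rnk (proj₂ x) (i + z) ≡ val h w c
      relQ⇔  : ∀ {i j c d} → n ≤ i → n ≤ j → QC w i c → QC w j d →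
               (rel (proj₂ x) (i + z) (j + z) ≡ true → c ≈ᶜ d) × (c ≈ᶜ d → rel (proj₂ x) (i + z) (j + z) ≡ true)
  open Rep public

  Rep-ext : ∀ {z x h w w′} → (∀ l → w l ≡ w′ l) → Rep z x h w → Rep z x h w′
  Rep-ext {z} {x} {h} {w} {w′} e r = record
    { rankP⇐ = λ {i} {c} n≤i p → trans (rankP⇐ r n≤i (PC-cong (λ l → sym (e l)) p)) (valeq c)
    ; relP⇔  = λ n≤i n≤j p q → relP⇔ r n≤i n≤j (PC-cong (λ l → sym (e l)) p) (PC-cong (λ l → sym (e l)) q)
    ; rankQ⇐ = λ {i} {c} n≤i p → trans (rankQ⇐ r n≤i (QC-cong (λ l → sym (e l)) p)) (valeq c)
    ; relQ⇔  = λ n≤i n≤j p q → relQ⇔ r n≤i n≤j (QC-cong (λ l → sym (e l)) p) (QC-cong (λ l → sym (e l)) q) }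
    where
    valeq : ∀ c → val h w c ≡ val h w′ c
    valeq (just k) = e k
    valeq nothing  = refl

  Rep-≅ : ∀ {z z′ x h w} → z ≅ z′ → Rep z x h w → Rep z′ x h w
  Rep-≅ {z} {z′} {x} {h} {w} e r = record
    { rankP⇐ = λ {i} a p → trans (rnk-cong (proj₁ x) (m i)) (rankP⇐ r a p)
    ; relP⇔  = λ {i} {j} a b p q → subst (λ o → (o ≡ true → _) × (_ → o ≡ true)) (rel-cong (proj₁ x) (≅-sym (m i)) (≅-sym (m j))) (relP⇔ r a b p q)
    ; rankQ⇐ = λ {i} a p → trans (rnk-cong (proj₂ x) (m i)) (rankQ⇐ r a p)
    ; relQ⇔  = λ {i} {j} a b p q → subst (λ o → (o ≡ true → _) × (_ → o ≡ true)) (rel-cong (proj₂ x) (≅-sym (m i)) (≅-sym (m j))) (relQ⇔ r a b p q) }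
    where
    m : ∀ i → i + z′ ≅ i + z
    m i = ≅-trans (≡⇒≅ (ℕP.+-comm i z′)) (≅-trans (≅-+ i (≅-sym e)) (≡⇒≅ (ℕP.+-comm z i)))

  Rep-shift : ∀ {z x h w} t → Rep z x h w → Rep (t + z) x h (shift t w)
  Rep-shift {z} {x} {h} {w} t r = record
    { rankP⇐ = λ {i} {c} a p → trans (cong (rnk (proj₁ x)) (sym (ℕP.+-assoc i t z))) (trans (rankP⇐ r (up a) (PC-shift w t a p)) (valeq c))
    ; relP⇔  = λ {i} {j} {c} {d} a b p q → subst (λ o → (o ≡ true → _) × (_ → o ≡ true)) (cong₂ (rel (proj₁ x)) (ℕP.+-assoc i t z) (ℕP.+-assoc j t z))
        ((λ o → ⊞-≈⁻ t (proj₁ (relP⇔ r (up a) (up b) (PC-shift w t a p) (PC-shift w t b q)) o)) , (λ o → proj₂ (relP⇔ r (up a) (up b) (PC-shift w t a p) (PC-shift w t b q)) (⊞-≈ t o)))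
    ; rankQ⇐ = λ {i} {c} a p → trans (cong (rnk (proj₂ x)) (sym (ℕP.+-assoc i t z))) (trans (rankQ⇐ r (up a) (QC-shift w t p)) (valeq c))
    ; relQ⇔  = λ {i} {j} {c} {d} a b p q → subst (λ o → (o ≡ true → _) × (_ → o ≡ true)) (cong₂ (rel (proj₂ x)) (ℕP.+-assoc i t z) (ℕP.+-assoc j t z))
        ((λ o → ⊞-≈⁻ t (proj₁ (relQ⇔ r (up a) (up b) (QC-shift w t p) (QC-shift w t q)) o)) , (λ o → proj₂ (relQ⇔ r (up a) (up b) (QC-shift w t p) (QC-shift w t q)) (⊞-≈ t o))) }
    where
    up : ∀ {i} → n ≤ i → n ≤ i + t
    up h = ℕP.≤-trans h (ℕP.m≤m+n _ t)
    valeq : ∀ c → val h w (c ⊞ t) ≡ val h (shift t w) c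
    valeq (just k) = refl
    valeq nothing  = refl

  Rep-rot : ∀ {z x y d h w} → SameData x y d → Rep z y h w → Rep (z + d) x h w
  Rep-rot {z} {x} {y} {d} e r = record
    { rankP⇐ = λ {i} a p → trans (trans (cong (rnk (proj₁ x)) (sym (ℕP.+-assoc i z d))) (rnkP≡ e (i + z))) (rankP⇐ r a p)
    ; relP⇔  = λ {i} {j} a b p q → subst (λ o → (o ≡ true → _) × (_ → o ≡ true)) (sym (trans (cong₂ (rel (proj₁ x)) (sym (ℕP.+-assoc i z d)) (sym (ℕP.+-assoc j z d))) (relP≡ e (i + z) (j + z)))) (relP⇔ r a b p q)
    ; rankQ⇐ = λ {i} a p → trans (trans (cong (rnk (proj₂ x)) (sym (ℕP.+-assoc i z d))) (rnkQ≡ e (i + z))) (rankQ⇐ r a p)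
    ; relQ⇔  = λ {i} {j} a b p q → subst (λ o → (o ≡ true → _) × (_ → o ≡ true)) (sym (trans (cong₂ (rel (proj₂ x)) (sym (ℕP.+-assoc i z d)) (sym (ℕP.+-assoc j z d))) (relQ≡ e (i + z) (j + z)))) (relQ⇔ r a b p q) }

  -- Targets exist for all labels and depend only on the word, so all entries and ranks are
  -- determined.
  Rep-unique : ∀ {z x y h w} → Rep z x h w → Rep z y h w → x ≡ y
  Rep-unique {z} {x} {y} {h} {w} r r′ = cong₂ _,_
    (lpart-ext (proj₁ x) (proj₁ y)
      (λ i j → trans (rel-cong (proj₁ x) (≅-sym (L≅ i)) (≅-sym (L≅ j)))
        (trans (bool-iff (λ e → proj₂ (relP⇔ r′ (big i) (big j) (pc i) (pc j)) (proj₁ (relP⇔ r (big i) (big j) (pc i) (pc j)) e))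
                         (λ e → proj₂ (relP⇔ r (big i) (big j) (pc i) (pc j)) (proj₁ (relP⇔ r′ (big i) (big j) (pc i) (pc j)) e)))
          (rel-cong (proj₁ y) (L≅ i) (L≅ j))))
      (λ i → trans (rnk-cong (proj₁ x) (≅-sym (L≅ i))) (trans (rankP⇐ r (big i) (pc i))
        (trans (sym (rankP⇐ r′ (big i) (pc i))) (rnk-cong (proj₁ y) (L≅ i))))))
    (lpart-ext (proj₂ x) (proj₂ y)
      (λ i j → trans (rel-cong (proj₂ x) (≅-sym (L≅ i)) (≅-sym (L≅ j)))
        (trans (bool-iff (λ e → proj₂ (relQ⇔ r′ (big i) (big j) (qc i) (qc j)) (proj₁ (relQ⇔ r (big i) (big j) (qc i) (qc j)) e))
                         (λ e → proj₂ (relQ⇔ r (big i) (big j) (qc i) (qc j)) (proj₁ (relQ⇔ r′ (big i) (big j) (qc i) (qc j)) e)))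
          (rel-cong (proj₂ y) (L≅ i) (L≅ j))))
      (λ i → trans (rnk-cong (proj₂ x) (≅-sym (L≅ i))) (trans (rankQ⇐ r (big i) (qc i))
        (trans (sym (rankQ⇐ r′ (big i) (qc i))) (rnk-cong (proj₂ y) (L≅ i))))))
    where
    L : ℕ → ℕ
    L i = unshift z i + n
    big : ∀ i → n ≤ L i
    big i = ℕP.m≤n+m n (unshift z i)
    L≅ : ∀ i → L i + z ≅ i
    L≅ i = ≅-trans (≡⇒≅ (swap (unshift z i) z n)) (≅-trans (+n-≅ (unshift z i + z)) (unshift-+ z i))
    pc : ∀ i → PC w (L i) (proj₁ (PC-total w (L i)))
    pc i = proj₂ (PC-total w (L i))
    qc : ∀ i → QC w (L i) (proj₁ (QC-total w (L i)))
    qc i = proj₂ (QC-total w (L i))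

  -- One period is enough; it is checked in its second copy, where a turn to the left is available.
  Rep-intro : ∀ {x h w} → Periodic w →
    (∀ {i c} → i < n → PC w (i + n) c → rnk (proj₁ x) i ≡ val h w c) →
    (∀ {i j c d} → i < n → j < n → PC w (i + n) c → PC w (j + n) d →
      (rel (proj₁ x) i j ≡ true → c ≈ᶜ d) × (c ≈ᶜ d → rel (proj₁ x) i j ≡ true)) →
    (∀ {i c} → i < n → QC w (i + n) c → rnk (proj₂ x) i ≡ val h w c) →
    (∀ {i j c d} → i < n → j < n → QC w (i + n) c → QC w (j + n) d →
      (rel (proj₂ x) i j ≡ true → c ≈ᶜ d) × (c ≈ᶜ d → rel (proj₂ x) i j ≡ true)) →
    Rep 0 x h w
  Rep-intro {x} {h} {w} per rP lP rQ lQ = record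
    { rankP⇐ = λ {i} a p → trans (rnk-cong (proj₁ x) (low i)) (trans (rP (m%n<n i n) (pc i)) (val-≈ per (≈ᶜ-sym (pc≈ a p))))
    ; relP⇔  = λ {i} {j} a b p q → subst (λ o → (o ≡ true → _) × (_ → o ≡ true)) (rel-cong (proj₁ x) (≅-sym (low i)) (≅-sym (low j)))
        ((λ o → ≈ᶜ-trans (pc≈ a p) (≈ᶜ-trans (proj₁ (lP (m%n<n i n) (m%n<n j n) (pc i) (pc j)) o) (≈ᶜ-sym (pc≈ b q)))) ,
         (λ o → proj₂ (lP (m%n<n i n) (m%n<n j n) (pc i) (pc j)) (≈ᶜ-trans (≈ᶜ-sym (pc≈ a p)) (≈ᶜ-trans o (pc≈ b q)))))
    ; rankQ⇐ = λ {i} a p → trans (rnk-cong (proj₂ x) (low i)) (trans (rQ (m%n<n i n) (qc i)) (val-≈ per (≈ᶜ-sym (qc≈ p))))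
    ; relQ⇔  = λ {i} {j} a b p q → subst (λ o → (o ≡ true → _) × (_ → o ≡ true)) (rel-cong (proj₂ x) (≅-sym (low i)) (≅-sym (low j)))
        ((λ o → ≈ᶜ-trans (qc≈ p) (≈ᶜ-trans (proj₁ (lQ (m%n<n i n) (m%n<n j n) (qc i) (qc j)) o) (≈ᶜ-sym (qc≈ q)))) ,
         (λ o → proj₂ (lQ (m%n<n i n) (m%n<n j n) (qc i) (qc j)) (≈ᶜ-trans (≈ᶜ-sym (qc≈ p)) (≈ᶜ-trans o (qc≈ q))))) }
    where
    low : ∀ i → i + 0 ≅ i % n
    low i = ≅-trans (≡⇒≅ (ℕP.+-identityʳ i)) (≅-sym (%-≅ i))
    pc : ∀ i → PC w (i % n + n) (proj₁ (PC-total w (i % n + n)))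
    pc i = proj₂ (PC-total w (i % n + n))
    qc : ∀ i → QC w (i % n + n) (proj₁ (QC-total w (i % n + n)))
    qc i = proj₂ (QC-total w (i % n + n))
    same : ∀ i → i + 1 * n ≡ (i % n + n) + (i / n) * n
    same i = trans (cong₂ _+_ (m≡m%n+[m/n]*n i n) (ℕP.*-identityˡ n)) (swap (i % n) n ((i / n) * n))
    pc≈ : ∀ {i c} → n ≤ i → PC w i c → c ≈ᶜ proj₁ (PC-total w (i % n + n))
    pc≈ {i} {c} a p = ≈ᶜ-trans (≈ᶜ-sym (⊞-period c 1)) (≈ᶜ-trans (≡⇒≈ᶜ (PC-unique (PC-period per 1 a p)
      (subst (λ z → PC w z (proj₁ (PC-total w (i % n + n)) ⊞ ((i / n) * n))) (sym (same i)) (PC-period per (i / n) (ℕP.m≤n+m n (i % n)) (pc i)))))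
      (⊞-period _ (i / n)))
    qc≈ : ∀ {i c} → QC w i c → c ≈ᶜ proj₁ (QC-total w (i % n + n))
    qc≈ {i} {c} p = ≈ᶜ-trans (≈ᶜ-sym (⊞-period c 1)) (≈ᶜ-trans (≡⇒≈ᶜ (QC-unique (QC-period per 1 p)
      (subst (λ z → QC w z (proj₁ (QC-total w (i % n + n)) ⊞ ((i / n) * n))) (sym (same i)) (QC-period per (i / n) (qc i)))))
      (⊞-period _ (i / n)))

-- The two words of a Dyck path.

charge : ℕ → ℕ → ℕ → ℤ
charge a b r = + b ℤ.* + r ℤ.- + a

module PathWords (a n′ : ℕ) (v : Vec ℕ (suc (suc n′))) (a>0 : 0 < a) (cop : Coprime a (suc (suc n′))) (dyck : Dyck a (suc (suc n′)) v) where

  private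
    n = suc n′
    b = suc n
    H = Path.height a n v a>0 cop dyck

  open Access n′
  open Cover n′ (charge a b)
  open Path a n v a>0 cop dyck
  open PathBlocks a n′ v a>0 cop dyck using (rel-P; rel-Q; rnk-P; rnk-Q)

  height-suc : ∀ k → height (suc k) ≡ height k ℤ.+ charge a b (run v k)
  height-suc k = trans (cong₂ (λ x y → x ℤ.- y) (trans (ℤP.pos-* b (ht v k + run v k)) refl) (trans (cong +_ (ℕP.*-suc a k)) refl))
    (trans (l (+ b) (+ ht v k) (+ run v k) (+ a) (+ (a * k))) (cong (λ z → z ℤ.- + (a * k) ℤ.+ charge a b (run v k)) (sym (ℤP.pos-* b (ht v k)))))
    where
    l : ∀ b h r a x → b ℤ.* (h ℤ.+ r) ℤ.- (a ℤ.+ x) ≡ b ℤ.* h ℤ.- x ℤ.+ (b ℤ.* r ℤ.- a)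
    l = ℤS.solve-∀

  -- With v_n set aside as the root rank, v_0 becomes the successor of v_(n-1) on the circle and
  -- fills the last place.
  wrap : ℕ → ℕ
  wrap k with k ℕ.≟ n′
  ... | yes _ = run v 0
  ... | no _  = run v (suc k)

  -- The path rooted at the P-block of label 1, resp. at the Q-block of label n.
  wP wQ : ℕ → ℕ
  wP i = run v (suc (i % n))
  wQ i = wrap (i % n)

  wP-periodic : Periodic wP
  wP-periodic i = cong (λ z → run v (suc z)) ([m+n]%n≡m%n i n)

  wQ-periodic : Periodic wQ
  wQ-periodic i = cong wrap ([m+n]%n≡m%n i n)

  wP-< : ∀ {i} → i < n → wP i ≡ run v (suc i)
  wP-< h = cong (λ z → run v (suc z)) (m<n⇒m%n≡m h)

  wQ-last : wQ n′ ≡ run v 0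
  wQ-last = trans (cong wrap {x = n′ % n} {y = n′} (m<n⇒m%n≡m {m = n′} ℕP.≤-refl)) wrap-n′
    where
    wrap-n′ : wrap n′ ≡ run v 0
    wrap-n′ with n′ ℕ.≟ n′
    ... | yes _ = refl
    ... | no ne = ⊥-elim (ne refl)

  wQ-< : ∀ {i} → i < n′ → wQ i ≡ run v (suc i)
  wQ-< {i} h = trans (cong wrap {x = i % n} {y = i} (m<n⇒m%n≡m (ℕP.m<n⇒m<1+n h))) wrap-<
    where
    wrap-< : wrap i ≡ run v (suc i)
    wrap-< with i ℕ.≟ n′
    ... | yes refl = ⊥-elim (ℕP.<-irrefl refl h)
    ... | no _     = refl

  s-period : ∀ {w} → Periodic w → ∀ i → s w (i + n) ≡ s w i ℤ.+ s w n
  s-period {w} per i = trans (s-shift w n i) (cong (ℤ._+ s w n) (s-cong per i))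

  height-1 : height 1 ≡ charge a b (run v 0)
  height-1 = trans (height-suc 0) (trans (cong (ℤ._+ charge a b (run v 0)) height-0) (ℤP.+-identityˡ _))

  sP : ∀ i → i ≤ n → s wP i ℤ.+ height 1 ≡ height (suc i)
  sP zero    h = ℤP.+-identityˡ _
  sP (suc i) h = trans (l (s wP i) (charge a b (wP i)) (height 1))
    (trans (cong₂ ℤ._+_ (sP i (ℕP.<⇒≤ h)) (cong (charge a b) (wP-< h))) (sym (height-suc (suc i))))
    where
    l : ∀ x y z → x ℤ.+ y ℤ.+ z ≡ x ℤ.+ z ℤ.+ y
    l = ℤS.solve-∀

  sQ : ∀ i → i < n → s wQ i ℤ.+ height 1 ≡ height (suc i)
  sQ zero    h = ℤP.+-identityˡ _
  sQ (suc i) (s≤s h) = trans (l (s wQ i) (charge a b (wQ i)) (height 1))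
    (trans (cong₂ ℤ._+_ (sQ i (ℕP.m<n⇒m<1+n h)) (cong (charge a b) (wQ-< h))) (sym (height-suc (suc i))))
    where
    l : ∀ x y z → x ℤ.+ y ℤ.+ z ≡ x ℤ.+ z ℤ.+ y
    l = ℤS.solve-∀

  -- So the Q-rooted word rises by `height n` per period, while by `sP-n` the P-rooted one falls by
  -- `height 1`. The sign of this drift is what leaves the root without a finite target, to the
  -- right or to the left.
  sQ-n : s wQ n ≡ height n
  sQ-n = trans (cong (λ z → s wQ n′ ℤ.+ charge a b z) wQ-last) (trans (cong (λ z → s wQ n′ ℤ.+ z) (sym height-1)) (sQ n′ ℕP.≤-refl))

  sP-n : s wP n ℤ.+ height 1 ≡ + 0
  sP-n = trans (sP n ℕP.≤-refl) height-b

  sP₂ : ∀ i → i ≤ n → s wP (i + n) ℤ.+ (height 1 ℤ.+ height 1) ≡ height (suc i)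
  sP₂ i h = trans (cong (ℤ._+ (height 1 ℤ.+ height 1)) (s-period wP-periodic i))
    (trans (l (s wP i) (s wP n) (height 1)) (trans (cong₂ ℤ._+_ (sP i h) sP-n) (ℤP.+-identityʳ _)))
    where
    l : ∀ x y z → x ℤ.+ y ℤ.+ (z ℤ.+ z) ≡ (x ℤ.+ z) ℤ.+ (y ℤ.+ z)
    l = ℤS.solve-∀

  sQ₂ : ∀ i → i < n → s wQ (i + n) ℤ.+ height 1 ≡ height (suc i) ℤ.+ height n
  sQ₂ i h = trans (cong (ℤ._+ height 1) (s-period wQ-periodic i))
    (trans (l (s wQ i) (s wQ n) (height 1)) (cong₂ ℤ._+_ (sQ i h) sQ-n))
    where
    l : ∀ x y z → x ℤ.+ y ℤ.+ z ≡ (x ℤ.+ z) ℤ.+ y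
    l = ℤS.solve-∀

  private
    cancel-< : ∀ {x y u v} c → x ℤ.+ c ≡ u → y ℤ.+ c ≡ v → u ℤ.< v → x ℤ.< y
    cancel-< {x} {y} c e f h = subst₂ ℤ._<_ (l x c) (l y c) (ℤP.+-monoˡ-< (ℤ.- c) (subst₂ ℤ._<_ (sym e) (sym f) h))
      where
      l : ∀ x c → x ℤ.+ c ℤ.+ (ℤ.- c) ≡ x
      l = ℤS.solve-∀
    cancel-≤ : ∀ {x y u v} c → x ℤ.+ c ≡ u → y ℤ.+ c ≡ v → u ℤ.≤ v → x ℤ.≤ y
    cancel-≤ {x} {y} c e f h = subst₂ ℤ._≤_ (l x c) (l y c) (ℤP.+-monoˡ-≤ (ℤ.- c) (subst₂ ℤ._≤_ (sym e) (sym f) h))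
      where
      l : ∀ x c → x ℤ.+ c ℤ.+ (ℤ.- c) ≡ x
      l = ℤS.solve-∀

    split : ∀ {l} → n ≤ l → ∃ λ l′ → l ≡ l′ + n
    split {l} h = l ∸ n , sym (ℕP.m∸n+n≡m h)

  -- From positions on the path to targets in the word: path position p + 1 is element p, read in
  -- the second copy. The origin is the root for P; in the Q-rooted word it sits at n′, just before
  -- the second copy, where v_0 was put.
  codeP codeQ : ℕ → Maybe ℕ
  codeP zero    = nothing
  codeP (suc p) = just (p + n)
  codeQ zero    = just n′
  codeQ (suc p) = just (p + n)

  pcP : ∀ {i p} → i < n → IsPrev height (suc i) p → PC wP (i + n) (codeP p)
  pcP {i} {suc p} i<n (isPrev x y z) = pcJ (ℕP.≤-trans (ℕP.+-monoˡ-≤ n (ℕP.<⇒≤ i<n)) (ℕP.+-monoˡ-≤ n (ℕP.m≤n+m n p)))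
    (isPrev (ℕP.+-monoˡ-< n p<i) (cancel-< (height 1 ℤ.+ height 1) (sP₂ p (ℕP.<⇒≤ (ℕP.<-trans p<i i<n))) (sP₂ i (ℕP.<⇒≤ i<n)) y) up)
    where
    p<i : p < i
    p<i = ℕ.s≤s⁻¹ x
    up : ∀ l → p + n < l → l < i + n → s wP (i + n) ℤ.≤ s wP l
    up l h₁ h₂ with split (ℕP.≤-trans (ℕP.m≤n+m n p) (ℕP.<⇒≤ h₁))
    ... | l′ , refl = cancel-≤ (height 1 ℤ.+ height 1) (sP₂ i (ℕP.<⇒≤ i<n)) (sP₂ l′ (ℕP.<⇒≤ (ℕP.<-trans l<i i<n)))
        (z (suc l′) (s≤s (ℕP.+-cancelʳ-< n p l′ h₁)) (s≤s l<i))
      where l<i = ℕP.+-cancelʳ-< n l′ i h₂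
  pcP {i} {zero} i<n (isPrev x y z) = pcN up
    where
    ≤first : height (suc i) ℤ.≤ height 1
    ≤first = go i z
      where
      go : ∀ i → (∀ l → 0 < l → l < suc i → height (suc i) ℤ.≤ height l) → height (suc i) ℤ.≤ height 1
      go zero    z = ℤP.≤-refl
      go (suc i) z = z 1 (s≤s z≤n) (s≤s (s≤s z≤n))
    up : ∀ l → l < i + n → i + n ≤ l + n → s wP (i + n) ℤ.≤ s wP l
    up l h₁ h₂ with n ℕ.≤? l
    -- One turn earlier all sums are larger by `height 1`, which is at least the height of label i +
    -- 1.
    ... | no l<n = cancel-≤ (height 1 ℤ.+ height 1) (sP₂ i (ℕP.<⇒≤ i<n)) (trans (sym (ℤP.+-assoc (s wP l) (height 1) (height 1))) (cong (ℤ._+ height 1) (sP l (ℕP.<⇒≤ (ℕP.≰⇒> l<n)))))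
        (ℤP.≤-trans ≤first (subst (ℤ._≤ height (suc l) ℤ.+ height 1) (ℤP.+-identityˡ _) (ℤP.+-monoˡ-≤ (height 1) (height-≥0 (ℕP.m≤n⇒m≤1+n (ℕP.≰⇒> l<n))))))
    ... | yes n≤l with split n≤l
    ...   | l′ , refl = cancel-≤ (height 1 ℤ.+ height 1) (sP₂ i (ℕP.<⇒≤ i<n)) (sP₂ l′ (ℕP.<⇒≤ (ℕP.<-trans l<i i<n))) (z (suc l′) (s≤s z≤n) (s≤s l<i))
      where l<i = ℕP.+-cancelʳ-< n l′ i h₁

  qcP : ∀ {i e} → i < n → e < n → IsNext height (suc i) (suc e) → QC wP (i + n) (just (e + n))
  qcP {i} {e} i<n e<n (isNext x y z) = qcJ (ℕP.+-monoˡ-< n (ℕP.<-≤-trans e<n (ℕP.m≤n+m n i)))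
    (isNext (ℕP.+-monoˡ-≤ n (ℕ.s≤s⁻¹ x)) (cancel-< (height 1 ℤ.+ height 1) (sP₂ (suc e) e<n) (sP₂ i (ℕP.<⇒≤ i<n)) y) up)
    where
    up : ∀ l → i + n < l → l ≤ e + n → s wP (i + n) ℤ.≤ s wP l
    up l h₁ h₂ with split (ℕP.≤-trans (ℕP.m≤n+m n i) (ℕP.<⇒≤ h₁))
    ... | l′ , refl = cancel-≤ (height 1 ℤ.+ height 1) (sP₂ i (ℕP.<⇒≤ i<n)) (sP₂ l′ (ℕP.<⇒≤ (ℕP.≤-<-trans l≤e e<n)))
        (z (suc l′) (s≤s (ℕP.+-cancelʳ-< n i l′ h₁)) (s≤s l≤e))
      where l≤e = ℕP.+-cancelʳ-≤ n l′ e h₂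

  pcQ : ∀ {i p} → i < n → IsPrev height (suc i) p → PC wQ (i + n) (codeQ p)
  pcQ {i} {suc p} i<n (isPrev x y z) = pcJ (ℕP.≤-trans (ℕP.+-monoˡ-≤ n (ℕP.<⇒≤ i<n)) (ℕP.+-monoˡ-≤ n (ℕP.m≤n+m n p)))
    (isPrev (ℕP.+-monoˡ-< n p<i) (cancel-< (height 1) (sQ₂ p (ℕP.<-trans p<i i<n)) (sQ₂ i i<n) (ℤP.+-monoˡ-< (height n) y)) up)
    where
    p<i : p < i
    p<i = ℕ.s≤s⁻¹ x
    up : ∀ l → p + n < l → l < i + n → s wQ (i + n) ℤ.≤ s wQ l
    up l h₁ h₂ with split (ℕP.≤-trans (ℕP.m≤n+m n p) (ℕP.<⇒≤ h₁))
    ... | l′ , refl = cancel-≤ (height 1) (sQ₂ i i<n) (sQ₂ l′ (ℕP.<-trans l<i i<n))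
        (ℤP.+-monoˡ-≤ (height n) (z (suc l′) (s≤s (ℕP.+-cancelʳ-< n p l′ h₁)) (s≤s l<i)))
      where l<i = ℕP.+-cancelʳ-< n l′ i h₂
  pcQ {i} {zero} i<n (isPrev x y z) = pcJ (ℕP.+-monoˡ-≤ n (ℕ.s≤s⁻¹ i<n))
    (isPrev (ℕP.m≤n+m n i) (cancel-< (height 1) (sQ n′ ℕP.≤-refl) (sQ₂ i i<n)
      (subst (ℤ._< height (suc i) ℤ.+ height n) (ℤP.+-identityˡ _) (ℤP.+-monoˡ-< (height n) (height->0 (s≤s z≤n) i<n)))) up)
    where
    up : ∀ l → n′ < l → l < i + n → s wQ (i + n) ℤ.≤ s wQ l
    up l h₁ h₂ with split h₁
    ... | l′ , refl = cancel-≤ (height 1) (sQ₂ i i<n) (sQ₂ l′ (ℕP.<-trans l<i i<n)) (ℤP.+-monoˡ-≤ (height n) (z (suc l′) (s≤s z≤n) (s≤s l<i)))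
      where l<i = ℕP.+-cancelʳ-< n l′ i h₂

  qcQ : ∀ {i e} → i < n → e < n′ → IsNext height (suc i) (suc e) → QC wQ (i + n) (just (e + n))
  qcQ {i} {e} i<n e<n′ (isNext x y z) = qcJ (ℕP.+-monoˡ-< n (ℕP.<-≤-trans e<n (ℕP.m≤n+m n i)))
    (isNext (ℕP.+-monoˡ-≤ n (ℕ.s≤s⁻¹ x)) (cancel-< (height 1) (sQ₂ (suc e) (s≤s e<n′)) (sQ₂ i i<n) (ℤP.+-monoˡ-< (height n) y)) up)
    where
    e<n = ℕP.m<n⇒m<1+n e<n′
    up : ∀ l → i + n < l → l ≤ e + n → s wQ (i + n) ℤ.≤ s wQ l
    up l h₁ h₂ with split (ℕP.≤-trans (ℕP.m≤n+m n i) (ℕP.<⇒≤ h₁))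
    ... | l′ , refl = cancel-≤ (height 1) (sQ₂ i i<n) (sQ₂ l′ (ℕP.≤-<-trans l≤e e<n))
        (ℤP.+-monoˡ-≤ (height n) (z (suc l′) (s≤s (ℕP.+-cancelʳ-< n i l′ h₁)) (s≤s l≤e)))
      where l≤e = ℕP.+-cancelʳ-≤ n l′ e h₂

  qcQ-root : ∀ {i} → i < n → IsNext height (suc i) n → QC wQ (i + n) nothing
  qcQ-root {i} i<n (isNext x y z) = qcN up
    where
    ≤last : height (suc i) ℤ.≤ height n
    ≤last with ℕP.m≤n⇒m<n∨m≡n i<n
    ... | inj₁ h = z n h ℕP.≤-refl
    ... | inj₂ e = ℤP.≤-reflexive (cong height e)
    up : ∀ l → i + n < l → l ≤ i + n + n → s wQ (i + n) ℤ.≤ s wQ l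
    up l h₁ h₂ with split (ℕP.≤-trans (ℕP.m≤n+m n i) (ℕP.<⇒≤ h₁))
    ... | l′ , refl with n ℕ.≤? l′
    ...   | no l<n = cancel-≤ (height 1) (sQ₂ i i<n) (sQ₂ l′ (ℕP.≰⇒> l<n)) (ℤP.+-monoˡ-≤ (height n) (z (suc l′) (s≤s (ℕP.+-cancelʳ-< n i l′ h₁)) (ℕP.≰⇒> l<n)))
    -- One turn later all sums are larger by `height n`, which is at least the height of label i +
    -- 1.
    ...   | yes n≤l′ with split n≤l′
    ...     | l″ , refl = cancel-≤ (height 1) (sQ₂ i i<n) eq
          (ℤP.+-monoˡ-≤ (height n) (ℤP.≤-trans ≤last (subst (ℤ._≤ height (suc l″) ℤ.+ height n) (ℤP.+-identityˡ _) (ℤP.+-monoˡ-≤ (height n) (height-≥0 (s≤s (ℕP.<⇒≤ l<n)))))))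
      where
      l<n : l″ < n
      l<n = ℕP.≤-<-trans (ℕP.+-cancelʳ-≤ n l″ i (ℕP.+-cancelʳ-≤ n (l″ + n) (i + n) h₂)) i<n
      eq : s wQ (l″ + n + n) ℤ.+ height 1 ≡ (height (suc l″) ℤ.+ height n) ℤ.+ height n
      eq = trans (cong (ℤ._+ height 1) (s-period wQ-periodic (l″ + n))) (trans (swap (s wQ (l″ + n)) (s wQ n) (height 1))
        (cong₂ ℤ._+_ (sQ₂ l″ l<n) sQ-n))
        where
        swap : ∀ x y z → x ℤ.+ y ℤ.+ z ≡ (x ℤ.+ z) ℤ.+ y
        swap = ℤS.solve-∀

  private
    prv : ∀ {i} → i < n → ∃ (IsPrev height (suc i))
    prv h = hasPrev (s≤s z≤n) h

    nxt : ∀ {i} → i < n → ∃ λ e → e < n × IsNext height (suc i) (suc e) × laser (suc i) ≡ suc e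
    nxt {i} h = go (laser (suc i)) refl
      where
      go : ∀ e → laser (suc i) ≡ e → ∃ λ e → e < n × IsNext height (suc i) (suc e) × laser (suc i) ≡ suc e
      go zero    eq = ⊥-elim (ℕP.<⇒≱ (s≤s z≤n) (subst (suc i ≤_) eq (IsNext.after (proj₁ (laser-spec (s≤s z≤n) h)))))
      go (suc e) eq = e , subst (_≤ n) eq (proj₂ (laser-spec (s≤s z≤n) h)) , subst (IsNext height (suc i)) eq (proj₁ (laser-spec (s≤s z≤n) h)) , eq

    +n-cancel : ∀ {p q} → p < n → q < n → p + n ≅ q + n → p ≡ q
    +n-cancel hp hq e = trans (sym (m<n⇒m%n≡m hp)) (trans (%≡ (≅-+⁻ n e)) (m<n⇒m%n≡m hq))

    codeP-inj : ∀ {p q} → p < suc n → q < suc n → codeP p ≈ᶜ codeP q → p ≡ q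
    codeP-inj {zero}  {zero}  _ _ none = refl
    codeP-inj {suc p} {suc q} (s≤s hp) (s≤s hq) (both e) = cong suc (+n-cancel hp hq e)

    codeQ-inj : ∀ {p q} → p < n → q < n → codeQ p ≈ᶜ codeQ q → p ≡ q
    codeQ-inj {zero}  {zero}  _ _ _ = refl
    codeQ-inj {suc p} {suc q} (s≤s hp) (s≤s hq) (both e) = cong suc (+n-cancel (ℕP.m<n⇒m<1+n hp) (ℕP.m<n⇒m<1+n hq) e)
    codeQ-inj {zero}  {suc q} _ (s≤s hq) (both e) = ⊥-elim (ℕP.<-irrefl (trans (sym (m<n⇒m%n≡m (ℕP.m<n⇒m<1+n hq))) (trans (sym (%≡ (+n-≅ q))) (trans (sym (%≡ e)) (m<n⇒m%n≡m ℕP.≤-refl)))) hq)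
    codeQ-inj {suc p} {zero}  (s≤s hp) _ (both e) = ⊥-elim (ℕP.<-irrefl (trans (sym (m<n⇒m%n≡m (ℕP.m<n⇒m<1+n hp))) (trans (sym (%≡ (+n-≅ p))) (trans (%≡ e) (m<n⇒m%n≡m ℕP.≤-refl)))) hp)

    x = piD a b v

    rnkP′ : ∀ {i} (h : i < n) → rnk (proj₁ x) i ≡ run v (proj₁ (prv h))
    rnkP′ {i} h = trans (rnk-P i h) (rankP-run h (proj₂ (prv h)))

    rnkQ′ : ∀ {i} (h : i < n) → rnk (proj₂ x) i ≡ run v (suc (proj₁ (nxt h)))
    rnkQ′ {i} h = trans (rnk-Q i h) (cong (run v) (proj₂ (proj₂ (proj₂ (nxt h)))))

    relP′ : ∀ {i j} (hi : i < n) (hj : j < n) → (rel (proj₁ x) i j ≡ true → proj₁ (prv hi) ≡ proj₁ (prv hj)) × (proj₁ (prv hi) ≡ proj₁ (prv hj) → rel (proj₁ x) i j ≡ true)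
    relP′ {i} {j} hi hj = (λ e → relP⇒ hi hj (proj₂ (prv hi)) (proj₂ (prv hj)) (trans (sym (rel-P i j hi hj)) e)) ,
      (λ e → trans (rel-P i j hi hj) (relP⇐ hi hj (proj₂ (prv hi)) (subst (IsPrev height (suc j)) (sym e) (proj₂ (prv hj)))))

    relQ′ : ∀ {i j} (hi : i < n) (hj : j < n) → (rel (proj₂ x) i j ≡ true → proj₁ (nxt hi) ≡ proj₁ (nxt hj)) × (proj₁ (nxt hi) ≡ proj₁ (nxt hj) → rel (proj₂ x) i j ≡ true)
    relQ′ {i} {j} hi hj = (λ e → ℕP.suc-injective (trans (sym (lz hi)) (trans (relQ⇒ (s≤s z≤n) hi (s≤s z≤n) hj (trans (sym (rel-Q i j hi hj)) e)) (lz hj)))) ,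
      (λ e → trans (rel-Q i j hi hj) (relQ⇐ (s≤s z≤n) hi (s≤s z≤n) hj (trans (lz hi) (trans (cong suc e) (sym (lz hj))))))
      where
      lz : ∀ {i} (h : i < n) → laser (suc i) ≡ suc (proj₁ (nxt h))
      lz h = proj₂ (proj₂ (proj₂ (nxt h)))

    rep : ∀ {h w} → Periodic w → (cp cq : ℕ → Maybe ℕ) →
      (∀ {i p} → i < n → IsPrev height (suc i) p → PC w (i + n) (cp p)) →
      (∀ {i e} → i < n → e < n → IsNext height (suc i) (suc e) → QC w (i + n) (cq e)) →
      (∀ {p q} → p < n → q < n → cp p ≈ᶜ cp q → p ≡ q) →
      (∀ {p q} → p < n → q < n → cq p ≈ᶜ cq q → p ≡ q) →
      (∀ {p} → p < n → run v p ≡ val h w (cp p)) →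
      (∀ {e} → e < n → run v (suc e) ≡ val h w (cq e)) →
      Rep 0 x h w
    rep {h} {w} per cp cq hp hq ip iq vp vq = Rep-intro per
      (λ {i} {c} hi p → trans (rnkP′ hi) (trans (vp (isPrev-≤ hi (proj₂ (prv hi)))) (cong (val h w) (PC-unique (pP hi) p))))
      (λ {i} {j} hi hj p q → (λ e → subst₂ _≈ᶜ_ (PC-unique (pP hi) p) (PC-unique (pP hj) q) (≡⇒≈ᶜ (cong cp (proj₁ (relP′ hi hj) e)))) ,
         (λ e → proj₂ (relP′ hi hj) (ip (isPrev-≤ hi (proj₂ (prv hi))) (isPrev-≤ hj (proj₂ (prv hj))) (subst₂ _≈ᶜ_ (PC-unique p (pP hi)) (PC-unique q (pP hj)) e))))
      (λ {i} {c} hi p → trans (rnkQ′ hi) (trans (vq (proj₁ (proj₂ (nxt hi)))) (cong (val h w) (QC-unique (pQ hi) p))))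
      (λ {i} {j} hi hj p q → (λ e → subst₂ _≈ᶜ_ (QC-unique (pQ hi) p) (QC-unique (pQ hj) q) (≡⇒≈ᶜ (cong cq (proj₁ (relQ′ hi hj) e)))) ,
         (λ e → proj₂ (relQ′ hi hj) (iq (proj₁ (proj₂ (nxt hi))) (proj₁ (proj₂ (nxt hj))) (subst₂ _≈ᶜ_ (QC-unique p (pQ hi)) (QC-unique q (pQ hj)) e))))
      where
      pP : ∀ {i} (hi : i < n) → PC w (i + n) (cp (proj₁ (prv hi)))
      pP hi = hp hi (proj₂ (prv hi))
      pQ : ∀ {i} (hi : i < n) → QC w (i + n) (cq (proj₁ (nxt hi)))
      pQ hi = hq hi (proj₁ (proj₂ (nxt hi))) (proj₁ (proj₂ (proj₂ (nxt hi))))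

    cqQ : ℕ → Maybe ℕ
    cqQ e with e ℕ.≟ n′
    ... | yes _ = nothing
    ... | no _  = just (e + n)

  repP : Rep 0 (piD a b v) (run v 0) wP
  repP = rep wP-periodic codeP (λ e → just (e + n)) pcP qcP
    (λ hp hq → codeP-inj (ℕP.m<n⇒m<1+n hp) (ℕP.m<n⇒m<1+n hq)) (λ { hp hq (both e) → +n-cancel hp hq e }) vp
    (λ {e} he → sym (trans (wP-periodic e) (wP-< he)))
    where
    vp : ∀ {p} → p < n → run v p ≡ val (run v 0) wP (codeP p)
    vp {zero}  h = refl
    vp {suc p} h = sym (trans (wP-periodic p) (wP-< (ℕP.<-trans (ℕP.n<1+n p) h)))

  repQ : Rep 0 (piD a b v) (run v n) wQ
  repQ = rep wQ-periodic codeQ cqQ pcQ qq codeQ-inj iq vp vq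
    where
    qq : ∀ {i e} → i < n → e < n → IsNext height (suc i) (suc e) → QC wQ (i + n) (cqQ e)
    qq {i} {e} hi he p with e ℕ.≟ n′
    ... | yes refl = qcQ-root hi p
    ... | no ne    = qcQ hi (ℕP.≤∧≢⇒< (ℕ.s≤s⁻¹ he) ne) p
    iq : ∀ {p q} → p < n → q < n → cqQ p ≈ᶜ cqQ q → p ≡ q
    iq {p} {q} hp hq e with p ℕ.≟ n′ | q ℕ.≟ n′
    iq hp hq e        | yes refl | yes e′ = sym e′
    iq hp hq (both e) | no _     | no _   = +n-cancel hp hq e
    vp : ∀ {p} → p < n → run v p ≡ val (run v n) wQ (codeQ p)
    vp {zero}  h = sym wQ-last
    vp {suc p} h = sym (trans (wQ-periodic p) (wQ-< (ℕ.s≤s⁻¹ h)))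
    vq : ∀ {e} → e < n → run v (suc e) ≡ val (run v n) wQ (cqQ e)
    vq {e} h with e ℕ.≟ n′
    ... | yes refl = refl
    ... | no ne    = sym (trans (wQ-periodic e) (wQ-< (ℕP.≤∧≢⇒< (ℕ.s≤s⁻¹ h) ne)))

-- Sums over words, injectivity of π, and paths read off from words.

psum : (ℕ → ℕ) → ℕ → ℕ
psum f zero    = 0
psum f (suc k) = psum f k + f k

psum-cong : ∀ {f g} k → (∀ i → i < k → f i ≡ g i) → psum f k ≡ psum g k
psum-cong zero    h = refl
psum-cong (suc k) h = cong₂ _+_ (psum-cong k (λ i i<k → h i (ℕP.m<n⇒m<1+n i<k))) (h k ℕP.≤-refl)

psum-suc : ∀ f k → psum f (suc k) ≡ f 0 + psum (λ i → f (suc i)) k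
psum-suc f zero    = sym (ℕP.+-identityʳ (f 0))
psum-suc f (suc k) = trans (cong (_+ f (suc k)) (psum-suc f k)) (ℕP.+-assoc (f 0) _ _)

ht-psum : ∀ {b} (v : Vec ℕ b) k → ht v k ≡ psum (run v) k
ht-psum v zero    = refl
ht-psum v (suc k) = cong (_+ run v k) (ht-psum v k)

psum-rotate : ∀ f n → (∀ i → f (i + n) ≡ f i) → ∀ t → psum (λ i → f (i + t)) n ≡ psum f n
psum-rotate f n per zero    = psum-cong n (λ i _ → cong f (ℕP.+-identityʳ i))
psum-rotate f n per (suc t) = trans (ℕP.+-cancelˡ-≡ (f t) _ _ step) (psum-rotate f n per t)
  where
  step : f t + psum (λ i → f (i + suc t)) n ≡ f t + psum (λ i → f (i + t)) n
  step = trans (cong (λ z → f t + z) (psum-cong n (λ i _ → cong f (ℕP.+-suc i t))))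
    (trans (sym (psum-suc (λ i → f (i + t)) n)) (trans (ℕP.+-comm (psum (λ i → f (i + t)) n) (f (n + t))) (cong (_+ psum (λ i → f (i + t)) n) (trans (cong f (ℕP.+-comm n t)) (per t)))))

psum-replace : ∀ f g n e → e < n → (∀ i → i < n → i ≢ e → f i ≡ g i) → psum f n + g e ≡ psum g n + f e
psum-replace f g (suc n) e e<n h with e ℕ.≟ n
... | yes refl = trans (l (psum f n) (f n) (g n)) (cong (λ z → z + g n + f n) (psum-cong n (λ i i<n → h i (ℕP.m<n⇒m<1+n i<n) (ℕP.<⇒≢ i<n))))
  where
  l : ∀ x y z → x + y + z ≡ x + z + y
  l = ℕS.solve-∀
... | no ne = trans (l (psum f n) (f n) (g e)) (trans (cong₂ _+_ (psum-replace f g n e (ℕP.≤∧≢⇒< (ℕ.s≤s⁻¹ e<n) ne) (λ i i<n → h i (ℕP.m<n⇒m<1+n i<n))) (h n ℕP.≤-refl (λ x → ne (sym x))))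
    (l (psum g n) (f e) (g n)))
  where
  l : ∀ x y z → x + y + z ≡ x + z + y
  l = ℕS.solve-∀

sgn : ℕ → ℕ
sgn zero    = 0
sgn (suc _) = 1

fromFun : (ℕ → ℕ) → ∀ k → Vec ℕ k
fromFun f zero    = []
fromFun f (suc k) = f 0 ∷ fromFun (λ i → f (suc i)) k

run-fromFun : ∀ f {k i} → i < k → run (fromFun f k) i ≡ f i
run-fromFun f {suc k} {zero}  _       = refl
run-fromFun f {suc k} {suc i} (s≤s h) = run-fromFun (λ i → f (suc i)) h

run-ext : ∀ {k} (u v : Vec ℕ k) → (∀ i → i < k → run u i ≡ run v i) → u ≡ v
run-ext []      []      h = refl
run-ext (x ∷ u) (y ∷ v) h = cong₂ _∷_ (h 0 (s≤s z≤n)) (run-ext u v (λ i i<k → h (suc i) (s≤s i<k)))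

-- The function stays arbitrary so that one argument preserves both the sum of the runs (identity)
-- and the number of blocks (`sgn`).
stat : (ℕ → ℕ) → ∀ {b} → Vec ℕ b → ℕ
stat f {b} v = psum (λ i → f (run v i)) b

stat-fromFun : ∀ f g k → stat f (fromFun g k) ≡ psum (λ i → f (g i)) k
stat-fromFun f g k = psum-cong k (λ i h → cong f (run-fromFun g h))

module Orbit (a n′ : ℕ) (a>0 : 0 < a) (cop : Coprime a (suc (suc n′))) where

  private
    n = suc n′
    b = suc n
    inc = charge a b

  open Access n′
  open Cover n′ inc

  -- opaque, as unfolding piD is expensive
  opaque
    π : Vec ℕ b → LPair n
    π = piD a b

    π-def : ∀ v → π v ≡ piD a b v
    π-def v = refl

  D : Vec ℕ b → Set
  D = Dyck a b

  module _ {v v′ : Vec ℕ b} (d : D v) (d′ : D v′) (sameπ : π v ≡ π v′) where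

    private
      same : piD a b v ≡ piD a b v′
      same = trans (sym (π-def v)) (trans sameπ (π-def v′))

      module V = Path a n v a>0 cop d
      module V′ = Path a n v′ a>0 cop d′
      module B = PathBlocks a n′ v a>0 cop d
      module B′ = PathBlocks a n′ v′ a>0 cop d′

      relP≡′ : ∀ i j → i < n → j < n → relP a b v (suc i) (suc j) ≡ relP a b v′ (suc i) (suc j)
      relP≡′ i j hi hj = trans (sym (B.rel-P i j hi hj)) (trans (cong (λ x → rel (proj₁ x) i j) same) (B′.rel-P i j hi hj))

      rankP≡′ : ∀ i → i < n → rankP a b v (suc i) ≡ rankP a b v′ (suc i)
      rankP≡′ i hi = trans (sym (B.rnk-P i hi)) (trans (cong (λ x → rnk (proj₁ x) i) same) (B′.rnk-P i hi))

      rankQ≡′ : ∀ i → i < n → run v (V.laser (suc i)) ≡ run v′ (V′.laser (suc i))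
      rankQ≡′ i hi = trans (sym (B.rnk-Q i hi)) (trans (cong (λ x → rnk (proj₂ x) i) same) (B′.rnk-Q i hi))

    -- P alone shows the P-rises: there is one at i exactly when label i + 1 is the minimum of its
    -- block.
    mixed : ∀ {u u′ : Vec ℕ b} (d : D u) (d′ : D u′) i → i < n →
      (∀ i j → i < n → j < n → relP a b u (suc i) (suc j) ≡ relP a b u′ (suc i) (suc j)) →
      Path.height a n u a>0 cop d i ℤ.< Path.height a n u a>0 cop d (suc i) →
      ¬ (Path.height a n u′ a>0 cop d′ i ℤ.< Path.height a n u′ a>0 cop d′ (suc i)) → ⊥
    mixed {u} {u′} d d′ i i<n eq rise nrise = bad (U′.hasPrev {suc i} (s≤s z≤n) i<n)
      where
      module U = Path a n u a>0 cop d
      module U′ = Path a n u′ a>0 cop d′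
      pi : IsPrev U.height (suc i) i
      pi = PathBlocks.pRise-prev a n′ u a>0 cop d rise
      bad : ∃ (IsPrev U′.height (suc i)) → ⊥
      bad (p , ip) with p ℕ.≟ i
      ... | yes refl = nrise (IsPrev.below ip)
      ... | no ne    = ℕP.<-irrefl (sym i≡q) (ℕP.<-≤-trans (IsPrev.before (proj₂ q)) p<i)
        where
        p<i : p < i
        p<i = ℕP.≤∧≢⇒< (ℕ.s≤s⁻¹ (IsPrev.before ip)) ne
        p<n = ℕP.<-trans p<i i<n
        q = U.hasPrev {suc p} (s≤s z≤n) p<n
        i≡q : i ≡ proj₁ q
        i≡q = U.relP⇒ {suc i} {suc p} i<n p<n pi (proj₂ q) (trans (eq i p i<n p<n) (U′.relP⇐ {suc i} {suc p} i<n p<n ip (U′.firstChild ip)))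

    -- Each run is the rank of a block, of P at a P-rise and of Q otherwise, and by `mixed` the two
    -- paths agree on which case holds.
    π-injective : v ≡ v′
    π-injective = run-ext v v′ (λ { zero _ → at0 ; (suc i) (s≤s h) → at i h })
      where
      first : ∀ {u : Vec ℕ b} (d : D u) → rankP a b u 1 ≡ run u 0
      first {u} d = U.rankP-run (s≤s z≤n) (isPrev (s≤s z≤n) (subst (ℤ._< U.height 1) (sym U.height-0) (U.height->0 (s≤s z≤n) (s≤s z≤n))) (λ l p q → ⊥-elim (ℕP.<⇒≱ p (ℕ.s≤s⁻¹ q))))
        where module U = Path a n u a>0 cop d
      at0 : run v 0 ≡ run v′ 0
      at0 = trans (sym (first d)) (trans (rankP≡′ 0 (s≤s z≤n)) (first d′))
      at : ∀ i → i < n → run v (suc i) ≡ run v′ (suc i)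
      at i h with V.height (suc i) ℤ.<? V.height (suc (suc i)) | V′.height (suc i) ℤ.<? V′.height (suc (suc i))
      ... | yes r | yes r′ = trans (sym (V.rankP-run i<n (B.pRise-prev r))) (trans (rankP≡′ (suc i) i<n) (V′.rankP-run i<n (B′.pRise-prev r′)))
        where i<n = B.pRise-<n h r
      ... | no r  | no r′  = trans (sym (cong (run v) (B.descent-laser (s≤s z≤n) h (B.pRise-or-descent r)))) (trans (rankQ≡′ i h) (cong (run v′) (B′.descent-laser (s≤s z≤n) h (B′.pRise-or-descent r′))))
      ... | yes r | no r′  = ⊥-elim (mixed d d′ (suc i) (B.pRise-<n h r) relP≡′ r r′)
      ... | no r  | yes r′ = ⊥-elim (mixed d′ d (suc i) (B′.pRise-<n h r′) (λ i j hi hj → sym (relP≡′ i j hi hj)) r′ r)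

  s-psum : ∀ w k → s w k ≡ + b ℤ.* + psum w k ℤ.- + a ℤ.* + k
  s-psum w zero    = sym (trans (cong₂ ℤ._-_ (ℤP.*-zeroʳ (+ b)) (ℤP.*-zeroʳ (+ a))) refl)
  s-psum w (suc k) = trans (cong (ℤ._+ inc (w k)) (s-psum w k)) (l (+ b) (+ psum w k) (+ a) (+ k) (+ w k))
    where
    l : ∀ b p a k x → b ℤ.* p ℤ.- a ℤ.* k ℤ.+ (b ℤ.* x ℤ.- a) ≡ b ℤ.* (p ℤ.+ x) ℤ.- a ℤ.* (+ 1 ℤ.+ k)
    l = ℤS.solve-∀

  s-suc : ∀ w k → s w (suc k) ≡ inc (w 0) ℤ.+ s (λ i → w (suc i)) k
  s-suc w zero    = trans (ℤP.+-identityˡ (inc (w 0))) (sym (ℤP.+-identityʳ (inc (w 0))))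
  s-suc w (suc k) = trans (cong (ℤ._+ inc (w (suc k))) (s-suc w k)) (ℤP.+-assoc (inc (w 0)) _ _)

  s-below : ∀ {w w′} k → (∀ i → i < k → w i ≡ w′ i) → s w k ≡ s w′ k
  s-below zero    h = refl
  s-below (suc k) h = cong₂ (λ x y → x ℤ.+ inc y) (s-below k (λ i p → h i (ℕP.m<n⇒m<1+n p))) (h k ℕP.≤-refl)

  dyck-from-s : ∀ f → psum f b ≡ a → (∀ i → i ≤ b → + 0 ℤ.≤ s f i) → D (fromFun f b)
  dyck-from-s f tot h = record
    { above = λ i i≤b → ℤP.drop‿+≤+ (subst₂ ℤ._≤_ (sym (ℤP.pos-* a i)) (trans (cong (λ z → + b ℤ.* + z) (sym (hts i i≤b))) (sym (ℤP.pos-* b (ht (fromFun f b) i)))) (0≤-⇒≤ (subst (+ 0 ℤ.≤_) (s-psum f i) (h i i≤b))))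
    ; total = trans (hts b ℕP.≤-refl) tot }
    where
    hts : ∀ i → i ≤ b → ht (fromFun f b) i ≡ psum f i
    hts i i≤b = trans (ht-psum (fromFun f b) i) (psum-cong i (λ l l<i → run-fromFun f (ℕP.<-≤-trans l<i i≤b)))
    0≤-⇒≤ : ∀ {x y} → + 0 ℤ.≤ x ℤ.- y → y ℤ.≤ x
    0≤-⇒≤ {x} {y} h = subst₂ ℤ._≤_ (ℤP.+-identityˡ y) (l x y) (ℤP.+-monoˡ-≤ y h)
      where
      l : ∀ x y → x ℤ.- y ℤ.+ y ≡ x
      l = ℤS.solve-∀

  -- Paths of words: the root rank is written first (root in P) or last (root in Q).
  consN snocN : ℕ → (ℕ → ℕ) → ℕ → ℕ
  consN h w zero    = h
  consN h w (suc i) = w i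
  snocN h w i with i ℕ.<? n
  ... | yes _ = w i
  ... | no _  = h

  snocN-< : ∀ {h w i} → i < n → snocN h w i ≡ w i
  snocN-< {i = i} p with i ℕ.<? n
  ... | yes _ = refl
  ... | no q  = ⊥-elim (q p)

  snocN-n : ∀ {h w} → snocN h w n ≡ h
  snocN-n with n ℕ.<? n
  ... | yes q = ⊥-elim (ℕP.<-irrefl refl q)
  ... | no _  = refl

  pathP pathQ : ℕ → (ℕ → ℕ) → Vec ℕ b
  pathP h w = fromFun (consN h w) b
  pathQ h w = fromFun (snocN h w) b

  Total : ℕ → (ℕ → ℕ) → Set
  Total h w = h + psum w n ≡ a

  weightOf : (ℕ → ℕ) → ℕ → (ℕ → ℕ) → ℕ
  weightOf f h w = f h + psum (λ i → f (w i)) n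

  stat-pathP : ∀ f h w → stat f (pathP h w) ≡ weightOf f h w
  stat-pathP f h w = trans (stat-fromFun f (consN h w) b) (psum-suc (λ i → f (consN h w i)) n)

  stat-pathQ : ∀ f h w → stat f (pathQ h w) ≡ weightOf f h w
  stat-pathQ f h w = trans (stat-fromFun f (snocN h w) b) (trans (cong₂ _+_ (psum-cong n (λ i p → cong f (snocN-< p))) (cong f (snocN-n {h} {w}))) (ℕP.+-comm _ (f h)))

  total⇒s : ∀ {h w} → Total h w → inc h ℤ.+ s w n ≡ + 0
  total⇒s {h} {w} t = trans (cong (λ z → inc h ℤ.+ z) (s-psum w n)) (trans (l (+ b) (+ h) (+ psum w n) (+ a) (+ n))
    (trans (cong (λ z → + b ℤ.* z ℤ.- + a ℤ.* (+ 1 ℤ.+ + n)) (cong +_ t)) (l′ (+ b) (+ a))))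
    where
    l : ∀ b h p a n → (b ℤ.* h ℤ.- a) ℤ.+ (b ℤ.* p ℤ.- a ℤ.* n) ≡ b ℤ.* (h ℤ.+ p) ℤ.- a ℤ.* (+ 1 ℤ.+ n)
    l = ℤS.solve-∀
    l′ : ∀ b a → b ℤ.* a ℤ.- a ℤ.* b ≡ + 0
    l′ = ℤS.solve-∀

  period-s : ∀ {w} → Periodic w → ∀ i → s w (i + n) ≡ s w i ℤ.+ s w n
  period-s {w} per i = trans (s-shift w n i) (cong (ℤ._+ s w n) (s-cong per i))

  -- A P-root at n means that `s w n` is the least sum of the period, and the charge of h lifts
  -- exactly this value to 0.
  dyckP : ∀ {h w} → Total h w → PC w n nothing → D (pathP h w)
  dyckP {h} {w} t (pcN z) = dyck-from-s (consN h w) (trans (psum-suc (consN h w) n) t) pos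
    where
    pos : ∀ i → i ≤ b → + 0 ℤ.≤ s (consN h w) i
    pos zero    _ = ℤP.≤-refl
    pos (suc i) (s≤s i≤n) = subst₂ ℤ._≤_ (total⇒s {h} {w} t) (sym (s-suc (consN h w) i)) (ℤP.+-monoʳ-≤ (inc h) (le (ℕP.m≤n⇒m<n∨m≡n i≤n)))
      where
      le : i < n ⊎ i ≡ n → s w n ℤ.≤ s w i
      le (inj₁ p)    = z i p (ℕP.m≤n+m n i)
      le (inj₂ refl) = ℤP.≤-refl

  dyckQ : ∀ {h w} → Total h w → (∀ i → i ≤ n → + 0 ℤ.≤ s w i) → D (pathQ h w)
  dyckQ {h} {w} t z = dyck-from-s (snocN h w) tot pos
    where
    tot : psum (snocN h w) b ≡ a
    tot = trans (cong₂ _+_ (psum-cong n (λ i p → snocN-< p)) (snocN-n {h} {w})) (trans (ℕP.+-comm (psum w n) h) t)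
    low : ∀ i → i ≤ n → s (snocN h w) i ≡ s w i
    low i i≤n = s-below i (λ l l<i → snocN-< (ℕP.<-≤-trans l<i i≤n))
    pos : ∀ i → i ≤ b → + 0 ℤ.≤ s (snocN h w) i
    pos i i≤b with ℕP.m≤n⇒m<n∨m≡n i≤b
    ... | inj₁ (s≤s i≤n) = subst (+ 0 ℤ.≤_) (sym (low i i≤n)) (z i i≤n)
    ... | inj₂ refl = ℤP.≤-reflexive (sym (trans (cong₂ (λ x y → x ℤ.+ inc y) (low n ℕP.≤-refl) (snocN-n {h} {w})) (trans (ℤP.+-comm (s w n) (inc h)) (total⇒s {h} {w} t))))

  -- For a Q-root at n the sums of the next turn are at least `s w n`; they are the sums of this
  -- turn plus `s w n`.
  dyckQ′ : ∀ {h w} → Periodic w → Total h w → QC w n nothing → D (pathQ h w)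
  dyckQ′ {h} {w} per t (qcN z) = dyckQ {h} {w} t pos
    where
    pos : ∀ i → i ≤ n → + 0 ℤ.≤ s w i
    pos zero    _ = ℤP.≤-refl
    pos (suc i) h = subst₂ ℤ._≤_ (l (s w n)) (l′ (s w (suc i)) (s w n)) (ℤP.+-monoˡ-≤ (ℤ.- s w n) (subst (s w n ℤ.≤_) (period-s per (suc i)) (z (suc i + n) (s≤s (ℕP.m≤n+m n i)) (ℕP.+-monoˡ-≤ n h))))
      where
      l : ∀ x → x ℤ.+ (ℤ.- x) ≡ + 0
      l = ℤS.solve-∀
      l′ : ∀ y x → y ℤ.+ x ℤ.+ (ℤ.- x) ≡ y
      l′ = ℤS.solve-∀

  module Words (v : Vec ℕ b) (d : D v) where

    open PathWords a n′ v a>0 cop d public hiding (repP; repQ)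

    private
      module W = PathWords a n′ v a>0 cop d

    repP : Rep 0 (π v) (run v 0) wP
    repP = subst (λ x → Rep 0 x (run v 0) wP) (sym (π-def v)) W.repP

    repQ : Rep 0 (π v) (run v n) wQ
    repQ = subst (λ x → Rep 0 x (run v n) wQ) (sym (π-def v)) W.repQ

  repPathP : ∀ {h w} → Periodic w → D (pathP h w) → Rep 0 (π (pathP h w)) h w
  repPathP {h} {w} per d = Rep-ext (λ i → trans (run-fromFun (consN h w) (s≤s (m%n<n i n))) (periodic-≅ per (%-≅ i)))
    (Words.repP (pathP h w) d)

  repQ-as : ∀ (v : Vec ℕ b) (d : D v) {h u} → Periodic u → run v n ≡ h → u n′ ≡ run v 0 →
            (∀ k → k < n′ → u k ≡ run v (suc k)) → Rep 0 (π v) h u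
  repQ-as v d {h} {u} per refl last low = Rep-ext eq W.repQ
    where
    module W = Words v d
    eq : ∀ i → W.wQ i ≡ u i
    eq i = trans (periodic-≅ W.wQ-periodic (≅-sym (%-≅ i))) (trans (go (i % n) (m%n<n i n)) (periodic-≅ per (%-≅ i)))
      where
      go : ∀ k → k < n → W.wQ k ≡ u k
      go k k<n with ℕP.m≤n⇒m<n∨m≡n (ℕ.s≤s⁻¹ k<n)
      ... | inj₂ refl = trans W.wQ-last (sym last)
      ... | inj₁ k<n′ = trans (W.wQ-< k<n′) (sym (low k k<n′))

  shift-periodic : ∀ t {w} → Periodic w → Periodic (shift t w)
  shift-periodic t {w} per i = trans (cong w (trans (ℕP.+-assoc i n t) (trans (cong (λ z → i + z) (ℕP.+-comm n t)) (sym (ℕP.+-assoc i t n))))) (per (i + t))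

  -- The shift by 1 arises because the path starts with the letter `w 0`, while its Q-rooted word
  -- starts with the run 1.
  repPathQ : ∀ {h w} → Periodic w → D (pathQ h w) → Rep 0 (π (pathQ h w)) h (shift 1 w)
  repPathQ {h} {w} per d = repQ-as (pathQ h w) d (shift-periodic 1 per)
    (trans (run-fromFun (snocN h w) {b} {n} ℕP.≤-refl) (snocN-n {h} {w}))
    (trans (trans (cong w (ℕP.+-comm n′ 1)) (per 0)) (sym (trans (run-fromFun (snocN h w) {b} {0} (s≤s z≤n)) (snocN-< {h} {w} {0} (s≤s z≤n)))))
    (λ k k<n′ → trans (cong w (ℕP.+-comm k 1)) (sym (trans (run-fromFun (snocN h w) {b} {suc k} (s≤s (s≤s (ℕP.<⇒≤ k<n′)))) (snocN-< {h} {w} {suc k} (s≤s k<n′)))))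

-- Closure under rotation.

module Closure (a n′ : ℕ) (a>0 : 0 < a) (cop : Coprime a (suc (suc n′))) where

  private
    n = suc n′
    b = suc n
    inc = charge a b

  open Access n′
  open Cover n′ inc
  open Orbit a n′ a>0 cop

  rotPow-+ : ∀ z y (x : LPair n) → rotPow (z + y) x ≡ rotPow z (rotPow y x)
  rotPow-+ zero    y x = refl
  rotPow-+ (suc z) y x = cong rotLPair (rotPow-+ z y x)

  sameData-sym≅ : ∀ {x y : LPair n} {d d′} → d ≅ d′ → SameData x y d → SameData x y d′
  sameData-sym≅ {x} {y} {d} {d′} e r = record
    { relP≡ = λ i j → trans (rel-cong (proj₁ x) (m i) (m j)) (relP≡ r i j)
    ; rnkP≡ = λ i → trans (rnk-cong (proj₁ x) (m i)) (rnkP≡ r i)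
    ; relQ≡ = λ i j → trans (rel-cong (proj₂ x) (m i) (m j)) (relQ≡ r i j)
    ; rnkQ≡ = λ i → trans (rnk-cong (proj₂ x) (m i)) (rnkQ≡ r i) }
    where
    m : ∀ i → i + d′ ≅ i + d
    m i = ≅-trans (≡⇒≅ (ℕP.+-comm i d′)) (≅-trans (≅-+ i (≅-sym e)) (≡⇒≅ (ℕP.+-comm d i)))

  rotPow-≅ : ∀ {d d′} (x : LPair n) → d ≅ d′ → rotPow d x ≡ rotPow d′ x
  rotPow-≅ {d} {d′} x e = sameData-unique {z = x} (sameData-sym≅ e (rotPow-data d x)) (rotPow-data d′ x)

  relate : ∀ z {x y h w} → Rep z x h w → Rep 0 y h w → x ≡ rotPow z y
  relate z {x} {y} r r₀ = Rep-unique r (Rep-rot (rotPow-data z y) r₀)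

  module _ (v : Vec ℕ b) (d : D v) where

    private
      module P = Path a n v a>0 cop d
      module W = Words v d
      w = W.wP
      h = run v 0
      per : Periodic w
      per = W.wP-periodic
      H₁ = P.height 1
      0<H₁ : + 0 ℤ.< H₁
      0<H₁ = P.height->0 (s≤s z≤n) (s≤s z≤n)

    stat-wP : ∀ f → stat f v ≡ weightOf f h w
    stat-wP f = trans (psum-suc (λ i → f (run v i)) n) (cong (λ z → f h + z) (psum-cong n (λ i p → cong f (sym (W.wP-< p)))))

    total-wP : Total h w
    total-wP = trans (sym (stat-wP (λ x → x))) (trans (sym (ht-psum v b)) (Dyck.total d))

    private
      sn<0 : s w n ℤ.< + 0
      sn<0 = subst₂ ℤ._<_ (ℤP.+-identityʳ _) W.sP-n (ℤP.+-monoʳ-< (s w n) 0<H₁)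

      sn≤ : ∀ m → m ≤ n → s w n ℤ.≤ s w m
      sn≤ m h′ = subst₂ ℤ._≤_ (l (s w n) H₁) (l (s w m) H₁) (ℤP.+-monoˡ-≤ (ℤ.- H₁) (subst₂ ℤ._≤_ (sym W.sP-n) (sym (W.sP m h′)) (P.height-≥0 (s≤s h′))))
        where
        l : ∀ x y → x ℤ.+ y ℤ.+ (ℤ.- y) ≡ x
        l = ℤS.solve-∀

    laser₀ : ∃ λ e → e < n × IsNext (s w) 0 e
    laser₀ with QC-total w 0
    ... | just e , qcJ p q = e , p , q
    ... | nothing , qcN z  = ⊥-elim (ℤP.<⇒≱ sn<0 (z n (s≤s z≤n) ℕP.≤-refl))

    -- Label 1 lies in the root block of P and in the Q-block ending at e. Moving on within the root
    -- block yields v₁, whose pair turned by e + 1 is that of v. Rooting v₁ in its last Q-block and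
    -- moving back within it yields v₂, whose pair is that of v₁ turned by e. So v is v₂ turned by
    -- one.
    module Step (e : ℕ) (e<n : e < n) (nx : IsNext (s w) 0 e) where

      private
        A<0 : s w (suc e) ℤ.< + 0
        A<0 = IsNext.below nx
        s≥0 : ∀ l → l ≤ e → + 0 ℤ.≤ s w l
        s≥0 zero    _ = ℤP.≤-refl
        s≥0 (suc l) p = IsNext.above nx (suc l) (s≤s z≤n) p

        w₁ = shift (suc e) w
        per₁ : Periodic w₁
        per₁ i = trans (cong w (trans (ℕP.+-assoc i n (suc e)) (trans (cong (λ z → i + z) (ℕP.+-comm n (suc e))) (sym (ℕP.+-assoc i (suc e) n))))) (per (i + suc e))

        total₁ : Total h w₁
        total₁ = trans (cong (λ z → h + z) (psum-rotate w n per (suc e))) total-wP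

        root₁ : PC w₁ n nothing
        root₁ = pcN (λ l l<n _ → cancel (subst₂ ℤ._≤_ (s-shift w (suc e) n) (s-shift w (suc e) l) (le l l<n)))
          where
          cancel : ∀ {x y c} → x ℤ.+ c ℤ.≤ y ℤ.+ c → x ℤ.≤ y
          cancel {x} {y} {c} q = subst₂ ℤ._≤_ (l x c) (l y c) (ℤP.+-monoˡ-≤ (ℤ.- c) q)
            where
            l : ∀ x y → x ℤ.+ y ℤ.+ (ℤ.- y) ≡ x
            l = ℤS.solve-∀
          sn≤m : ∀ m → m < n + suc e → s w n ℤ.≤ s w m
          sn≤m m p with m ℕ.≤? n
          ... | yes q = sn≤ m q
          ... | no q  = subst (s w n ℤ.≤_) (sym (trans (cong (s w) (sym split)) (period-s per (m ∸ n))))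
                (subst (ℤ._≤ s w (m ∸ n) ℤ.+ s w n) (ℤP.+-identityˡ _) (ℤP.+-monoˡ-≤ (s w n) (s≥0 (m ∸ n) (ℕ.s≤s⁻¹ (ℕP.+-cancelʳ-< n (m ∸ n) (suc e) (subst₂ _<_ (sym split) (ℕP.+-comm n (suc e)) p))))))
            where
            split : m ∸ n + n ≡ m
            split = ℕP.m∸n+n≡m (ℕP.<⇒≤ (ℕP.≰⇒> q))
          le : ∀ l → l < n → s w (n + suc e) ℤ.≤ s w (l + suc e)
          le l p = ℤP.≤-trans (subst₂ ℤ._≤_ (sym (trans (cong (s w) (ℕP.+-comm n (suc e))) (period-s per (suc e)))) (ℤP.+-identityˡ _) (ℤP.+-monoˡ-≤ (s w n) (ℤP.<⇒≤ A<0)))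
            (sn≤m (l + suc e) (ℕP.+-monoˡ-< (suc e) p))

        v₁ = pathP h w₁
        d₁ : D v₁
        d₁ = dyckP {h} {w₁} total₁ root₁

        πv-v₁ : π v ≡ rotPow (suc e) (π v₁)
        πv-v₁ = relate (suc e) (Rep-≅ (≡⇒≅ (ℕP.+-comm (suc e) 0)) (Rep-shift (suc e) W.repP)) (repPathP per₁ d₁)

        put : ℕ → ℕ → ℕ
        put k x with k ℕ.≟ e
        ... | yes _ = h
        ... | no _  = x

        put-e : ∀ {k x} → k ≡ e → put k x ≡ h
        put-e {k} p with k ℕ.≟ e
        ... | yes _ = refl
        ... | no q  = ⊥-elim (q p)

        put-≢ : ∀ {k x} → k ≢ e → put k x ≡ x
        put-≢ {k} p with k ℕ.≟ e
        ... | yes q = ⊥-elim (p q)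
        ... | no _  = refl

        -- The root moves across the edge to the Q-block: the letter at e becomes the root rank and
        -- the old root rank h takes its place.
        u : ℕ → ℕ
        u i = put (i % n) (w i)

        per-u : Periodic u
        per-u i = cong₂ put ([m+n]%n≡m%n i n) (per i)

        u-e : u e ≡ h
        u-e = put-e (m<n⇒m%n≡m e<n)

        u-≢ : ∀ i → i < n → i ≢ e → u i ≡ w i
        u-≢ i p q = put-≢ (λ z → q (trans (sym (m<n⇒m%n≡m p)) z))

        weight-u : ∀ f → weightOf f (w e) u ≡ weightOf f h w
        weight-u f = trans (ℕP.+-comm (f (w e)) _) (trans (psum-replace (λ i → f (u i)) (λ i → f (w i)) n e e<n (λ i p q → cong f (u-≢ i p q)))
          (trans (ℕP.+-comm (psum (λ i → f (w i)) n) (f (u e))) (cong (λ z → f z + psum (λ i → f (w i)) n) u-e)))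

        total-u : Total (w e) u
        total-u = trans (weight-u (λ x → x)) total-wP

        s-u-low : ∀ i → i ≤ e → s u i ≡ s w i
        s-u-low i p = s-below i (λ l q → u-≢ l (ℕP.<-trans (ℕP.<-≤-trans q p) e<n) (ℕP.<⇒≢ (ℕP.<-≤-trans q p)))

        s-u-high : ∀ i → e < i → i ≤ n → s u i ℤ.+ inc (w e) ≡ s w i ℤ.+ inc h
        s-u-high (suc i) e<i i<n with ℕP.m≤n⇒m<n∨m≡n (ℕ.s≤s⁻¹ e<i)
        ... | inj₂ refl = trans (cong₂ (λ x y → x ℤ.+ inc y ℤ.+ inc (w i)) (s-u-low i ℕP.≤-refl) u-e) (l (s w i) (inc h) (inc (w i)))
          where
          l : ∀ x y z → x ℤ.+ y ℤ.+ z ≡ x ℤ.+ z ℤ.+ y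
          l = ℤS.solve-∀
        ... | inj₁ e<i′ = trans (l (s u i) (inc (u i)) (inc (w e))) (trans (cong₂ (λ x y → x ℤ.+ inc y) (s-u-high i e<i′ (ℕP.<⇒≤ i<n)) (u-≢ i i<n (λ z → ℕP.<-irrefl (sym z) e<i′))) (l (s w i) (inc h) (inc (w i))))
          where
          l : ∀ x y z → x ℤ.+ y ℤ.+ z ≡ x ℤ.+ z ℤ.+ y
          l = ℤS.solve-∀

        u≥0 : ∀ i → i ≤ n → + 0 ℤ.≤ s u i
        u≥0 i p with i ℕ.≤? e
        ... | yes q = subst (+ 0 ℤ.≤_) (sym (s-u-low i q)) (s≥0 i q)
        -- Past e the sum equals `height (i+1)` plus the drop of `s w` from e to e + 1, both
        -- nonnegative.
        ... | no q  = subst (+ 0 ℤ.≤_) eq (ℤP.+-mono-≤ (P.height-≥0 (s≤s p)) (ℤP.i≤j⇒0≤j-i (ℤP.≤-trans (ℤP.<⇒≤ A<0) (s≥0 e ℕP.≤-refl))))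
          where
          eq : P.height (suc i) ℤ.+ (s w e ℤ.- s w (suc e)) ≡ s u i
          eq = trans (cong (ℤ._+ (s w e ℤ.- s w (suc e))) (trans (sym (W.sP i p)) (cong (λ z → s w i ℤ.+ z) W.height-1)))
            (trans (l (s w i ℤ.+ inc h) (s w e) (inc (w e))) (trans (cong (ℤ._- inc (w e)) (sym (s-u-high i (ℕP.≰⇒> q) p))) (l′ (s u i) (inc (w e)))))
            where
            l : ∀ x y z → x ℤ.+ (y ℤ.- (y ℤ.+ z)) ≡ x ℤ.- z
            l = ℤS.solve-∀
            l′ : ∀ x z → x ℤ.+ z ℤ.- z ≡ x
            l′ = ℤS.solve-∀

        v₂ = pathQ (w e) u
        d₂ : D v₂
        d₂ = dyckQ {w e} {u} total-u u≥0

        rep₂ : Rep (e + 0) (π v₂) (w e) (shift (suc e) u)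
        rep₂ = Rep-ext (λ i → cong u (trans (ℕP.+-assoc i e 1) (cong (λ z → i + z) (ℕP.+-comm e 1)))) (Rep-shift e (repPathQ per-u d₂))

        wrapped : n′ + suc e ≡ e + n
        wrapped = trans (ℕP.+-suc n′ e) (ℕP.+-comm n e)

        rep₁ : Rep 0 (π v₁) (w e) (shift (suc e) u)
        rep₁ = repQ-as v₁ d₁ (shift-periodic (suc e) per-u)
          (trans (run-fromFun (consN h w₁) {b} {n} ℕP.≤-refl) (trans (cong w wrapped) (per e)))
          (trans (trans (cong u wrapped) (trans (per-u e) u-e)) (sym (run-fromFun (consN h w₁) {b} {0} (s≤s z≤n))))
          (λ k k<n′ → trans (put-≢ (apart k k<n′)) (sym (run-fromFun (consN h w₁) {b} {suc k} (s≤s (ℕP.m<n⇒m<1+n k<n′)))))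
          where
          apart : ∀ k → k < n′ → (k + suc e) % n ≢ e
          apart k k<n′ z = ℕP.<-irrefl (trans (sym (m<n⇒m%n≡m (ℕP.m<n⇒m<1+n k<n′))) (trans (%≡ {k} {n′} (≅-+⁻ (suc e) k≅)) (m<n⇒m%n≡m {m = n′} ℕP.≤-refl))) k<n′
            where
            k≅ : k + suc e ≅ n′ + suc e
            k≅ = ≅-trans (cong% {k + suc e} {e} (trans z (sym (m<n⇒m%n≡m e<n)))) (≅-trans (≅-sym (+n-≅ e)) (≡⇒≅ (sym wrapped)))

        πv₂-v₁ : π v₂ ≡ rotPow e (π v₁)
        πv₂-v₁ = relate e (Rep-≅ (≡⇒≅ (ℕP.+-comm e 0)) rep₂) rep₁

        stat₂ : ∀ f → stat f v₂ ≡ stat f v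
        stat₂ f = trans (stat-pathQ f (w e) u) (trans (weight-u f) (sym (stat-wP f)))

        rot₂ : rotLPair (π v₂) ≡ π v
        rot₂ = trans (cong rotLPair πv₂-v₁) (sym πv-v₁)

      unrotate-step : ∃ λ v′ → D v′ × rotLPair (π v′) ≡ π v × (∀ f → stat f v′ ≡ stat f v)
      unrotate-step = v₂ , d₂ , rot₂ , stat₂

    unrotate : ∃ λ v′ → D v′ × rotLPair (π v′) ≡ π v × (∀ f → stat f v′ ≡ stat f v)
    unrotate = Step.unrotate-step (proj₁ laser₀) (proj₁ (proj₂ laser₀)) (proj₂ (proj₂ laser₀))

  Turned : ℕ → Vec ℕ b → Set
  Turned z v = ∃ λ v′ → D v′ × rotPow z (π v′) ≡ π v × (∀ f → stat f v′ ≡ stat f v)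

  unrotate-by : ∀ z v → D v → Turned z v
  unrotate-by zero    v d = v , d , refl , λ f → refl
  unrotate-by (suc z) v d = go (unrotate v d)
    where
    go : (∃ λ v′ → D v′ × rotLPair (π v′) ≡ π v × (∀ f → stat f v′ ≡ stat f v)) → Turned (suc z) v
    go (v₁ , d₁ , e₁ , t₁) = go′ (unrotate-by z v₁ d₁)
      where
      go′ : Turned z v₁ → Turned (suc z) v
      go′ (v₂ , d₂ , e₂ , t₂) = v₂ , d₂ , trans (cong rotLPair e₂) e₁ , λ f → trans (t₂ f) (t₁ f)

  -- Turning by z is undoing a turn by z n - z.
  rotate-by : ∀ z v → D v → ∃ λ v′ → D v′ × π v′ ≡ rotPow z (π v) × (∀ f → stat f v′ ≡ stat f v)
  rotate-by z v d = go (unrotate-by (z * n ∸ z) v d)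
    where
    full : ∀ x → rotPow z (rotPow (z * n ∸ z) x) ≡ x
    full x = trans (sym (rotPow-+ z (z * n ∸ z) x)) (rotPow-≅ {z + (z * n ∸ z)} {0} x (≅-trans (≡⇒≅ (ℕP.m+[n∸m]≡n (ℕP.m≤m*n z n))) (+kn-≅ 0 z)))
    go : Turned (z * n ∸ z) v → ∃ λ v′ → D v′ × π v′ ≡ rotPow z (π v) × (∀ f → stat f v′ ≡ stat f v)
    go (v′ , d′ , e , t) = v′ , d′ , trans (sym (full (π v′))) (cong (rotPow z) e) , t

-- The central block.

greatest : ∀ {P : ℕ → Set} → (∀ i → Dec (P i)) → ∀ m → (∃ λ c → c < m × P c × (∀ l → c < l → l < m → ¬ P l)) ⊎ (∀ l → l < m → ¬ P l)
greatest P? zero    = inj₂ λ l ()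
greatest {P} P? (suc m) with P? m
... | yes p = inj₁ (m , ℕP.≤-refl , p , λ l m<l l<sm → ⊥-elim (ℕP.<⇒≱ m<l (ℕ.s≤s⁻¹ l<sm)))
... | no np with greatest P? m
...   | inj₁ (c , c<m , pc , g) = inj₁ (c , ℕP.m<n⇒m<1+n c<m , pc , λ l c<l l<sm → up l c<l (ℕP.m≤n⇒m<n∨m≡n (ℕ.s≤s⁻¹ l<sm)))
  where
  up : ∀ l → c < l → l < m ⊎ l ≡ m → ¬ P l
  up l c<l (inj₁ q)    = g l c<l q
  up l c<l (inj₂ refl) = np
...   | inj₂ g = inj₂ λ l l<sm → up l (ℕP.m≤n⇒m<n∨m≡n (ℕ.s≤s⁻¹ l<sm))
  where
  up : ∀ l → l < m ⊎ l ≡ m → ¬ P l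
  up l (inj₁ q)    = g l q
  up l (inj₂ refl) = np

argmin : ∀ (f : ℕ → ℤ) lo d → ∃ λ k → lo ≤ k × k ≤ lo + d × (∀ l → lo ≤ l → l ≤ lo + d → f k ℤ.≤ f l)
argmin f lo zero = lo , ℕP.≤-refl , ℕP.m≤m+n lo 0 , λ l p q → ℤP.≤-reflexive (cong f (ℕP.≤-antisym p (subst (l ≤_) (ℕP.+-identityʳ lo) q)))
argmin f lo (suc d) with argmin f lo d
... | k , p , q , mn with f k ℤ.≤? f (lo + suc d)
...   | yes h = k , p , ℕP.≤-trans q (ℕP.+-monoʳ-≤ lo (ℕP.n≤1+n d)) , λ l a b → up l a (ℕP.m≤n⇒m<n∨m≡n b)
  where
  up : ∀ l → lo ≤ l → l < lo + suc d ⊎ l ≡ lo + suc d → f k ℤ.≤ f l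
  up l a (inj₁ b)    = mn l a (ℕ.s≤s⁻¹ (subst (l <_) (ℕP.+-suc lo d) b))
  up l a (inj₂ refl) = h
...   | no h  = lo + suc d , ℕP.m≤m+n lo (suc d) , ℕP.≤-refl , λ l a b → up l a (ℕP.m≤n⇒m<n∨m≡n b)
  where
  up : ∀ l → lo ≤ l → l < lo + suc d ⊎ l ≡ lo + suc d → f (lo + suc d) ℤ.≤ f l
  up l a (inj₁ b)    = ℤP.≤-trans (ℤP.<⇒≤ (ℤP.≰⇒> h)) (mn l a (ℕ.s≤s⁻¹ (subst (l <_) (ℕP.+-suc lo d) b)))
  up l a (inj₂ refl) = ℤP.≤-refl

-- The blocks of P and Q are the vertices of a plane tree with b vertices whose
-- edges are the labels; its centroid is a block all of whose cyclic gaps are at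
-- most b/2. It is found below the last label whose subtree is heavier than b/2.
module Centroid (a n : ℕ) (v : Vec ℕ (suc n)) (a>0 : 0 < a) (cop : Coprime a (suc n)) (dyck : Dyck a (suc n) v) where

  private
    b = suc n

  open Path a n v a>0 cop dyck

  Near : ℕ → ℕ → ℕ → Set
  Near i t j = i + t ≡ j ⊎ i + t ≡ j + n

  CentralP : ℕ → Set
  CentralP k = ∀ i → 0 < i → i ≤ n → IsPrev height i k →
    ∃₂ λ j t → 0 < j × j ≤ n × IsPrev height j k × 0 < t × t + t ≤ b × Near i t j

  CentralQ : ℕ → Set
  CentralQ e = ∀ i → 0 < i → i ≤ n → laser i ≡ e →
    ∃₂ λ j t → 0 < j × j ≤ n × laser j ≡ e × 0 < t × t + t ≤ n × Near i t j

  nextSibling : ∀ {i k} → 0 < i → i ≤ n → IsPrev height i k → height k ℤ.< height (suc (laser i)) → IsPrev height (suc (laser i)) k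
  nextSibling {i} {k} p h (isPrev x y z) lt = isPrev (ℕP.<-trans x (s≤s (IsNext.after nx))) lt up
    where
    nx = proj₁ (laser-spec p h)
    up : ∀ l → k < l → l < suc (laser i) → height (suc (laser i)) ℤ.≤ height l
    up l k<l l≤ with ℕP.<-cmp l i
    ... | tri< l<i _ _  = ℤP.≤-trans (ℤP.<⇒≤ (IsNext.below nx)) (z l k<l l<i)
    ... | tri≈ _ refl _ = ℤP.<⇒≤ (IsNext.below nx)
    ... | tri> _ _ i<l  = ℤP.≤-trans (ℤP.<⇒≤ (IsNext.below nx)) (IsNext.above nx l i<l (ℕ.s≤s⁻¹ l≤))

  strict : ∀ {i j} → 0 < i → i < j → j ≤ n → height j ℤ.≤ height i → height j ℤ.< height i
  strict {i} {j} p i<j j≤n le = ℤP.≤∧≢⇒< le (λ e → height-≢ i<j (ℕP.≤-<-trans j≤n (ℕP.<-≤-trans (ℕP.n<1+n n) (ℕP.m≤n+m b i))) (sym e))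

  -- The labels i to `laser i` form the branch attached to the P-block of i by the edge i; it has as
  -- many vertices as labels. Inequalities are doubled to avoid halves.
  Heavy : ℕ → Set
  Heavy i = 0 < i × b + (i + i) < suc (laser i) + suc (laser i)

  heavy? : ∀ i → Dec (Heavy i)
  heavy? i with 0 ℕ.<? i | b + (i + i) ℕ.<? suc (laser i) + suc (laser i)
  ... | yes p | yes q = yes (p , q)
  ... | no p  | _     = no (λ h → p (proj₁ h))
  ... | yes _ | no q  = no (λ h → q (proj₂ h))

  private
    gap≤ : ∀ {i x} → i ≤ x → x + x ≤ b + (i + i) → (x ∸ i) + (x ∸ i) ≤ b
    gap≤ {i} {x} i≤x h = ℕP.+-cancelʳ-≤ (i + i) _ _ (subst (_≤ b + (i + i)) (sym eq) h)
      where
      l : ∀ d i → d + d + (i + i) ≡ (d + i) + (d + i)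
      l = ℕS.solve-∀
      eq : (x ∸ i) + (x ∸ i) + (i + i) ≡ x + x
      eq = trans (l (x ∸ i) i) (cong₂ _+_ (ℕP.m∸n+n≡m i≤x) (ℕP.m∸n+n≡m i≤x))

  light-gap : ∀ {i} → 0 < i → i ≤ n → ¬ Heavy i → let t = suc (laser i) ∸ i in 0 < t × t + t ≤ b × i + t ≡ suc (laser i)
  light-gap {i} p h nh = ℕP.m<n⇒0<n∸m i< , gap≤ (ℕP.<⇒≤ i<) (ℕP.≮⇒≥ (λ q → nh (p , q))) , ℕP.m+[n∸m]≡n (ℕP.<⇒≤ i<)
    where
    i< : i < suc (laser i)
    i< = s≤s (IsNext.after (proj₁ (laser-spec p h)))

  firstPrev : 0 < n → IsPrev height 1 0
  firstPrev n>0 = isPrev (s≤s z≤n) (subst (ℤ._< height 1) (sym height-0) (height->0 (s≤s z≤n) n>0)) (λ l p q → ⊥-elim (ℕP.<⇒≱ p (ℕ.s≤s⁻¹ q)))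

  -- The next label of the root block comes right behind the laser; behind the last laser, which
  -- ends at n, the circle closes at label 1.
  rootCentral : (∀ i → i < b → ¬ Heavy i) → CentralP 0
  rootCentral light i p h ip = go (ℕP.m≤n⇒m<n∨m≡n (proj₂ (laser-spec p h)))
    where
    g = light-gap p h (light i (s≤s h))
    go : laser i < n ⊎ laser i ≡ n → ∃₂ λ j t → 0 < j × j ≤ n × IsPrev height j 0 × 0 < t × t + t ≤ b × Near i t j
    go (inj₂ e) = 1 , suc (laser i) ∸ i , s≤s z≤n , ℕP.≤-trans p h , firstPrev (ℕP.≤-trans p h) , proj₁ g , proj₁ (proj₂ g) , inj₂ (trans (proj₂ (proj₂ g)) (cong suc e))
    go (inj₁ l) = suc (laser i) , suc (laser i) ∸ i , s≤s z≤n , l , nextSibling p h ip (subst (ℤ._< height (suc (laser i))) (sym height-0) (height->0 (s≤s z≤n) l)) , proj₁ g , proj₁ (proj₂ g) , inj₁ (proj₂ (proj₂ g))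

  module HeavyCase (c : ℕ) (c≤n : c ≤ n) (hc : Heavy c) (top : ∀ l → c < l → l < b → ¬ Heavy l) where

    private
      e = laser c
      c>0 = proj₁ hc
      nc : IsNext height c e
      nc = proj₁ (laser-spec c>0 c≤n)
      e≤n : e ≤ n
      e≤n = proj₂ (laser-spec c>0 c≤n)

    -- a big gap of the Q-block of c, seen from the P-block beyond it
    Bad : ℕ → Set
    Bad i = laser i ≡ e × ∃ λ k → IsPrev height i k × c ≤ k × b + (k + k) ≤ i + i

    bad? : (t : Fin n) → Dec (Bad (suc (toℕ t)))
    bad? t with hasPrev {suc (toℕ t)} (s≤s z≤n) (FinP.toℕ<n t)
    ... | k , p with laser (suc (toℕ t)) ℕ.≟ e | c ℕ.≤? k | b + (k + k) ℕ.≤? suc (toℕ t) + suc (toℕ t)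
    ...   | yes x | yes y | yes z = yes (x , k , p , y , z)
    ...   | no x  | _     | _     = no (λ h → x (proj₁ h))
    ...   | yes _ | no y  | _     = no (λ { (_ , k′ , p′ , y′ , _) → y (subst (c ≤_) (isPrev-unique p′ p) y′) })
    ...   | yes _ | yes _ | no z  = no (λ { (_ , k′ , p′ , _ , z′) → z (subst (λ k → b + (k + k) ≤ suc (toℕ t) + suc (toℕ t)) (isPrev-unique p′ p) z′) })

    above-prev : ∀ {i k l} → IsPrev height i k → k < l → l < i ⊎ l ≡ i → height k ℤ.< height l
    above-prev pi k<l (inj₁ q)    = ℤP.<-≤-trans (IsPrev.below pi) (IsPrev.above pi _ k<l q)
    above-prev pi k<l (inj₂ refl) = IsPrev.below pi

    badCentral : ∀ {i k} → 0 < i → i ≤ n → laser i ≡ e → IsPrev height i k → c ≤ k → b + (k + k) ≤ i + i → CentralP k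
    badCentral {i} {k} i>0 i≤n li pi c≤k big j j>0 j≤n pj with ℕP.<-cmp j i
    ... | tri< j<i _ _ = suc (laser j) , suc (laser j) ∸ j , s≤s z≤n , ℕP.≤-trans e′<i i≤n , nextSibling j>0 j≤n pj k<e′ , proj₁ g , proj₁ (proj₂ g) , inj₁ (proj₂ (proj₂ g))
      where
      g = light-gap j>0 j≤n (top j (ℕP.≤-<-trans c≤k (IsPrev.before pj)) (s≤s j≤n))
      nj = proj₁ (laser-spec j>0 j≤n)
      hi<hj : height i ℤ.< height j
      hi<hj = strict j>0 j<i i≤n (IsPrev.above pi j (IsPrev.before pj) j<i)
      e′<i : suc (laser j) ≤ i
      e′<i = ℕP.≰⇒> (λ i≤e′ → ℤP.<⇒≱ hi<hj (IsNext.above nj i j<i i≤e′))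
      k<e′ : height k ℤ.< height (suc (laser j))
      k<e′ = above-prev pi (ℕP.<-trans (IsPrev.before pj) (s≤s (IsNext.after nj))) (ℕP.m≤n⇒m<n∨m≡n e′<i)
    -- From i the circle closes at the first label k + 1; this gap is short because i - k is at
    -- least b/2.
    ... | tri≈ _ refl _ = suc k , n + suc k ∸ i , s≤s z≤n , ℕP.≤-trans (IsPrev.before pi) i≤n , firstChild pi , ℕP.m<n⇒0<n∸m i<nk , t≤ , inj₂ (trans (ℕP.m+[n∸m]≡n (ℕP.<⇒≤ i<nk)) (ℕP.+-comm n (suc k)))
      where
      i<nk : i < n + suc k
      i<nk = ℕP.≤-<-trans i≤n (ℕP.m<m+n n (s≤s z≤n))
      t≤ : (n + suc k ∸ i) + (n + suc k ∸ i) ≤ b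
      t≤ = gap≤ (ℕP.<⇒≤ i<nk) (subst (_≤ b + (i + i)) (l n k) (ℕP.+-monoʳ-≤ b big))
        where
        l : ∀ n k → suc n + (suc n + (k + k)) ≡ (n + suc k) + (n + suc k)
        l = ℕS.solve-∀
    -- A label of the block after i would be at or beyond e + 1, where the path has already fallen
    -- below the level of k.
    ... | tri> _ _ i<j = ⊥-elim (contra (ℕP.m≤n⇒m<n∨m≡n se≤j))
      where
      ni : IsNext height i e
      ni = subst (IsNext height i) li (proj₁ (laser-spec i>0 i≤n))
      hj<hi : height j ℤ.< height i
      hj<hi = strict i>0 i<j j≤n (IsPrev.above pj i (IsPrev.before pi) i<j)
      se≤j : suc e ≤ j
      se≤j = ℕP.≰⇒> (λ j≤e → ℤP.<⇒≱ hj<hi (IsNext.above ni j i<j j≤e))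
      k≤e : k ≤ e
      k≤e = ℕP.<⇒≤ (ℕP.<-≤-trans (IsPrev.before pi) (IsNext.after ni))
      hc≤hk : height c ℤ.≤ height k
      hc≤hk with ℕP.m≤n⇒m<n∨m≡n c≤k
      ... | inj₁ q    = IsNext.above nc k q k≤e
      ... | inj₂ refl = ℤP.≤-refl
      se<k : height (suc e) ℤ.< height k
      se<k = ℤP.<-≤-trans (IsNext.below nc) hc≤hk
      contra : suc e < j ⊎ suc e ≡ j → ⊥
      contra (inj₁ q)    = ℤP.<-asym (IsPrev.below pj) (ℤP.≤-<-trans (IsPrev.above pj (suc e) (s≤s k≤e) q) se<k)
      contra (inj₂ refl) = ℤP.<-asym (IsPrev.below pj) se<k

    private
      half-gap : n + c ∸ e + (n + c ∸ e) ≤ n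
      half-gap = ℕP.+-cancelʳ-≤ (e + e + (suc (suc n))) _ _ (subst₂ _≤_ (sym eq) (l₂ n e) (ℕP.+-monoʳ-≤ (n + n) (proj₂ hc)))
        where
        e≤nc : e ≤ n + c
        e≤nc = ℕP.≤-trans e≤n (ℕP.m≤m+n n c)
        l₁ : ∀ d e m → d + d + (e + e + m) ≡ (d + e) + (d + e) + m
        l₁ = ℕS.solve-∀
        l₂ : ∀ n e → n + n + (suc e + suc e) ≡ n + (e + e + suc (suc n))
        l₂ = ℕS.solve-∀
        l₃ : ∀ n c → (n + c) + (n + c) + suc (suc n) ≡ n + n + suc (suc n + (c + c))
        l₃ = ℕS.solve-∀
        eq : n + c ∸ e + (n + c ∸ e) + (e + e + suc (suc n)) ≡ n + n + suc (suc n + (c + c))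
        eq = trans (l₁ (n + c ∸ e) e (suc (suc n))) (trans (cong (λ x → x + x + suc (suc n)) (ℕP.m∸n+n≡m e≤nc)) (l₃ n c))

      2c≤n : c + c ≤ n
      2c≤n = ℕP.+-cancelˡ-≤ (suc b) _ _ (ℕP.≤-trans (proj₂ hc) (ℕP.≤-trans (ℕP.+-mono-≤ (s≤s e≤n) (s≤s e≤n)) (ℕP.≤-reflexive (ℕP.+-suc b n))))

    -- The step may skip labels of the block; for centrality only its length counts.
    Gap : ℕ → Set
    Gap i = ∃₂ λ j t → 0 < j × j ≤ n × laser j ≡ e × 0 < t × t + t ≤ n × Near i t j

    gap-last : Gap e
    gap-last = c , n + c ∸ e , c>0 , c≤n , refl , ℕP.m<n⇒0<n∸m e<nc , half-gap , inj₂ (trans (ℕP.m+[n∸m]≡n (ℕP.<⇒≤ e<nc)) (ℕP.+-comm n c))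
      where
      e<nc : e < n + c
      e<nc = ℕP.≤-<-trans e≤n (ℕP.m<m+n n c>0)

    gap-before : ∀ {i} → i < c → Gap i
    gap-before {i} i<c = c , c ∸ i , c>0 , c≤n , refl , ℕP.m<n⇒0<n∸m i<c , ℕP.≤-trans (ℕP.+-mono-≤ (ℕP.m∸n≤m c i) (ℕP.m∸n≤m c i)) 2c≤n , inj₁ (ℕP.m+[n∸m]≡n (ℕP.<⇒≤ i<c))

    -- k minimises the height between i and e, so it belongs to the same Q-block and its nearest
    -- smaller value is i. A step to k of half a turn or more would make k bad.
    gap-inside : (∀ i → 0 < i → i ≤ n → ¬ Bad i) → ∀ {i k} → 0 < i → i ≤ n → c ≤ i → IsNext height i e → i < e →
      i < k → k ≤ e → (∀ l → i < l → l ≤ e → height k ℤ.≤ height l) → Gap i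
    gap-inside good {i} {k} p h c≤i ni i<e a₁ k≤e mn = k , k ∸ i , k>0 , k≤n , lk , ℕP.m<n⇒0<n∸m a₁ , t≤ , inj₁ (ℕP.m+[n∸m]≡n (ℕP.<⇒≤ a₁))
      where
      k>0 = ℕP.≤-<-trans z≤n a₁
      k≤n = ℕP.≤-trans k≤e e≤n
      hi<hk : height i ℤ.< height k
      hi<hk = ℤP.≤∧≢⇒< (IsNext.above ni k a₁ k≤e) (height-≢ a₁ (ℕP.≤-<-trans k≤n (ℕP.<-≤-trans (ℕP.n<1+n n) (ℕP.m≤n+m b i))))
      pk : IsPrev height k i
      pk = isPrev a₁ hi<hk (λ l i<l l<k → mn l i<l (ℕP.<⇒≤ (ℕP.<-≤-trans l<k k≤e)))
      lk : laser k ≡ e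
      lk = isNext⇒laser k>0 k≤n (isNext k≤e (ℤP.<-trans (IsNext.below ni) hi<hk) (λ l k<l l≤e → mn l (ℕP.<-trans a₁ k<l) l≤e))
      t≤ : (k ∸ i) + (k ∸ i) ≤ n
      t≤ = ℕ.s≤s⁻¹ (ℕP.+-cancelʳ-< (i + i) _ _ (subst (_< b + (i + i)) eq (ℕP.≰⇒> (λ big → good k k>0 k≤n (lk , i , pk , c≤i , big)))))
        where
        l : ∀ d i → (d + i) + (d + i) ≡ d + d + (i + i)
        l = ℕS.solve-∀
        eq : k + k ≡ (k ∸ i) + (k ∸ i) + (i + i)
        eq = trans (sym (cong₂ _+_ (ℕP.m∸n+n≡m (ℕP.<⇒≤ a₁)) (ℕP.m∸n+n≡m (ℕP.<⇒≤ a₁)))) (l (k ∸ i) i)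

    goodCentral : (∀ i → 0 < i → i ≤ n → ¬ Bad i) → CentralQ e
    goodCentral good i p h li = go (ℕP.m≤n⇒m<n∨m≡n (IsNext.after ni)) (i ℕ.<? c)
      where
      ni : IsNext height i e
      ni = subst (IsNext height i) li (proj₁ (laser-spec p h))
      inside : c ≤ i → i < e → (∃ λ k → suc i ≤ k × k ≤ suc i + (e ∸ suc i) × (∀ l → suc i ≤ l → l ≤ suc i + (e ∸ suc i) → height k ℤ.≤ height l)) → Gap i
      inside c≤i i<e (k , a₁ , a₂ , mn) = gap-inside good p h c≤i ni i<e a₁ (subst (k ≤_) end a₂) (λ l x y → mn l x (subst (l ≤_) (sym end) y))
        where
        end : suc i + (e ∸ suc i) ≡ e
        end = ℕP.m+[n∸m]≡n i<e
      go : i < e ⊎ i ≡ e → Dec (i < c) → Gap i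
      go (inj₂ q)   _         = subst Gap (sym q) gap-last
      go (inj₁ _)   (yes i<c) = gap-before i<c
      go (inj₁ i<e) (no i≮c)  = inside (ℕP.≮⇒≥ i≮c) i<e (argmin height (suc i) (e ∸ suc i))

    centralBlock : (∃₂ λ i k → 0 < i × i ≤ n × IsPrev height i k × CentralP k) ⊎ (∃ λ i → 0 < i × i ≤ n × CentralQ (laser i))
    centralBlock with FinP.any? bad?
    ... | yes (t , l , k , p , q , r) = inj₁ (suc (toℕ t) , k , s≤s z≤n , FinP.toℕ<n t , p , badCentral (s≤s z≤n) (FinP.toℕ<n t) l p q r)
    ... | no none = inj₂ (c , c>0 , c≤n , goodCentral (λ { (suc i) _ h bad → none (fromℕ< h , subst (λ z → Bad (suc z)) (sym (FinP.toℕ-fromℕ< h)) bad) }))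

  centroid : 0 < n → (∃₂ λ i k → 0 < i × i ≤ n × IsPrev height i k × CentralP k) ⊎ (∃ λ i → 0 < i × i ≤ n × CentralQ (laser i))
  centroid n>0 with greatest heavy? b
  ... | inj₂ light = inj₁ (1 , 0 , s≤s z≤n , n>0 , firstPrev n>0 , rootCentral light)
  ... | inj₁ (c , c<b , hc , top) = HeavyCase.centralBlock c (ℕ.s≤s⁻¹ c<b) hc top

-- Central classes of noncrossing partitions are invariant.

module Noncrossing (n′ : ℕ) (R : ℕ → ℕ → Set)
  (R-resp : ∀ {i i′ j j′} → Access._≅_ n′ i i′ → Access._≅_ n′ j j′ → R i j → R i′ j′)
  (R-refl : ∀ {i} → R i i) (R-sym : ∀ {i j} → R i j → R j i) (R-trans : ∀ {i j k} → R i j → R j k → R i k)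
  (linear : ∀ {i i′ j j′} → i < i′ → i′ < j → j < j′ → j′ < suc n′ → R i j → R i′ j′ → R i i′)
  where

  private
    n = suc n′
    b = suc n

  open Access n′

  private
    back : ∀ {l} → n ≤ l → l ∸ n + n ≡ l
    back = ℕP.m∸n+n≡m

    back≅ : ∀ {l} → n ≤ l → l ≅ l ∸ n
    back≅ {l} h = ≅-trans (≡⇒≅ (sym (back h))) (+n-≅ (l ∸ n))

    low : ∀ {l i} → n ≤ l → l < i + n → l ∸ n < i
    low {l} {i} h p = ℕP.+-cancelʳ-< n (l ∸ n) i (subst (_< i + n) (sym (back h)) p)

    less : ∀ {k l} → n ≤ k → k < l → k ∸ n < l ∸ n
    less h p = ℕP.∸-monoˡ-< p h

    cyclic₀ : ∀ {i i′ j j′} → i < n → i < i′ → i′ < j → j < j′ → j′ < i + n → R i j → R i′ j′ → R i i′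
    cyclic₀ {i} {i′} {j} {j′} i<n x y z u r r′ with j′ ℕ.<? n
    ... | yes j′<n = linear x y z j′<n r r′
    ... | no j′≮n with j ℕ.<? n
    ...   | yes j<n = R-trans (R-sym moved) (R-resp (back≅ n≤j′) ≅-refl (R-sym r′))
      where
      n≤j′ = ℕP.≮⇒≥ j′≮n
      moved : R (j′ ∸ n) i
      moved = linear (low n≤j′ u) x y j<n (R-resp (back≅ n≤j′) ≅-refl (R-sym r′)) r
    ...   | no j≮n with i′ ℕ.<? n
    ...     | yes i′<n = R-trans r (R-trans (R-resp (≅-sym (back≅ n≤j)) (≅-sym (back≅ n≤j′)) moved) (R-sym r′))
      where
      n≤j = ℕP.≮⇒≥ j≮n
      n≤j′ = ℕP.≮⇒≥ j′≮n
      moved : R (j ∸ n) (j′ ∸ n)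
      moved = linear (less n≤j z) (low n≤j′ u) x i′<n (R-resp (back≅ n≤j) ≅-refl (R-sym r)) (R-resp (back≅ n≤j′) ≅-refl (R-sym r′))
    ...     | no i′≮n = R-trans r (R-sym (R-resp (≅-sym (back≅ n≤i′)) (≅-sym (back≅ n≤j)) moved))
      where
      n≤i′ = ℕP.≮⇒≥ i′≮n
      n≤j = ℕP.≮⇒≥ j≮n
      n≤j′ = ℕP.≮⇒≥ j′≮n
      moved : R (i′ ∸ n) (j ∸ n)
      moved = linear (less n≤i′ y) (less n≤j z) (low n≤j′ u) i<n (R-resp (back≅ n≤i′) (back≅ n≤j′) r′) (R-resp (back≅ n≤j) ≅-refl (R-sym r))

  -- Points past the end are moved back by n; in each of the four cases the points then reappear in
  -- linear order, with the two classes interleaved again.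
  cyclic : ∀ {i i′ j j′} → i < i′ → i′ < j → j < j′ → j′ < i + n → R i j → R i′ j′ → R i i′
  cyclic {i} {i′} {j} {j′} x y z u r r′ = R-resp (≅-sym (down≅ ℕP.≤-refl)) (≅-sym (down≅ (ℕP.<⇒≤ x)))
    (cyclic₀ (subst (_< n) (sym i∸q) (m%n<n i n)) (ℕP.∸-monoˡ-< x q≤i) (ℕP.∸-monoˡ-< y q≤i′) (ℕP.∸-monoˡ-< z q≤j)
      (ℕP.+-cancelʳ-< q _ _ (subst₂ _<_ (sym (ℕP.m∸n+n≡m q≤j′)) (trans (cong (_+ n) (sym (ℕP.m∸n+n≡m q≤i))) (swap (i ∸ q) q n)) u))
      (R-resp (down≅ ℕP.≤-refl) (down≅ (ℕP.<⇒≤ (ℕP.<-trans x y))) r) (R-resp (down≅ (ℕP.<⇒≤ x)) (down≅ (ℕP.<⇒≤ (ℕP.<-trans x (ℕP.<-trans y z)))) r′))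
    where
    q = (i / n) * n
    swap : ∀ k t m → k + t + m ≡ k + m + t
    swap = ℕS.solve-∀
    q≤i : q ≤ i
    q≤i = subst (q ≤_) (sym (m≡m%n+[m/n]*n i n)) (ℕP.m≤n+m q (i % n))
    q≤i′ = ℕP.≤-trans q≤i (ℕP.<⇒≤ x)
    q≤j = ℕP.≤-trans q≤i′ (ℕP.<⇒≤ y)
    q≤j′ = ℕP.≤-trans q≤j (ℕP.<⇒≤ z)
    i∸q : i ∸ q ≡ i % n
    i∸q = trans (cong (_∸ q) (m≡m%n+[m/n]*n i n)) (ℕP.m+n∸n≡m (i % n) q)
    down≅ : ∀ {l} → i ≤ l → l ≅ l ∸ q
    down≅ {l} h = ≅-trans (≡⇒≅ (sym (ℕP.m∸n+n≡m (ℕP.≤-trans q≤i h)))) (+kn-≅ (l ∸ q) (i / n))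

  module _ (R? : ∀ i j → Dec (R i j)) (m i₀ : ℕ) (m>0 : 0 < m)
    (inv : ∀ {i j} → R i j → R (i + m) (j + m)) (inv⁻ : ∀ {i j} → R (i + m) (j + m) → R i j)
    (central : ∀ {i} → R i₀ i → ∃ λ t → 0 < t × t + t ≤ b × R i₀ (i + t)) where

    private
      p = i₀ + m

      Around : Set
      Around = ∃ λ c → ∃ λ t → c < p × p < c + t × t + t ≤ b × R i₀ c × R i₀ (c + t)

      -- Walking on from i₀ by the steps of `central`, the class must at some point step over p.
      around : ¬ R i₀ p → ∀ f c → p ≤ c + f → c < p → R i₀ c → Around
      around np zero    c h c<p r = ⊥-elim (ℕP.<⇒≱ c<p (subst (p ≤_) (ℕP.+-identityʳ c) h))
      around np (suc f) c h c<p r = go (central r)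
        where
        go : (∃ λ t → 0 < t × t + t ≤ b × R i₀ (c + t)) → Around
        go (t , t>0 , t≤ , r′) with ℕP.<-cmp (c + t) p
        ... | tri≈ _ q _ = ⊥-elim (np (subst (R i₀) q r′))
        ... | tri> _ _ q = c , t , c<p , q , t≤ , r , r′
        ... | tri< q _ _ = around np f (c + t) (ℕP.≤-trans h (subst (_≤ c + t + f) (ℕP.+-assoc c 1 f) (ℕP.+-monoˡ-≤ f (ℕP.+-monoʳ-≤ c t>0)))) q r′

      central′ : ∀ {j} → p ≤ j → R p j → ∃ λ t → 0 < t × t + t ≤ b × R p (j + t)
      central′ {j} p≤j r = go (central (inv⁻ (subst (R p) (sym e) r)))
        where
        m≤j : m ≤ j
        m≤j = ℕP.≤-trans (ℕP.m≤n+m m i₀) p≤j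
        e : j ∸ m + m ≡ j
        e = ℕP.m∸n+n≡m m≤j
        go : (∃ λ t → 0 < t × t + t ≤ b × R i₀ (j ∸ m + t)) → ∃ λ t → 0 < t × t + t ≤ b × R p (j + t)
        go (t , t>0 , t≤ , r′) = t , t>0 , t≤ , subst (R p) (trans (swap (j ∸ m) t m) (cong (_+ t) e)) (inv r′)
          where
          swap : ∀ k t m → k + t + m ≡ k + m + t
          swap = ℕS.solve-∀

      -- The class of p is central as well and walks on from p. It can neither meet nor cross the
      -- class of i₀, so from inside the gap (c, c + t) it would have to jump past c + n at once.
      escape : ¬ R i₀ p → ∀ {c t} → c < p → t + t ≤ b → R i₀ c → R i₀ (c + t) → ∀ f j → c + t ≤ j + f → p ≤ j → j < c + t → R p j → ⊥
      escape np c<p t≤ rc rt zero j h p≤j j< r = ℕP.<⇒≱ j< (subst (_ ≤_) (ℕP.+-identityʳ j) h)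
      escape np {c} {t} c<p t≤ rc rt (suc f) j h p≤j j< r = go (central′ p≤j r)
        where
        distinct : ∀ {l} → R i₀ l → R p l → ⊥
        distinct x y = np (R-trans x (R-sym y))
        go : (∃ λ t → 0 < t × t + t ≤ b × R p (j + t)) → ⊥
        go (t′ , t′>0 , t′≤ , r′) with ℕP.<-cmp (j + t′) (c + t)
        ... | tri≈ _ q _ = distinct rt (subst (R p) q r′)
        ... | tri< q _ _ = escape np c<p t≤ rc rt f (j + t′) (ℕP.≤-trans h (subst (_≤ j + t′ + f) (ℕP.+-assoc j 1 f) (ℕP.+-monoˡ-≤ f (ℕP.+-monoʳ-≤ j t′>0)))) (ℕP.≤-trans p≤j (ℕP.m≤m+n j t′)) q r′
        ... | tri> _ _ q with ℕP.<-cmp (j + t′) (c + n)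
        ...   | tri< u _ _ = distinct (R-trans rc (cyclic (ℕP.<-≤-trans c<p p≤j) j< q u (R-trans (R-sym rc) rt) (R-trans (R-sym r) r′))) r
        ...   | tri≈ _ u _ = distinct rc (R-resp ≅-refl (+n-≅ c) (subst (R p) u r′))
        ...   | tri> _ _ u = ℕP.<⇒≱ (ℕP.<-≤-trans strict (ℕP.+-mono-≤ t≤ t′≤)) (ℕP.≤-reflexive (l₀ n))
          where
          l₀ : ∀ n → suc n + suc n ≡ n + n + 2
          l₀ = ℕS.solve-∀
          l₁ : ∀ c j n → suc j + suc (c + n) ≡ suc (suc n) + (c + j)
          l₁ = ℕS.solve-∀
          l₂ : ∀ c j t t′ → (c + t) + (j + t′) ≡ (t + t′) + (c + j)
          l₂ = ℕS.solve-∀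
          -- Gap and jump together would exceed a full turn, against 2t + 2t′ <= 2b = 2n + 2.
          sum : suc (suc n) ≤ t + t′
          sum = ℕP.+-cancelʳ-≤ (c + j) _ _ (subst₂ _≤_ (l₁ c j n) (l₂ c j t t′) (ℕP.+-mono-≤ j< u))
          l₃ : ∀ t t′ → t + t′ + (t + t′) ≡ t + t + (t′ + t′)
          l₃ = ℕS.solve-∀
          l₄ : ∀ n → suc (suc n) + suc (suc n) ≡ suc (suc (n + n + 2))
          l₄ = ℕS.solve-∀
          strict : n + n + 2 < t + t + (t′ + t′)
          strict = ℕP.<-≤-trans (ℕP.n<1+n _) (ℕP.≤-trans (ℕP.n≤1+n _) (subst₂ _≤_ (l₄ n) (l₃ t t′) (ℕP.+-mono-≤ sum sum)))

    -- In a noncrossing partition a class all of whose gaps are at most half a turn meets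
    -- every rotation of itself that is again a class.
    central-invariant : R i₀ (i₀ + m)
    central-invariant with R? i₀ p
    ... | yes r = r
    ... | no np = ⊥-elim (go (around np m i₀ ℕP.≤-refl (ℕP.m<m+n i₀ m>0) R-refl))
      where
      go : Around → ⊥
      go (c , t , c<p , p<ct , t≤ , rc , rt) = escape np c<p t≤ rc rt (c + t) p (ℕP.m≤n+m (c + t) p) ℕP.≤-refl p<ct R-refl

-- The word of a fixed pair, rooted at its fixed block, has the period of the rotation.

module Rigid (a n′ : ℕ) (a>0 : 0 < a) (cop : Coprime a (suc (suc n′))) where

  private
    n = suc n′
    b = suc n
    inc = charge a b

  open Access n′
  open Cover n′ inc
  open Orbit a n′ a>0 cop
  open Closure a n′ a>0 cop

  rotPow-full : ∀ z (x : LPair n) → rotPow (z * n ∸ z) (rotPow z x) ≡ x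
  rotPow-full z x = trans (sym (rotPow-+ (z * n ∸ z) z x)) (rotPow-≅ {z * n ∸ z + z} {0} x (≅-trans (≡⇒≅ (ℕP.m∸n+n≡m (ℕP.m≤m*n z n))) (+kn-≅ 0 z)))

  rotPow-cancel : ∀ z {x y : LPair n} → rotPow z x ≡ rotPow z y → x ≡ y
  rotPow-cancel z {x} {y} e = trans (sym (rotPow-full z x)) (trans (cong (rotPow (z * n ∸ z)) e) (rotPow-full z y))

  rotPow-comm : ∀ y z (x : LPair n) → rotPow y (rotPow z x) ≡ rotPow z (rotPow y x)
  rotPow-comm y z x = trans (sym (rotPow-+ y z x)) (trans (cong (λ t → rotPow t x) (ℕP.+-comm y z)) (rotPow-+ z y x))

  fixed-unrotate : ∀ z m {x y : LPair n} → rotPow z y ≡ x → rotPow m x ≡ x → rotPow m y ≡ y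
  fixed-unrotate z m {x} {y} e f = rotPow-cancel z (trans (rotPow-comm z m y) (trans (cong (rotPow m) e) (trans f (sym e))))

  sameData : ∀ {x y : LPair n} z → rotPow z y ≡ x → SameData x y z
  sameData {x} {y} z e = subst (λ t → SameData t y z) e (rotPow-data z y)

  Rep-home : ∀ z {x h w} → Periodic w → Rep z x h w → Rep 0 x h (shift (z * n ∸ z) w)
  Rep-home z per r = Rep-≅ (≅-trans (≡⇒≅ (ℕP.m∸n+n≡m (ℕP.m≤m*n z n))) (+kn-≅ 0 z)) (Rep-shift (z * n ∸ z) r)

  weightOf-shift : ∀ f h {w} t → Periodic w → weightOf f h (shift t w) ≡ weightOf f h w
  weightOf-shift f h {w} t per = cong (λ z → f h + z) (psum-rotate (λ i → f (w i)) n (λ i → cong f (per i)) t)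

  Recurs : ℕ → (ℕ → ℕ) → Set
  Recurs m w = ∀ i → w (i + m) ≡ w i

  shift-recurs : ∀ {m w} t → Recurs m w → Recurs m (shift t w)
  shift-recurs {m} {w} t r i = trans (cong w (swap i m t)) (r (i + t))
    where
    swap : ∀ i m t → i + m + t ≡ i + t + m
    swap = ℕS.solve-∀

  recurs-< : ∀ {m w} → Periodic w → (∀ i → i < n → w (i + m) ≡ w i) → Recurs m w
  recurs-< {m} {w} per h i = trans (periodic-≅ per (≅-+ m (≅-sym (%-≅ i)))) (trans (h (i % n) (m%n<n i n)) (periodic-≅ per (%-≅ i)))

  nothing≉just : ∀ {k} → nothing ≈ᶜ just k → ⊥
  nothing≉just ()

  nothing≢just : ∀ {k : ℕ} → nothing ≡ just k → ⊥
  nothing≢just ()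

  PC-root-shift : ∀ {w} t → PC w (n + t) nothing → PC (shift t w) n nothing
  PC-root-shift {w} t p = go (PC-total (shift t w) n)
    where
    go : ∃ (PC (shift t w) n) → PC (shift t w) n nothing
    go (nothing , q) = q
    go (just k , q) = ⊥-elim (nothing≢just (PC-unique p (PC-shift w t ℕP.≤-refl q)))

  QC-root-shift : ∀ {w} t → QC w (n + t) nothing → QC (shift t w) n nothing
  QC-root-shift {w} t p = go (QC-total (shift t w) n)
    where
    go : ∃ (QC (shift t w) n) → QC (shift t w) n nothing
    go (nothing , q) = q
    go (just k , q) = ⊥-elim (nothing≢just (QC-unique p (QC-shift w t q)))

  stat-wQ : ∀ f v (d : D v) → stat f v ≡ weightOf f (run v n) (Words.wQ v d)
  stat-wQ f v d = trans (cong (_+ f (run v n)) (psum-suc (λ i → f (run v i)) n′)) (trans (ℕP.+-comm _ (f (run v n)))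
    (cong (λ z → f (run v n) + z) (trans (ℕP.+-comm (f (run v 0)) _) (cong₂ _+_ (psum-cong n′ (λ i p → cong f (sym (W.wQ-< p)))) (cong f (sym W.wQ-last))))))
    where module W = Words v d

  module Turns (m : ℕ) where

    -- Since the root block contains the elements 0 and m, the word shifted by m is rooted there
    -- too, and it represents the turned pair, which is the pair itself. By injectivity both give
    -- the same path, hence the same word.
    turnP : ∀ v (d : D v) → rotPow m (π v) ≡ π v → rel (proj₁ (π v)) 0 m ≡ true → Recurs m (Words.wP v d)
    turnP v d fix r = recurs-< W.wP-periodic (λ i p → trans (sym (run-fromFun (consN h u) (s≤s p))) (trans (cong (λ x → run x (suc i)) (sym v≡)) (sym (W.wP-< p))))
      where
      module W = Words v d
      module P = Path a n v a>0 cop d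
      w = W.wP
      h = run v 0
      u = shift m w
      root : PC w n nothing
      root = W.pcP {0} {0} (s≤s z≤n) (isPrev (s≤s z≤n) (subst (ℤ._< P.height 1) (sym P.height-0) (P.height->0 (s≤s z≤n) (s≤s z≤n))) (λ l x y → ⊥-elim (ℕP.<⇒≱ x (ℕ.s≤s⁻¹ y))))
      same : rel (proj₁ (π v)) (n + 0) (n + m + 0) ≡ true
      same = trans (rel-cong (proj₁ (π v)) {n + 0} {0} {n + m + 0} {m} (≅-trans (≡⇒≅ (ℕP.+-comm n 0)) (+n-≅ 0)) (≅-trans (≡⇒≅ (trans (ℕP.+-identityʳ (n + m)) (ℕP.+-comm n m))) (+n-≅ m))) r
      root′ : PC w (n + m) nothing
      root′ = go (PC-total w (n + m))
        where
        go : ∃ (PC w (n + m)) → PC w (n + m) nothing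
        go (nothing , q) = q
        go (just k , q) = ⊥-elim (nothing≉just (proj₁ (relP⇔ W.repP ℕP.≤-refl (ℕP.m≤m+n n m) root q) same))
      d′ : D (pathP h u)
      d′ = dyckP {h} {u} (trans (weightOf-shift (λ x → x) h m W.wP-periodic) (total-wP v d)) (PC-root-shift m root′)
      v≡ : v ≡ pathP h u
      v≡ = π-injective d d′ (rotPow-cancel m (trans fix (relate m (Rep-≅ (≡⇒≅ (ℕP.+-comm m 0)) (Rep-shift m W.repP)) (repPathP (shift-periodic m W.wP-periodic) d′))))

    -- As for P, but a Q-root is recognised at the last label, whose laser ends at n.
    turnQ : ∀ v (d : D v) → rotPow m (π v) ≡ π v → rel (proj₂ (π v)) n′ (n′ + m) ≡ true → Recurs m (Words.wQ v d)
    turnQ v d fix r i = trans (sym (at (suc i + m) (i + m) (ℕP.+-comm 1 (i + m)))) (trans (rec (suc i)) (at (suc i) i (ℕP.+-comm 1 i)))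
      where
      module W = Words v d
      module P = Path a n v a>0 cop d
      w = W.wQ
      h = run v n
      u₀ = shift n′ w
      u = shift m u₀
      per₀ : Periodic u₀
      per₀ = shift-periodic n′ W.wQ-periodic
      at : ∀ k i → k ≡ i + 1 → u₀ k ≡ w i
      at k i refl = trans (cong w (ℕP.+-assoc i 1 n′)) (W.wQ-periodic i)
      laser-n : P.laser n ≡ n
      laser-n = ℕP.≤-antisym (proj₂ (P.laser-spec (s≤s z≤n) ℕP.≤-refl)) (IsNext.after (proj₁ (P.laser-spec (s≤s z≤n) ℕP.≤-refl)))
      root : QC w (n′ + n) nothing
      root = W.qcQ-root {n′} ℕP.≤-refl (subst (IsNext P.height n) laser-n (proj₁ (P.laser-spec (s≤s z≤n) ℕP.≤-refl)))
      same : rel (proj₂ (π v)) (n′ + n + 0) (n + m + n′ + 0) ≡ true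
      same = trans (rel-cong (proj₂ (π v)) {n′ + n + 0} {n′} {n + m + n′ + 0} {n′ + m} (≅-trans (≡⇒≅ (ℕP.+-identityʳ (n′ + n))) (+n-≅ n′)) (≅-trans (≡⇒≅ (l n m n′)) (+n-≅ (n′ + m)))) r
        where
        l : ∀ n m k → n + m + k + 0 ≡ k + m + n
        l = ℕS.solve-∀
      root′ : QC w (n + m + n′) nothing
      root′ = go (QC-total w (n + m + n′))
        where
        go : ∃ (QC w (n + m + n′)) → QC w (n + m + n′) nothing
        go (nothing , q) = q
        go (just k , q) = ⊥-elim (nothing≉just (proj₁ (relQ⇔ W.repQ (ℕP.m≤n+m n n′) (ℕP.≤-trans (ℕP.m≤m+n n m) (ℕP.m≤m+n (n + m) n′)) root q) same))
      root₀ : QC u₀ (n + m) nothing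
      root₀ = go (QC-total u₀ (n + m))
        where
        go : ∃ (QC u₀ (n + m)) → QC u₀ (n + m) nothing
        go (nothing , q) = q
        go (just k , q) = ⊥-elim (nothing≢just (QC-unique root′ (QC-shift w n′ q)))
      total : Total h u
      total = trans (weightOf-shift (λ x → x) h m per₀) (trans (weightOf-shift (λ x → x) h n′ W.wQ-periodic)
        (trans (sym (stat-wQ (λ x → x) v d)) (trans (sym (ht-psum v b)) (Dyck.total d))))
      d′ : D (pathQ h u)
      d′ = dyckQ′ {h} {u} (shift-periodic m per₀) total (QC-root-shift m root₀)
      t = 1 + m + n′
      v≡ : v ≡ pathQ h u
      v≡ = π-injective d d′ (rotPow-cancel m (trans fix (trans (relate t (Rep-≅ (≡⇒≅ (ℕP.+-comm t 0)) (Rep-ext (λ i → cong w (l i m n′)) (Rep-shift t W.repQ)))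
          (repPathQ (shift-periodic m per₀) d′)) (rotPow-≅ {t} {m} (π (pathQ h u)) (≅-trans (≡⇒≅ (l′ m n′)) (+n-≅ m))))))
        where
        l : ∀ i m k → i + (1 + m + k) ≡ i + 1 + m + k
        l = ℕS.solve-∀
        l′ : ∀ m k → 1 + m + k ≡ m + suc k
        l′ = ℕS.solve-∀
      run-v : ∀ i → i < n → run v i ≡ u₀ i
      run-v zero    _       = sym W.wQ-last
      run-v (suc i) (s≤s p) = trans (sym (W.wQ-< p)) (sym (at (suc i) i (ℕP.+-comm 1 i)))
      rec : Recurs m u₀
      rec = recurs-< per₀ (λ i p → trans (sym (snocN-< {h} {u} p)) (trans (sym (run-fromFun (snocN h u) (ℕP.m<n⇒m<1+n p))) (trans (cong (λ x → run x i) (sym v≡)) (run-v i p))))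

  Unfolds : ℕ → Vec ℕ b → Set
  Unfolds m v = ∃₂ λ h w → Recurs m w × Periodic w × Rep 0 (π v) h w × (∀ f → stat f v ≡ weightOf f h w)

  -- A pair fixed by a rotation is the pair of a word having that period: the word is
  -- read off from the central block, which the rotation has to fix.
  module Fixed (m : ℕ) (m>0 : 0 < m) (v : Vec ℕ b) (d : D v) (fix : rotPow m (π v) ≡ π v) where

    private
      module P = Path a n v a>0 cop d
      module B = PathBlocks a n′ v a>0 cop d
      module C = Centroid a n v a>0 cop d

      fixed : SameData (π v) (π v) m
      fixed = sameData m fix

      SameP SameQ : ℕ → ℕ → Set
      SameP i j = ∃ λ k → IsPrev P.height (suc (i % n)) k × IsPrev P.height (suc (j % n)) k
      SameQ i j = P.laser (suc (i % n)) ≡ P.laser (suc (j % n))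

      relP≡ᵖ : ∀ i j → rel (proj₁ (π v)) i j ≡ relP a b v (suc (i % n)) (suc (j % n))
      relP≡ᵖ i j = trans (rel-cong (proj₁ (π v)) (≅-sym (%-≅ i)) (≅-sym (%-≅ j))) (trans (cong (λ x → rel (proj₁ x) (i % n) (j % n)) (π-def v)) (B.rel-P (i % n) (j % n) (m%n<n i n) (m%n<n j n)))

      relQ≡ᵖ : ∀ i j → rel (proj₂ (π v)) i j ≡ relQ a b v (suc (i % n)) (suc (j % n))
      relQ≡ᵖ i j = trans (rel-cong (proj₂ (π v)) (≅-sym (%-≅ i)) (≅-sym (%-≅ j))) (trans (cong (λ x → rel (proj₂ x) (i % n) (j % n)) (π-def v)) (B.rel-Q (i % n) (j % n) (m%n<n i n) (m%n<n j n)))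

      prv : ∀ i → ∃ (IsPrev P.height (suc (i % n)))
      prv i = P.hasPrev (s≤s z≤n) (m%n<n i n)

      P⇒ : ∀ i j → rel (proj₁ (π v)) i j ≡ true → SameP i j
      P⇒ i j e = proj₁ (prv i) , proj₂ (prv i) , subst (IsPrev P.height (suc (j % n))) (sym (P.relP⇒ (m%n<n i n) (m%n<n j n) (proj₂ (prv i)) (proj₂ (prv j)) (trans (sym (relP≡ᵖ i j)) e))) (proj₂ (prv j))

      P⇐ : ∀ i j → SameP i j → rel (proj₁ (π v)) i j ≡ true
      P⇐ i j (k , p , q) = trans (relP≡ᵖ i j) (P.relP⇐ (m%n<n i n) (m%n<n j n) p q)

      Q⇒ : ∀ i j → rel (proj₂ (π v)) i j ≡ true → SameQ i j
      Q⇒ i j e = P.relQ⇒ (s≤s z≤n) (m%n<n i n) (s≤s z≤n) (m%n<n j n) (trans (sym (relQ≡ᵖ i j)) e)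

      Q⇐ : ∀ i j → SameQ i j → rel (proj₂ (π v)) i j ≡ true
      Q⇐ i j e = trans (relQ≡ᵖ i j) (P.relQ⇐ (s≤s z≤n) (m%n<n i n) (s≤s z≤n) (m%n<n j n) e)

      repr : ∀ {l} → l < n → l % n ≡ l
      repr = m<n⇒m%n≡m

      linearP : ∀ {i i′ j j′} → i < i′ → i′ < j → j < j′ → j′ < n → SameP i j → SameP i′ j′ → SameP i i′
      linearP {i} {i′} {j} {j′} x y z u (k , pi , pj) (k′ , pi′ , pj′) = k , pi , subst (IsPrev P.height (suc (i′ % n))) (sym (cross (at i<n pi) (at j<n pj) (at i′<n pi′) (at u pj′))) pi′
        where
        j<n = ℕP.<-trans z u
        i′<n = ℕP.<-trans y j<n
        i<n = ℕP.<-trans x i′<n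
        at : ∀ {l k} → l < n → IsPrev P.height (suc (l % n)) k → IsPrev P.height (suc l) k
        at {l} {k} h = subst (λ z → IsPrev P.height (suc z) k) (repr h)
        cross : IsPrev P.height (suc i) k → IsPrev P.height (suc j) k → IsPrev P.height (suc i′) k′ → IsPrev P.height (suc j′) k′ → k ≡ k′
        cross pi pj pi′ pj′ = ℕP.≤-antisym k≤ ≤k
          where
          -- If k < k′, the heights satisfy H(j′+1) <= H(j+1) <= H(k′) < H(j′+1); the other case is
          -- similar.
          ≤k : k′ ≤ k
          ≤k = ℕP.≮⇒≥ (λ k<k′ → ℤP.<⇒≱ (IsPrev.below pj′) (ℤP.≤-trans (IsPrev.above pj′ (suc j) (ℕP.<-trans (IsPrev.before pi′) (s≤s y)) (s≤s z))
            (IsPrev.above pj k′ k<k′ (ℕP.<-trans (IsPrev.before pi′) (s≤s y)))))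
          k≤ : k ≤ k′
          k≤ = ℕP.≮⇒≥ (λ k′<k → ℤP.<⇒≱ (ℤP.<-≤-trans (IsPrev.below pj) (IsPrev.above pj (suc i′) (ℕP.<-trans (IsPrev.before pi) (s≤s x)) (s≤s y)))
            (IsPrev.above pi′ k k′<k (ℕP.<-trans (IsPrev.before pi) (s≤s x))))

      linearQ : ∀ {i i′ j j′} → i < i′ → i′ < j → j < j′ → j′ < n → SameQ i j → SameQ i′ j′ → SameQ i i′
      linearQ {i} {i′} {j} {j′} x y z u e e′ = subst₂ (λ k k′ → P.laser (suc k) ≡ P.laser (suc k′)) (sym (repr i<n)) (sym (repr i′<n))
          (cross (nx i<n) (subst (IsNext P.height (suc j)) (sym eᵢ) (nx j<n)) (nx i′<n) (subst (IsNext P.height (suc j′)) (sym eᵢ′) (nx u)))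
        where
        j<n = ℕP.<-trans z u
        i′<n = ℕP.<-trans y j<n
        i<n = ℕP.<-trans x i′<n
        nx : ∀ {l} → l < n → IsNext P.height (suc l) (P.laser (suc l))
        nx h = proj₁ (P.laser-spec (s≤s z≤n) h)
        eᵢ : P.laser (suc i) ≡ P.laser (suc j)
        eᵢ = subst₂ (λ k k′ → P.laser (suc k) ≡ P.laser (suc k′)) (repr i<n) (repr j<n) e
        eᵢ′ : P.laser (suc i′) ≡ P.laser (suc j′)
        eᵢ′ = subst₂ (λ k k′ → P.laser (suc k) ≡ P.laser (suc k′)) (repr i′<n) (repr u) e′
        cross : ∀ {e e′} → IsNext P.height (suc i) e → IsNext P.height (suc j) e → IsNext P.height (suc i′) e′ → IsNext P.height (suc j′) e′ → e ≡ e′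
        cross {e} {e′} ni nj ni′ nj′ = ℕP.≤-antisym e≤ ≤e
          where
          ≤e : e′ ≤ e
          ≤e = ℕP.≮⇒≥ (λ e<e′ → ℤP.<⇒≱ (ℤP.<-≤-trans (IsNext.below ni) (IsNext.above ni (suc i′) (s≤s x) (ℕP.≤-trans (s≤s (ℕP.<⇒≤ y)) (IsNext.after nj))))
            (IsNext.above ni′ (suc e) (s≤s (ℕP.≤-trans (s≤s (ℕP.<⇒≤ y)) (IsNext.after nj))) e<e′))
          e≤ : e ≤ e′
          e≤ = ℕP.≮⇒≥ (λ e′<e → ℤP.<⇒≱ (ℤP.<-≤-trans (IsNext.below ni′) (IsNext.above ni′ (suc j) (s≤s y) (ℕP.≤-trans (s≤s (ℕP.<⇒≤ z)) (IsNext.after nj′))))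
            (IsNext.above nj (suc e′) (s≤s (ℕP.≤-trans (s≤s (ℕP.<⇒≤ z)) (IsNext.after nj′))) e′<e))

      respP : ∀ {i i′ j j′} → i ≅ i′ → j ≅ j′ → SameP i j → SameP i′ j′
      respP e f (k , p , q) = k , subst (λ z → IsPrev P.height (suc z) k) (%≡ e) p , subst (λ z → IsPrev P.height (suc z) k) (%≡ f) q

      transP : ∀ {i j l} → SameP i j → SameP j l → SameP i l
      transP {l = l} (k , p , q) (k′ , p′ , q′) = k , p , subst (IsPrev P.height (suc (l % n))) (isPrev-unique p′ q) q′

      respQ : ∀ {i i′ j j′} → i ≅ i′ → j ≅ j′ → SameQ i j → SameQ i′ j′
      respQ e f = subst₂ (λ z z′ → P.laser (suc z) ≡ P.laser (suc z′)) (%≡ e) (%≡ f)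

      decide : ∀ {A : Set} {t} → (t ≡ true → A) → (A → t ≡ true) → Dec A
      decide {t = true}  f g = yes (f refl)
      decide {t = false} f g = no (λ x → false≢true (g x))

      module NP = Noncrossing n′ SameP respP (λ {i} → proj₁ (prv i) , proj₂ (prv i) , proj₂ (prv i)) (λ (k , p , q) → k , q , p) (λ {i} {j} {l} → transP {i} {j} {l}) (λ {i} {i′} {j} {j′} → linearP {i} {i′} {j} {j′})
      module NQ = Noncrossing n′ SameQ respQ refl sym trans (λ {i} {i′} {j} {j′} → linearQ {i} {i′} {j} {j′})

      near : ∀ {l t j} → suc l + t ≡ suc j ⊎ suc l + t ≡ suc j + n → l + t ≅ j
      near (inj₁ e) = ≡⇒≅ (ℕP.suc-injective e)
      near {j = j} (inj₂ e) = ≅-trans (≡⇒≅ (ℕP.suc-injective e)) (+n-≅ j)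

      pastP : ∀ i₀ k → IsPrev P.height (suc (i₀ % n)) k → C.CentralP k → SameP i₀ (i₀ + m)
      pastP i₀ k p cen = NP.central-invariant (λ i j → decide (P⇒ i j) (P⇐ i j)) m i₀ m>0
          (λ {i} {j} r → P⇒ (i + m) (j + m) (trans (relP≡ fixed i j) (P⇐ i j r)))
          (λ {i} {j} r → P⇒ i j (trans (sym (relP≡ fixed i j)) (P⇐ (i + m) (j + m) r))) (λ {i} → gap {i})
        where
        gap : ∀ {i} → SameP i₀ i → ∃ λ t → 0 < t × t + t ≤ b × SameP i₀ (i + t)
        gap {i} (k′ , p′ , q′) = go (cen (suc (i % n)) (s≤s z≤n) (m%n<n i n) (subst (IsPrev P.height (suc (i % n))) (isPrev-unique p′ p) q′))
          where
          go : (∃₂ λ j t → 0 < j × j ≤ n × IsPrev P.height j k × 0 < t × t + t ≤ b × C.Near (suc (i % n)) t j) → ∃ λ t → 0 < t × t + t ≤ b × SameP i₀ (i + t)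
          go (suc j , t , _ , j<n , pj , t>0 , t≤ , nr) = t , t>0 , t≤ , k , p , subst (λ z → IsPrev P.height (suc z) k) (sym (trans (%≡ (≅-trans (≅-+ t (≅-sym (%-≅ i))) (near {i % n} {t} {j} nr))) (repr j<n))) pj

      pastQ : ∀ i₀ → C.CentralQ (P.laser (suc (i₀ % n))) → SameQ i₀ (i₀ + m)
      pastQ i₀ cen = NQ.central-invariant (λ i j → P.laser (suc (i % n)) ℕ.≟ P.laser (suc (j % n))) m i₀ m>0
          (λ {i} {j} r → Q⇒ (i + m) (j + m) (trans (relQ≡ fixed i j) (Q⇐ i j r)))
          (λ {i} {j} r → Q⇒ i j (trans (sym (relQ≡ fixed i j)) (Q⇐ (i + m) (j + m) r))) (λ {i} → gap {i})
        where
        gap : ∀ {i} → SameQ i₀ i → ∃ λ t → 0 < t × t + t ≤ b × SameQ i₀ (i + t)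
        gap {i} e = go (cen (suc (i % n)) (s≤s z≤n) (m%n<n i n) (sym e))
          where
          go : (∃₂ λ j t → 0 < j × j ≤ n × P.laser j ≡ P.laser (suc (i₀ % n)) × 0 < t × t + t ≤ n × C.Near (suc (i % n)) t j) → ∃ λ t → 0 < t × t + t ≤ b × SameQ i₀ (i + t)
          go (suc j , t , _ , j<n , lj , t>0 , t≤ , nr) = t , t>0 , ℕP.m≤n⇒m≤1+n t≤ , trans (sym lj) (cong (λ z → P.laser (suc z)) (sym (trans (%≡ (≅-trans (≅-+ t (≅-sym (%-≅ i))) (near {i % n} {t} {j} nr))) (repr j<n))))

      open Turns m

      finish : ∀ z {v′ h w} → rotPow z (π v′) ≡ π v → Recurs m w → Periodic w → Rep 0 (π v′) h w → (∀ f → stat f v′ ≡ stat f v) → (∀ f → stat f v′ ≡ weightOf f h w) → Unfolds m v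
      finish z {v′} {h} {w} e rec per r st wt = h , shift t w , shift-recurs t rec , shift-periodic t per ,
          Rep-home z per (Rep-rot (sameData z e) r) , λ f → trans (sym (st f)) (trans (wt f) (sym (weightOf-shift f h t per)))
        where t = z * n ∸ z

      fromP : ∀ i₀ → SameP i₀ (i₀ + m) → Unfolds m v
      fromP i₀ r = go (unrotate-by i₀ v d)
        where
        go : Turned i₀ v → Unfolds m v
        go (v′ , d′ , e , st) = finish i₀ e (turnP v′ d′ (fixed-unrotate i₀ m e fix) same) W.wP-periodic W.repP st (λ f → stat-wP v′ d′ f)
          where
          module W = Words v′ d′
          same : rel (proj₁ (π v′)) 0 m ≡ true
          same = trans (sym (relP≡ (sameData i₀ e) 0 m)) (trans (cong (rel (proj₁ (π v)) i₀) (ℕP.+-comm m i₀)) (P⇐ i₀ (i₀ + m) r))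

      -- Turned back by i₀ + 1 and not by i₀, because the root is read at the last element n′.
      fromQ : ∀ i₀ → SameQ i₀ (i₀ + m) → Unfolds m v
      fromQ i₀ r = go (unrotate-by (suc i₀) v d)
        where
        go : Turned (suc i₀) v → Unfolds m v
        go (v′ , d′ , e , st) = finish (suc i₀) e (turnQ v′ d′ (fixed-unrotate (suc i₀) m e fix) same) W.wQ-periodic W.repQ st (λ f → stat-wQ f v′ d′)
          where
          module W = Words v′ d′
          same : rel (proj₂ (π v′)) n′ (n′ + m) ≡ true
          same = trans (sym (relQ≡ (sameData (suc i₀) e) n′ (n′ + m))) (trans (rel-cong (proj₂ (π v)) {n′ + suc i₀} {i₀} {n′ + m + suc i₀} {i₀ + m}
            (≅-trans (≡⇒≅ (l n′ i₀)) (+n-≅ i₀)) (≅-trans (≡⇒≅ (l′ n′ m i₀)) (+n-≅ (i₀ + m)))) (Q⇐ i₀ (i₀ + m) r))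
            where
            l : ∀ k i → k + suc i ≡ i + suc k
            l = ℕS.solve-∀
            l′ : ∀ k m i → k + m + suc i ≡ i + m + suc k
            l′ = ℕS.solve-∀

    unfolds : Unfolds m v
    unfolds = go (C.centroid (s≤s z≤n))
      where
      go : (∃₂ λ i k → 0 < i × i ≤ n × IsPrev P.height i k × C.CentralP k) ⊎ (∃ λ i → 0 < i × i ≤ n × C.CentralQ (P.laser i)) → Unfolds m v
      go (inj₁ (suc i , k , _ , i<n , p , cen)) = fromP i (pastP i k (subst (λ z → IsPrev P.height (suc z) k) (sym (repr i<n)) p) cen)
      go (inj₂ (suc i , _ , i<n , cen)) = fromQ i (pastQ i (subst (λ z → C.CentralQ (P.laser (suc z))) (sym (repr i<n)) cen))

-- Membership in NC and in X.

compositions-complete : ∀ {b} (v : Vec ℕ b) a → psum (run v) b ≡ a → v ∈ compositions b a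
compositions-complete []          .0 refl = here refl
compositions-complete {suc b} (x ∷ v) a e = ∈-concatMap⁺ (λ x → map (x ∷_) (compositions b (a ∸ x))) {xs = filterᵇ (λ x → x ≤ᵇ a) (upTo (suc a))}
    (lose (∈-filterᵇ⁺ (λ x → x ≤ᵇ a) (∈-upTo⁺ (s≤s x≤a)) (≤ᵇ-true x≤a)) (∈-map⁺ (x ∷_) (compositions-complete v (a ∸ x) rest)))
  where
  sum : x + psum (run v) b ≡ a
  sum = trans (sym (psum-suc (run (x ∷ v)) b)) e
  x≤a : x ≤ a
  x≤a = subst (x ≤_) sum (ℕP.m≤m+n x _)
  rest : psum (run v) b ≡ a ∸ x
  rest = trans (sym (ℕP.m+n∸m≡n x _)) (cong (_∸ x) sum)

positives : ∀ (g f : ℕ → ℕ) b → length (filterᵇ (λ k → 0 <ᵇ g k) (applyUpTo f b)) ≡ psum (λ i → sgn (g (f i))) b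
positives g f zero    = refl
positives g f (suc b) = trans (go (g (f 0)) refl) (sym (psum-suc (λ i → sgn (g (f i))) b))
  where
  rest = positives g (λ i → f (suc i)) b
  go : ∀ m → g (f 0) ≡ m → length (filterᵇ (λ k → 0 <ᵇ g k) (f 0 ∷ applyUpTo (λ i → f (suc i)) b)) ≡ sgn (g (f 0)) + psum (λ i → sgn (g (f (suc i)))) b
  go zero    e rewrite e = rest
  go (suc m) e rewrite e = cong suc rest

deduplicate-unique : ∀ {A : Set} (r : A → A → Bool) → (∀ x → r x x ≡ true) → ∀ xs → Unique (deduplicateᵇ r xs)
deduplicate-unique r rr []       = []
deduplicate-unique r rr (x ∷ xs) = All.map (λ {y} ne e → ne (subst (λ z → T (r x z)) e (subst T (sym (rr x)) tt))) (AllP.all-filter (¬? ∘ T? ∘ r x) (deduplicateᵇ r xs))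
  ∷ UniqueP.filter⁺ (¬? ∘ T? ∘ r x) (deduplicate-unique r rr xs)

module Members (a n′ : ℕ) (a>0 : 0 < a) (cop : Coprime a (suc (suc n′))) where

  private
    n = suc n′
    b = suc n

  open Orbit a n′ a>0 cop

  totalBlocks-stat : ∀ {v} → D v → totalBlocks (π v) ≡ stat sgn v
  totalBlocks-stat {v} d = trans (cong totalBlocks (π-def v)) (trans (PathBlocks.totalBlocks-π a n′ v a>0 cop d) (positives (run v) (λ i → i) b))

  NC⁺ : ∀ {v} → D v → π v ∈ NC a b
  NC⁺ {v} d = subst (_∈ NC a b) (sym (π-def v)) (Membership.∈-deduplicate⁺ (≡.setoid _) (T? ∘₂ eqLPair)
      (λ {w} {x} {y} → respects {w} {x} {y}) {xs = map (piD a b) (dyckPaths a b)}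
      (∈-map⁺ (piD a b) (∈-filterᵇ⁺ (isDyck a b) (compositions-complete v a (trans (sym (ht-psum v b)) (Dyck.total d))) (isDyck-complete d))))

    where
    respects : ∀ {w x y : LPair n} → T (eqLPair y x) → w ≡ x → w ≡ y
    respects {w} {x} {y} t e = trans e (sym (eqLPair-sound y x (T→≡ t)))

  NC⁻ : ∀ {x} → x ∈ NC a b → ∃ λ v → D v × x ≡ π v
  NC⁻ {x} m = go (∈-map⁻ (piD a b) (∈-deduplicate⁻ (T? ∘₂ eqLPair) (map (piD a b) (dyckPaths a b)) m))
    where
    go : (∃ λ v → v ∈ dyckPaths a b × x ≡ piD a b v) → ∃ λ v → D v × x ≡ π v
    go (v , v∈ , e) = v , isDyck-sound (proj₂ (∈-filterᵇ⁻ (isDyck a b) (compositions b a) v∈)) , trans e (sym (π-def v))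

  X : ℕ → List (LPair n)
  X k = Xset a b k

  X⁺ : ∀ {v k} → D v → stat sgn v ≡ k → π v ∈ X k
  X⁺ {v} {k} d e = ∈-filterᵇ⁺ (λ x → totalBlocks x ≡ᵇ k) (NC⁺ d) (≡ᵇ-true {totalBlocks (π v)} (trans (totalBlocks-stat d) e))

  X⁻ : ∀ {x k} → x ∈ X k → ∃ λ v → D v × x ≡ π v × stat sgn v ≡ k
  X⁻ {x} {k} m = go (∈-filterᵇ⁻ (λ x → totalBlocks x ≡ᵇ k) (NC a b) m)
    where
    go : x ∈ NC a b × (totalBlocks x ≡ᵇ k) ≡ true → ∃ λ v → D v × x ≡ π v × stat sgn v ≡ k
    go (x∈ , e) = go′ (NC⁻ x∈)
      where
      go′ : (∃ λ v → D v × x ≡ π v) → ∃ λ v → D v × x ≡ π v × stat sgn v ≡ k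
      go′ (v , d , p) = v , d , p , trans (sym (totalBlocks-stat d)) (trans (cong totalBlocks (sym p)) (≡ᵇ-sound {totalBlocks x} e))

  X-unique : ∀ k → Unique (X k)
  X-unique k = filterᵇ-unique (λ x → totalBlocks x ≡ᵇ k) (deduplicate-unique eqLPair eqLPair-refl (map (piD a b) (dyckPaths a b)))

  Fixed : ℕ → ℕ → List (LPair n)
  Fixed k d = filterᵇ (λ x → eqLPair (rotPow d x) x) (X k)

  Fixed-unique : ∀ k d → Unique (Fixed k d)
  Fixed-unique k d = filterᵇ-unique (λ x → eqLPair (rotPow d x) x) (X-unique k)

  Fixed⁺ : ∀ {v k d x} → D v → stat sgn v ≡ k → π v ≡ x → rotPow d x ≡ x → x ∈ Fixed k d
  Fixed⁺ {d = d} dv e refl f = ∈-filterᵇ⁺ (λ x → eqLPair (rotPow d x) x) (X⁺ dv e) (trans (cong (λ z → eqLPair z (π _)) f) (eqLPair-refl (π _)))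

  Fixed⁻ : ∀ {x k d} → x ∈ Fixed k d → ∃ λ v → D v × x ≡ π v × stat sgn v ≡ k × rotPow d x ≡ x
  Fixed⁻ {x} {k} {d} m = go (∈-filterᵇ⁻ (λ x → eqLPair (rotPow d x) x) (X k) m)
    where
    go : x ∈ X k × eqLPair (rotPow d x) x ≡ true → ∃ λ v → D v × x ≡ π v × stat sgn v ≡ k × rotPow d x ≡ x
    go (x∈ , e) = go′ (X⁻ x∈)
      where
      go′ : (∃ λ v → D v × x ≡ π v × stat sgn v ≡ k) → ∃ λ v → D v × x ≡ π v × stat sgn v ≡ k × rotPow d x ≡ x
      go′ (v , dv , p , q) = v , dv , p , q , eqLPair-sound (rotPow d x) x e

-- Vectors with prescribed sum and number of nonzero entries.

open RootsOfUnity using (choose)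

stat-∷ : ∀ f x {m} (u : Vec ℕ m) → stat f (x ∷ u) ≡ f x + stat f u
stat-∷ f x {m} u = psum-suc (λ i → f (run (x ∷ u) i)) m

bump : ∀ {m} → Vec ℕ (suc m) → Vec ℕ (suc m)
bump (x ∷ u) = suc x ∷ u

-- s is the sum, κ the number of nonzero entries; in headed the first entry is nonzero.
vectors : (m s κ : ℕ) → List (Vec ℕ m)
headed  : (m s κ : ℕ) → List (Vec ℕ (suc m))
vectors zero    zero    zero    = [] ∷ []
vectors zero    zero    (suc κ) = []
vectors zero    (suc s) κ       = []
vectors (suc m) s       κ       = map (0 ∷_) (vectors m s κ) ++ headed m s κ
headed m zero    κ       = []
headed m (suc s) zero    = []
headed m (suc s) (suc κ) = map (1 ∷_) (vectors m s κ) ++ map bump (headed m s (suc κ))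

Spec : ∀ {m} → ℕ → ℕ → Vec ℕ m → Set
Spec s κ u = stat id u ≡ s × stat sgn u ≡ κ

vectors-sound : ∀ m s κ {u} → u ∈ vectors m s κ → Spec s κ u
headed-sound  : ∀ m s κ {u} → u ∈ headed m s κ → Spec s κ u × ∃ λ x → ∃ λ u′ → u ≡ suc x ∷ u′
vectors-sound zero    zero    zero (here refl) = refl , refl
vectors-sound (suc m) s       κ {u} p = go (∈-++⁻ (map (0 ∷_) (vectors m s κ)) p)
  where
  go : u ∈ map (0 ∷_) (vectors m s κ) ⊎ u ∈ headed m s κ → Spec s κ u
  go (inj₂ q) = proj₁ (headed-sound m s κ q)
  go (inj₁ q) with ∈-map⁻ (0 ∷_) q
  ... | u′ , q′ , refl = trans (stat-∷ id 0 u′) (proj₁ (vectors-sound m s κ q′)) , trans (stat-∷ sgn 0 u′) (proj₂ (vectors-sound m s κ q′))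
headed-sound m (suc s) (suc κ) {u} p = go (∈-++⁻ (map (1 ∷_) (vectors m s κ)) p)
  where
  go : u ∈ map (1 ∷_) (vectors m s κ) ⊎ u ∈ map bump (headed m s (suc κ)) → Spec (suc s) (suc κ) u × ∃ λ x → ∃ λ u′ → u ≡ suc x ∷ u′
  go (inj₁ q) with ∈-map⁻ (1 ∷_) q
  ... | u′ , q′ , refl = (trans (stat-∷ id 1 u′) (cong suc (proj₁ (vectors-sound m s κ q′))) , trans (stat-∷ sgn 1 u′) (cong suc (proj₂ (vectors-sound m s κ q′)))) , 0 , u′ , refl
  go (inj₂ q) with ∈-map⁻ bump q
  ... | u′ , q′ , refl with headed-sound m s (suc κ) q′
  ...   | (e , e′) , x , u″ , refl = (trans (stat-∷ id (suc (suc x)) u″) (cong suc (trans (sym (stat-∷ id (suc x) u″)) e)) ,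
            trans (stat-∷ sgn (suc (suc x)) u″) (trans (sym (stat-∷ sgn (suc x) u″)) e′)) , suc x , u″ , refl

vectors-complete : ∀ {m} (u : Vec ℕ m) s κ → Spec s κ u → u ∈ vectors m s κ
headed-complete  : ∀ {m} x (u : Vec ℕ m) s κ → Spec s κ (suc x ∷ u) → (suc x ∷ u) ∈ headed m s κ
vectors-complete []          .0 .0 (refl , refl) = here refl
vectors-complete (zero ∷ u)  s κ (e , e′) = ∈-++⁺ˡ {xs = map (0 ∷_) (vectors _ s κ)} (∈-map⁺ (0 ∷_) (vectors-complete u s κ (trans (sym (stat-∷ id 0 u)) e , trans (sym (stat-∷ sgn 0 u)) e′)))
vectors-complete {suc m} (suc x ∷ u) s κ p = ∈-++⁺ʳ (map (0 ∷_) (vectors m s κ)) (headed-complete x u s κ p)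
headed-complete {m} x u s κ (e , e′) = go x s κ (trans (sym (stat-∷ id (suc x) u)) e) (trans (sym (stat-∷ sgn (suc x) u)) e′)
  where
  go : ∀ x s κ → suc x + stat id u ≡ s → 1 + stat sgn u ≡ κ → (suc x ∷ u) ∈ headed m s κ
  go zero    (suc s) (suc κ) e e′ = ∈-++⁺ˡ {xs = map (1 ∷_) (vectors m s κ)} (∈-map⁺ (1 ∷_) (vectors-complete u s κ (ℕP.suc-injective e , ℕP.suc-injective e′)))
  go (suc x) (suc s) (suc κ) e e′ = ∈-++⁺ʳ (map (1 ∷_) (vectors m s κ)) (∈-map⁺ bump (go x s (suc κ) (ℕP.suc-injective e) e′))

cons-inj : ∀ {m} {x : ℕ} {u v : Vec ℕ m} → x ∷ u ≡ x ∷ v → u ≡ v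
cons-inj refl = refl

bump-inj : ∀ {m} {u v : Vec ℕ (suc m)} → bump u ≡ bump v → u ≡ v
bump-inj {u = x ∷ u} {y ∷ v} refl = refl

vectors-unique : ∀ m s κ → Unique (vectors m s κ)
headed-unique  : ∀ m s κ → Unique (headed m s κ)
vectors-unique zero    zero    zero    = [] ∷ []
vectors-unique zero    zero    (suc κ) = []
vectors-unique zero    (suc s) κ       = []
vectors-unique (suc m) s       κ       = UniqueP.++⁺ (UniqueP.map⁺ cons-inj (vectors-unique m s κ)) (headed-unique m s κ) disjoint
  where
  disjoint : ∀ {u} → u ∈ map (0 ∷_) (vectors m s κ) × u ∈ headed m s κ → ⊥
  disjoint (p , q) with ∈-map⁻ (0 ∷_) p | headed-sound m s κ q
  ... | u′ , _ , refl | _ , _ , _ , ()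
headed-unique m zero    κ       = []
headed-unique m (suc s) zero    = []
headed-unique m (suc s) (suc κ) = UniqueP.++⁺ (UniqueP.map⁺ cons-inj (vectors-unique m s κ)) (UniqueP.map⁺ bump-inj (headed-unique m s (suc κ))) disjoint
  where
  disjoint : ∀ {u} → u ∈ map (1 ∷_) (vectors m s κ) × u ∈ map bump (headed m s (suc κ)) → ⊥
  disjoint (p , q) with ∈-map⁻ (1 ∷_) p | ∈-map⁻ bump q
  ... | u′ , _ , refl | u″ , q′ , e with headed-sound m s (suc κ) q′
  ...   | _ , x , u‴ , refl with e
  ...     | ()

-- the number of compositions of s into κ positive parts
parts : ℕ → ℕ → ℕ
parts zero    zero    = 1
parts zero    (suc κ) = 0
parts (suc s) zero    = 0
parts (suc s) (suc κ) = choose s κ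

choose-0 : ∀ n → choose n 0 ≡ 1
choose-0 zero    = refl
choose-0 (suc n) = refl

parts-suc : ∀ s κ → parts s κ + parts s (suc κ) ≡ choose s κ
parts-suc zero    zero    = refl
parts-suc zero    (suc κ) = refl
parts-suc (suc s) zero    = choose-0 s
parts-suc (suc s) (suc κ) = refl

-- Choose the positions of the nonzero entries, then a composition of s into κ positive parts.
length-vectors : ∀ m s κ → length (vectors m s κ) ≡ choose m κ * parts s κ
length-headed  : ∀ m s κ → length (headed m s (suc κ)) ≡ choose m κ * parts s (suc κ)
length-vectors zero    zero    zero    = refl
length-vectors zero    zero    (suc κ) = refl
length-vectors zero    (suc s) zero    = refl
length-vectors zero    (suc s) (suc κ) = refl
length-vectors (suc m) s       zero    = trans (LP.length-++ (map (0 ∷_) (vectors m s 0))) (trans (cong₂ _+_ (LP.length-map (0 ∷_) (vectors m s 0)) (none s))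
    (trans (ℕP.+-identityʳ _) (trans (length-vectors m s 0) (cong (_* parts s 0) (choose-0 m)))))
  where
  none : ∀ s → length (headed m s 0) ≡ 0
  none zero    = refl
  none (suc s) = refl
length-vectors (suc m) s       (suc κ) = trans (LP.length-++ (map (0 ∷_) (vectors m s (suc κ)))) (trans (cong₂ _+_ (trans (LP.length-map (0 ∷_) (vectors m s (suc κ))) (length-vectors m s (suc κ))) (length-headed m s κ))
    (trans (sym (ℕP.*-distribʳ-+ (parts s (suc κ)) (choose m (suc κ)) (choose m κ))) (cong (_* parts s (suc κ)) (ℕP.+-comm (choose m (suc κ)) (choose m κ)))))
length-headed m zero    κ = sym (ℕP.*-zeroʳ (choose m κ))
length-headed m (suc s) κ = trans (LP.length-++ (map (1 ∷_) (vectors m s κ))) (trans (cong₂ _+_ (trans (LP.length-map (1 ∷_) (vectors m s κ)) (length-vectors m s κ))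
    (trans (LP.length-map bump (headed m s (suc κ))) (length-headed m s κ)))
    (trans (sym (ℕP.*-distribˡ-+ (choose m κ) (parts s κ) (parts s (suc κ)))) (cong (choose m κ *_) (parts-suc s κ))))

upToSum : (m S κ : ℕ) → List (Vec ℕ m)
upToSum m zero    κ = vectors m 0 κ
upToSum m (suc S) κ = upToSum m S κ ++ vectors m (suc S) κ

upToSum-sound : ∀ m S κ {u} → u ∈ upToSum m S κ → stat id u ≤ S × stat sgn u ≡ κ
upToSum-sound m zero    κ p = ℕP.≤-reflexive (proj₁ (vectors-sound m 0 κ p)) , proj₂ (vectors-sound m 0 κ p)
upToSum-sound m (suc S) κ {u} p = go (∈-++⁻ (upToSum m S κ) p)
  where
  go : u ∈ upToSum m S κ ⊎ u ∈ vectors m (suc S) κ → stat id u ≤ suc S × stat sgn u ≡ κ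
  go (inj₁ q) = ℕP.m≤n⇒m≤1+n (proj₁ (upToSum-sound m S κ q)) , proj₂ (upToSum-sound m S κ q)
  go (inj₂ q) = ℕP.≤-reflexive (proj₁ (vectors-sound m (suc S) κ q)) , proj₂ (vectors-sound m (suc S) κ q)

upToSum-complete : ∀ {m} (u : Vec ℕ m) S κ → stat id u ≤ S → stat sgn u ≡ κ → u ∈ upToSum m S κ
upToSum-complete u zero    κ h e = vectors-complete u 0 κ (ℕP.n≤0⇒n≡0 h , e)
upToSum-complete {m} u (suc S) κ h e = go (ℕP.m≤n⇒m<n∨m≡n h)
  where
  go : stat id u < suc S ⊎ stat id u ≡ suc S → u ∈ upToSum m (suc S) κ
  go (inj₁ q) = ∈-++⁺ˡ (upToSum-complete u S κ (ℕ.s≤s⁻¹ q) e)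
  go (inj₂ q) = ∈-++⁺ʳ (upToSum m S κ) (vectors-complete u (suc S) κ (q , e))

upToSum-unique : ∀ m S κ → Unique (upToSum m S κ)
upToSum-unique m zero    κ = vectors-unique m 0 κ
upToSum-unique m (suc S) κ = UniqueP.++⁺ (upToSum-unique m S κ) (vectors-unique m (suc S) κ)
  (λ (p , q) → ℕP.<-irrefl (proj₁ (vectors-sound m (suc S) κ q)) (s≤s (proj₁ (upToSum-sound m S κ p))))

-- The numbers `parts s κ` for s <= S add up to C(S, κ), by the Pascal rule.
length-upToSum : ∀ m S κ → length (upToSum m S κ) ≡ choose m κ * choose S κ
length-upToSum m zero    κ = trans (length-vectors m 0 κ) (cong (choose m κ *_) (base κ))
  where
  base : ∀ κ → parts 0 κ ≡ choose 0 κ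
  base zero    = refl
  base (suc κ) = refl
length-upToSum m (suc S) κ = trans (LP.length-++ (upToSum m S κ)) (trans (cong₂ _+_ (length-upToSum m S κ) (length-vectors m (suc S) κ))
    (trans (sym (ℕP.*-distribˡ-+ (choose m κ) (choose S κ) (parts (suc S) κ))) (cong (choose m κ *_) (step κ))))
  where
  step : ∀ κ → choose S κ + parts (suc S) κ ≡ choose (suc S) κ
  step zero    = trans (ℕP.+-identityʳ _) (choose-0 S)
  step (suc κ) = ℕP.+-comm (choose S (suc κ)) (choose S κ)

psum-+ : ∀ g i j → psum g (i + j) ≡ psum g i + psum (λ l → g (l + i)) j
psum-+ g i zero    = trans (cong (psum g) (ℕP.+-identityʳ i)) (sym (ℕP.+-identityʳ _))
psum-+ g i (suc j) = trans (cong (psum g) (ℕP.+-suc i j)) (trans (cong₂ _+_ (psum-+ g i j) (cong g (ℕP.+-comm i j))) (ℕP.+-assoc (psum g i) _ _))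

psum-repeat : ∀ g m → (∀ i → g (i + m) ≡ g i) → ∀ e → psum g (e * m) ≡ e * psum g m
psum-repeat g m per zero    = refl
psum-repeat g m per (suc e) = trans (psum-+ g m (e * m)) (cong (λ z → psum g m + z) (trans (psum-cong (e * m) (λ i _ → per i)) (psum-repeat g m per e)))

-- Fixed pairs correspond to periodic words.

module FixBij (a n′ : ℕ) (a>0 : 0 < a) (cop : Coprime a (suc (suc n′))) where

  private
    n = suc n′
    b = suc n
    inc = charge a b

  open Access n′
  open Cover n′ inc
  open Orbit a n′ a>0 cop
  open Closure a n′ a>0 cop
  open Rigid a n′ a>0 cop
  open Members a n′ a>0 cop

  private
    +-≤ : ∀ {x y} → y ℤ.≤ + 0 → x ℤ.+ y ℤ.≤ x
    +-≤ {x} {y} h = subst (x ℤ.+ y ℤ.≤_) (ℤP.+-identityʳ x) (ℤP.+-monoʳ-≤ x h)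

    +-≥ : ∀ {x y} → + 0 ℤ.≤ y → x ℤ.≤ x ℤ.+ y
    +-≥ {x} {y} h = subst (ℤ._≤ x ℤ.+ y) (ℤP.+-identityʳ x) (ℤP.+-monoʳ-≤ x h)

  -- Take the least sum in a period. With drift at most 0 the turn before it is nowhere lower, a
  -- P-root; with drift at least 0 the turn after it is nowhere lower, a Q-root.
  root : ∀ {w} → Periodic w → (∃ λ z → PC w (n + z) nothing) ⊎ (∃ λ z → QC w (n + z) nothing)
  root {w} per = go (argmin (s w) n n′) (ℤP.≤-total (s w n) (+ 0))
    where
    go : (∃ λ p → n ≤ p × p ≤ n + n′ × (∀ l → n ≤ l → l ≤ n + n′ → s w p ℤ.≤ s w l)) → s w n ℤ.≤ + 0 ⊎ + 0 ℤ.≤ s w n →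
      (∃ λ z → PC w (n + z) nothing) ⊎ (∃ λ z → QC w (n + z) nothing)
    go (p , n≤p , p≤ , mn) (inj₁ neg) = inj₁ (p ∸ n , subst (λ z → PC w z nothing) (sym (ℕP.m+[n∸m]≡n n≤p)) (pcN up))
      where
      up : ∀ l → l < p → p ≤ l + n → s w p ℤ.≤ s w l
      up l l<p p≤l with n ℕ.≤? l
      ... | yes h = mn l h (ℕP.≤-trans (ℕP.<⇒≤ l<p) p≤)
      ... | no h  = ℤP.≤-trans (mn (l + n) (ℕP.m≤n+m n l) (subst (_≤ n + n′) (ℕP.+-comm n l) (ℕP.+-monoʳ-≤ n (ℕ.s≤s⁻¹ (ℕP.≰⇒> h)))))
                (subst (ℤ._≤ s w l) (sym (period-s per l)) (+-≤ neg))
    go (p , n≤p , p≤ , mn) (inj₂ pos) = inj₂ (p ∸ n , subst (λ z → QC w z nothing) (sym (ℕP.m+[n∸m]≡n n≤p)) (qcN up))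
      where
      up : ∀ l → p < l → l ≤ p + n → s w p ℤ.≤ s w l
      up l p<l l≤ with l ℕ.≤? n + n′
      ... | yes h = mn l (ℕP.≤-trans n≤p (ℕP.<⇒≤ p<l)) h
      ... | no h  = ℤP.≤-trans (mn (l ∸ n) n≤l∸n (ℕP.≤-trans l∸n≤p p≤)) (subst (s w (l ∸ n) ℤ.≤_) (trans (sym (period-s per (l ∸ n))) (cong (s w) (ℕP.m∸n+n≡m n≤l))) (+-≥ pos))
        where
        n+n≤l : n + n ≤ l
        n+n≤l = subst (_≤ l) (sym (ℕP.+-suc n n′)) (ℕP.≰⇒> h)
        n≤l : n ≤ l
        n≤l = ℕP.≤-trans n≤p (ℕP.<⇒≤ p<l)
        n≤l∸n : n ≤ l ∸ n
        n≤l∸n = ℕP.m+n≤o⇒m≤o∸n n n+n≤l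
        l∸n≤p : l ∸ n ≤ p
        l∸n≤p = ℕP.m≤n+o⇒m∸n≤o l n (subst (l ≤_) (ℕP.+-comm p n) l≤)

  Realised : LPair n → ℕ → (ℕ → ℕ) → Set
  Realised x h w = Rep 0 x h w × ∃ λ v → D v × π v ≡ x × (∀ f → stat f v ≡ weightOf f h w)

  private
    unwind : ∀ z {w : ℕ → ℕ} → Periodic w → ∀ i → shift (z * n ∸ z) (shift z w) i ≡ w i
    unwind z {w} per i = trans (cong w (trans (ℕP.+-assoc i (z * n ∸ z) z) (cong (λ t → i + t) (ℕP.m∸n+n≡m (ℕP.m≤m*n z n))))) (periodic-* per z i)

    realise-at : ∀ z {v₁ h w} → D v₁ → Periodic w → Rep 0 (π v₁) h (shift z w) → (∀ f → stat f v₁ ≡ weightOf f h w) → ∃ λ x → Realised x h w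
    realise-at z {v₁} {h} {w} d per r wt = rotPow z (π v₁) , Rep-ext (unwind z per) (Rep-home z (shift-periodic z per) (Rep-rot (rotPow-data z (π v₁)) r)) , go (rotate-by z v₁ d)
      where
      go : (∃ λ v → D v × π v ≡ rotPow z (π v₁) × (∀ f → stat f v ≡ stat f v₁)) → ∃ λ v → D v × π v ≡ rotPow z (π v₁) × (∀ f → stat f v ≡ weightOf f h w)
      go (v , dv , e , st) = v , dv , e , λ f → trans (st f) (wt f)

  total-shift : ∀ z {h w} → Periodic w → Total h w → Total h (shift z w)
  total-shift z {h} per t = trans (weightOf-shift (λ x → x) h z per) t

  dyckP-at : ∀ z {h w} → Periodic w → Total h w → PC w (n + z) nothing → D (pathP h (shift z w))
  dyckP-at z {h} {w} per t p = dyckP {h} {shift z w} (total-shift z {h} {w} per t) (PC-root-shift z p)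

  dyckQ-at : ∀ z {h w} → Periodic w → Total h w → QC w (n + z) nothing → D (pathQ h (shift z w))
  dyckQ-at z {h} {w} per t p = dyckQ′ {h} {shift z w} (shift-periodic z per) (total-shift z {h} {w} per t) (QC-root-shift z p)

  -- Read from its root at z the word is a Dyck path; the resulting pair is turned back into place,
  -- which stays in NC by `rotate-by`.
  realise : ∀ {h w} → Periodic w → Total h w → ∃ λ x → Realised x h w
  realise {h} {w} per t = go (root per)
    where
    go : (∃ λ z → PC w (n + z) nothing) ⊎ (∃ λ z → QC w (n + z) nothing) → ∃ λ x → Realised x h w
    go (inj₁ (z , p)) = realise-at z d per (repPathP (shift-periodic z per) d) (λ f → trans (stat-pathP f h (shift z w)) (weightOf-shift f h z per))
      where
      d : D (pathP h (shift z w))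
      d = dyckP-at z {h} per t p
    go (inj₂ (z , q)) = realise-at (suc z) d per (Rep-ext (λ i → cong w (ℕP.+-assoc i 1 z)) (repPathQ (shift-periodic z per) d)) (λ f → trans (stat-pathQ f h (shift z w)) (weightOf-shift f h z per))
      where
      d : D (pathQ h (shift z w))
      d = dyckQ-at z {h} per t q

  module Period (m : ℕ) (0<m : 0 < m) (m<n : m < n) where

    m≇0 : ∀ {k} → k ≅ k + m → ⊥
    m≇0 {k} e = ℕP.<-irrefl (trans (%≡ (≅-+⁻ {0} {m} k (≅-trans e (≡⇒≅ (ℕP.+-comm k m))))) (m<n⇒m%n≡m m<n)) 0<m

    private
      just≉ : ∀ {k} → just k ≈ᶜ just (k + m) → ⊥
      just≉ (both e) = m≇0 e

    recurs-PC : ∀ {w i c} → Recurs m w → n ≤ i → PC w i c → PC w (i + m) (c ⊞ m)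
    recurs-PC {w} rec h p = PC-shift w m h (PC-cong (λ l → sym (rec l)) p)

    recurs-QC : ∀ {w i c} → Recurs m w → QC w i c → QC w (i + m) (c ⊞ m)
    recurs-QC {w} rec p = QC-shift w m (QC-cong (λ l → sym (rec l)) p)

    -- The block fixed by the rotation is unique, so it is the root of every such word.
    transferP : ∀ {x h w h′ w′} → Recurs m w → Recurs m w′ → Rep 0 x h w → Rep 0 x h′ w′ → ∀ {i} → n ≤ i → PC w i nothing → PC w′ i nothing
    transferP {x} {h} {w} {h′} {w′} rec rec′ r r′ {i} hi p = go (PC-total w′ i)
      where
      up : n ≤ i + m
      up = ℕP.≤-trans hi (ℕP.m≤m+n i m)
      same : rel (proj₁ x) (i + 0) (i + m + 0) ≡ _
      same = proj₂ (relP⇔ r hi up p (recurs-PC rec hi p)) none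
      go : ∃ (PC w′ i) → PC w′ i nothing
      go (nothing , q) = q
      go (just k , q)  = ⊥-elim (just≉ (proj₁ (relP⇔ r′ hi up q (recurs-PC rec′ hi q)) same))

    transferQ : ∀ {x h w h′ w′} → Recurs m w → Recurs m w′ → Rep 0 x h w → Rep 0 x h′ w′ → ∀ {i} → n ≤ i → QC w i nothing → QC w′ i nothing
    transferQ {x} {h} {w} {h′} {w′} rec rec′ r r′ {i} hi p = go (QC-total w′ i)
      where
      up : n ≤ i + m
      up = ℕP.≤-trans hi (ℕP.m≤m+n i m)
      same : rel (proj₂ x) (i + 0) (i + m + 0) ≡ _
      same = proj₂ (relQ⇔ r hi up p (recurs-QC rec p)) none
      go : ∃ (QC w′ i) → QC w′ i nothing
      go (nothing , q) = q
      go (just k , q)  = ⊥-elim (just≉ (proj₁ (relQ⇔ r′ hi up q (recurs-QC rec′ q)) same))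

    private
      shifted : ∀ z {w w′ : ℕ → ℕ} → Periodic w → Periodic w′ → (∀ i → i < n → shift z w i ≡ shift z w′ i) → ∀ i → w i ≡ w′ i
      shifted z {w} {w′} per per′ e i = trans (sym (unwind z per i)) (trans (at (i + (z * n ∸ z))) (unwind z per′ i))
        where
        at : ∀ j → shift z w j ≡ shift z w′ j
        at j = trans (periodic-≅ (shift-periodic z per) (≅-sym (%-≅ j))) (trans (e (j % n) (m%n<n j n)) (periodic-≅ (shift-periodic z per′) (%-≅ j)))

    -- Both words have a root at the same z, so the paths read from z have the same pair and are
    -- equal by `π-injective`.
    word-unique : ∀ {x h w h′ w′} → Periodic w → Periodic w′ → Total h w → Total h′ w′ → Recurs m w → Recurs m w′ →
      Rep 0 x h w → Rep 0 x h′ w′ → ∀ i → w i ≡ w′ i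
    word-unique {x} {h} {w} {h′} {w′} per per′ t t′ rec rec′ r r′ = go (root per)
      where
      go : (∃ λ z → PC w (n + z) nothing) ⊎ (∃ λ z → QC w (n + z) nothing) → ∀ i → w i ≡ w′ i
      go (inj₁ (z , p)) = shifted z per per′ (λ i h<n → trans (sym (run-fromFun (consN h (shift z w)) (s≤s h<n))) (trans (cong (λ v → run v (suc i)) same) (run-fromFun (consN h′ (shift z w′)) (s≤s h<n))))
        where
        d : D (pathP h (shift z w))
        d = dyckP-at z {h} per t p
        d′ : D (pathP h′ (shift z w′))
        d′ = dyckP-at z {h′} per′ t′ (transferP rec rec′ r r′ (ℕP.m≤m+n n z) p)
        at : ∀ {h w} → Rep 0 x h w → Rep z x h (shift z w)
        at q = Rep-≅ (≡⇒≅ (ℕP.+-identityʳ z)) (Rep-shift z q)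
        same : pathP h (shift z w) ≡ pathP h′ (shift z w′)
        same = π-injective d d′ (rotPow-cancel z (trans (sym (relate z (at r) (repPathP (shift-periodic z per) d))) (relate z (at r′) (repPathP (shift-periodic z per′) d′))))
      go (inj₂ (z , p)) = shifted z per per′ (λ i i<n → trans (trans (sym (snocN-< {h} {shift z w} i<n)) (sym (run-fromFun (snocN h (shift z w)) (ℕP.m<n⇒m<1+n i<n)))) (trans (cong (λ v → run v i) same) (trans (run-fromFun (snocN h′ (shift z w′)) (ℕP.m<n⇒m<1+n i<n)) (snocN-< {h′} {shift z w′} i<n))))
        where
        d : D (pathQ h (shift z w))
        d = dyckQ-at z {h} per t p
        d′ : D (pathQ h′ (shift z w′))
        d′ = dyckQ-at z {h′} per′ t′ (transferQ rec rec′ r r′ (ℕP.m≤m+n n z) p)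
        at : ∀ {h w} → Rep 0 x h w → Rep (suc z) x h (shift 1 (shift z w))
        at {h} {w} q = Rep-ext (λ i → cong w (sym (ℕP.+-assoc i 1 z))) (Rep-≅ (≡⇒≅ (ℕP.+-identityʳ (suc z))) (Rep-shift (suc z) q))
        same : pathQ h (shift z w) ≡ pathQ h′ (shift z w′)
        same = π-injective d d′ (rotPow-cancel (suc z) (trans (sym (relate (suc z) (at r) (repPathQ (shift-periodic z per) d))) (relate (suc z) (at r′) (repPathQ (shift-periodic z per′) d′))))

  module Sieve (m′ e : ℕ) (1<e : 1 < e) (n≡ : n ≡ e * suc m′) where

    private
      m = suc m′
      m<n : m < n
      m<n = subst (m <_) (sym n≡) (ℕP.<-≤-trans (ℕP.m<m+n m (s≤s z≤n)) (subst (_≤ e * m) (cong (λ z → m + z) (ℕP.+-identityʳ m)) (ℕP.*-monoˡ-≤ m 1<e)))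
      open Period m (s≤s z≤n) m<n

    word : Vec ℕ m → ℕ → ℕ
    word u i = run u (i % m)

    -- What is left of a for the root; `Fits` ensures that the subtraction is not truncated.
    rank : Vec ℕ m → ℕ
    rank u = a ∸ e * stat (λ x → x) u

    Fits : ℕ → Vec ℕ m → Set
    Fits k u = e * stat (λ x → x) u ≤ a × sgn (rank u) + e * stat sgn u ≡ k

    word-recurs : ∀ u → Recurs m (word u)
    word-recurs u i = cong (run u) (trans (cong (λ z → (i + z) % m) (sym (ℕP.*-identityˡ m))) ([m+kn]%n≡m%n i 1 m))

    word-periodic : ∀ u → Periodic (word u)
    word-periodic u i = cong (run u) (trans (cong (λ z → (i + z) % m) n≡) ([m+kn]%n≡m%n i e m))

    psum-period : ∀ f {w} → Recurs m w → psum (λ i → f (w i)) n ≡ e * psum (λ i → f (w i)) m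
    psum-period f {w} rec = trans (cong (psum (λ i → f (w i))) n≡) (psum-repeat (λ i → f (w i)) m (λ i → cong f (rec i)) e)

    psum-word : ∀ f u → psum (λ i → f (word u i)) n ≡ e * stat f u
    psum-word f u = trans (psum-period f (word-recurs u)) (cong (e *_) (psum-cong m (λ i i<m → cong (λ z → f (run u z)) (m<n⇒m%n≡m i<m))))

    word-fromFun : ∀ {w} → Recurs m w → ∀ i → word (fromFun w m) i ≡ w i
    word-fromFun {w} rec i = trans (run-fromFun w (m%n<n i m)) (sym (trans (cong w (m≡m%n+[m/n]*n i m)) (go (i % m) (i / m))))
      where
      go : ∀ j k → w (j + k * m) ≡ w j
      go j zero    = cong w (ℕP.+-identityʳ j)
      go j (suc k) = trans (cong w (swap j m (k * m))) (trans (rec (j + k * m)) (go j k))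
        where
        swap : ∀ j m x → j + (m + x) ≡ j + x + m
        swap = ℕS.solve-∀

    total-word : ∀ u → e * stat (λ x → x) u ≤ a → Total (rank u) (word u)
    total-word u h = trans (cong (λ z → rank u + z) (psum-word (λ x → x) u)) (ℕP.m∸n+n≡m h)

    R : LPair n → Vec ℕ m → Set
    R x u = Rep 0 x (rank u) (word u)

    -- A pair is matched with one period of its word; the total a then determines the root rank. The
    -- two implications allow m to be the gcd of d and n.
    fixedCount : ∀ k (ys : List (Vec ℕ m)) → Unique ys → (∀ {u} → u ∈ ys → Fits k u) → (∀ {u} → Fits k u → u ∈ ys) →
      ∀ d → (∀ (x : LPair n) → rotPow d x ≡ x → rotPow m x ≡ x) → (∀ (x : LPair n) → rotPow m x ≡ x → rotPow d x ≡ x) →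
      fixCount a b k d ≡ length ys
    fixedCount k ys uys sound complete d to from = bijection-length R (Fixed k d) ys (Fixed-unique k d) uys total onto (λ {x} {x′} {u} → injective {x} {x′} {u}) functional
      where
      total : ∀ {x} → x ∈ Fixed k d → ∃ λ u → u ∈ ys × R x u
      total {x} x∈ = go (Fixed⁻ {x} {k} {d} x∈)
        where
        go : (∃ λ v → D v × x ≡ π v × stat sgn v ≡ k × rotPow d x ≡ x) → ∃ λ u → u ∈ ys × R x u
        go (v , dv , refl , st , f) = go′ (Fixed.unfolds m (s≤s z≤n) v dv (to (π v) f))
          where
          go′ : Unfolds m v → ∃ λ u → u ∈ ys × R (π v) u
          go′ (h , w , rec , per , r , wt) = u , complete (≤a , fits) , subst (λ z → Rep 0 (π v) z (word u)) h≡ (Rep-ext (λ i → sym (word-fromFun rec i)) r)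
            where
            u = fromFun w m
            wt-u : ∀ f → psum (λ i → f (w i)) n ≡ e * stat f u
            wt-u f = trans (psum-cong n (λ i _ → cong f (sym (word-fromFun {w} rec i)))) (psum-word f u)
            sum : h + e * stat (λ x → x) u ≡ a
            sum = trans (cong (λ z → h + z) (sym (wt-u (λ x → x)))) (trans (sym (wt (λ x → x))) (trans (sym (ht-psum v b)) (Dyck.total dv)))
            ≤a : e * stat (λ x → x) u ≤ a
            ≤a = subst (e * stat (λ x → x) u ≤_) sum (ℕP.m≤n+m _ h)
            h≡ : h ≡ rank u
            h≡ = trans (sym (ℕP.m+n∸n≡m h (e * stat (λ x → x) u))) (cong (_∸ e * stat (λ x → x) u) sum)
            fits : sgn (rank u) + e * stat sgn u ≡ k
            fits = trans (cong₂ (λ y z → sgn y + z) (sym h≡) (sym (wt-u sgn))) (trans (sym (wt sgn)) st)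
      onto : ∀ {u} → u ∈ ys → ∃ λ x → x ∈ Fixed k d × R x u
      onto {u} u∈ = go (realise {rank u} {word u} (word-periodic u) (total-word u (proj₁ (sound {u} u∈))))
        where
        go : (∃ λ x → Realised x (rank u) (word u)) → ∃ λ x → x ∈ Fixed k d × R x u
        go (x , r , v , dv , e′ , wt) = x , Fixed⁺ {v} {k} {d} dv (trans (wt sgn) (trans (cong (λ z → sgn (rank u) + z) (psum-word sgn u)) (proj₂ (sound {u} u∈)))) e′
            (from x (Rep-unique {m + 0} (Rep-≅ (≡⇒≅ (ℕP.+-comm 0 m)) (Rep-rot (rotPow-data m x) r)) (Rep-ext (word-recurs u) (Rep-shift m r)))) , r
      injective : ∀ {x x′ u} → x ∈ Fixed k d → x′ ∈ Fixed k d → R x u → R x′ u → x ≡ x′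
      injective _ _ r r′ = Rep-unique r r′
      functional : ∀ {x u u′} → u ∈ ys → u′ ∈ ys → R x u → R x u′ → u ≡ u′
      functional {x} {u} {u′} m₁ m₂ r r′ = run-ext u u′ (λ i i<m → trans (cong (run u) (sym (m<n⇒m%n≡m i<m)))
        (trans (word-unique {x} {rank u} {word u} {rank u′} {word u′} (word-periodic u) (word-periodic u′) (total-word u (proj₁ (sound {u} m₁))) (total-word u′ (proj₁ (sound {u′} m₂))) (word-recurs u) (word-recurs u′) r r′ i)
          (cong (run u′) (m<n⇒m%n≡m i<m))))

-- The cycle lemma, counting all pairs.

length-cartesianProduct : ∀ {A B : Set} (xs : List A) (ys : List B) → length (cartesianProduct xs ys) ≡ length xs * length ys
length-cartesianProduct []       ys = refl
length-cartesianProduct (x ∷ xs) ys = trans (LP.length-++ (map (x ,_) ys)) (cong₂ _+_ (LP.length-map (x ,_) ys) (length-cartesianProduct xs ys))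

-- Every composition has exactly one rotation that is a Dyck path.
module CycleLemma (a₀ n′ : ℕ) (cop : Coprime (suc a₀) (suc (suc n′))) where

  private
    a = suc a₀
    n = suc n′
    b = suc n
    inc = charge a b

  open Orbit a n′ (s≤s z≤n) cop
  open Members a n′ (s≤s z≤n) cop
  -- Here the period is b: every run is a letter and no root is set aside.
  open Access n
  open Cover n inc

  W : Vec ℕ b → ℕ → ℕ
  W c i = run c (i % b)

  W-≅ : ∀ c {i j} → i ≅ j → W c i ≡ W c j
  W-≅ c e = cong (run c) (%≡ e)

  W-< : ∀ c {i} → i < b → W c i ≡ run c i
  W-< c h = cong (run c) (m<n⇒m%n≡m h)

  psum-W : ∀ f c t → psum (λ i → f (W c (i + t))) b ≡ stat f c
  psum-W f c t = trans (psum-rotate (λ i → f (W c i)) b (λ i → cong f (W-≅ c (+n-≅ i))) t) (psum-cong b (λ i h → cong f (W-< c h)))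

  psum-W₀ : ∀ f c → psum (λ i → f (W c i)) b ≡ stat f c
  psum-W₀ f c = psum-cong b (λ i h → cong f (W-< c h))

  Sum : Vec ℕ b → Set
  Sum c = stat (λ x → x) c ≡ a

  s-b : ∀ c → Sum c → s (W c) b ≡ + 0
  s-b c e = trans (sp (W c) b) (trans (cong (λ z → + b ℤ.* + z ℤ.- + a ℤ.* + b) (trans (psum-W₀ (λ x → x) c) e)) (l (+ b) (+ a)))
    where
    l : ∀ b a → b ℤ.* a ℤ.- a ℤ.* b ≡ + 0
    l = ℤS.solve-∀
    sp : ∀ w k → s w k ≡ + b ℤ.* + psum w k ℤ.- + a ℤ.* + k
    sp w zero    = sym (cong₂ ℤ._-_ (ℤP.*-zeroʳ (+ b)) (ℤP.*-zeroʳ (+ a)))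
    sp w (suc k) = trans (cong (λ z → z ℤ.+ inc (w k)) (sp w k)) (l′ (+ b) (+ psum w k) (+ a) (+ k) (+ w k))
      where
      l′ : ∀ b p a k x → b ℤ.* p ℤ.- a ℤ.* k ℤ.+ (b ℤ.* x ℤ.- a) ≡ b ℤ.* (p ℤ.+ x) ℤ.- a ℤ.* (+ 1 ℤ.+ k)
      l′ = ℤS.solve-∀

  s-per : ∀ c → Sum c → ∀ i → s (W c) (i + b) ≡ s (W c) i
  s-per c e i = trans (s-shift (W c) b i) (trans (cong₂ ℤ._+_ (s-cong (λ j → W-≅ c (+n-≅ j)) i) (s-b c e)) (ℤP.+-identityʳ _))

  Rotation : Vec ℕ b → Vec ℕ b → ℕ → Set
  Rotation v c t = ∀ i → i < b → run v i ≡ W c (i + t)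

  stat-rotation : ∀ f {v c t} → Rotation v c t → stat f v ≡ stat f c
  stat-rotation f {v} {c} {t} r = trans (psum-cong b (λ i h → cong f (r i h))) (psum-W f c t)

  rotate : ∀ c t → Rotation (fromFun (λ i → W c (i + t)) b) c t
  rotate c t i h = run-fromFun (λ i → W c (i + t)) h

  unrotate : ∀ v t → t < b → ∃ λ c → Rotation v c t
  unrotate v t t<b = c , λ i h → sym (trans (at (i + t)) (trans (W-≅ v (≅-trans (≡⇒≅ (l i)) (+n-≅ i))) (W-< v h)))
    where
    c = fromFun (λ i → W v (i + (b ∸ t))) b
    l : ∀ i → i + t + (b ∸ t) ≡ i + b
    l i = trans (ℕP.+-assoc i t (b ∸ t)) (cong (λ z → i + z) (ℕP.m+[n∸m]≡n (ℕP.<⇒≤ t<b)))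
    at : ∀ j → W c j ≡ W v (j + (b ∸ t))
    at j = trans (run-fromFun (λ i → W v (i + (b ∸ t))) (m%n<n j b)) (W-≅ v (≅-+ (b ∸ t) (%-≅ j)))

  private
    ≤-unshift : ∀ {x y z} → x ≡ y ℤ.+ z → z ℤ.≤ x → + 0 ℤ.≤ y
    ≤-unshift {x} {y} {z} refl h = subst₂ ℤ._≤_ (l z) (l′ y z) (ℤP.+-monoˡ-≤ (ℤ.- z) h)
      where
      l : ∀ z → z ℤ.+ (ℤ.- z) ≡ + 0
      l = ℤS.solve-∀
      l′ : ∀ y z → y ℤ.+ z ℤ.+ (ℤ.- z) ≡ y
      l′ = ℤS.solve-∀

  module Height (v : Vec ℕ b) (d : D v) where

    module P = Path a n v (s≤s z≤n) cop d

    height-s : ∀ i → P.height i ≡ s (run v) i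
    height-s zero    = P.height-0
    height-s (suc i) = trans (PathWords.height-suc a n′ v (s≤s z≤n) cop d i) (cong (λ z → z ℤ.+ inc (run v i)) (height-s i))

    rise : ∀ {c t} → Rotation v c t → ∀ {i} → 0 < i → i ≤ n → s (W c) t ℤ.< s (W c) (i + t)
    rise {c} {t} r {i} p h = subst₂ ℤ._<_ (ℤP.+-identityˡ _) (trans (cong (λ z → z ℤ.+ s (W c) t) (trans (height-s i) (below i (ℕP.m≤n⇒m≤1+n h)))) (sym (s-shift (W c) t i)))
        (ℤP.+-monoˡ-< (s (W c) t) (P.height->0 p h))
      where
      below : ∀ i → i ≤ b → s (run v) i ≡ s (shift t (W c)) i
      below zero    _ = refl
      below (suc i) q = cong₂ (λ x y → x ℤ.+ inc y) (below i (ℕP.<⇒≤ q)) (r i q)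

  -- A Dyck rotation starts at the strict minimum of the sums over a turn, which cannot be at both t
  -- and t′.
  later : ∀ {v v′ c t t′} → D v → D v′ → Sum c → Rotation v c t → Rotation v′ c t′ → t < t′ → t′ < b → ⊥
  later {v} {v′} {c} {t} {t′} d d′ e r r′ t<t′ t′<b = ℤP.<-asym up down
    where
    δ = t′ ∸ t
    split : δ + t ≡ t′
    split = ℕP.m∸n+n≡m (ℕP.<⇒≤ t<t′)
    0<δ : 0 < δ
    0<δ = ℕP.m<n⇒0<n∸m t<t′
    δ≤n : δ ≤ n
    δ≤n = ℕ.s≤s⁻¹ (ℕP.≤-<-trans (ℕP.m∸n≤m t′ t) t′<b)
    up : s (W c) t ℤ.< s (W c) t′
    up = subst (λ z → s (W c) t ℤ.< s (W c) z) split (Height.rise v d {c} {t} r 0<δ δ≤n)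
    wrap : b ∸ δ + t′ ≡ t + b
    wrap = trans (cong (λ z → b ∸ δ + z) (sym split)) (trans (sym (ℕP.+-assoc (b ∸ δ) δ t)) (trans (cong (λ z → z + t) (ℕP.m∸n+n≡m (ℕP.m≤n⇒m≤1+n δ≤n))) (ℕP.+-comm b t)))
    down : s (W c) t′ ℤ.< s (W c) t
    down = subst (s (W c) t′ ℤ.<_) (trans (cong (s (W c)) wrap) (s-per c e t)) (Height.rise v′ d′ {c} {t′} r′ (ℕP.m<n⇒0<n∸m (s≤s δ≤n)) (ℕ.s≤s⁻¹ (ℕP.∸-monoʳ-< 0<δ (ℕP.m≤n⇒m≤1+n δ≤n))))

  same-shift : ∀ {v v′ c t t′} → D v → D v′ → Sum c → Rotation v c t → Rotation v′ c t′ → t < b → t′ < b → t ≡ t′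
  same-shift {v} {v′} {c} {t} {t′} d d′ e r r′ h h′ with ℕP.<-cmp t t′
  ... | tri< q _ _ = ⊥-elim (later {v} {v′} {c} d d′ e r r′ q h′)
  ... | tri≈ _ q _ = q
  ... | tri> _ _ q = ⊥-elim (later {v′} {v} {c} d′ d e r′ r q h)

  -- Starting at a minimum keeps all sums nonnegative, since a full turn adds 0.
  dyckRotation : ∀ c → Sum c → ∃ λ t → t < b × D (fromFun (λ i → W c (i + t)) b)
  dyckRotation c e = go (argmin (s (W c)) 0 n)
    where
    go : (∃ λ t → 0 ≤ t × t ≤ n × (∀ l → 0 ≤ l → l ≤ n → s (W c) t ℤ.≤ s (W c) l)) → ∃ λ t → t < b × D (fromFun (λ i → W c (i + t)) b)
    go (t , _ , t≤n , mn) = t , s≤s t≤n , dyck-from-s (shift t (W c)) (trans (psum-W (λ x → x) c t) e) (λ i _ → subst (λ z → + 0 ℤ.≤ z) (agree (shift t (W c)) i) (≤-unshift (s-shift (W c) t i) (all (i + t))))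
      where
      agree : ∀ w i → s w i ≡ Cover.s n′ inc w i
      agree w zero    = refl
      agree w (suc i) = cong (λ z → z ℤ.+ inc (w i)) (agree w i)
      reduce : ∀ j k → s (W c) (j + k * b) ≡ s (W c) j
      reduce j zero    = cong (s (W c)) (ℕP.+-identityʳ j)
      reduce j (suc k) = trans (cong (s (W c)) (swap j b (k * b))) (trans (s-per c e (j + k * b)) (reduce j k))
        where
        swap : ∀ j m x → j + (m + x) ≡ j + x + m
        swap = ℕS.solve-∀
      all : ∀ j → s (W c) t ℤ.≤ s (W c) j
      all j = subst (s (W c) t ℤ.≤_) (sym (trans (cong (s (W c)) (m≡m%n+[m/n]*n j b)) (reduce (j % b) (j / b)))) (mn (j % b) z≤n (ℕ.s≤s⁻¹ (m%n<n j b)))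

  R : LPair n × ℕ → Vec ℕ b → Set
  R (x , t) c = ∃ λ v → D v × x ≡ π v × Rotation v c t

  -- Pairs of a path and a starting point correspond to compositions. The factor b is kept, as it
  -- meets [b] = b on the polynomial side.
  cycle-lemma : ∀ k₀ → length (X (suc k₀)) * b ≡ choose b (suc k₀) * choose a₀ k₀
  cycle-lemma k₀ = trans (cong (length (X k) *_) (sym (LP.length-upTo b))) (trans (sym (length-cartesianProduct (X k) (upTo b)))
      (trans (bijection-length R (cartesianProduct (X k) (upTo b)) (vectors b a k) (UniqueP.cartesianProduct⁺ (X-unique k) (UniqueP.upTo⁺ b)) (vectors-unique b a k)
        total onto (λ {p} {p′} {c} → injective {p} {p′} {c}) functional) (length-vectors b a k)))
    where
    k = suc k₀
    total : ∀ {p} → p ∈ cartesianProduct (X k) (upTo b) → ∃ λ c → c ∈ vectors b a k × R p c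
    total {x , t} p∈ = go (X⁻ (proj₁ mem)) (∈-upTo⁻ (proj₂ mem))
      where
      mem = ∈-cartesianProduct⁻ (X k) (upTo b) p∈
      go : (∃ λ v → D v × x ≡ π v × stat sgn v ≡ k) → t < b → ∃ λ c → c ∈ vectors b a k × R (x , t) c
      go (v , d , e , st) t<b = c , vectors-complete c a k (trans (sym (stat-rotation (λ x → x) {v} {c} {t} r)) (trans (sym (ht-psum v b)) (Dyck.total d)) , trans (sym (stat-rotation sgn {v} {c} {t} r)) st) , v , d , e , r
        where
        c = proj₁ (unrotate v t t<b)
        r = proj₂ (unrotate v t t<b)
    onto : ∀ {c} → c ∈ vectors b a k → ∃ λ p → p ∈ cartesianProduct (X k) (upTo b) × R p c
    onto {c} c∈ = go (dyckRotation c (proj₁ (vectors-sound b a k c∈)))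
      where
      go : (∃ λ t → t < b × D (fromFun (λ i → W c (i + t)) b)) → ∃ λ p → p ∈ cartesianProduct (X k) (upTo b) × R p c
      go (t , t<b , d) = (π v , t) , ∈-cartesianProduct⁺ (X⁺ d (trans (stat-rotation sgn {v} {c} {t} (rotate c t)) (proj₂ (vectors-sound b a k c∈)))) (∈-upTo⁺ t<b) , v , d , refl , rotate c t
        where v = fromFun (λ i → W c (i + t)) b
    injective : ∀ {p p′ c} → p ∈ cartesianProduct (X k) (upTo b) → p′ ∈ cartesianProduct (X k) (upTo b) → R p c → R p′ c → p ≡ p′
    injective {x , t} {x′ , t′} {c} m m′ (v , d , refl , r) (v′ , d′ , refl , r′) = cong₂ _,_ (cong π v≡) t≡
      where
      t≡ : t ≡ t′
      t≡ = same-shift {v} {v′} {c} d d′ (trans (sym (stat-rotation (λ x → x) {v} {c} {t} r)) (trans (sym (ht-psum v b)) (Dyck.total d))) r r′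
        (∈-upTo⁻ (proj₂ (∈-cartesianProduct⁻ (X k) (upTo b) m))) (∈-upTo⁻ (proj₂ (∈-cartesianProduct⁻ (X k) (upTo b) m′)))
      v≡ : v ≡ v′
      v≡ = run-ext v v′ (λ i h → trans (r i h) (trans (cong (λ z → W c (i + z)) t≡) (sym (r′ i h))))
    functional : ∀ {p c c′} → c ∈ vectors b a k → c′ ∈ vectors b a k → R p c → R p c′ → c ≡ c′
    functional {x , t} {c} {c′} _ _ (v , d , e , r) (v′ , d′ , e′ , r′) = run-ext c c′ (λ j h → trans (sym (W-< c h)) (trans (back {v} {c} r j) (trans (cong (λ u → run u (i₀ j % b)) v≡) (trans (sym (back {v′} {c′} r′ j)) (W-< c′ h)))))
      where
      v≡ : v ≡ v′
      v≡ = π-injective d d′ (trans (sym e) e′)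
      i₀ : ℕ → ℕ
      i₀ j = unshift t j
      back : ∀ {v c} → Rotation v c t → ∀ j → W c j ≡ run v (i₀ j % b)
      back {v} {c} r j = trans (W-≅ c (≅-trans (≅-sym (unshift-+ t j)) (≅-+ t (≅-sym (%-≅ (i₀ j)))))) (sym (r (i₀ j % b) (m%n<n (i₀ j) b)))

-- Values of the q-Narayana polynomial against numbers of fixed pairs.

open Polynomials
open RootsOfUnity
open Unimodality using (module Quotient; toℕₚ; toℤ-toℕ)

-- Typically s is the contribution of the root to k and x the number of nonzero letters in a period:
-- the last base-e digit of k tells whether the root rank is positive.
digits : ∀ {e s x j κ} → s < e → j < e → s + e * x ≡ κ * e + j → s ≡ j × x ≡ κ
digits {suc e} {s} {x} {j} {κ} s<e j<e eq = s≡j , ℕP.*-cancelˡ-≡ x κ (suc e) (ℕP.+-cancelˡ-≡ j _ _ (trans (cong (λ z → z + suc e * x) (sym s≡j)) (trans eq (trans (ℕP.+-comm (κ * suc e) j) (cong (λ z → j + z) (ℕP.*-comm κ (suc e)))))))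
  where
  s≡j : s ≡ j
  s≡j = trans (sym (m<n⇒m%n≡m s<e)) (trans (sym ([m+kn]%n≡m%n s x (suc e))) (trans (cong (_% suc e) (trans (cong (λ z → s + z) (ℕP.*-comm x (suc e))) (trans eq (ℕP.+-comm (κ * suc e) j)))) (trans ([m+kn]%n≡m%n j κ (suc e)) (m<n⇒m%n≡m j<e))))

sgn≤1 : ∀ x → sgn x ≤ 1
sgn≤1 zero    = z≤n
sgn≤1 (suc x) = s≤s z≤n

sgn-0 : ∀ {x} → sgn x ≡ 0 → x ≡ 0
sgn-0 {zero} _ = refl

sgn-1 : ∀ {x} → 0 < x → sgn x ≡ 1
sgn-1 (s≤s _) = refl

sgn-1⁻ : ∀ {x} → sgn x ≡ 1 → 0 < x
sgn-1⁻ {suc x} _ = s≤s z≤n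

filterᵇ-all : ∀ {A : Set} (p : A → Bool) xs → (∀ x → p x ≡ true) → length (filterᵇ p xs) ≡ length xs
filterᵇ-all p []       h = refl
filterᵇ-all p (x ∷ xs) h with p x | h x
... | true | _ = cong suc (filterᵇ-all p xs h)

value : Poly → ℤ
value []      = + 0
value (c ∷ p) = c ℤ.+ value p

sub-1 : ∀ p → sub 1ₚ p ≋ constₚ (value p)
sub-1 []      = ≋-sym 0∷[]
sub-1 (c ∷ p) = +ₚ-cong (≋-refl {constₚ c}) (≋-trans (*ₚ-identityˡ (sub 1ₚ p)) (sub-1 p))

module Narayana (a₀ n′ k₀ : ℕ) (cop : Coprime (suc a₀) (suc (suc n′))) where

  private
    a = suc a₀
    n = suc n′
    b = suc n
    k = suc k₀
    Φ = cyclotomic n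

  open Access n′
  open Orbit a n′ (s≤s z≤n) cop using (π)
  open Closure a n′ (s≤s z≤n) cop using (rotPow-+; rotPow-≅)
  open FixBij a n′ (s≤s z≤n) cop using (module Sieve)
  open Members a n′ (s≤s z≤n) cop using (X)

  XP : Poly
  XP = proj₁ (narayana a₀ n k₀ cop)

  eqa : int xₚ a *ₚ XP ≋ bin xₚ a k *ₚ bin xₚ n k₀
  eqa = proj₁ (proj₂ (narayana a₀ n k₀ cop))

  eqb : int xₚ b *ₚ XP ≋ bin xₚ b k *ₚ bin xₚ a₀ k₀
  eqb = proj₂ (proj₂ (narayana a₀ n k₀ cop))

  -- The identity with [b] is the one to evaluate: at n-th roots of unity [b] is 1 or b, never 0.
  sub-eqb : ∀ Q → int Q b *ₚ sub Q XP ≋ bin Q b k *ₚ bin Q a₀ k₀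
  sub-eqb Q = ≋-trans (*ₚ-cong (≋-sym (sub-int Q b)) (≋-refl {sub Q XP})) (≋-trans (≋-sym (sub-* Q (int xₚ b) XP)) (≋-trans (sub-cong Q eqb)
    (≋-trans (sub-* Q (bin xₚ b k) (bin xₚ a₀ k₀)) (*ₚ-cong (sub-bin Q b k) (sub-bin Q a₀ k₀)))))

  rotPow-period : ∀ y (x : LPair n) → rotPow (y * n) x ≡ x
  rotPow-period y x = rotPow-≅ {y * n} {0} x (+kn-≅ 0 y)

  rotPow-multiple : ∀ {m} q {x : LPair n} → rotPow m x ≡ x → rotPow (q * m) x ≡ x
  rotPow-multiple zero    h = refl
  rotPow-multiple {m} (suc q) {x} h = trans (rotPow-+ m (q * m) x) (trans (cong (rotPow m) (rotPow-multiple q h)) h)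

  rotPow-gcd : ∀ {m d} → Bézout.Identity m d n → ∀ {x : LPair n} → rotPow d x ≡ x → rotPow m x ≡ x
  rotPow-gcd {m} {d} (Bézout.+- y z eq) {x} h = trans (cong (rotPow m) (sym (rotPow-period z x))) (trans (sym (rotPow-+ m (z * n) x)) (trans (cong (λ t → rotPow t x) eq) (rotPow-multiple y h)))
  rotPow-gcd {m} {d} (Bézout.-+ y z eq) {x} h = trans (cong (rotPow m) (sym (rotPow-multiple y h))) (trans (sym (rotPow-+ m (y * d) x)) (trans (cong (λ t → rotPow t x) eq) (rotPow-period z x)))

  -- The case where ζ^d has order e >= 2, with m = n/e the gcd of d and n.
  module Proper (d m′ e′ q : ℕ) (n≡ : n ≡ suc (suc e′) * suc m′) (d≡ : d ≡ q * suc m′)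
    (prim : ∀ j → 0 < j → j < suc (suc e′) → ¬ n ∣ d * j) (n∣de : n ∣ d * suc (suc e′)) (bez : Bézout.Identity (suc m′) d n) where

    private
      m = suc m′
      e = suc (suc e′)
      Q = xₚ ^ₚ d
      1<e : 1 < e
      1<e = s≤s (s≤s z≤n)
      r = a₀ % e
      A = a₀ / e
      a₀≡ : a₀ ≡ A * e + r
      a₀≡ = trans (m≡m%n+[m/n]*n a₀ e) (ℕP.+-comm r (A * e))
      r<e : r < e
      r<e = m%n<n a₀ e

      module Rt = Root {n} {d} {suc e′} (s≤s z≤n) n∣de prim
      open Sieve m′ e 1<e n≡

    count : ∀ ys → Unique ys → (∀ {u} → u ∈ ys → Fits k u) → (∀ {u} → Fits k u → u ∈ ys) → fixCount a b k d ≡ length ys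
    count ys u s c = fixedCount k ys u s c d (λ x → rotPow-gcd bez) (λ x h → trans (cong (λ t → rotPow t x) d≡) (rotPow-multiple q h))

    -- b = m e + 1 has last digit 1, so the value is 0 as soon as the last digit of k exceeds 1.
    lucas-b : ∀ κ j → j < e → Mod Φ (bin Q b (κ * e + j)) (constℕ (choose m κ) *ₚ bin Q 1 j)
    lucas-b κ j j<e = subst (λ z → Mod Φ (bin Q z (κ * e + j)) (constℕ (choose m κ) *ₚ bin Q 1 j)) (trans (ℕP.+-comm (m * e) 1) (cong suc (trans (ℕP.*-comm m e) (sym n≡)))) (Rt.lucas m κ 1 j 1<e j<e)

    lucas-a : ∀ κ j → j < e → Mod Φ (bin Q a₀ (κ * e + j)) (constℕ (choose A κ) *ₚ bin Q r j)
    lucas-a κ j j<e = subst (λ z → Mod Φ (bin Q z (κ * e + j)) (constℕ (choose A κ) *ₚ bin Q r j)) (sym a₀≡) (Rt.lucas A κ r j r<e j<e)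

    private
      times-1 : ∀ c {p} → p ≋ 1ₚ → constℕ c *ₚ p ≋ constℕ c
      times-1 c {p} h = ≋-trans (*ₚ-cong (≋-refl {constℕ c}) h) (≋-trans (*ₚ-comm (constℕ c) 1ₚ) (*ₚ-identityˡ (constℕ c)))

      times-0 : ∀ p {r} → r ≋ [] → p *ₚ r ≋ constℕ 0
      times-0 p h = ≋-trans (*ₚ-cong (≋-refl {p}) h) (≋-trans (*ₚ-zeroʳ p) (≋-sym 0∷[]))

    Answer : ℕ → Set
    Answer c = Mod Φ (bin Q b k *ₚ bin Q a₀ k₀) (constℕ c) × fixCount a b k d ≡ c

    -- Last digit 1: the root has positive rank, so e times the sum of u is less than a, that is,
    -- the sum is at most A.
    answer-1 : ∀ κ → k ≡ κ * e + 1 → Answer (choose m κ * choose A κ)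
    answer-1 κ k≡ = Mod-trans (Mod-* (subst (λ z → Mod Φ (bin Q b z) (constℕ (choose m κ))) (sym k≡) (Mod-trans (lucas-b κ 1 1<e) (≋⇒Mod (times-1 (choose m κ) (bin-diag Q 1)))))
          (subst (λ z → Mod Φ (bin Q a₀ z) (constℕ (choose A κ))) (sym k₀≡) (Mod-trans (lucas-a κ 0 (s≤s z≤n)) (≋⇒Mod (times-1 (choose A κ) (bin-0 Q r))))))
        (≋⇒Mod (constℕ-* (choose m κ) (choose A κ)))
      , trans (count (upToSum m A κ) (upToSum-unique m A κ) sound complete) (length-upToSum m A κ)
      where
      bin-0 : ∀ Q n → bin Q n 0 ≋ 1ₚ
      bin-0 Q n = ≋-refl
      k₀≡ : k₀ ≡ κ * e + 0
      k₀≡ = ℕP.suc-injective (trans k≡ (ℕP.+-suc (κ * e) 0))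
      sound : ∀ {u} → u ∈ upToSum m A κ → Fits k u
      sound {u} u∈ = ℕP.<⇒≤ lt , trans (cong₂ (λ x y → x + e * y) (sgn-1 (ℕP.m<n⇒0<n∸m lt)) (proj₂ spec)) (trans (ℕP.+-comm 1 (e * κ)) (trans (cong (_+ 1) (ℕP.*-comm e κ)) (sym k≡)))
        where
        spec = upToSum-sound m A κ u∈
        lt : e * stat (λ x → x) u < a
        lt = s≤s (ℕP.≤-trans (ℕP.*-monoʳ-≤ e (proj₁ spec)) (subst (e * A ≤_) (sym a₀≡) (ℕP.≤-trans (ℕP.≤-reflexive (ℕP.*-comm e A)) (ℕP.m≤m+n (A * e) r))))
      complete : ∀ {u} → Fits k u → u ∈ upToSum m A κ
      complete {u} (_ , f) = upToSum-complete u A κ (ℕP.≮⇒≥ over) (proj₂ dg)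
        where
        dg : sgn (rank u) ≡ 1 × stat sgn u ≡ κ
        dg = digits {e} {sgn (rank u)} {stat sgn u} {1} {κ} (ℕP.≤-<-trans (sgn≤1 (rank u)) 1<e) 1<e (trans f k≡)
        lt : e * stat (λ x → x) u < a
        lt = ℕP.≰⇒> (λ h → ℕP.<⇒≱ (sgn-1⁻ (proj₁ dg)) (ℕP.≤-reflexive (ℕP.m≤n⇒m∸n≡0 h)))
        over : ¬ (A < stat (λ x → x) u)
        over h = ℕP.<⇒≱ (ℕP.<-≤-trans (ℕP.+-monoʳ-< (A * e) r<e) (ℕP.≤-trans (ℕP.≤-reflexive (trans (ℕP.+-comm (A * e) e) (ℕP.*-comm (suc A) e))) (ℕP.*-monoʳ-≤ e h))) (subst (e * stat (λ x → x) u ≤_) a₀≡ (ℕ.s≤s⁻¹ lt))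

    fits-0 : ∀ {u} κ → k ≡ κ * e + 0 → Fits k u → e * stat (λ x → x) u ≡ a × stat sgn u ≡ κ
    fits-0 {u} κ k≡ (h , f) = ℕP.≤-antisym h (ℕP.m∸n≡0⇒m≤n (sgn-0 (proj₁ dg))) , proj₂ dg
      where
      dg : sgn (rank u) ≡ 0 × stat sgn u ≡ κ
      dg = digits {e} {sgn (rank u)} {stat sgn u} {0} {κ} (ℕP.≤-<-trans (sgn≤1 (rank u)) 1<e) (s≤s z≤n) (trans f k≡)

    a≡ : a ≡ A * e + suc r
    a≡ = trans (cong suc a₀≡) (sym (ℕP.+-suc (A * e) r))

    b-part : ∀ κ → k ≡ κ * e + 0 → Mod Φ (bin Q b k) (constℕ (choose m κ))
    b-part κ k≡ = subst (λ z → Mod Φ (bin Q b z) (constℕ (choose m κ))) (sym k≡) (Mod-trans (lucas-b κ 0 (s≤s z≤n)) (≋⇒Mod (times-1 (choose m κ) (≋-refl {1ₚ}))))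

    k₀≡ : ∀ κ → k ≡ suc κ * e + 0 → k₀ ≡ κ * e + suc e′
    k₀≡ κ k≡ = ℕP.suc-injective (trans k≡ (l e′ (κ * e)))
      where
      l : ∀ e x → suc (suc e) + x + 0 ≡ suc (x + suc e)
      l = ℕS.solve-∀

    -- Last digit 0: the root has rank 0, so e times the sum of u is a. As a - 1 has last digit e -
    -- 1, the sum is A + 1.
    answer-0 : ∀ κ → k ≡ suc κ * e + 0 → r ≡ suc e′ → Answer (choose m (suc κ) * choose A κ)
    answer-0 κ k≡ r≡ = Mod-trans (Mod-* (b-part (suc κ) k≡) (subst (λ z → Mod Φ (bin Q a₀ z) (constℕ (choose A κ))) (sym (k₀≡ κ k≡))
          (Mod-trans (lucas-a κ (suc e′) ℕP.≤-refl) (≋⇒Mod (times-1 (choose A κ) (subst (λ z → bin Q z (suc e′) ≋ 1ₚ) (sym r≡) (bin-diag Q (suc e′))))))))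
        (≋⇒Mod (constℕ-* (choose m (suc κ)) (choose A κ)))
      , trans (count (vectors m (suc A) (suc κ)) (vectors-unique m (suc A) (suc κ)) sound complete) (length-vectors m (suc A) (suc κ))
      where
      a≡′ : e * suc A ≡ a
      a≡′ = trans (ℕP.*-comm e (suc A)) (trans (ℕP.+-comm e (A * e)) (sym (trans a≡ (cong (λ z → A * e + suc z) r≡))))
      sound : ∀ {u} → u ∈ vectors m (suc A) (suc κ) → Fits k u
      sound {u} u∈ = ℕP.≤-reflexive full , trans (cong₂ (λ x y → sgn x + e * y) (trans (cong (a ∸_) full) (ℕP.n∸n≡0 a)) (proj₂ spec)) (trans (ℕP.*-comm e (suc κ)) (trans (sym (ℕP.+-identityʳ _)) (sym k≡)))
        where
        spec = vectors-sound m (suc A) (suc κ) u∈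
        full : e * stat (λ x → x) u ≡ a
        full = trans (cong (e *_) (proj₁ spec)) a≡′
      complete : ∀ {u} → Fits k u → u ∈ vectors m (suc A) (suc κ)
      complete {u} f = vectors-complete u (suc A) (suc κ) (ℕP.*-cancelˡ-≡ _ _ e (trans (proj₁ (fits-0 {u} (suc κ) k≡ f)) (sym a≡′)) , proj₂ (fits-0 {u} (suc κ) k≡ f))

    -- Now e does not divide a, so no root of rank 0 is possible; on the other side [a-1 k-1]
    -- vanishes, its last digits being r < e - 1.
    answer-none : ∀ κ → k ≡ suc κ * e + 0 → r < suc e′ → Answer 0
    answer-none κ k≡ r< = Mod-trans (Mod-* (Mod-refl {p = bin Q b k}) (subst (λ z → Mod Φ (bin Q a₀ z) []) (sym (k₀≡ κ k≡))
          (Mod-trans (lucas-a κ (suc e′) ℕP.≤-refl) (≋⇒Mod (≋-trans (times-0 (constℕ (choose A κ)) (bin-> Q r<)) 0∷[])))))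
        (≋⇒Mod (times-0 (bin Q b k) ≋-refl))
      , count [] [] (λ ()) (λ {u} f → ⊥-elim (absurd u f))
      where
      absurd : ∀ u → Fits k u → ⊥
      absurd u f = zero≢ (proj₁ (digits {e} {0} {stat (λ x → x) u} {suc r} {A} (s≤s z≤n) (s≤s r<) (trans (proj₁ (fits-0 {u} (suc κ) k≡ f)) a≡)))
        where
        zero≢ : 0 ≡ suc r → ⊥
        zero≢ ()

    -- Blocks other than the root come in multiples of e, and the root adds at most 1.
    answer-≥2 : ∀ κ j → k ≡ κ * e + j → 1 < j → j < e → Answer 0
    answer-≥2 κ j k≡ 1<j j<e = Mod-trans (Mod-* (subst (λ z → Mod Φ (bin Q b z) []) (sym k≡) (Mod-trans (lucas-b κ j j<e) (≋⇒Mod (≋-trans (times-0 (constℕ (choose m κ)) (bin-> Q 1<j)) 0∷[])))) (Mod-refl {p = bin Q a₀ k₀}))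
        (≋⇒Mod (≋-sym 0∷[]))
      , count [] [] (λ ()) (λ {u} f → ⊥-elim (absurd u f))
      where
      absurd : ∀ u → Fits k u → ⊥
      absurd u (_ , f) = ℕP.<⇒≱ 1<j (subst (_≤ 1) (proj₁ (digits {e} {sgn (rank u)} {stat sgn u} {j} {κ} (ℕP.≤-<-trans (sgn≤1 (rank u)) 1<e) j<e (trans f k≡))) (sgn≤1 (rank u)))

    answer : ∃ Answer
    answer = go (k / e) (k % e) (trans (m≡m%n+[m/n]*n k e) (ℕP.+-comm (k % e) _)) (m%n<n k e)
      where
      go : ∀ κ j → k ≡ κ * e + j → j < e → ∃ Answer
      go zero    zero          () _
      go (suc κ) zero          k≡ _   = go′ (ℕP.m≤n⇒m<n∨m≡n (ℕ.s≤s⁻¹ r<e))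
        where
        go′ : r < suc e′ ⊎ r ≡ suc e′ → ∃ Answer
        go′ (inj₁ h) = _ , answer-none κ k≡ h
        go′ (inj₂ h) = _ , answer-0 κ k≡ h
      go κ       (suc zero)    k≡ _   = _ , answer-1 κ k≡
      go κ       (suc (suc j)) k≡ j<e = _ , answer-≥2 κ (suc (suc j)) k≡ (s≤s (s≤s z≤n)) j<e

    evaluation : Mod Φ (sub Q XP) (constℕ (fixCount a b k d))
    evaluation = go answer
      where
      -- [b] = 1 + q^d [n] in base q^d, and [n] vanishes at an n-th root of unity other than 1.
      one : Mod Φ (int Q b) 1ₚ
      one = Mod-trans (Mod-+ (Mod-refl {p = 1ₚ}) (Mod-* (Mod-refl {p = Q}) (Rt.int-vanish {n} 1<e (n∣m*n d)))) (≋⇒Mod (≋-trans (+ₚ-cong (≋-refl {1ₚ}) (*ₚ-zeroʳ Q)) (+ₚ-identityʳ 1ₚ)))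
      go : ∃ Answer → Mod Φ (sub Q XP) (constℕ (fixCount a b k d))
      go (c , h , f) = Mod-trans (≋⇒Mod (≋-sym (*ₚ-identityˡ (sub Q XP)))) (Mod-trans (Mod-* (Mod-sym one) (Mod-refl {p = sub Q XP}))
        (Mod-trans (≋⇒Mod (sub-eqb Q)) (subst (λ z → Mod Φ (bin Q b k *ₚ bin Q a₀ k₀) (constℕ z)) (sym f) h)))

  module Trivial (d q : ℕ) (d≡ : d ≡ q * n) where

    private
      Q = xₚ ^ₚ d

    fixes : ∀ (x : LPair n) → eqLPair (rotPow d x) x ≡ true
    fixes x = trans (cong (λ z → eqLPair z x) (trans (cong (λ t → rotPow t x) d≡) (rotPow-period q x))) (eqLPair-refl x)

    -- At q = 1 the identity with [b] becomes b X(1) = C(b,k) C(a-1,k-1), the count of the cycle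
    -- lemma.
    value-X : value XP ≡ + length (X k)
    value-X = ℤP.*-cancelˡ-≡ (+ b) _ _ (trans (at eq 0) (trans (cong +_ (trans (sym (CycleLemma.cycle-lemma a₀ n′ cop k₀)) (ℕP.*-comm (length (X k)) b))) (ℤP.pos-* b (length (X k)))))
      where
      eq : constₚ (+ b ℤ.* value XP) ≋ constℕ (choose b k * choose a₀ k₀)
      eq = ≋-trans (≋-sym (const*≋ (+ b) (constₚ (value XP)))) (≋-trans (*ₚ-cong (≋-sym (int-1 b)) (≋-sym (sub-1 XP))) (≋-trans (sub-eqb 1ₚ)
        (≋-trans (*ₚ-cong (bin-1 b k) (bin-1 a₀ k₀)) (constℕ-* (choose b k) (choose a₀ k₀)))))

    evaluation : Mod Φ (sub Q XP) (constℕ (fixCount a b k d))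
    evaluation = Mod-trans (Mod-sub XP one) (≋⇒Mod (≋-trans (sub-1 XP) (≡⇒≋ (cong constₚ (trans value-X (cong +_ (sym (filterᵇ-all (λ x → eqLPair (rotPow d x) x) (X k) fixes))))))))
      where
      one : Mod Φ Q 1ₚ
      one = Mod-trans (≋⇒Mod (≡⇒≋ (cong (xₚ ^ₚ_) d≡))) (xⁿ-power (s≤s z≤n) (isCyclotomic n (s≤s z≤n)) q)

  -- The cases are distinguished by e = n / gcd(d, n), the order of ζ^d.
  evaluation : ∀ d → Mod Φ (sub (xₚ ^ₚ d) XP) (constℕ (fixCount a b k d))
  evaluation d = go (gcd d n) (gcd-GCD d n)
    where
    go : ∀ m → GCD.GCD d n m → Mod Φ (sub (xₚ ^ₚ d) XP) (constℕ (fixCount a b k d))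
    go m g with GCD.gcd∣m g | GCD.gcd∣n g
    ... | divides q d≡ | divides e n≡ = go′ m e g d≡ n≡
      where
      go′ : ∀ m e → GCD.GCD d n m → d ≡ q * m → n ≡ e * m → Mod Φ (sub (xₚ ^ₚ d) XP) (constℕ (fixCount a b k d))
      go′ zero    e              g d≡ n≡ with () ← trans n≡ (ℕP.*-zeroʳ e)
      go′ (suc m) (suc zero)     g d≡ n≡ = Trivial.evaluation d q (trans d≡ (cong (q *_) (trans (sym (ℕP.+-identityʳ (suc m))) (sym n≡))))
      go′ (suc m) (suc (suc e′)) g d≡ n≡ = Proper.evaluation d m e′ q n≡ d≡ prim n∣de (Bézout.identity g)
        where
        n∣de : n ∣ d * suc (suc e′)
        n∣de = divides q (trans (cong (_* suc (suc e′)) d≡) (trans (ℕP.*-assoc q (suc m) (suc (suc e′))) (cong (q *_) (trans (ℕP.*-comm (suc m) (suc (suc e′))) (sym n≡)))))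
        prim : ∀ j → 0 < j → j < suc (suc e′) → ¬ n ∣ d * j
        prim (suc j) _ j<e h = ℕP.<⇒≱ j<e (∣⇒≤ (coprime-divisor {suc (suc e′)} {q} {suc j} (ℕC.sym cpr) (*-cancelʳ-∣ (suc m) (subst₂ _∣_ n≡ (trans (cong (_* suc j) d≡) (l q (suc m) (suc j))) h))))
          where
          l : ∀ q m j → q * m * j ≡ q * j * m
          l = ℕS.solve-∀
          cpr : Coprime q (suc (suc e′))
          cpr = ℕC.Bézout-coprime {d = suc m} (subst₂ (Bézout.Identity (suc m)) d≡ n≡ (Bézout.identity g))

  statement : Σ (List ℕ) (λ Xq → (qint a *ₚ toℤₚ Xq ≈ₚ qbinom a k *ₚ qbinom (b ∸ 1) (k ∸ 1)) × CyclicSieving (b ∸ 1) (fixCount a b k) Xq)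
  statement = toℕₚ XP , subst (λ p → qint a *ₚ p ≈ₚ qbinom a k *ₚ qbinom n k₀) (sym nat) (at first) , subst (λ p → ∀ d → EvalAtRootPow n d p (+ fixCount a b k d)) (sym nat) sieve
    where
    -- `toℕₚ` takes absolute values, which changes nothing because the coefficients are nonnegative.
    nat : toℤₚ (toℕₚ XP) ≡ XP
    nat = toℤ-toℕ XP (Quotient.nonneg a₀ n k k₀ XP eqa)
    first : qint a *ₚ XP ≋ qbinom a k *ₚ qbinom n k₀
    first = ≋-trans (*ₚ-cong (qint≋ a) (≋-refl {XP})) (≋-trans eqa (*ₚ-cong (≋-sym (qbinom≋ a k)) (≋-sym (qbinom≋ n k₀))))
    sieve : ∀ d → EvalAtRootPow n d XP (+ fixCount a b k d)
    sieve d = Mod.quo ev , at (Mod.eq ev)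
      where
      ev : Mod Φ (substPow d XP) (constℕ (fixCount a b k d))
      ev = Mod-trans (≋⇒Mod (substPow≋ d XP)) (evaluation d)

theorem6p2 : (a b k : ℕ) → 1 ≤ a → 2 ≤ b → Coprime a b → 1 ≤ k → k ≤ a →
    Σ (List ℕ) (λ Xq →
      (qint a *ₚ toℤₚ Xq ≈ₚ qbinom a k *ₚ qbinom (b ∸ 1) (k ∸ 1))
      × CyclicSieving (b ∸ 1) (fixCount a b k) Xq)
theorem6p2 (suc a) (suc zero) (suc k) _ (s≤s ()) _ _ _
theorem6p2 (suc a) (suc (suc n′)) (suc k) _ _ cop _ _ = Narayana.statement a n′ k cop
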